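{- Let $k\geq 4$ be an even integer and write $$G_k = \sum_{\substack{a,b\geq 0\\ 4a+6b=k}} w_{a,k}\, G_4^{a} G_6^{b}$$ with $w_{a,k}\in\mathbb{Q}$. Then $\min_a \nu_2(w_{a,k}) \geq 0$, i.e. $\nu_2(w_{a,k})\geq 0$ for every $a$.
   Context: For even $k\ge 4$, $E_k(z) = 1-\frac{2k}{B_k}\sum_{n\geq 1}\sigma_{k-1}(n)e^{2\pi i n z}$ is the normalized Eisenstein series of weight $k$ on $\mathrm{SL}_2(\mathbb{Z})$, $\zeta$ is the Riemann zeta function, and $G_k = 2\zeta(k)E_k$. The coefficients $w_{a,k}$ are uniquely determined since the monomials $G_4^aG_6^b$ with $4a+6b=k$ form a basis of the space of modular forms of weight $k$. For a prime $p$, $\nu_p$ is the $p$-adic valuation on $\mathbb{Q}$ with $\nu_p(0)=\infty$. -}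

module Defs where

open import Algebra.Bundles.Raw using (RawSemiring)
import Algebra.Definitions.RawSemiring as RawSemiringOps
open import Data.Bool.Base using (if_then_else_)
open import Data.Integer.Base as ℤ using (ℤ; +_)
open import Data.List.Base using (List; map; filter; foldr; upTo; cartesianProduct)
open import Data.Nat.Base as ℕ using (ℕ; zero; suc; _!; _≤ᵇ_)
open import Data.Nat.Combinatorics using (_C_)
open import Data.Nat.Divisibility using (_∣?_)
import Data.Nat.ListAction as ℕList
import Data.Nat.Properties as ℕ
open import Data.Product.Base using (∃; _×_; _,_; proj₁; proj₂)
open import Data.Rational.Base as ℚ
  using (ℚ; 0ℚ; 1ℚ; ½; ∣_∣; Positive; ↥_; ↧ₙ_; _/_; 1/_)
import Data.Rational.Properties as ℚ
open import Data.Rational.Solver using (module +-*-Solver)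
open import Relation.Binary.Construct.Add.Supremum.NonStrict ℤ._≤_ public
  using (_≤⁺_)
open import Relation.Binary.PropositionalEquality
  using (_≡_; refl; sym; trans; cong; cong₂; subst)
open import Relation.Nullary.Construct.Add.Supremum public using (_⁺; ⊤⁺; [_])
open import Relation.Nullary.Decidable.Core using (yes; no; does)

-- Real numbers: Cauchy sequences of rationals, compared by _≈ʳ_.

record ℝ : Set where
  constructor mkℝ
  field
    approx : ℕ → ℚ
    cauchy : ∀ ε → 0ℚ ℚ.< ε → ∃ λ N → ∀ m n → N ℕ.≤ m → N ℕ.≤ n →
             ∣ approx m ℚ.- approx n ∣ ℚ.≤ ε

open ℝ public

-- Holds when |x - y| < ε and implies |x - y| ≤ ε; it is only ever used
-- with ε ranging over all positive rationals.
Withinʳ : ℚ → ℝ → ℝ → Set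
Withinʳ ε x y = ∃ λ N → ∀ n → N ℕ.≤ n → ∣ approx x n ℚ.- approx y n ∣ ℚ.≤ ε

Positiveʳ : ℝ → Set
Positiveʳ x = ∃ λ ε → 0ℚ ℚ.< ε × ∃ λ N → ∀ n → N ℕ.≤ n → ε ℚ.≤ approx x n

fromℚʳ : ℚ → ℝ
fromℚʳ p = mkℝ (λ _ → p) λ ε 0<ε → 0 , λ _ _ _ _ →
  subst (ℚ._≤ ε) (sym (cong ∣_∣ (ℚ.+-inverseʳ p))) (ℚ.<⇒≤ 0<ε)

private
  open ℚ.≤-Reasoning

  half : ∀ {ε} → 0ℚ ℚ.< ε → 0ℚ ℚ.< ε ℚ.* ½
  half {ε} 0<ε =
    subst (ℚ._< ε ℚ.* ½) (ℚ.*-zeroˡ ½) (ℚ.*-monoˡ-<-pos ½ 0<ε)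

  halves : ∀ ε → ε ℚ.* ½ ℚ.+ ε ℚ.* ½ ≡ ε
  halves ε = trans (sym (ℚ.*-distribˡ-+ ε ½ ½)) (ℚ.*-identityʳ ε)

  +-rearrange : ∀ a b c d → (a ℚ.+ b) ℚ.- (c ℚ.+ d) ≡ (a ℚ.- c) ℚ.+ (b ℚ.- d)
  +-rearrange = solve 4 (λ a b c d →
    (a :+ b) :- (c :+ d) := (a :- c) :+ (b :- d)) refl
    where open +-*-Solver

  *-rearrange : ∀ a b c d →
    a ℚ.* b ℚ.- c ℚ.* d ≡ a ℚ.* (b ℚ.- d) ℚ.+ (a ℚ.- c) ℚ.* d
  *-rearrange = solve 4 (λ a b c d →
    a :* b :- c :* d := a :* (b :- d) :+ (a :- c) :* d) refl
    where open +-*-Solver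

  neg-rearrange : ∀ a b → ℚ.- a ℚ.- ℚ.- b ≡ ℚ.- (a ℚ.- b)
  neg-rearrange = solve 2 (λ a b → :- a :- :- b := :- (a :- b)) refl
    where open +-*-Solver

  split : ∀ a b → a ≡ b ℚ.+ (a ℚ.- b)
  split = solve 2 (λ a b → a := b :+ (a :- b)) refl
    where open +-*-Solver

  bounded : (x : ℝ) → ∃ λ B → Positive B × ∃ λ N → ∀ n → N ℕ.≤ n →
            ∣ approx x n ∣ ℚ.≤ B
  bounded x with cauchy x 1ℚ (ℚ.positive⁻¹ 1ℚ)
  ... | N , close = ∣ approx x N ∣ ℚ.+ 1ℚ , pos , N , λ n N≤n → begin
    ∣ approx x n ∣
      ≡⟨ cong ∣_∣ (split (approx x n) (approx x N)) ⟩
    ∣ approx x N ℚ.+ (approx x n ℚ.- approx x N) ∣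
      ≤⟨ ℚ.∣p+q∣≤∣p∣+∣q∣ (approx x N) _ ⟩
    ∣ approx x N ∣ ℚ.+ ∣ approx x n ℚ.- approx x N ∣
      ≤⟨ ℚ.+-monoʳ-≤ ∣ approx x N ∣ (close n N N≤n ℕ.≤-refl) ⟩
    ∣ approx x N ∣ ℚ.+ 1ℚ ∎
    where
    pos : Positive (∣ approx x N ∣ ℚ.+ 1ℚ)
    pos = ℚ.positive (ℚ.+-mono-≤-< (ℚ.0≤∣p∣ (approx x N)) (ℚ.positive⁻¹ 1ℚ))

  *-mono-≤ : ∀ a b c d → 0ℚ ℚ.≤ c → a ℚ.≤ b → c ℚ.≤ d → 0ℚ ℚ.≤ b →
             a ℚ.* c ℚ.≤ b ℚ.* d
  *-mono-≤ a b c d 0≤c a≤b c≤d 0≤b = begin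
    a ℚ.* c ≤⟨ ℚ.*-monoʳ-≤-nonNeg c {{ℚ.nonNegative 0≤c}} a≤b ⟩
    b ℚ.* c ≤⟨ ℚ.*-monoˡ-≤-nonNeg b {{ℚ.nonNegative 0≤b}} c≤d ⟩
    b ℚ.* d ∎

  *-close : ∀ a b c d B E δ → 0ℚ ℚ.≤ B → 0ℚ ℚ.≤ δ →
            ∣ a ∣ ℚ.≤ B → ∣ d ∣ ℚ.≤ E → ∣ a ℚ.- c ∣ ℚ.≤ δ → ∣ b ℚ.- d ∣ ℚ.≤ δ →
            ∣ a ℚ.* b ℚ.- c ℚ.* d ∣ ℚ.≤ δ ℚ.* (B ℚ.+ E)
  *-close a b c d B E δ 0≤B 0≤δ a≤B d≤E ac bd = begin
    ∣ a ℚ.* b ℚ.- c ℚ.* d ∣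
      ≡⟨ cong ∣_∣ (*-rearrange a b c d) ⟩
    ∣ a ℚ.* (b ℚ.- d) ℚ.+ (a ℚ.- c) ℚ.* d ∣
      ≤⟨ ℚ.∣p+q∣≤∣p∣+∣q∣ (a ℚ.* (b ℚ.- d)) ((a ℚ.- c) ℚ.* d) ⟩
    ∣ a ℚ.* (b ℚ.- d) ∣ ℚ.+ ∣ (a ℚ.- c) ℚ.* d ∣
      ≡⟨ cong₂ ℚ._+_ (ℚ.∣p*q∣≡∣p∣*∣q∣ a (b ℚ.- d)) (ℚ.∣p*q∣≡∣p∣*∣q∣ (a ℚ.- c) d) ⟩
    ∣ a ∣ ℚ.* ∣ b ℚ.- d ∣ ℚ.+ ∣ a ℚ.- c ∣ ℚ.* ∣ d ∣
      ≤⟨ ℚ.+-mono-≤ (*-mono-≤ (∣ a ∣) B (∣ b ℚ.- d ∣) δ (ℚ.0≤∣p∣ (b ℚ.- d)) a≤B bd 0≤B)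
                    (*-mono-≤ (∣ a ℚ.- c ∣) δ (∣ d ∣) E (ℚ.0≤∣p∣ d) ac d≤E 0≤δ) ⟩
    B ℚ.* δ ℚ.+ δ ℚ.* E
      ≡⟨ cong (ℚ._+ δ ℚ.* E) (ℚ.*-comm B δ) ⟩
    δ ℚ.* B ℚ.+ δ ℚ.* E
      ≡⟨ ℚ.*-distribˡ-+ δ B E ⟨
    δ ℚ.* (B ℚ.+ E) ∎

  quotient : ∀ ε D → 0ℚ ℚ.< ε → Positive D → ∃ λ δ → 0ℚ ℚ.< δ × δ ℚ.* D ≡ ε
  quotient ε D 0<ε D>0 =
    δ , subst (ℚ._< δ) (ℚ.*-zeroˡ (1/ D)) (ℚ.*-monoˡ-<-pos (1/ D) 0<ε) ,
    trans (ℚ.*-assoc ε (1/ D) D)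
          (trans (cong (ε ℚ.*_) (ℚ.*-inverseˡ D)) (ℚ.*-identityʳ ε))
    where
    instance
      D≢0 : ℚ.NonZero D
      D≢0 = ℚ.pos⇒nonZero D {{D>0}}
      1/D>0 : Positive (1/ D)
      1/D>0 = ℚ.1/pos⇒pos D {{D>0}}
    δ : ℚ
    δ = ε ℚ.* 1/ D

infixl 6 _+ʳ_ _-ʳ_
infixl 7 _*ʳ_
infix  8 -ʳ_

_+ʳ_ : ℝ → ℝ → ℝ
x +ʳ y = mkℝ (λ n → approx x n ℚ.+ approx y n) λ ε 0<ε →
  let N₁ , close₁ = cauchy x (ε ℚ.* ½) (half 0<ε)
      N₂ , close₂ = cauchy y (ε ℚ.* ½) (half 0<ε)
  in N₁ ℕ.⊔ N₂ , λ m n N≤m N≤n → begin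
    ∣ (approx x m ℚ.+ approx y m) ℚ.- (approx x n ℚ.+ approx y n) ∣
      ≡⟨ cong ∣_∣ (+-rearrange (approx x m) (approx y m) (approx x n) (approx y n)) ⟩
    ∣ (approx x m ℚ.- approx x n) ℚ.+ (approx y m ℚ.- approx y n) ∣
      ≤⟨ ℚ.∣p+q∣≤∣p∣+∣q∣ (approx x m ℚ.- approx x n) _ ⟩
    ∣ approx x m ℚ.- approx x n ∣ ℚ.+ ∣ approx y m ℚ.- approx y n ∣
      ≤⟨ ℚ.+-mono-≤ (close₁ m n (ℕ.m⊔n≤o⇒m≤o N₁ N₂ N≤m) (ℕ.m⊔n≤o⇒m≤o N₁ N₂ N≤n))
                    (close₂ m n (ℕ.m⊔n≤o⇒n≤o N₁ N₂ N≤m) (ℕ.m⊔n≤o⇒n≤o N₁ N₂ N≤n)) ⟩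
    ε ℚ.* ½ ℚ.+ ε ℚ.* ½
      ≡⟨ halves ε ⟩
    ε ∎

-ʳ_ : ℝ → ℝ
-ʳ x = mkℝ (λ n → ℚ.- approx x n) λ ε 0<ε →
  let N , close = cauchy x ε 0<ε
  in N , λ m n N≤m N≤n → begin
    ∣ ℚ.- approx x m ℚ.- ℚ.- approx x n ∣
      ≡⟨ cong ∣_∣ (neg-rearrange (approx x m) (approx x n)) ⟩
    ∣ ℚ.- (approx x m ℚ.- approx x n) ∣
      ≡⟨ ℚ.∣-p∣≡∣p∣ (approx x m ℚ.- approx x n) ⟩
    ∣ approx x m ℚ.- approx x n ∣
      ≤⟨ close m n N≤m N≤n ⟩
    ε ∎

_-ʳ_ : ℝ → ℝ → ℝ
x -ʳ y = x +ʳ -ʳ y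

_*ʳ_ : ℝ → ℝ → ℝ
x *ʳ y = mkℝ (λ n → approx x n ℚ.* approx y n) λ ε 0<ε →
  let B , B>0 , N₁ , x≤B = bounded x
      E , E>0 , N₂ , y≤E = bounded y
      δ , 0<δ , δD≡ε     = quotient ε (B ℚ.+ E) 0<ε (ℚ.pos+pos⇒pos B {{B>0}} E {{E>0}})
      N₃ , close₁        = cauchy x δ 0<δ
      N₄ , close₂        = cauchy y δ 0<δ
  in (N₁ ℕ.⊔ N₂) ℕ.⊔ (N₃ ℕ.⊔ N₄) , λ m n N≤m N≤n →
    let N₁₂≤m = ℕ.m⊔n≤o⇒m≤o (N₁ ℕ.⊔ N₂) (N₃ ℕ.⊔ N₄) N≤m
        N₁₂≤n = ℕ.m⊔n≤o⇒m≤o (N₁ ℕ.⊔ N₂) (N₃ ℕ.⊔ N₄) N≤n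
        N₃₄≤m = ℕ.m⊔n≤o⇒n≤o (N₁ ℕ.⊔ N₂) (N₃ ℕ.⊔ N₄) N≤m
        N₃₄≤n = ℕ.m⊔n≤o⇒n≤o (N₁ ℕ.⊔ N₂) (N₃ ℕ.⊔ N₄) N≤n
    in subst (∣ approx x m ℚ.* approx y m ℚ.- approx x n ℚ.* approx y n ∣ ℚ.≤_) δD≡ε
         (*-close (approx x m) (approx y m) (approx x n) (approx y n) B E δ
           (ℚ.<⇒≤ (ℚ.positive⁻¹ B {{B>0}})) (ℚ.<⇒≤ 0<δ)
           (x≤B m (ℕ.m⊔n≤o⇒m≤o N₁ N₂ N₁₂≤m))
           (y≤E n (ℕ.m⊔n≤o⇒n≤o N₁ N₂ N₁₂≤n))
           (close₁ m n (ℕ.m⊔n≤o⇒m≤o N₃ N₄ N₃₄≤m) (ℕ.m⊔n≤o⇒m≤o N₃ N₄ N₃₄≤n))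
           (close₂ m n (ℕ.m⊔n≤o⇒n≤o N₃ N₄ N₃₄≤m) (ℕ.m⊔n≤o⇒n≤o N₃ N₄ N₃₄≤n)))

record ℂ : Set where
  constructor _+i_
  field
    re im : ℝ

open ℂ public

infix  4 _≈_
infixl 6 _+ᶜ_ _-ᶜ_
infixl 7 _*ᶜ_
infix  8 -ᶜ_

Within : ℚ → ℂ → ℂ → Set
Within ε x y = Withinʳ ε (re x) (re y) × Withinʳ ε (im x) (im y)

_≈_ : ℂ → ℂ → Set
x ≈ y = ∀ ε → 0ℚ ℚ.< ε → Within ε x y

fromℚ : ℚ → ℂ
fromℚ p = fromℚʳ p +i fromℚʳ 0ℚ

fromℕ : ℕ → ℂ
fromℕ n = fromℚ (+ n / 1)

𝕚 : ℂ
𝕚 = fromℚʳ 0ℚ +i fromℚʳ 1ℚ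

_+ᶜ_ : ℂ → ℂ → ℂ
x +ᶜ y = (re x +ʳ re y) +i (im x +ʳ im y)

-ᶜ_ : ℂ → ℂ
-ᶜ x = (-ʳ re x) +i (-ʳ im x)

_-ᶜ_ : ℂ → ℂ → ℂ
x -ᶜ y = x +ᶜ -ᶜ y

_*ᶜ_ : ℂ → ℂ → ℂ
x *ᶜ y = (re x *ʳ re y -ʳ im x *ʳ im y) +i (re x *ʳ im y +ʳ im x *ʳ re y)

ℂ-rawSemiring : RawSemiring _ _
ℂ-rawSemiring = record
  { Carrier = ℂ ; _≈_ = _≈_ ; _+_ = _+ᶜ_ ; _*_ = _*ᶜ_
  ; 0# = fromℚ 0ℚ ; 1# = fromℚ 1ℚ }

open RawSemiringOps ℂ-rawSemiring public using () renaming (_^_ to _^ᶜ_)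

∑ : {A : Set} → List A → (A → ℂ) → ℂ
∑ xs f = foldr (λ x acc → f x +ᶜ acc) (fromℚ 0ℚ) xs

-- HasSum f s:  f 0 + f 1 + f 2 + ⋯ converges to s.
HasSum : (ℕ → ℂ) → ℂ → Set
HasSum f s = ∀ ε → 0ℚ ℚ.< ε → ∃ λ N → ∀ n → N ℕ.≤ n → Within ε (∑ (upTo n) f) s

InUpperHalfPlane : ℂ → Set
InUpperHalfPlane z = Positiveʳ (im z)

-- Limits are described by the relation "y is the value of the series",
-- so that no convergence proof is needed to define the functions below.

-- exp x = ∑_{n ≥ 0} xⁿ / n!
IsExp : ℂ → ℂ → Set
IsExp x y = HasSum (λ n → fromℚ ((+ 1 / (n !)) {{n ℕ.!≢0}}) *ᶜ x ^ᶜ n) y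

-- π / 4 = ∑_{n ≥ 0} (-1)ⁿ / (2n + 1)
IsPi : ℂ → Set
IsPi p = HasSum (λ n → fromℕ 4 *ᶜ (-ᶜ fromℕ 1) ^ᶜ n *ᶜ
                       fromℚ (+ 1 / suc (2 ℕ.* n))) p

-- ζ(k) = ∑_{n ≥ 1} 1 / nᵏ
IsZeta : ℕ → ℂ → Set
IsZeta k s = HasSum (λ n → fromℚ ((+ 1 / (suc n ℕ.^ k)) {{ℕ.m^n≢0 (suc n) k}})) s

-- σ m n = ∑_{d ∣ n} dᵐ
σ : ℕ → ℕ → ℕ
σ m n = ℕList.sum (map (ℕ._^ m) (filter (_∣? n) (map suc (upTo n))))

-- bernoulliUpTo n is correct at all indices ≤ n.  It implements
-- ∑_{j ≤ m} C(m+1, j) B_j = 0 for m ≥ 1, with B_0 = 1.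
bernoulliUpTo : ℕ → ℕ → ℚ
bernoulliUpTo zero    _ = 1ℚ
bernoulliUpTo (suc n) j = if j ≤ᵇ n then bernoulliUpTo n j else
  ℚ.- ((+ 1 / suc (suc n)) ℚ.*
       foldr (λ i acc → (+ (suc (suc n) C i) / 1) ℚ.* bernoulliUpTo n i ℚ.+ acc)
             0ℚ (upTo (suc n)))

bernoulli : ℕ → ℚ
bernoulli n = bernoulliUpTo n n

-- Total reciprocal; the value at 0 is irrelevant below, because B_k ≠ 0
-- for even k.
inv : ℚ → ℚ
inv p with p ℚ.≟ 0ℚ
... | yes _   = 0ℚ
... | no  p≢0 = (1/ p) {{ℚ.≢-nonZero p≢0}}

-- e = E_k(z), with e^{2πinz} written as qⁿ for q = e^{2πiz}.
IsE : ℕ → ℂ → ℂ → Set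
IsE k z e =
  ∃ λ p → ∃ λ q → ∃ λ s →
  IsPi p × IsExp (fromℕ 2 *ᶜ p *ᶜ 𝕚 *ᶜ z) q ×
  HasSum (λ n → fromℕ (σ (k ℕ.∸ 1) (suc n)) *ᶜ q ^ᶜ suc n) s ×
  e ≈ fromℕ 1 -ᶜ fromℚ ((+ (2 ℕ.* k) / 1) ℚ.* inv (bernoulli k)) *ᶜ s

-- g = G_k(z) = 2 ζ(k) E_k(z)
IsG : ℕ → ℂ → ℂ → Set
IsG k z g =
  ∃ λ s → ∃ λ e → IsZeta k s × IsE k z e × g ≈ fromℕ 2 *ᶜ s *ᶜ e

-- The pairs (a, b) of natural numbers with 4a + 6b = k; such a and b are
-- at most k.
exponents : ℕ → List (ℕ × ℕ)
exponents k = filter (λ (a , b) → 4 ℕ.* a ℕ.+ 6 ℕ.* b ℕ.≟ k)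
                     (cartesianProduct (upTo (suc k)) (upTo (suc k)))

-- G_k = ∑_{4a+6b=k} w a · G_4ᵃ G_6ᵇ as functions on the upper half plane.
-- The coefficient is indexed by a alone, since a determines b.
IsExpansion : ℕ → (ℕ → ℚ) → Set
IsExpansion k w =
  ∀ z g₄ g₆ gₖ → InUpperHalfPlane z →
  IsG 4 z g₄ → IsG 6 z g₆ → IsG k z gₖ →
  gₖ ≈ ∑ (exponents k) (λ (a , b) → fromℚ (w a) *ᶜ (g₄ ^ᶜ a *ᶜ g₆ ^ᶜ b))

-- The largest e ≤ bound with pᵉ ∣ n.
maxExponent : (p n bound : ℕ) → ℕ
maxExponent p n zero    = 0
maxExponent p n (suc e) =
  if does (p ℕ.^ suc e ∣? n) then suc e else maxExponent p n e

-- For p ≥ 2 and n ≥ 1, pᵉ ∣ n forces e ≤ n, so the bound n loses nothing.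
νℕ : ℕ → ℕ → ℕ
νℕ p n = maxExponent p n n

-- ⊤⁺ plays the role of ∞.
ν : ℕ → ℚ → ℤ ⁺
ν p x with x ℚ.≟ 0ℚ
... | yes _ = ⊤⁺
... | no  _ = [ + νℕ p ℤ.∣ ↥ x ∣ ℤ.- + νℕ p (↧ₙ x) ]

{-# OPTIONS --safe #-}
module Submission where

-- All Taylor coefficients of a Weierstrass ℘-function are polynomials in two of them; the proof shows
-- that, suitably normalised, these polynomials have 2-integral coefficients. In the coordinates t = x/y
-- and w = 1/y of y² = x³ - 15 G₄ x - 35 G₆ the uniformisation solves a polynomial differential system
-- whose recurrence divides by odd numbers only, so (2n - 1) G₂ₙ is a polynomial in 3 G₄ and 5 G₆ over
-- ℤ₍₂₎, obtained from the ℘-recurrence (2n + 1)(n - 3) aₙ = 3 Σ aᵢ aₙ₋ᵢ for aₙ = (2n - 1) G₂ₙ.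
-- That the Eisenstein series satisfy this recurrence is a statement about their q-expansions. It follows
-- from a divisor-sum identity of Liouville type together with the degenerate ℘-function
-- (x²/4) / sinh²(x/2) + x²/12, whose coefficients are the Bernoulli constant terms.
-- Uniqueness of the expansion uses only points z = i y. For z = i ρ / 2π every approximation of 2πiz is
-- exactly -ρ, so a relation between complex values turns into a null sequence of rationals. As ρ → ∞ the
-- ratio of E₆² to E₄³ tends to 1 without attaining it, and a polynomial in this ratio that vanishes at all
-- such points is divisible by every power of t - 1, hence is zero.

open import Data.Bool.Base using (true; false; if_then_else_)
open import Data.Empty using (⊥-elim)
open import Data.Fin.Base using (Fin; toℕ)
open import Data.Integer.Base as ℤ using ()
import Data.Integer.Properties as ℤ
open import Data.List.Base using (List; []; _∷_; upTo)
open import Data.Nat.Base as ℕ using (ℕ; zero; suc)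
import Data.Nat.ListAction as ℕ
import Data.Nat.Properties as ℕ
open import Data.Nat.Solver using () renaming (module +-*-Solver to ℕS)
open import Data.Product.Base using (∃; _×_; _,_; proj₁; proj₂)
open import Data.Sum.Base using (_⊎_; inj₁; inj₂)
open import Function.Base using (_∘_)
open import Relation.Binary.PropositionalEquality hiding ([_])
open import Relation.Nullary.Decidable.Core using (Dec; yes; no; does; toWitness)
open import Relation.Nullary.Negation.Core using (¬_; contradiction)
open import Defs using (inv)

-- The ℘-recurrence divides by n - 3, which is even for every second n, so it cannot give
-- integrality. It is used over ℚ, to identify the Eisenstein values with the coefficients attached
-- to the curve, whose own system divides by 2n + 1 and 2n + 3 only. It is void at n = 3, so G₆ as
-- well as G₄ remains free.
--
-- An expansion relates the G₂ₙ, whereas the q-expansions give G₂ₙ / (2πi)²ⁿ, so Euler's formula for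
-- ζ(2n) has to be proved as well. There (2πi)² is replaced by -24 ζ(2), and this number is never
-- compared with the π of Leibniz's series, which enters only through z: every monomial carries the
-- same power of (2πi)², and it cancels. Euler's formula also yields B₂ₙ ≠ 0, without which the
-- reciprocal of B₂ₙ in E₂ₙ would be a default value.
--
-- All estimates concern sequences of rationals whose difference tends to zero. Sums are truncated
-- according to the index of the approximation, so that a single index controls the number of terms,
-- the approximation of q and that of ζ.

-- Rational arithmetic, powers and finite sums.

module RationalArithmetic where

  open import Data.Rational.Base
  open import Data.Rational.Properties
  open import Data.Rational.Solver using (module +-*-Solver)
  open import Data.Rational.Unnormalised.Base as ℚᵘ using (mkℚᵘ; *≡*; *≤*)
  import Data.Rational.Unnormalised.Properties as ℚᵘ
  open +-*-Solver using (solve; _:+_; _:*_; _:-_; :-_; _:=_; con)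

  -- Opaque, so that comparing terms never computes normalised fractions.
  opaque
    ι : ℕ → ℚ
    ι n = ℤ.+ n / 1

    ι-def : ∀ n → ι n ≡ ℤ.+ n / 1
    ι-def n = refl

  ι⇒ℚᵘ : ∀ n → toℚᵘ (ι n) ℚᵘ.≃ mkℚᵘ (ℤ.+ n) 0
  ι⇒ℚᵘ n = subst (λ p → toℚᵘ p ℚᵘ.≃ mkℚᵘ (ℤ.+ n) 0) (sym (ι-def n)) (toℚᵘ-fromℚᵘ (mkℚᵘ (ℤ.+ n) 0))

  ι0 : ι 0 ≡ 0ℚ
  ι0 = ι-def 0

  ι1 : ι 1 ≡ 1ℚ
  ι1 = ι-def 1

  ι-+ : ∀ m n → ι (m ℕ.+ n) ≡ ι m + ι n
  ι-+ m n = toℚᵘ-injective (ℚᵘ.≃-trans (ι⇒ℚᵘ (m ℕ.+ n)) (ℚᵘ.≃-trans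
    (*≡* (cong (ℤ._* (ℤ.+ 1)) (sym (cong₂ ℤ._+_ (ℤ.*-identityʳ (ℤ.+ m)) (ℤ.*-identityʳ (ℤ.+ n))))))
    (ℚᵘ.≃-sym (ℚᵘ.≃-trans (toℚᵘ-homo-+ (ι m) (ι n)) (ℚᵘ.+-cong (ι⇒ℚᵘ m) (ι⇒ℚᵘ n))))))

  ι-* : ∀ m n → ι (m ℕ.* n) ≡ ι m * ι n
  ι-* m n = toℚᵘ-injective (ℚᵘ.≃-trans (ι⇒ℚᵘ (m ℕ.* n)) (ℚᵘ.≃-trans
    (*≡* (cong (ℤ._* (ℤ.+ 1)) (ℤ.pos-* m n)))
    (ℚᵘ.≃-sym (ℚᵘ.≃-trans (toℚᵘ-homo-* (ι m) (ι n)) (ℚᵘ.*-cong (ι⇒ℚᵘ m) (ι⇒ℚᵘ n))))))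

  ι-suc : ∀ n → ι (suc n) ≡ 1ℚ + ι n
  ι-suc n = trans (ι-+ 1 n) (cong (_+ ι n) ι1)

  ι-mono-≤ : ∀ {m n} → m ℕ.≤ n → ι m ≤ ι n
  ι-mono-≤ {m} {n} m≤n = toℚᵘ-cancel-≤ (ℚᵘ.≤-respˡ-≃ (ℚᵘ.≃-sym (ι⇒ℚᵘ m))
    (ℚᵘ.≤-respʳ-≃ (ℚᵘ.≃-sym (ι⇒ℚᵘ n))
      (*≤* (ℤ.*-monoʳ-≤-nonNeg (ℤ.+ 1) (ℤ.+≤+ m≤n)))))

  0≤ι : ∀ n → 0ℚ ≤ ι n
  0≤ι n = subst (_≤ ι n) ι0 (ι-mono-≤ ℕ.z≤n)

  1≤ι : ∀ n → 1ℚ ≤ ι (suc n)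
  1≤ι n = subst (_≤ ι (suc n)) ι1 (ι-mono-≤ (ℕ.s≤s ℕ.z≤n))

  0<1 : 0ℚ < 1ℚ
  0<1 = positive⁻¹ 1ℚ

  0<ι : ∀ n → 0ℚ < ι (suc n)
  0<ι n = <-≤-trans 0<1 (1≤ι n)

  <⇒≢0 : ∀ {p} → 0ℚ < p → p ≢ 0ℚ
  <⇒≢0 0<p refl = <-irrefl refl 0<p

  ι≢0 : ∀ n → ι (suc n) ≢ 0ℚ
  ι≢0 n = <⇒≢0 (0<ι n)

  ≢0⇒ι≢0 : ∀ {n} → n ≢ 0 → ι n ≢ 0ℚ
  ≢0⇒ι≢0 {zero} n≢0 = ⊥-elim (n≢0 refl)
  ≢0⇒ι≢0 {suc n} _ = ι≢0 n

  inverseʳ : ∀ {p} → p ≢ 0ℚ → p * inv p ≡ 1ℚ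
  inverseʳ {p} p≢0 with p ≟ 0ℚ
  ... | yes p≡0 = ⊥-elim (p≢0 p≡0)
  ... | no  p≢0 = *-inverseʳ p {{≢-nonZero p≢0}}

  inverseˡ : ∀ {p} → p ≢ 0ℚ → inv p * p ≡ 1ℚ
  inverseˡ {p} p≢0 = trans (*-comm (inv p) p) (inverseʳ p≢0)

  *-cancelˡ : ∀ {p a b} → p ≢ 0ℚ → p * a ≡ p * b → a ≡ b
  *-cancelˡ {p} {a} {b} p≢0 eq = begin
    a               ≡⟨ lem a ⟩
    inv p * (p * a) ≡⟨ cong (inv p *_) eq ⟩
    inv p * (p * b) ≡⟨ lem b ⟨
    b               ∎
    where
    open ≡-Reasoning
    lem : ∀ c → c ≡ inv p * (p * c)
    lem c = trans (sym (*-identityˡ c))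
      (trans (cong (_* c) (sym (inverseˡ p≢0))) (*-assoc (inv p) p c))

  *-≢0 : ∀ {a b} → a ≢ 0ℚ → b ≢ 0ℚ → a * b ≢ 0ℚ
  *-≢0 {a} a≢0 b≢0 eq = b≢0 (*-cancelˡ a≢0 (trans eq (sym (*-zeroʳ a))))

  *≡0⇒≡0 : ∀ {a b} → a ≢ 0ℚ → a * b ≡ 0ℚ → b ≡ 0ℚ
  *≡0⇒≡0 {a} a≢0 eq = *-cancelˡ a≢0 (trans eq (sym (*-zeroʳ a)))

  inv-unique : ∀ a {b} → a * b ≡ 1ℚ → b ≡ inv a
  inv-unique a {b} eq = *-cancelˡ a≢0 (trans eq (sym (inverseʳ a≢0)))
    where
    a≢0 : a ≢ 0ℚ
    a≢0 refl = 1≢0 (trans (sym eq) (*-zeroˡ b))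

  *ι-cancel : ∀ n .{{_ : ℕ.NonZero n}} → ι n * (ℤ.+ 1 / n) ≡ 1ℚ
  *ι-cancel (suc n) = toℚᵘ-injective (ℚᵘ.≃-trans
    (ℚᵘ.≃-trans (toℚᵘ-homo-* (ι (suc n)) (ℤ.+ 1 / suc n))
      (ℚᵘ.*-cong (ι⇒ℚᵘ (suc n)) (toℚᵘ-fromℚᵘ (mkℚᵘ (ℤ.+ 1) n))))
    (*≡* (trans (ℤ.*-identityʳ _)
        (trans (ℤ.*-identityʳ _) (sym (trans (ℤ.*-identityˡ _) (cong ℤ.+_ (cong suc (ℕ.+-identityʳ n)))))))))

  1/ι : ∀ n .{{_ : ℕ.NonZero n}} → ℤ.+ 1 / n ≡ inv (ι n)
  1/ι n = inv-unique (ι n) (*ι-cancel n)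

  inv-* : ∀ {a b} → a ≢ 0ℚ → b ≢ 0ℚ → inv (a * b) ≡ inv a * inv b
  inv-* {a} {b} a≢0 b≢0 = sym (inv-unique (a * b) (begin
    a * b * (inv a * inv b)   ≡⟨ solve 4 (λ a b c d → a :* b :* (c :* d) := (a :* c) :* (b :* d)) refl a b
        (inv a) (inv b) ⟩
    a * inv a * (b * inv b)   ≡⟨ cong₂ _*_ (inverseʳ a≢0) (inverseʳ b≢0) ⟩
    1ℚ ∎))
    where open ≡-Reasoning

  *-mono-≤ : ∀ {a b c d} → 0ℚ ≤ a → 0ℚ ≤ c → a ≤ b → c ≤ d → a * c ≤ b * d
  *-mono-≤ {a} {b} {c} {d} 0≤a 0≤c a≤b c≤d = ≤-trans
    (*-monoʳ-≤-nonNeg c {{nonNegative 0≤c}} a≤b)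
    (*-monoˡ-≤-nonNeg b {{nonNegative (≤-trans 0≤a a≤b)}} c≤d)

  *-monoˡ : ∀ {a b c} → 0ℚ ≤ a → b ≤ c → a * b ≤ a * c
  *-monoˡ {a} 0≤a = *-monoˡ-≤-nonNeg a {{nonNegative 0≤a}}

  *-monoʳ : ∀ {a b c} → 0ℚ ≤ a → b ≤ c → b * a ≤ c * a
  *-monoʳ {a} 0≤a = *-monoʳ-≤-nonNeg a {{nonNegative 0≤a}}

  0≤* : ∀ {a b} → 0ℚ ≤ a → 0ℚ ≤ b → 0ℚ ≤ a * b
  0≤* {a} {b} 0≤a 0≤b = subst (_≤ a * b) (*-zeroˡ b) (*-monoʳ 0≤b 0≤a)

  0<* : ∀ {a b} → 0ℚ < a → 0ℚ < b → 0ℚ < a * b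
  0<* {a} {b} 0<a 0<b = subst (_< a * b) (*-zeroˡ b) (*-monoˡ-<-pos b {{positive 0<b}} 0<a)

  0≤+ : ∀ {a b} → 0ℚ ≤ a → 0ℚ ≤ b → 0ℚ ≤ a + b
  0≤+ 0≤a 0≤b = +-mono-≤ 0≤a 0≤b

  0<inv : ∀ {a} → 0ℚ < a → 0ℚ < inv a
  0<inv {a} 0<a = *-cancelˡ-<-nonNeg a {{nonNegative (<⇒≤ 0<a)}}
    (subst₂ _<_ (sym (*-zeroʳ a)) (sym (inverseʳ (<⇒≢0 0<a))) 0<1)

  0≤inv : ∀ {a} → 0ℚ < a → 0ℚ ≤ inv a
  0≤inv 0<a = <⇒≤ (0<inv 0<a)

  inv-antimono : ∀ {a b} → 0ℚ < a → a ≤ b → inv b ≤ inv a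
  inv-antimono {a} {b} 0<a a≤b = begin
    inv b               ≡⟨ *-identityʳ _ ⟨
    inv b * 1ℚ          ≡⟨ cong (inv b *_) (inverseʳ (<⇒≢0 0<a)) ⟨
    inv b * (a * inv a) ≤⟨ *-monoˡ (0≤inv 0<b) (*-monoʳ (0≤inv 0<a) a≤b) ⟩
    inv b * (b * inv a) ≡⟨ *-assoc (inv b) b (inv a) ⟨
    inv b * b * inv a   ≡⟨ cong (_* inv a) (inverseˡ (<⇒≢0 0<b)) ⟩
    1ℚ * inv a          ≡⟨ *-identityˡ _ ⟩
    inv a               ∎
    where
    open ≤-Reasoning
    0<b : 0ℚ < b
    0<b = <-≤-trans 0<a a≤b

  ≤-fromDiff : ∀ {p q e} → q - p ≡ e → 0ℚ ≤ e → p ≤ q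
  ≤-fromDiff {p} {q} {e} eq 0≤e = begin
    p           ≡⟨ +-identityʳ p ⟨
    p + 0ℚ      ≤⟨ +-monoʳ-≤ p 0≤e ⟩
    p + e       ≡⟨ cong (p +_) eq ⟨
    p + (q - p) ≡⟨ solve 2 (λ p q → p :+ (q :- p) := q) refl p q ⟩
    q           ∎
    where open ≤-Reasoning

  0≤diff : ∀ {p q} → p ≤ q → 0ℚ ≤ q - p
  0≤diff {p} {q} p≤q = subst (_≤ q - p) (+-inverseʳ p) (+-monoˡ-≤ (- p) p≤q)

  ≤∣∣ : ∀ a → a ≤ ∣ a ∣
  ≤∣∣ a with ≤-total 0ℚ a
  ... | inj₁ 0≤a = ≤-reflexive (sym (0≤p⇒∣p∣≡p 0≤a))
  ... | inj₂ a≤0 = ≤-trans a≤0 (0≤∣p∣ a)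

  ∣-∣-sym : ∀ a b → ∣ a - b ∣ ≡ ∣ b - a ∣
  ∣-∣-sym a b = trans (sym (∣-p∣≡∣p∣ (a - b)))
    (cong ∣_∣ (solve 2 (λ a b → :- (a :- b) := b :- a) refl a b))

  ∣*∣≤ : ∀ {a b c d} → ∣ a ∣ ≤ b → ∣ c ∣ ≤ d → ∣ a * c ∣ ≤ b * d
  ∣*∣≤ {a} {b} {c} {d} p q = subst (_≤ b * d) (sym (∣p*q∣≡∣p∣*∣q∣ a c)) (*-mono-≤ (0≤∣p∣ a) (0≤∣p∣ c) p q)

  ∣+∣≤ : ∀ {a b c d} → ∣ a ∣ ≤ b → ∣ c ∣ ≤ d → ∣ a + c ∣ ≤ b + d
  ∣+∣≤ {a} {b} {c} {d} p q = ≤-trans (∣p+q∣≤∣p∣+∣q∣ a c) (+-mono-≤ p q)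

  infixr 8 _^_
  _^_ : ℚ → ℕ → ℚ
  x ^ zero = 1ℚ
  x ^ suc n = x * x ^ n

  ^-+ : ∀ x m n → x ^ (m ℕ.+ n) ≡ x ^ m * x ^ n
  ^-+ x zero n = sym (*-identityˡ _)
  ^-+ x (suc m) n = trans (cong (x *_) (^-+ x m n)) (sym (*-assoc x _ _))

  ^-*-distrib : ∀ x y n → (x * y) ^ n ≡ x ^ n * y ^ n
  ^-*-distrib x y zero = refl
  ^-*-distrib x y (suc n) = trans (cong (x * y *_) (^-*-distrib x y n))
    (solve 4 (λ x y p q → x :* y :* (p :* q) := x :* p :* (y :* q)) refl x y (x ^ n) (y ^ n))

  1^ : ∀ n → 1ℚ ^ n ≡ 1ℚ
  1^ zero = refl
  1^ (suc n) = trans (*-identityˡ _) (1^ n)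

  ^-*-assoc : ∀ x m n → (x ^ m) ^ n ≡ x ^ (m ℕ.* n)
  ^-*-assoc x zero n = 1^ n
  ^-*-assoc x (suc m) n = trans (^-*-distrib x (x ^ m) n)
    (trans (cong (x ^ n *_) (^-*-assoc x m n)) (sym (^-+ x n (m ℕ.* n))))

  ι-^ : ∀ m n → ι (m ℕ.^ n) ≡ ι m ^ n
  ι-^ m zero = ι1
  ι-^ m (suc n) = trans (ι-* m (m ℕ.^ n)) (cong (ι m *_) (ι-^ m n))

  0≤^ : ∀ {x} n → 0ℚ ≤ x → 0ℚ ≤ x ^ n
  0≤^ zero _ = <⇒≤ 0<1
  0≤^ (suc n) 0≤x = 0≤* 0≤x (0≤^ n 0≤x)

  ^-mono-≤ : ∀ {x y} n → 0ℚ ≤ x → x ≤ y → x ^ n ≤ y ^ n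
  ^-mono-≤ zero _ _ = ≤-refl
  ^-mono-≤ (suc n) 0≤x x≤y = *-mono-≤ 0≤x (0≤^ n 0≤x) x≤y (^-mono-≤ n 0≤x x≤y)

  1≤^ : ∀ {x} n → 1ℚ ≤ x → 1ℚ ≤ x ^ n
  1≤^ {x} n 1≤x = subst (_≤ x ^ n) (1^ n) (^-mono-≤ n (<⇒≤ 0<1) 1≤x)

  ^-≢0 : ∀ {x} n → x ≢ 0ℚ → x ^ n ≢ 0ℚ
  ^-≢0 zero _ = 1≢0
  ^-≢0 (suc n) x≢0 = *-≢0 x≢0 (^-≢0 n x≢0)

  Σ< : ℕ → (ℕ → ℚ) → ℚ
  Σ< zero    f = 0ℚ
  Σ< (suc n) f = Σ< n f + f n

  Σ-cong< : ∀ n {f g} → (∀ i → i ℕ.< n → f i ≡ g i) → Σ< n f ≡ Σ< n g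
  Σ-cong< zero _ = refl
  Σ-cong< (suc n) eq = cong₂ _+_ (Σ-cong< n (λ i i<n → eq i (ℕ.m≤n⇒m≤1+n i<n))) (eq n ℕ.≤-refl)

  Σ-cong : ∀ n {f g} → (∀ i → f i ≡ g i) → Σ< n f ≡ Σ< n g
  Σ-cong n eq = Σ-cong< n (λ i _ → eq i)

  Σ-0 : ∀ n {f} → (∀ i → i ℕ.< n → f i ≡ 0ℚ) → Σ< n f ≡ 0ℚ
  Σ-0 zero _ = refl
  Σ-0 (suc n) eq = cong₂ _+_ (Σ-0 n (λ i i<n → eq i (ℕ.m≤n⇒m≤1+n i<n))) (eq n ℕ.≤-refl)

  Σ-+ : ∀ n f g → Σ< n (λ i → f i + g i) ≡ Σ< n f + Σ< n g
  Σ-+ zero f g = refl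
  Σ-+ (suc n) f g = trans (cong (_+ (f n + g n)) (Σ-+ n f g))
    (solve 4 (λ a b c d → a :+ b :+ (c :+ d) := a :+ c :+ (b :+ d)) refl (Σ< n f) (Σ< n g) (f n) (g n))

  Σ-*ˡ : ∀ n c f → Σ< n (λ i → c * f i) ≡ c * Σ< n f
  Σ-*ˡ zero c f = sym (*-zeroʳ c)
  Σ-*ˡ (suc n) c f = trans (cong (_+ c * f n) (Σ-*ˡ n c f)) (sym (*-distribˡ-+ c (Σ< n f) (f n)))

  Σ-*ʳ : ∀ n c f → Σ< n (λ i → f i * c) ≡ Σ< n f * c
  Σ-*ʳ n c f = trans (Σ-cong n (λ i → *-comm (f i) c)) (trans (Σ-*ˡ n c f) (*-comm c _))

  Σ-neg : ∀ n f → Σ< n (λ i → - f i) ≡ - Σ< n f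
  Σ-neg zero f = refl
  Σ-neg (suc n) f = trans (cong (_+ - f n) (Σ-neg n f)) (sym (neg-distrib-+ (Σ< n f) (f n)))

  Σ-- : ∀ n f g → Σ< n (λ i → f i - g i) ≡ Σ< n f - Σ< n g
  Σ-- n f g = trans (Σ-+ n f (λ i → - g i)) (cong (Σ< n f +_) (Σ-neg n g))

  Σ-swap : ∀ m n (f : ℕ → ℕ → ℚ) → Σ< m (λ i → Σ< n (f i)) ≡ Σ< n (λ j → Σ< m (λ i → f i j))
  Σ-swap zero n f = sym (Σ-0 n (λ _ _ → refl))
  Σ-swap (suc m) n f = trans (cong (_+ Σ< n (f m)) (Σ-swap m n f)) (sym (Σ-+ n _ (f m)))

  Σ-head : ∀ n f → Σ< (suc n) f ≡ f 0 + Σ< n (λ i → f (suc i))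
  Σ-head zero f = +-comm 0ℚ (f 0)
  Σ-head (suc n) f = trans (cong (_+ f (suc n)) (Σ-head n f)) (+-assoc (f 0) _ _)

  Σ-split : ∀ m n f → Σ< (m ℕ.+ n) f ≡ Σ< m f + Σ< n (λ i → f (m ℕ.+ i))
  Σ-split m zero f = trans (cong (λ k → Σ< k f) (ℕ.+-identityʳ m)) (sym (+-identityʳ _))
  Σ-split m (suc n) f = trans (cong (λ k → Σ< k f) (ℕ.+-suc m n))
    (trans (cong (_+ f (m ℕ.+ n)) (Σ-split m n f)) (+-assoc (Σ< m f) _ _))

  Σ-mono : ∀ n {f g} → (∀ i → i ℕ.< n → f i ≤ g i) → Σ< n f ≤ Σ< n g
  Σ-mono zero _ = ≤-refl
  Σ-mono (suc n) le = +-mono-≤ (Σ-mono n (λ i i<n → le i (ℕ.m≤n⇒m≤1+n i<n))) (le n ℕ.≤-refl)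

  0≤Σ : ∀ n {f} → (∀ i → i ℕ.< n → 0ℚ ≤ f i) → 0ℚ ≤ Σ< n f
  0≤Σ n {f} le = subst (_≤ Σ< n f) (Σ-0 n (λ _ _ → refl)) (Σ-mono n le)

  ∣Σ∣≤ : ∀ n f → ∣ Σ< n f ∣ ≤ Σ< n (λ i → ∣ f i ∣)
  ∣Σ∣≤ zero f = ≤-refl
  ∣Σ∣≤ (suc n) f = ∣+∣≤ (∣Σ∣≤ n f) ≤-refl

  Σ-const : ∀ n c → Σ< n (λ _ → c) ≡ ι n * c
  Σ-const zero c = trans (sym (*-zeroˡ c)) (cong (_* c) (sym ι0))
  Σ-const (suc n) c = trans (cong (_+ c) (Σ-const n c))
    (trans (solve 2 (λ n c → n :* c :+ c := (con 1ℚ :+ n) :* c) refl (ι n) c) (cong (_* c) (sym (ι-suc n))))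

  Σ-telescope : ∀ n (f : ℕ → ℚ) → Σ< n (λ i → f (suc i) - f i) ≡ f n - f 0
  Σ-telescope zero f = sym (+-inverseʳ (f 0))
  Σ-telescope (suc n) f = trans (cong (_+ (f (suc n) - f n)) (Σ-telescope n f))
    (solve 3 (λ a b c → b :- a :+ (c :- b) := c :- a) refl (f 0) (f n) (f (suc n)))

-- Formal power series over ℚ, the Euler operator and exponentials.

module PowerSeries where

  import Algebra.Solver.Ring as RingSolver
  open import Algebra.Bundles using (CommutativeRing)
  open import Algebra.Solver.Ring.AlmostCommutativeRing using (fromCommutativeRing; _-Raw-AlmostCommutative⟶_)
  open import Data.Maybe.Base using (Maybe; just; nothing)
  open import Data.Rational.Base
  open import Data.Rational.Properties
  open import Data.Rational.Solver using () renaming (module +-*-Solver to ℚS)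
  open import Level using (0ℓ)
  open RationalArithmetic

  -- anti F n = Σ_{i+j=n} F i j
  anti : (ℕ → ℕ → ℚ) → ℕ → ℚ
  anti F zero    = F 0 0
  anti F (suc n) = F 0 (suc n) + anti (λ i j → F (suc i) j) n

  anti-cong⁺ : ∀ n {F G} → (∀ i j → i ℕ.+ j ≡ n → F i j ≡ G i j) → anti F n ≡ anti G n
  anti-cong⁺ zero eq = eq 0 0 refl
  anti-cong⁺ (suc n) eq = cong₂ _+_ (eq 0 (suc n) refl)
      (anti-cong⁺ n (λ i j i+j≡n → eq (suc i) j (cong suc i+j≡n)))

  anti-cong : ∀ n {F G} → (∀ i j → F i j ≡ G i j) → anti F n ≡ anti G n
  anti-cong n eq = anti-cong⁺ n (λ i j _ → eq i j)

  anti-0 : ∀ n {F} → (∀ i j → i ℕ.+ j ≡ n → F i j ≡ 0ℚ) → anti F n ≡ 0ℚ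
  anti-0 zero eq = eq 0 0 refl
  anti-0 (suc n) eq = cong₂ _+_ (eq 0 (suc n) refl) (anti-0 n (λ i j i+j≡n → eq (suc i) j (cong suc i+j≡n)))

  anti-+ : ∀ n F G → anti (λ i j → F i j + G i j) n ≡ anti F n + anti G n
  anti-+ zero F G = refl
  anti-+ (suc n) F G = trans (cong (F 0 (suc n) + G 0 (suc n) +_) (anti-+ n _ _))
    (ℚS.solve 4 (λ a b c d → a ℚS.:+ b ℚS.:+ (c ℚS.:+ d) ℚS.:= a ℚS.:+ c ℚS.:+ (b ℚS.:+ d)) refl
      (F 0 (suc n)) (G 0 (suc n)) (anti (λ i j → F (suc i) j) n) (anti (λ i j → G (suc i) j) n))

  anti-*ˡ : ∀ n c F → anti (λ i j → c * F i j) n ≡ c * anti F n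
  anti-*ˡ zero c F = refl
  anti-*ˡ (suc n) c F = trans (cong (c * F 0 (suc n) +_) (anti-*ˡ n c _)) (sym (*-distribˡ-+ c _ _))

  anti-*ʳ : ∀ n c F → anti (λ i j → F i j * c) n ≡ anti F n * c
  anti-*ʳ n c F = trans (anti-cong n (λ i j → *-comm (F i j) c)) (trans (anti-*ˡ n c F) (*-comm c _))

  anti-neg : ∀ n F → anti (λ i j → - F i j) n ≡ - anti F n
  anti-neg zero F = refl
  anti-neg (suc n) F = trans (cong (- F 0 (suc n) +_) (anti-neg n _)) (sym (neg-distrib-+ (F 0 (suc n)) _))

  anti-last : ∀ n F → anti F (suc n) ≡ anti (λ i j → F i (suc j)) n + F (suc n) 0
  anti-last zero F = refl
  anti-last (suc n) F = trans (cong (F 0 (suc (suc n)) +_) (anti-last n (λ i j → F (suc i) j)))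
      (sym (+-assoc (F 0 (suc (suc n))) _ _))

  anti-comm : ∀ n F → anti F n ≡ anti (λ i j → F j i) n
  anti-comm zero F = refl
  anti-comm (suc n) F = trans (+-comm (F 0 (suc n)) _)
    (trans (cong (_+ F 0 (suc n)) (anti-comm n (λ i j → F (suc i) j))) (sym (anti-last n (λ i j → F j i))))

  anti-assoc : ∀ n (F : ℕ → ℕ → ℕ → ℚ) →
    anti (λ i j → anti (λ u v → F u v j) i) n ≡ anti (λ i j → anti (F i) j) n
  anti-assoc zero F = refl
  anti-assoc (suc n) F = trans (cong (F 0 0 (suc n) +_) (trans
    (anti-+ n (λ i j → F 0 (suc i) j) (λ i j → anti (λ u v → F (suc u) v j) i))
    (cong (anti (λ i j → F 0 (suc i) j) n +_) (anti-assoc n (λ u → F (suc u))))))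
    (sym (+-assoc (F 0 0 (suc n)) _ _))

  anti-Σ : ∀ n m (F : ℕ → ℕ → ℕ → ℚ) → anti (λ i j → Σ< m (F i j)) n ≡ Σ< m (λ k → anti (λ i j → F i j k) n)
  anti-Σ zero m F = refl
  anti-Σ (suc n) m F = trans (cong (Σ< m (F 0 (suc n)) +_) (anti-Σ n m (λ i → F (suc i)))) (sym (Σ-+ m _ _))

  record Series : Set where
    no-eta-equality
    constructor ser
    infixl 9 _!_
    field _!_ : ℕ → ℚ
  open Series public

  infix 4 _≋_
  record _≋_ (a b : Series) : Set where
    constructor mk
    field at : ∀ n → a ! n ≡ b ! n
  open _≋_ public

  infixl 6 _⊕_ _⊖_
  infixl 7 _⊗_
  infix 8 ⊝_

  _⊕_ _⊗_ _⊖_ : Series → Series → Series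
  (a ⊕ b) ! n = a ! n + b ! n
  (a ⊗ b) ! n = anti (λ i j → a ! i * b ! j) n

  ⊝_ : Series → Series
  (⊝ a) ! n = - a ! n

  a ⊖ b = a ⊕ ⊝ b

  κ : ℚ → Series
  κ c ! zero    = c
  κ c ! suc n = 0ℚ

  X : Series
  X ! zero          = 0ℚ
  X ! suc zero      = 1ℚ
  X ! suc (suc n)   = 0ℚ

  ≋-refl : ∀ {a} → a ≋ a
  ≋-refl = mk λ _ → refl

  ≋-sym : ∀ {a b} → a ≋ b → b ≋ a
  ≋-sym (mk e) = mk λ n → sym (e n)

  ≋-trans : ∀ {a b c} → a ≋ b → b ≋ c → a ≋ c
  ≋-trans (mk e) (mk f) = mk λ n → trans (e n) (f n)

  ⊗-cong : ∀ {a a′ b b′} → a ≋ a′ → b ≋ b′ → a ⊗ b ≋ a′ ⊗ b′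
  ⊗-cong (mk e) (mk f) = mk λ n → anti-cong n (λ i j → cong₂ _*_ (e i) (f j))

  ⊕-cong : ∀ {a a′ b b′} → a ≋ a′ → b ≋ b′ → a ⊕ b ≋ a′ ⊕ b′
  ⊕-cong (mk e) (mk f) = mk λ n → cong₂ _+_ (e n) (f n)

  ⊝-cong : ∀ {a a′} → a ≋ a′ → ⊝ a ≋ ⊝ a′
  ⊝-cong (mk e) = mk λ n → cong -_ (e n)

  κ-⊗ : ∀ c a n → (κ c ⊗ a) ! n ≡ c * a ! n
  κ-⊗ c a zero = refl
  κ-⊗ c a (suc n) = trans (cong (c * a ! suc n +_) (anti-0 n (λ i j _ → *-zeroˡ (a ! j)))) (+-identityʳ _)

  X-⊗ : ∀ a n → (X ⊗ a) ! suc n ≡ a ! n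
  X-⊗ a n = trans (cong₂ _+_ (*-zeroˡ (a ! suc n))
    (trans (anti-cong n {G = λ i j → κ 1ℚ ! i * a ! j} λ { zero j → refl ; (suc i) j → refl })
      (trans (κ-⊗ 1ℚ a n) (*-identityˡ (a ! n))))) (+-identityˡ (a ! n))

  ⊗-comm : ∀ a b → a ⊗ b ≋ b ⊗ a
  ⊗-comm a b = mk λ n → trans (anti-comm n _) (anti-cong n (λ i j → *-comm (a ! j) (b ! i)))

  ⊗-assoc : ∀ a b c → (a ⊗ b) ⊗ c ≋ a ⊗ (b ⊗ c)
  ⊗-assoc a b c = mk λ n → begin
    anti (λ i j → anti (λ u v → a ! u * b ! v) i * c ! j) n ≡⟨ anti-cong n (λ i j → sym (anti-*ʳ i (c ! j) _)) ⟩
    anti (λ i j → anti (λ u v → a ! u * b ! v * c ! j) i) n ≡⟨ anti-assoc n (λ u v j → a ! u * b ! v * c ! j) ⟩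
    anti (λ i j → anti (λ u v → a ! i * b ! u * c ! v) j) n ≡⟨ anti-cong n
        (λ i j → trans (anti-cong j (λ u v → *-assoc (a ! i) (b ! u) (c ! v))) (anti-*ˡ j (a ! i) _)) ⟩
    anti (λ i j → a ! i * anti (λ u v → b ! u * c ! v) j) n ∎
    where open ≡-Reasoning

  ⊗-distribˡ : ∀ a b c → a ⊗ (b ⊕ c) ≋ a ⊗ b ⊕ a ⊗ c
  ⊗-distribˡ a b c = mk λ n → trans (anti-cong n (λ i j → *-distribˡ-+ (a ! i) (b ! j) (c ! j))) (anti-+ n _ _)

  ⊗-identityˡ : ∀ a → κ 1ℚ ⊗ a ≋ a
  ⊗-identityˡ a = mk λ n → trans (κ-⊗ 1ℚ a n) (*-identityˡ (a ! n))

  Series-commutativeRing : CommutativeRing 0ℓ 0ℓ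
  Series-commutativeRing = record
    { Carrier = Series ; _≈_ = _≋_ ; _+_ = _⊕_ ; _*_ = _⊗_ ; -_ = ⊝_ ; 0# = κ 0ℚ ; 1# = κ 1ℚ
    ; isCommutativeRing = record
      { isRing = record
        { +-isAbelianGroup = record
          { isGroup = record
            { isMonoid = record
              { isSemigroup = record
                { isMagma = record
                  { isEquivalence = record { refl = ≋-refl ; sym = ≋-sym ; trans = ≋-trans }
                  ; ∙-cong = ⊕-cong }
                ; assoc = λ a b c → mk λ n → +-assoc (a ! n) (b ! n) (c ! n) }
              ; identity = (λ a → mk λ { zero → +-identityˡ (a ! 0) ; (suc n) → +-identityˡ (a ! suc n) })
                         , (λ a → mk λ { zero → +-identityʳ (a ! 0) ; (suc n) → +-identityʳ (a ! suc n) }) }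
            ; inverse = (λ a → mk λ { zero → +-inverseˡ (a ! 0) ; (suc n) → +-inverseˡ (a ! suc n) })
                      , (λ a → mk λ { zero → +-inverseʳ (a ! 0) ; (suc n) → +-inverseʳ (a ! suc n) })
            ; ⁻¹-cong = ⊝-cong }
          ; comm = λ a b → mk λ n → +-comm (a ! n) (b ! n) }
        ; *-cong = ⊗-cong
        ; *-assoc = ⊗-assoc
        ; *-identity = ⊗-identityˡ , (λ a → ≋-trans (⊗-comm a (κ 1ℚ)) (⊗-identityˡ a))
        ; distrib = ⊗-distribˡ , (λ a b c → ≋-trans (⊗-comm (b ⊕ c) a)
            (≋-trans (⊗-distribˡ a b c) (⊕-cong (⊗-comm a b) (⊗-comm a c)))) }
      ; *-comm = ⊗-comm } }

  -- Makes ℚ the coefficient ring of the solver, so that identities with rational constants such as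
  -- 1/12 can be decided.
  κ-morphism : CommutativeRing.rawRing +-*-commutativeRing -Raw-AlmostCommutative⟶ fromCommutativeRing
      Series-commutativeRing
  κ-morphism = record
    { ⟦_⟧ = κ
    ; +-homo = λ a b → mk λ { zero → refl ; (suc n) → refl }
    ; *-homo = λ a b → mk λ { zero → refl ; (suc n) → sym (trans (κ-⊗ a (κ b) (suc n)) (*-zeroʳ a)) }
    ; -‿homo = λ a → mk λ { zero → refl ; (suc n) → refl }
    ; 0-homo = ≋-refl
    ; 1-homo = ≋-refl }

  κ-≟ : ∀ a b → Maybe (κ a ≋ κ b)
  κ-≟ a b with a ≟ b
  ... | yes refl = just ≋-refl
  ... | no _ = nothing

  module SeriesSolver = RingSolver (CommutativeRing.rawRing +-*-commutativeRing)
    (fromCommutativeRing Series-commutativeRing) κ-morphism κ-≟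

  X-cancel : ∀ {a b} → X ⊗ a ≋ X ⊗ b → a ≋ b
  X-cancel {a} {b} (mk e) = mk λ n → trans (sym (X-⊗ a n)) (trans (e (suc n)) (X-⊗ b n))

  -- θ = x d/dx
  θ : Series → Series
  θ a ! n = ι n * a ! n

  θ-cong : ∀ {a b} → a ≋ b → θ a ≋ θ b
  θ-cong (mk e) = mk λ n → cong (ι n *_) (e n)

  θ-⊕ : ∀ a b → θ (a ⊕ b) ≋ θ a ⊕ θ b
  θ-⊕ a b = mk λ n → *-distribˡ-+ (ι n) (a ! n) (b ! n)

  θ-⊝ : ∀ a → θ (⊝ a) ≋ ⊝ θ a
  θ-⊝ a = mk λ n → sym (neg-distribʳ-* (ι n) (a ! n))

  θ-κ : ∀ c → θ (κ c) ≋ κ 0ℚ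
  θ-κ c = mk λ { zero → trans (cong (_* c) ι0) (*-zeroˡ c) ; (suc n) → *-zeroʳ (ι (suc n)) }

  θ-X : θ X ≋ X
  θ-X = mk λ { zero → *-zeroʳ (ι 0) ; (suc zero) → trans (*-identityʳ (ι 1)) ι1 ; (suc (suc n)) → *-zeroʳ
      (ι (suc (suc n))) }

  θ-⊗ : ∀ a b → θ (a ⊗ b) ≋ θ a ⊗ b ⊕ a ⊗ θ b
  θ-⊗ a b = mk λ n → trans (sym (anti-*ˡ n (ι n) _)) (trans (anti-cong⁺ n λ { i j refl →
      trans (cong (_* (a ! i * b ! j)) (ι-+ i j))
      (ℚS.solve 4 (λ i j a b → (i ℚS.:+ j) ℚS.:* (a ℚS.:* b) ℚS.:= i ℚS.:* a ℚS.:* b ℚS.:+ a ℚS.:* (j ℚS.:* b))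
          refl (ι i) (ι j) (a ! i) (b ! j)) })
    (anti-+ n _ _))

  θ-· : ∀ c a → θ (κ c ⊗ a) ≋ κ c ⊗ θ a
  θ-· c a = mk λ n → trans (cong (ι n *_) (κ-⊗ c a n)) (trans
    (ℚS.solve 3 (λ i c a → i ℚS.:* (c ℚS.:* a) ℚS.:= c ℚS.:* (i ℚS.:* a)) refl (ι n) c (a ! n))
        (sym (κ-⊗ c (θ a) n)))

  -- E a = exp(a x)
  E : ℚ → Series
  E a ! zero = 1ℚ
  E a ! suc n = a * E a ! n * inv (ι (suc n))

  ι*E : ∀ a n → ι (suc n) * E a ! suc n ≡ a * E a ! n
  ι*E a n = trans (ℚS.solve 3 (λ i e v → i ℚS.:* (e ℚS.:* v) ℚS.:= e ℚS.:* (i ℚS.:* v)) refl (ι (suc n))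
      (a * E a ! n) (inv (ι (suc n))))
    (trans (cong (a * E a ! n *_) (inverseʳ (ι≢0 n))) (*-identityʳ _))

  θ-E : ∀ a → θ (E a) ≋ X ⊗ (κ a ⊗ E a)
  θ-E a = mk λ { zero → trans (cong (_* 1ℚ) ι0) (sym (*-zeroˡ ((κ a ⊗ E a) ! 0)))
               ; (suc n) → trans (ι*E a n) (sym (trans (X-⊗ (κ a ⊗ E a) n) (κ-⊗ a (E a) n))) }

  -- The equation reads (n + 1) F (n + 1) = c F n, so the constant term determines all coefficients.
  E-unique : ∀ c F → F ! 0 ≡ 1ℚ → θ F ≋ X ⊗ (κ c ⊗ F) → F ≋ E c
  E-unique c F F0 (mk e) = mk go
    where
    go : ∀ n → F ! n ≡ E c ! n
    go zero = F0
    go (suc n) = *-cancelˡ (ι≢0 n) (trans (e (suc n)) (trans (X-⊗ (κ c ⊗ F) n) (trans (κ-⊗ c F n)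
      (trans (cong (c *_) (go n)) (sym (ι*E c n))))))

  module Reasoning where
    open import Relation.Binary.Reasoning.Setoid (CommutativeRing.setoid Series-commutativeRing) public

  open SeriesSolver using (solve; _:+_; _:*_; _:-_; :-_; _:=_; con)

  -- Both sides satisfy θ F = (a + b) x F with constant term 1, which avoids the binomial theorem.
  E-+ : ∀ a b → E a ⊗ E b ≋ E (a + b)
  E-+ a b = E-unique (a + b) (E a ⊗ E b) (*-identityˡ _) (begin
    θ (E a ⊗ E b)                                         ≈⟨ θ-⊗ (E a) (E b) ⟩
    θ (E a) ⊗ E b ⊕ E a ⊗ θ (E b)                         ≈⟨ ⊕-cong (⊗-cong (θ-E a) ≋-refl)
        (⊗-cong ≋-refl (θ-E b)) ⟩
    X ⊗ (κ a ⊗ E a) ⊗ E b ⊕ E a ⊗ (X ⊗ (κ b ⊗ E b))       ≈⟨ solve 5 (λ x ca cb ea eb →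
       x :* (ca :* ea) :* eb :+ ea :* (x :* (cb :* eb)) := x :* ((ca :+ cb) :* (ea :* eb))) ≋-refl X (κ a) (κ b)
           (E a) (E b) ⟩
    X ⊗ ((κ a ⊕ κ b) ⊗ (E a ⊗ E b))                       ≈⟨ ⊗-cong ≋-refl
        (⊗-cong (mk λ { zero → refl ; (suc n) → refl }) ≋-refl) ⟩
    X ⊗ (κ (a + b) ⊗ (E a ⊗ E b)) ∎)
    where open Reasoning

  E-0 : E 0ℚ ≋ κ 1ℚ
  E-0 = mk λ { zero → refl ; (suc n) → trans (cong (_* inv (ι (suc n))) (*-zeroˡ (E 0ℚ ! n)))
      (*-zeroˡ (inv (ι (suc n)))) }

  E-neg : ∀ a n → E (- a) ! n ≡ (- 1ℚ) ^ n * E a ! n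
  E-neg a zero = refl
  E-neg a (suc n) = trans (cong (λ e → - a * e * inv (ι (suc n))) (E-neg a n))
    (ℚS.solve 4 (λ a s e v → (ℚS.:- a) ℚS.:* (s ℚS.:* e) ℚS.:* v ℚS.:= ℚS.con (- 1ℚ) ℚS.:* s ℚS.:*
        (a ℚS.:* e ℚS.:* v)) refl a ((- 1ℚ) ^ n) (E a ! n) (inv (ι (suc n))))

  dbl : ℕ → ℕ
  dbl zero = zero
  dbl (suc n) = suc (suc (dbl n))

  ev : Series → Series
  ev a ! n = a ! dbl n

  -- In even degree an odd index of `b` is always paired with an odd index of `a`, so it is enough
  -- that one factor is even.
  ⊗-ev : ∀ a b n → (∀ i → a ! suc (dbl i) ≡ 0ℚ) → (a ⊗ b) ! dbl n ≡ (ev a ⊗ ev b) ! n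
  ⊗-ev a b zero odd = refl
  ⊗-ev a b (suc n) odd = cong (a ! 0 * b ! dbl (suc n) +_) (trans
    (cong₂ _+_ (trans (cong (_* b ! suc (dbl n)) (odd 0)) (*-zeroˡ (b ! suc (dbl n))))
        (⊗-ev (ser λ i → a ! suc (suc i)) b n (λ i → odd (suc i))))
    (+-identityˡ _))

-- Bernoulli numbers and the degenerate ℘-function.

module BernoulliSeries where

  open import Data.Bool.Base using (T)
  open import Data.List.Base using (foldr; applyUpTo)
  open import Data.Nat.Base using (_!)
  open import Data.Nat.Combinatorics using (_C_; nCk≡n!/k![n-k]!; k![n∸k]!∣n!; nCk≡nC[n∸k]; nC1≡n)
  open import Data.Nat.DivMod using (m/n*n≡m)
  open import Data.Rational.Base
  open import Data.Rational.Properties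
  open import Data.Rational.Solver using (module +-*-Solver)
  open import Defs using (bernoulli; bernoulliUpTo)
  open RationalArithmetic
  open PowerSeries hiding (module Reasoning)
  open PowerSeries.Reasoning
  open +-*-Solver using (solve; _:+_; _:*_; _:-_; :-_; _:=_; con)
  private
    module S = SeriesSolver

  foldr-upTo : (h : ℕ → ℚ) (f : ℕ → ℕ) (n : ℕ) →
    foldr (λ i acc → h i + acc) 0ℚ (applyUpTo f n) ≡ Σ< n (h ∘ f)
  foldr-upTo h f zero = refl
  foldr-upTo h f (suc n) = trans (cong (h (f 0) +_) (foldr-upTo h (f ∘ suc) n)) (sym (Σ-head n (h ∘ f)))

  if-T : ∀ {b} {x y : ℚ} → T b → (if b then x else y) ≡ x
  if-T {true} _ = refl

  if-¬T : ∀ {b} {x y : ℚ} → ¬ T b → (if b then x else y) ≡ y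
  if-¬T {true} ¬t = ⊥-elim (¬t _)
  if-¬T {false} _ = refl

  bernoulliUpTo-stable : ∀ n i → i ℕ.≤ n → bernoulliUpTo n i ≡ bernoulli i
  bernoulliUpTo-stable zero .zero ℕ.z≤n = refl
  bernoulliUpTo-stable (suc n) i i≤1+n = by-cases (ℕ.m≤n⇒m<n∨m≡n i≤1+n)
    where
    by-cases : i ℕ.< suc n ⊎ i ≡ suc n → bernoulliUpTo (suc n) i ≡ bernoulli i
    by-cases (inj₁ (ℕ.s≤s i≤n)) = trans (if-T {i ℕ.≤ᵇ n} (ℕ.≤⇒≤ᵇ i≤n)) (bernoulliUpTo-stable n i i≤n)
    by-cases (inj₂ i≡1+n) = cong (λ m → bernoulliUpTo m i) (sym i≡1+n)

  bernoulli-suc : ∀ n → bernoulli (suc n) ≡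
    - ((ℤ.+ 1 / suc (suc n)) * Σ< (suc n) (λ i → ι (suc (suc n) C i) * bernoulli i))
  bernoulli-suc n = trans (if-¬T {suc n ℕ.≤ᵇ n} (λ t → ℕ.1+n≰n (ℕ.≤ᵇ⇒≤ (suc n) n t)))
    (cong (λ s → - ((ℤ.+ 1 / suc (suc n)) * s)) (trans
    (foldr-upTo (λ i → (ℤ.+ (suc (suc n) C i) / 1) * bernoulliUpTo n i) (λ i → i) (suc n))
    (Σ-cong< (suc n) (λ i i<n → cong₂ _*_ (sym (ι-def _)) (bernoulliUpTo-stable n i (ℕ.s≤s⁻¹ i<n))))))

  ιC : ∀ {n i} → i ℕ.≤ n → ι (n C i) * (ι (i !) * ι ((n ℕ.∸ i) !)) ≡ ι (n !)
  ιC {n} {i} i≤n = trans (cong (ι (n C i) *_) (sym (ι-* (i !) _))) (trans (sym (ι-* (n C i) _))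
    (cong ι (trans (cong (ℕ._* (i ! ℕ.* (n ℕ.∸ i) !)) (nCk≡n!/k![n-k]! i≤n))
      (m/n*n≡m {{_}} (k![n∸k]!∣n! i≤n)))))
    where
    instance _ = ℕ._!≢0 i
    instance _ = ℕ._!≢0 (n ℕ.∸ i)
    instance _ = ℕ.m*n≢0 (i !) ((n ℕ.∸ i) !)

  ι!≢0 : ∀ n → ι (n !) ≢ 0ℚ
  ι!≢0 n = ≢0⇒ι≢0 (ℕ.≢-nonZero⁻¹ (n !) {{ℕ._!≢0 n}})

  E-! : ∀ a n → E a ! n * ι (n !) ≡ a ^ n
  E-! a zero = trans (*-identityˡ _) ι1
  E-! a (suc n) = trans (cong (E a ! suc n *_) (ι-* (suc n) (n !))) (trans
    (solve 5 (λ a e v m f → a :* e :* v :* (m :* f) := a :* (e :* f) :* (m :* v)) refl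
      a (E a ! n) (inv (ι (suc n))) (ι (suc n)) (ι (n !)))
    (trans (cong₂ (λ x y → a * x * y) (E-! a n) (inverseʳ (ι≢0 n))) (*-identityʳ (a * a ^ n))))

  anti-Σ< : ∀ n F → anti F n ≡ Σ< (suc n) (λ i → F i (n ℕ.∸ i))
  anti-Σ< zero F = sym (+-identityˡ (F 0 0))
  anti-Σ< (suc n) F = trans (cong (F 0 (suc n) +_) (anti-Σ< n (λ i → F (suc i)))) (sym (Σ-head (suc n) _))

  -- the exponential generating function x / (eˣ - 1) of the Bernoulli numbers
  𝐁 : Series
  𝐁 ! n = bernoulli n * inv (ι (n !))

  𝐁-! : ∀ n → 𝐁 ! n * ι (n !) ≡ bernoulli n
  𝐁-! n = trans (*-assoc (bernoulli n) _ _) (trans (cong (bernoulli n *_) (inverseˡ (ι!≢0 n))) (*-identityʳ _))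

  𝐁-0 : 𝐁 ! 0 ≡ 1ℚ
  𝐁-0 = cong (λ x → 1ℚ * inv x) ι1

  e : Series
  e = E 1ℚ

  bernoulli-recurrence : ∀ n → Σ< (suc (suc n)) (λ i → ι (suc (suc n) C i) * bernoulli i) ≡ 0ℚ
  bernoulli-recurrence n = trans (cong (s +_) (trans (cong₂ _*_ last (bernoulli-suc n))
    (trans (solve 3 (λ m r s → m :* (:- (r :* s)) := :- (m :* r :* s)) refl (ι (suc (suc n)))
        (ℤ.+ 1 / suc (suc n)) s)
      (cong -_ (trans (cong (_* s) (*ι-cancel (suc (suc n)))) (*-identityˡ s)))))) (+-inverseʳ s)
    where
    s : ℚ
    s = Σ< (suc n) (λ i → ι (suc (suc n) C i) * bernoulli i)
    last : ι (suc (suc n) C suc n) ≡ ι (suc (suc n))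
    last = cong ι (trans (nCk≡nC[n∸k] (ℕ.n≤1+n (suc n)))
        (trans (cong (suc (suc n) C_) (ℕ.m+n∸n≡m 1 (suc n))) (nC1≡n (suc (suc n)))))

  -- Multiplied by N!, the coefficient of degree N ≥ 2 is the recurrence of the Bernoulli numbers;
  -- coefficient N of 𝐁 drops out because eˣ - 1 has no constant term.
  𝐁-functional : 𝐁 ⊗ (e ⊖ κ 1ℚ) ≋ X
  𝐁-functional = mk go
    where
    open import Relation.Binary.PropositionalEquality.Properties using (module ≡-Reasoning)
    go : ∀ n → (𝐁 ⊗ (e ⊖ κ 1ℚ)) ! n ≡ X ! n
    go zero = *-zeroʳ (𝐁 ! 0)
    go (suc zero) = trans (cong₂ _+_ (cong₂ _*_ 𝐁-0 (cong (λ x → 1ℚ * 1ℚ * inv x - 0ℚ) ι1)) (*-zeroʳ (𝐁 ! 1)))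
        refl
    go (suc (suc n)) = *-cancelˡ (ι!≢0 (suc (suc n))) (trans main (sym (*-zeroʳ (ι (suc (suc n) !)))))
      where
      N : ℕ
      N = suc (suc n)
      term : ∀ i → i ℕ.< N → ι (N !) * (𝐁 ! i * (e ⊖ κ 1ℚ) ! suc (suc n ℕ.∸ i)) ≡ ι (N C i) * bernoulli i
      term i i<N = ≡R.begin
        ι (N !) * (𝐁 ! i * (e ! suc (suc n ℕ.∸ i) - 0ℚ))
          ≡R.≡⟨ cong₂ (λ x y → x * (𝐁 ! i * y)) (sym (ιC (ℕ.<⇒≤ i<N)))
               (trans (+-identityʳ (e ! suc (suc n ℕ.∸ i))) (cong (e !_) (sym (ℕ.+-∸-assoc 1 (ℕ.s≤s⁻¹ i<N))))) ⟩
        ι (N C i) * (ι (i !) * ι ((N ℕ.∸ i) !)) * (𝐁 ! i * e ! (N ℕ.∸ i))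
          ≡R.≡⟨ solve 5 (λ c u v b e → c :* (u :* v) :* (b :* e) := c :* (b :* u) :* (e :* v)) refl
               (ι (N C i)) (ι (i !)) (ι ((N ℕ.∸ i) !)) (𝐁 ! i) (e ! (N ℕ.∸ i)) ⟩
        ι (N C i) * (𝐁 ! i * ι (i !)) * (e ! (N ℕ.∸ i) * ι ((N ℕ.∸ i) !))
          ≡R.≡⟨ cong₂ (λ x y → ι (N C i) * x * y) (𝐁-! i) (trans (E-! 1ℚ (N ℕ.∸ i)) (1^ (N ℕ.∸ i))) ⟩
        ι (N C i) * bernoulli i * 1ℚ
          ≡R.≡⟨ *-identityʳ _ ⟩
        ι (N C i) * bernoulli i ≡R.∎
        where module ≡R = ≡-Reasoning
      F : ℕ → ℕ → ℚ
      F i j = 𝐁 ! i * (e ⊖ κ 1ℚ) ! j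
      main : ι (N !) * (𝐁 ⊗ (e ⊖ κ 1ℚ)) ! N ≡ 0ℚ
      main = trans (cong (ι (N !) *_) (trans (anti-last (suc n) F)
          (trans (cong (anti (λ i j → F i (suc j)) (suc n) +_) (*-zeroʳ (𝐁 ! N)))
            (trans (+-identityʳ _) (anti-Σ< (suc n) (λ i j → F i (suc j)))))))
        (trans (sym (Σ-*ˡ N (ι (N !)) _)) (trans (Σ-cong< N term) (bernoulli-recurrence n)))

  𝐁-shift : 𝐁 ⊗ e ≋ 𝐁 ⊕ X
  𝐁-shift = begin
    𝐁 ⊗ e                     ≈⟨ S.solve 2 (λ b e → b S.:* e S.:= b S.:+ b S.:* (e S.:- S.con 1ℚ)) ≋-refl 𝐁 e ⟩
    𝐁 ⊕ 𝐁 ⊗ (e ⊖ κ 1ℚ)        ≈⟨ ⊕-cong ≋-refl 𝐁-functional ⟩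
    𝐁 ⊕ X                     ∎

  θ-e : θ e ≋ X ⊗ e
  θ-e = ≋-trans (θ-E 1ℚ) (⊗-cong ≋-refl (⊗-identityˡ e))

  -- Differentiate 𝐁 (eˣ - 1) = x and remove the exponential by 𝐁 eˣ = 𝐁 + x. The extra factor x
  -- stands for 𝐁 (eˣ - 1), so no division by eˣ - 1 is needed.
  𝐁-Riccati : θ 𝐁 ≋ 𝐁 ⊖ X ⊗ 𝐁 ⊖ 𝐁 ⊗ 𝐁
  𝐁-Riccati = X-cancel (begin
    X ⊗ θ 𝐁                             ≈⟨ ⊗-cong (≋-sym 𝐁-functional) ≋-refl ⟩
    𝐁 ⊗ (e ⊖ κ 1ℚ) ⊗ θ 𝐁                ≈⟨ S.solve 5 (λ b e e′ t x →
        b S.:* (e S.:- S.con 1ℚ) S.:* t S.:= b S.:*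
            (t S.:* (e S.:- S.con 1ℚ) S.:+ b S.:* (x S.:* e S.:- S.con 0ℚ)) S.:- x S.:* b S.:* (b S.:* e))
        ≋-refl 𝐁 e (θ e) (θ 𝐁) X ⟩
    𝐁 ⊗ (θ 𝐁 ⊗ (e ⊖ κ 1ℚ) ⊕ 𝐁 ⊗ (X ⊗ e ⊖ κ 0ℚ)) ⊖ X ⊗ 𝐁 ⊗ (𝐁 ⊗ e)
      ≈⟨ ⊕-cong (⊗-cong ≋-refl (≋-sym derivative)) (⊝-cong (⊗-cong ≋-refl 𝐁-shift)) ⟩
    𝐁 ⊗ X ⊖ X ⊗ 𝐁 ⊗ (𝐁 ⊕ X)             ≈⟨ S.solve 2
        (λ b x → b S.:* x S.:- x S.:* b S.:* (b S.:+ x) S.:= x S.:* (b S.:- x S.:* b S.:- b S.:* b)) ≋-refl 𝐁 X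
        ⟩
    X ⊗ (𝐁 ⊖ X ⊗ 𝐁 ⊖ 𝐁 ⊗ 𝐁)             ∎)
    where
    derivative : X ≋ θ 𝐁 ⊗ (e ⊖ κ 1ℚ) ⊕ 𝐁 ⊗ (X ⊗ e ⊖ κ 0ℚ)
    derivative = begin
      X                        ≈⟨ θ-X ⟨
      θ X                      ≈⟨ θ-cong 𝐁-functional ⟨
      θ (𝐁 ⊗ (e ⊖ κ 1ℚ))       ≈⟨ θ-⊗ 𝐁 (e ⊖ κ 1ℚ) ⟩
      θ 𝐁 ⊗ (e ⊖ κ 1ℚ) ⊕ 𝐁 ⊗ θ (e ⊖ κ 1ℚ)
        ≈⟨ ⊕-cong ≋-refl (⊗-cong ≋-refl
            (≋-trans (θ-⊕ e (⊝ κ 1ℚ)) (⊕-cong θ-e (≋-trans (θ-⊝ (κ 1ℚ)) (⊝-cong (θ-κ 1ℚ)))))) ⟩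
      θ 𝐁 ⊗ (e ⊖ κ 1ℚ) ⊕ 𝐁 ⊗ (X ⊗ e ⊖ κ 0ℚ) ∎

  -- The substitution of -x for x.
  reflect : Series → Series
  reflect a ! n = (- 1ℚ) ^ n * a ! n

  reflect-cong : ∀ {a b} → a ≋ b → reflect a ≋ reflect b
  reflect-cong (mk eq) = mk λ n → cong ((- 1ℚ) ^ n *_) (eq n)

  reflect-⊗ : ∀ a b → reflect (a ⊗ b) ≋ reflect a ⊗ reflect b
  reflect-⊗ a b = mk λ n → trans (sym (anti-*ˡ n ((- 1ℚ) ^ n) _)) (anti-cong⁺ n λ { i j refl →
    trans (cong (_* (a ! i * b ! j)) (^-+ (- 1ℚ) i j))
      (solve 4 (λ p q a b → p :* q :* (a :* b) := p :* a :* (q :* b)) refl ((- 1ℚ) ^ i) ((- 1ℚ) ^ j) (a ! i)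
          (b ! j)) })

  reflect-⊕ : ∀ a b → reflect (a ⊕ b) ≋ reflect a ⊕ reflect b
  reflect-⊕ a b = mk λ n → *-distribˡ-+ ((- 1ℚ) ^ n) (a ! n) (b ! n)

  reflect-X : reflect X ≋ ⊝ X
  reflect-X = mk λ { zero → refl ; (suc zero) → refl ; (suc (suc n)) → *-zeroʳ ((- 1ℚ) ^ suc (suc n)) }

  reflect-e-1 : reflect (e ⊖ κ 1ℚ) ≋ E (- 1ℚ) ⊖ κ 1ℚ
  reflect-e-1 = ≋-trans (reflect-⊕ e (⊝ κ 1ℚ))
      (⊕-cong (mk λ n → sym (E-neg 1ℚ n)) (mk λ { zero → refl ; (suc n) → *-zeroʳ ((- 1ℚ) ^ suc n) }))

  -- Follows from e⁻ˣ - 1 = -e⁻ˣ (eˣ - 1). It is the reason why 𝐁 becomes even after adding x/2.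
  reflect-𝐁 : reflect 𝐁 ≋ 𝐁 ⊕ X
  reflect-𝐁 = X-cancel (begin
    X ⊗ R                        ≈⟨ ⊗-cong (≋-sym 𝐁-functional) ≋-refl ⟩
    𝐁 ⊗ (e ⊖ κ 1ℚ) ⊗ R           ≈⟨ ⊗-cong
        (⊗-cong ≋-refl (⊕-cong ≋-refl (⊝-cong (≋-sym (≋-trans (E-+ 1ℚ (- 1ℚ)) E-0))))) ≋-refl ⟩
    𝐁 ⊗ (e ⊖ e ⊗ m) ⊗ R          ≈⟨ S.solve 4
        (λ b e m r → b S.:* (e S.:- e S.:* m) S.:* r S.:= S.:- (b S.:* e S.:* (r S.:* (m S.:- S.con 1ℚ))))
        ≋-refl 𝐁 e m R ⟩
    ⊝ (𝐁 ⊗ e ⊗ (R ⊗ (m ⊖ κ 1ℚ))) ≈⟨ ⊝-cong (⊗-cong 𝐁-shift reflected) ⟩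
    ⊝ ((𝐁 ⊕ X) ⊗ ⊝ X)            ≈⟨ S.solve 2
        (λ b x → S.:- ((b S.:+ x) S.:* S.:- x) S.:= x S.:* (b S.:+ x)) ≋-refl 𝐁 X ⟩
    X ⊗ (𝐁 ⊕ X)                  ∎)
    where
    R m : Series
    R = reflect 𝐁
    m = E (- 1ℚ)
    reflected : R ⊗ (m ⊖ κ 1ℚ) ≋ ⊝ X
    reflected = begin
      R ⊗ (m ⊖ κ 1ℚ)           ≈⟨ ⊗-cong ≋-refl reflect-e-1 ⟨
      R ⊗ reflect (e ⊖ κ 1ℚ)   ≈⟨ reflect-⊗ 𝐁 (e ⊖ κ 1ℚ) ⟨
      reflect (𝐁 ⊗ (e ⊖ κ 1ℚ)) ≈⟨ reflect-cong 𝐁-functional ⟩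
      reflect X                ≈⟨ reflect-X ⟩
      ⊝ X                      ∎

  -- (x/2) coth (x/2)
  𝐘 : Series
  𝐘 = 𝐁 ⊕ κ ½ ⊗ X

  ¼ : ℚ
  ¼ = ½ * ½

  -- Adding x/2 completes the square in the equation of 𝐁: the mixed term x 𝐁 disappears.
  𝐘-Riccati : θ 𝐘 ≋ 𝐘 ⊖ 𝐘 ⊗ 𝐘 ⊕ κ ¼ ⊗ (X ⊗ X)
  𝐘-Riccati = begin
    θ 𝐘                                         ≈⟨ θ-⊕ 𝐁 (κ ½ ⊗ X) ⟩
    θ 𝐁 ⊕ θ (κ ½ ⊗ X)                           ≈⟨ ⊕-cong 𝐁-Riccati (≋-trans (θ-· ½ X) (⊗-cong ≋-refl θ-X)) ⟩
    𝐁 ⊖ X ⊗ 𝐁 ⊖ 𝐁 ⊗ 𝐁 ⊕ κ ½ ⊗ X                 ≈⟨ S.solve 2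
        (λ b x → b S.:- x S.:* b S.:- b S.:* b S.:+ S.con ½ S.:* x S.:=
       (b S.:+ S.con ½ S.:* x) S.:- (b S.:+ S.con ½ S.:* x) S.:* (b S.:+ S.con ½ S.:* x) S.:+ S.con ¼ S.:*
           (x S.:* x)) ≋-refl 𝐁 X ⟩
    𝐘 ⊖ 𝐘 ⊗ 𝐘 ⊕ κ ¼ ⊗ (X ⊗ X)                   ∎

  -1^odd : ∀ i → (- 1ℚ) ^ suc (dbl i) ≡ - 1ℚ
  -1^odd zero = refl
  -1^odd (suc i) = trans (sym (*-assoc (- 1ℚ) (- 1ℚ) ((- 1ℚ) ^ suc (dbl i)))) (trans (*-identityˡ _) (-1^odd i))

  𝐘-odd : ∀ i → 𝐘 ! suc (dbl i) ≡ 0ℚ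
  𝐘-odd i = *-cancelˡ {p = 1ℚ + 1ℚ} (ι2≢0) (trans
    (solve 1 (λ y → (con 1ℚ :+ con 1ℚ) :* y := y :- con (- 1ℚ) :* y) refl y)
    (trans (cong (λ u → y - u) (trans (sym (cong (_* y) (-1^odd i))) (at reflected n)))
        (trans (+-inverseʳ y) (sym (*-zeroʳ (1ℚ + 1ℚ))))))
    where
    n = suc (dbl i)
    y = 𝐘 ! n
    ι2≢0 : 1ℚ + 1ℚ ≢ 0ℚ
    ι2≢0 ()
    reflected : reflect 𝐘 ≋ 𝐘
    reflected = begin
      reflect 𝐘                              ≈⟨ reflect-⊕ 𝐁 (κ ½ ⊗ X) ⟩
      reflect 𝐁 ⊕ reflect (κ ½ ⊗ X)          ≈⟨ ⊕-cong reflect-𝐁 (≋-trans (reflect-⊗ (κ ½) X)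
        (⊗-cong {b = reflect X} (mk λ { zero → refl ; (suc n) → *-zeroʳ ((- 1ℚ) ^ suc n) }) reflect-X)) ⟩
      𝐁 ⊕ X ⊕ κ ½ ⊗ ⊝ X                      ≈⟨ S.solve 2
          (λ b x → b S.:+ x S.:+ S.con ½ S.:* (S.:- x) S.:= b S.:+ S.con ½ S.:* x) ≋-refl 𝐁 X ⟩
      𝐘                                      ∎

  ι-dbl : ∀ n → ι (dbl n) ≡ ι n + ι n
  ι-dbl zero = trans ι0 (sym (cong₂ _+_ ι0 ι0))
  ι-dbl (suc n) = trans (ι-suc (suc (dbl n)))
      (trans (cong (1ℚ +_) (trans (ι-suc (dbl n)) (cong (1ℚ +_) (ι-dbl n))))
    (trans (solve 1 (λ n → con 1ℚ :+ (con 1ℚ :+ (n :+ n)) := con 1ℚ :+ n :+ (con 1ℚ :+ n)) refl (ι n))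
      (sym (cong₂ _+_ (ι-suc n) (ι-suc n)))))

  2ℚ 6ℚ 10ℚ : ℚ
  2ℚ = ℤ.+ 2 / 1
  6ℚ = ℤ.+ 6 / 1
  10ℚ = ℤ.+ 10 / 1

  -- y_n = B_{2n} / (2n)!
  y : Series
  y = ev 𝐘

  y-𝐁 : ∀ n → y ! n ≡ 𝐁 ! dbl n
  y-𝐁 n = trans (cong (𝐁 ! dbl n +_) (trans (κ-⊗ ½ X (dbl n)) (lem n))) (+-identityʳ _)
    where
    lem : ∀ n → ½ * X ! dbl n ≡ 0ℚ
    lem zero = refl
    lem (suc n) = refl

  -- In the variable x² the operator x d/dx becomes 2θ. All odd coefficients of 𝐘 vanish, so
  -- squaring commutes with passing to the even ones.
  y-Riccati : κ 2ℚ ⊗ θ y ≋ y ⊖ y ⊗ y ⊕ κ ¼ ⊗ X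
  y-Riccati = mk λ n → trans (κ-⊗ 2ℚ (θ y) n) (trans
    (trans (solve 2 (λ i y → con 2ℚ :* (i :* y) := (i :+ i) :* y) refl (ι n) (y ! n))
        (cong (_* y ! n) (sym (ι-dbl n))))
    (trans (at 𝐘-Riccati (dbl n)) (cong₂ (λ u v → y ! n - u + v) (⊗-ev 𝐘 𝐘 n 𝐘-odd)
      (trans (κ-⊗ ¼ (X ⊗ X) (dbl n)) (trans (cong (¼ *_) (lem n)) (sym (κ-⊗ ¼ X n)))))))
    where
    lem : ∀ n → (X ⊗ X) ! dbl n ≡ X ! n
    lem zero = refl
    lem (suc zero) = X-⊗ X 1
    lem (suc (suc n)) = X-⊗ X (suc (suc (suc (dbl n))))

  -- If Q is z² ℘(z) as a series in X = z², then `ode` is ℘″ = 6 ℘² + c multiplied by z⁴: because of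
  -- the factor z⁻², the operator z d/dz becomes 2θ - 2, and (2θ - 2)(2θ - 3) = 4θ² - 10θ + 6.
  record Weierstrass (Q : Series) (c : ℚ) : Set where
    field
      Q-0 : Q ! 0 ≡ 1ℚ
      Q-1 : Q ! 1 ≡ 0ℚ
      ode : κ (2ℚ * 2ℚ) ⊗ θ (θ Q) ⊖ κ 10ℚ ⊗ θ Q ⊕ κ 6ℚ ⊗ Q ≋ κ 6ℚ ⊗ (Q ⊗ Q) ⊕ κ c ⊗ (X ⊗ X)

  -- For a Weierstrass series this removes the constant term 1, the double pole of ℘.
  tail² : Series → Series
  tail² Q ! zero = 0ℚ
  tail² Q ! suc zero = 0ℚ
  tail² Q ! suc (suc n) = Q ! suc (suc n)

  -- the recurrence satisfied by the Laurent coefficients of a ℘-function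
  Recurrence : (Q : ℕ → ℚ) → ℕ → Set
  Recurrence Q n = ι (suc (dbl (suc (suc (suc n))))) * ι n * Q (suc (suc (suc n))) ≡
                   ι 3 * anti (λ i j → Q i * Q j) (suc (suc (suc n)))

  3ℚ : ℚ
  3ℚ = ℤ.+ 3 / 1

  -- The constant term 1 of Q contributes 12 times coefficient m to the right side of `ode`. Moved
  -- to the left, it leaves 4m² - 10m - 6 = 2(2m + 1)(m - 3) with m = n + 3, a degree that the term
  -- in X² does not reach.
  recurrence : ∀ {Q c} → Weierstrass Q c → ∀ n → Recurrence (tail² Q !_) n
  recurrence {Q} {c} W n = *-cancelˡ {p = 2ℚ} (λ ()) (trans (cong (λ u → 2ℚ * (u * ι n * q)) (ι-odd N))
    (trans (cong (λ u → 2ℚ * ((1ℚ + (u + u)) * ι n * q)) ιN)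
    (trans (solve 2 (λ m q → con 2ℚ :* ((con 1ℚ :+ ((con 3ℚ :+ m) :+ (con 3ℚ :+ m))) :* m :* q) :=
         (con (2ℚ * 2ℚ) :* ((con 3ℚ :+ m) :* ((con 3ℚ :+ m) :* q)) :- con 10ℚ :*
             ((con 3ℚ :+ m) :* q) :+ con 6ℚ :* q)
         :- con 6ℚ :* (q :+ q)) refl (ι n) q)
    (trans (cong (λ u → (2ℚ * 2ℚ * (u * (u * q)) - 10ℚ * (u * q) + 6ℚ * q) - 6ℚ * (q + q)) (sym ιN))
    (trans (cong (_- 6ℚ * (q + q)) coefficient)
    (trans (cong (λ u → 6ℚ * (t + q + q) + c * u - 6ℚ * (q + q)) (X-⊗ X (suc (suc n))))
    (trans (solve 3 (λ t q c → con 6ℚ :* (t :+ q :+ q) :+ c :* con 0ℚ :- con 6ℚ :* (q :+ q) := con 2ℚ :*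
        (con 3ℚ :* t)) refl t q c)
      (cong (λ u → 2ℚ * (u * t)) (sym (ι-def 3))))))))))
    where
    open Weierstrass W
    N = suc (suc (suc n))
    q = Q ! N
    t = (tail² Q ⊗ tail² Q) ! N
    ιN : ι N ≡ 3ℚ + ι n
    ιN = trans (ι-+ 3 n) (cong (_+ ι n) (ι-def 3))
    ι-odd : ∀ m → ι (suc (dbl m)) ≡ 1ℚ + (ι m + ι m)
    ι-odd m = trans (ι-suc (dbl m)) (cong (1ℚ +_) (ι-dbl m))
    split : Q ≋ tail² Q ⊕ κ 1ℚ
    split = mk λ { zero → Q-0 ; (suc zero) → Q-1 ; (suc (suc n)) → sym (+-identityʳ _) }
    square : (Q ⊗ Q) ! N ≡ t + q + q
    square = trans (at (≋-trans (⊗-cong split split)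
        (S.solve 1 (λ t → (t S.:+ S.con 1ℚ) S.:* (t S.:+ S.con 1ℚ) S.:= t S.:* t S.:+ t S.:+ t S.:+ S.con 1ℚ)
        ≋-refl (tail² Q))) N)
      (+-identityʳ _)
    coefficient : 2ℚ * 2ℚ * (ι N * (ι N * q)) - 10ℚ * (ι N * q) + 6ℚ * q ≡ 6ℚ * (t + q + q) + c * (X ⊗ X) ! N
    coefficient = trans (sym (cong₂ _+_ (cong₂ _-_ (κ-⊗ (2ℚ * 2ℚ) (θ (θ Q)) N) (κ-⊗ 10ℚ (θ Q) N)) (κ-⊗ 6ℚ Q N)))
      (trans (at ode N) (cong₂ _+_ (trans (κ-⊗ 6ℚ (Q ⊗ Q) N) (cong (6ℚ *_) square)) (κ-⊗ c (X ⊗ X) N)))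

  -- the degenerate ℘-function (x²/4) / sinh² (x/2) + x²/12, in the variable x²
  ℘₀ : Series
  ℘₀ = y ⊗ y ⊖ κ (½ * (ℤ.+ 1 / 3)) ⊗ X

  ⅙ 1/12 : ℚ
  ⅙ = ½ * (ℤ.+ 1 / 3)
  1/12 = ½ * ⅙

  -- The Riccati equation makes the square linear, so that for n ≥ 2 the coefficients become (1 -
  -- 2n) B₂ₙ / (2n)!.
  ℘₀-y : ℘₀ ≋ y ⊖ κ 2ℚ ⊗ θ y ⊕ κ 1/12 ⊗ X
  ℘₀-y = begin
    y ⊗ y ⊖ κ ⅙ ⊗ X                              ≈⟨ S.solve 2
        (λ y x → y S.:* y S.:- S.con ⅙ S.:* x S.:= y S.:-
        (y S.:- y S.:* y S.:+ S.con ¼ S.:* x) S.:+ S.con 1/12 S.:* x) ≋-refl y X ⟩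
    y ⊖ (y ⊖ y ⊗ y ⊕ κ ¼ ⊗ X) ⊕ κ 1/12 ⊗ X       ≈⟨ ⊕-cong (⊕-cong ≋-refl (⊝-cong y-Riccati)) ≋-refl ⟨
    y ⊖ κ 2ℚ ⊗ θ y ⊕ κ 1/12 ⊗ X                  ∎

  y-0 : y ! 0 ≡ 1ℚ
  y-0 = trans (y-𝐁 0) 𝐁-0

  y-1 : y ! 1 ≡ 1/12
  y-1 = *-cancelˡ {p = 3ℚ} (λ ())
      (trans (solve 1 (λ y → con 3ℚ :* y := con 2ℚ :* (con 1ℚ :* y) :+ y) refl (y ! 1))
    (trans (cong (_+ y ! 1) (trans (cong (λ u → 2ℚ * (u * y ! 1)) (sym ι1)) (trans (sym (κ-⊗ 2ℚ (θ y) 1))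
      (trans (at y-Riccati 1) (cong (λ u → y ! 1 - (u * y ! 1 + y ! 1 * u) + (κ ¼ ⊗ X) ! 1) y-0)))))
     (trans (cong (λ v → y ! 1 - (1ℚ * y ! 1 + y ! 1 * 1ℚ) + v + y ! 1) (κ-⊗ ¼ X 1))
     (solve 1 (λ y → y :- (con 1ℚ :* y :+ y :* con 1ℚ) :+ con (¼ * 1ℚ) :+ y := con (3ℚ * 1/12)) refl (y ! 1)))))

  -- Once 2θ y is replaced by the right side P of the Riccati equation, `ode` is a polynomial
  -- identity in y and X.
  ℘₀-Weierstrass : Weierstrass ℘₀ (- (¼ * ⅙))
  ℘₀-Weierstrass = record
    { Q-0 = trans (cong₂ _-_ (cong₂ _*_ y-0 y-0) (κ-⊗ ⅙ X 0)) refl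
    ; Q-1 = trans (cong₂ _-_ (cong₂ _+_ (cong₂ _*_ y-0 y-1) (cong₂ _*_ y-1 y-0)) (κ-⊗ ⅙ X 1)) refl
    ; ode = begin
      κ (2ℚ * 2ℚ) ⊗ θ (θ ℘₀) ⊖ κ 10ℚ ⊗ θ ℘₀ ⊕ κ 6ℚ ⊗ ℘₀
        ≈⟨ ⊕-cong (⊕-cong (⊗-cong ≋-refl second) (⊝-cong (⊗-cong ≋-refl first))) ≋-refl ⟩
      κ (2ℚ * 2ℚ) ⊗ (D ⊗ P ⊕ y ⊗ (D ⊖ κ 2ℚ ⊗ (y ⊗ D) ⊕ κ ¼ ⊗ X) ⊖ κ ⅙ ⊗ X) ⊖ κ 10ℚ ⊗
          (y ⊗ P ⊖ κ ⅙ ⊗ X) ⊕ κ 6ℚ ⊗ ℘₀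
        ≈⟨ S.solve 4 (λ t p y x →
           S.con (2ℚ * 2ℚ) S.:* (t S.:* p S.:+ y S.:*
               (t S.:- S.con 2ℚ S.:* (y S.:* t) S.:+ S.con ¼ S.:* x) S.:- S.con ⅙ S.:* x) S.:- S.con 10ℚ S.:*
               (y S.:* p S.:- S.con ⅙ S.:* x) S.:+ S.con 6ℚ S.:* (y S.:* y S.:- S.con ⅙ S.:* x) S.:=
           S.con 2ℚ S.:* ((S.con 2ℚ S.:* t) S.:* p S.:+ y S.:*
               (S.con 2ℚ S.:* t S.:- S.con 2ℚ S.:* (y S.:* (S.con 2ℚ S.:* t)) S.:+ S.con ½ S.:* x) S.:- S.con
               (2ℚ * ⅙) S.:* x) S.:- S.con 10ℚ S.:* (y S.:* p S.:- S.con ⅙ S.:* x) S.:+ S.con 6ℚ S.:*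
               (y S.:* y S.:- S.con ⅙ S.:* x))
           ≋-refl D P y X ⟩
      κ 2ℚ ⊗ ((κ 2ℚ ⊗ D) ⊗ P ⊕ y ⊗ (κ 2ℚ ⊗ D ⊖ κ 2ℚ ⊗ (y ⊗ (κ 2ℚ ⊗ D)) ⊕ κ ½ ⊗ X) ⊖ κ (2ℚ * ⅙) ⊗ X) ⊖ κ 10ℚ ⊗
          (y ⊗ P ⊖ κ ⅙ ⊗ X) ⊕ κ 6ℚ ⊗ ℘₀
        ≈⟨ ⊕-cong (⊕-cong (⊗-cong ≋-refl
            (⊕-cong (⊕-cong (⊗-cong y-Riccati ≋-refl)
            (⊗-cong ≋-refl (⊕-cong (⊕-cong y-Riccati (⊝-cong (⊗-cong ≋-refl (⊗-cong ≋-refl y-Riccati))))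
            ≋-refl))) ≋-refl)) ≋-refl) ≋-refl ⟩
      κ 2ℚ ⊗ (P ⊗ P ⊕ y ⊗ (P ⊖ κ 2ℚ ⊗ (y ⊗ P) ⊕ κ ½ ⊗ X) ⊖ κ (2ℚ * ⅙) ⊗ X) ⊖ κ 10ℚ ⊗
          (y ⊗ P ⊖ κ ⅙ ⊗ X) ⊕ κ 6ℚ ⊗ ℘₀
        ≈⟨ S.solve 2 (λ y x → let p = y S.:- y S.:* y S.:+ S.con ¼ S.:* x ; q = y S.:* y S.:- S.con ⅙ S.:* x in
           S.con 2ℚ S.:* (p S.:* p S.:+ y S.:* (p S.:- S.con 2ℚ S.:* (y S.:* p) S.:+ S.con ½ S.:* x) S.:- S.con
               (2ℚ * ⅙) S.:* x) S.:- S.con 10ℚ S.:* (y S.:* p S.:- S.con ⅙ S.:* x) S.:+ S.con 6ℚ S.:* q S.:=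
           S.con 6ℚ S.:* (q S.:* q) S.:+ S.con (- (¼ * ⅙)) S.:* (x S.:* x)) ≋-refl y X ⟩
      κ 6ℚ ⊗ (℘₀ ⊗ ℘₀) ⊕ κ (- (¼ * ⅙)) ⊗ (X ⊗ X) ∎ }
    where
    D P : Series
    D = θ y
    P = y ⊖ y ⊗ y ⊕ κ ¼ ⊗ X
    θκX : ∀ c → θ (κ c ⊗ X) ≋ κ c ⊗ X
    θκX c = ≋-trans (θ-· c X) (⊗-cong ≋-refl θ-X)
    first : θ ℘₀ ≋ y ⊗ P ⊖ κ ⅙ ⊗ X
    first = begin
      θ ℘₀                                    ≈⟨ θ-⊕ (y ⊗ y) (⊝ (κ ⅙ ⊗ X)) ⟩
      θ (y ⊗ y) ⊕ θ (⊝ (κ ⅙ ⊗ X))             ≈⟨ ⊕-cong (θ-⊗ y y) (≋-trans (θ-⊝ (κ ⅙ ⊗ X)) (⊝-cong (θκX ⅙))) ⟩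
      D ⊗ y ⊕ y ⊗ D ⊖ κ ⅙ ⊗ X                 ≈⟨ S.solve 3
          (λ t y x → t S.:* y S.:+ y S.:* t S.:- S.con ⅙ S.:* x S.:= y S.:*
          (S.con 2ℚ S.:* t) S.:- S.con ⅙ S.:* x) ≋-refl D y X ⟩
      y ⊗ (κ 2ℚ ⊗ D) ⊖ κ ⅙ ⊗ X                ≈⟨ ⊕-cong (⊗-cong ≋-refl y-Riccati) ≋-refl ⟩
      y ⊗ P ⊖ κ ⅙ ⊗ X                         ∎
    second : θ (θ ℘₀) ≋ D ⊗ P ⊕ y ⊗ (D ⊖ κ 2ℚ ⊗ (y ⊗ D) ⊕ κ ¼ ⊗ X) ⊖ κ ⅙ ⊗ X
    second = begin
      θ (θ ℘₀)                                ≈⟨ θ-cong first ⟩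
      θ (y ⊗ P ⊖ κ ⅙ ⊗ X)                     ≈⟨ θ-⊕ (y ⊗ P) (⊝ (κ ⅙ ⊗ X)) ⟩
      θ (y ⊗ P) ⊕ θ (⊝ (κ ⅙ ⊗ X))             ≈⟨ ⊕-cong (θ-⊗ y P) (≋-trans (θ-⊝ (κ ⅙ ⊗ X)) (⊝-cong (θκX ⅙))) ⟩
      D ⊗ P ⊕ y ⊗ θ P ⊖ κ ⅙ ⊗ X               ≈⟨ ⊕-cong (⊕-cong ≋-refl (⊗-cong ≋-refl θP)) ≋-refl ⟩
      D ⊗ P ⊕ y ⊗ (D ⊖ κ 2ℚ ⊗ (y ⊗ D) ⊕ κ ¼ ⊗ X) ⊖ κ ⅙ ⊗ X ∎
      where
      θP : θ P ≋ D ⊖ κ 2ℚ ⊗ (y ⊗ D) ⊕ κ ¼ ⊗ X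
      θP = begin
        θ P                                   ≈⟨ ≋-trans (θ-⊕ (y ⊖ y ⊗ y) (κ ¼ ⊗ X))
            (⊕-cong (≋-trans (θ-⊕ y (⊝ (y ⊗ y))) (⊕-cong ≋-refl (≋-trans (θ-⊝ (y ⊗ y)) (⊝-cong (θ-⊗ y y)))))
            (θκX ¼)) ⟩
        D ⊖ (D ⊗ y ⊕ y ⊗ D) ⊕ κ ¼ ⊗ X         ≈⟨ S.solve 3
            (λ t y x → t S.:- (t S.:* y S.:+ y S.:* t) S.:+ S.con ¼ S.:* x S.:= t S.:- S.con 2ℚ S.:*
            (y S.:* t) S.:+ S.con ¼ S.:* x) ≋-refl D y X ⟩
        D ⊖ κ 2ℚ ⊗ (y ⊗ D) ⊕ κ ¼ ⊗ X          ∎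

-- Even coefficients of sums of exponentials.

module EvenSeries where

  open import Data.Rational.Base
  open import Data.Rational.Properties
  open import Data.Rational.Solver using (module +-*-Solver)
  open RationalArithmetic
  open PowerSeries hiding (module Reasoning)
  open BernoulliSeries
  open PowerSeries.Reasoning
  open +-*-Solver using (solve; _:+_; _:*_; _:-_; :-_; _:=_; con)
  private
    module S = SeriesSolver

  -- Sums of exponentials over a + b = d. The weight b in `W` yields the sums of b a²ᴺ that appear
  -- on the right of the divisor identity.
  V W : ℕ → Series
  V d ! n = anti (λ a b → E (ι a) ! n) d
  W d ! n = anti (λ a b → ι b * E (ι a) ! n) d

  E-suc : ∀ d → E (ι (suc d)) ≋ E (ι d) ⊗ e
  E-suc d = ≋-sym (≋-trans (E-+ (ι d) 1ℚ)
      (mk λ n → cong (λ a → E a ! n) (trans (+-comm (ι d) 1ℚ) (sym (ι-suc d)))))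

  V-suc : ∀ d → V (suc d) ≋ V d ⊕ E (ι (suc d))
  V-suc d = mk λ n → anti-last d (λ a b → E (ι a) ! n)

  W-suc : ∀ d → W (suc d) ≋ W d ⊕ V d
  W-suc d = mk λ n → trans (anti-last d (λ a b → ι b * E (ι a) ! n)) (trans
    (cong₂ _+_ (trans (anti-cong d (λ a b → trans (cong (_* E (ι a) ! n) (ι-suc b))
        (solve 2 (λ b e → (con 1ℚ :+ b) :* e := b :* e :+ e) refl (ι b) (E (ι a) ! n)))) (anti-+ d _ _))
      (trans (cong (_* E (ι (suc d)) ! n) ι0) (*-zeroˡ (E (ι (suc d)) ! n)))) (+-identityʳ _))

  V-closed : ∀ d → V d ⊗ (e ⊖ κ 1ℚ) ≋ E (ι (suc d)) ⊖ κ 1ℚ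
  V-closed zero = begin
    V 0 ⊗ (e ⊖ κ 1ℚ)       ≈⟨ ⊗-cong (≋-trans (mk λ n → cong (λ a → E a ! n) ι0) E-0) ≋-refl ⟩
    κ 1ℚ ⊗ (e ⊖ κ 1ℚ)      ≈⟨ ⊗-identityˡ _ ⟩
    e ⊖ κ 1ℚ               ≈⟨ ⊕-cong (mk λ n → cong (λ a → E a ! n) ι1) ≋-refl ⟨
    E (ι 1) ⊖ κ 1ℚ         ∎
  V-closed (suc d) = begin
    V (suc d) ⊗ (e ⊖ κ 1ℚ)                   ≈⟨ ⊗-cong (V-suc d) ≋-refl ⟩
    (V d ⊕ F) ⊗ (e ⊖ κ 1ℚ)                   ≈⟨ S.solve 3
        (λ v f e → (v S.:+ f) S.:* (e S.:- S.con 1ℚ) S.:= v S.:* (e S.:- S.con 1ℚ) S.:+ (f S.:* e S.:- f))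
        ≋-refl (V d) F e ⟩
    V d ⊗ (e ⊖ κ 1ℚ) ⊕ (F ⊗ e ⊖ F)           ≈⟨ ⊕-cong (V-closed d) (⊕-cong (≋-sym (E-suc (suc d))) ≋-refl) ⟩
    F ⊖ κ 1ℚ ⊕ (E (ι (suc (suc d))) ⊖ F)     ≈⟨ S.solve 2
        (λ f g → f S.:- S.con 1ℚ S.:+ (g S.:- f) S.:= g S.:- S.con 1ℚ) ≋-refl F (E (ι (suc (suc d)))) ⟩
    E (ι (suc (suc d))) ⊖ κ 1ℚ               ∎
    where
    F : Series
    F = E (ι (suc d))

  -- As 𝐁 + x = 𝐁 eˣ, this is x² eˣ / (eˣ - 1)² = (x²/4) / sinh² (x/2), the degenerate ℘-function up
  -- to x²/12.
  𝐐 : Series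
  𝐐 = 𝐁 ⊗ (𝐁 ⊕ X)

  -- Σ_{a+b=d} b eᵃˣ = (𝐐 (eᵈˣ - 1) - d x 𝐁) / x²
  W-closed : ∀ d → X ⊗ (X ⊗ W d) ≋ 𝐐 ⊗ (E (ι d) ⊖ κ 1ℚ) ⊖ κ (ι d) ⊗ (X ⊗ 𝐁)
  W-closed zero = begin
    X ⊗ (X ⊗ W 0)              ≈⟨ ⊗-cong ≋-refl
        (⊗-cong ≋-refl (mk λ { n → trans (cong (_* E (ι 0) ! n) ι0)
        (trans (*-zeroˡ (E (ι 0) ! n)) (sym (lem n))) })) ⟩
    X ⊗ (X ⊗ κ 0ℚ)             ≈⟨ S.solve 3
        (λ x q b → x S.:* (x S.:* S.con 0ℚ) S.:= q S.:* (S.con 1ℚ S.:- S.con 1ℚ) S.:- S.con 0ℚ S.:* (x S.:* b))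
        ≋-refl X 𝐐 𝐁 ⟩
    𝐐 ⊗ (κ 1ℚ ⊖ κ 1ℚ) ⊖ κ 0ℚ ⊗ (X ⊗ 𝐁)
      ≈⟨ ⊕-cong (⊗-cong ≋-refl (⊕-cong (≋-sym (≋-trans (mk λ n → cong (λ a → E a ! n) ι0) E-0)) ≋-refl))
          (⊝-cong (⊗-cong (mk λ n → cong (λ a → κ a ! n) (sym ι0)) ≋-refl)) ⟩
    𝐐 ⊗ (E (ι 0) ⊖ κ 1ℚ) ⊖ κ (ι 0) ⊗ (X ⊗ 𝐁) ∎
    where
    lem : ∀ n → κ 0ℚ ! n ≡ 0ℚ
    lem zero = refl
    lem (suc n) = refl
  W-closed (suc d) = begin
    X ⊗ (X ⊗ W (suc d))                                   ≈⟨ ⊗-cong ≋-refl (⊗-cong ≋-refl (W-suc d)) ⟩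
    X ⊗ (X ⊗ (W d ⊕ V d))                                 ≈⟨ S.solve 3
        (λ x w v → x S.:* (x S.:* (w S.:+ v)) S.:= x S.:* (x S.:* w) S.:+ x S.:* v S.:* x) ≋-refl X (W d)
        (V d) ⟩
    -- The last factor X is turned into 𝐁 (eˣ - 1), which lets `V-closed` sum the geometric series.
    X ⊗ (X ⊗ W d) ⊕ X ⊗ V d ⊗ X                           ≈⟨ ⊕-cong (W-closed d)
        (⊗-cong ≋-refl (≋-sym 𝐁-functional)) ⟩
    𝐐 ⊗ (F ⊖ κ 1ℚ) ⊖ k ⊗ (X ⊗ 𝐁) ⊕ X ⊗ V d ⊗ (𝐁 ⊗ (e ⊖ κ 1ℚ))
      ≈⟨ S.solve 7 (λ q f k x b v e → q S.:* (f S.:- S.con 1ℚ) S.:- k S.:* (x S.:* b) S.:+ x S.:* v S.:*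
          (b S.:* (e S.:- S.con 1ℚ)) S.:=
           q S.:* (f S.:- S.con 1ℚ) S.:- k S.:* (x S.:* b) S.:+ x S.:* b S.:* (v S.:* (e S.:- S.con 1ℚ))) ≋-refl
               𝐐 F k X 𝐁 (V d) e ⟩
    𝐐 ⊗ (F ⊖ κ 1ℚ) ⊖ k ⊗ (X ⊗ 𝐁) ⊕ X ⊗ 𝐁 ⊗ (V d ⊗ (e ⊖ κ 1ℚ))
      ≈⟨ ⊕-cong ≋-refl (⊗-cong ≋-refl (≋-trans (V-closed d) (⊕-cong (E-suc d) ≋-refl))) ⟩
    𝐐 ⊗ (F ⊖ κ 1ℚ) ⊖ k ⊗ (X ⊗ 𝐁) ⊕ X ⊗ 𝐁 ⊗ (F ⊗ e ⊖ κ 1ℚ)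
      ≈⟨ S.solve 6 (λ q f k x b e → q S.:* (f S.:- S.con 1ℚ) S.:- k S.:* (x S.:* b) S.:+ x S.:* b S.:*
          (f S.:* e S.:- S.con 1ℚ) S.:=
           q S.:* (f S.:- S.con 1ℚ) S.:- (S.con 1ℚ S.:+ k) S.:* (x S.:* b) S.:+ x S.:* f S.:* (b S.:* e)) ≋-refl
               𝐐 F k X 𝐁 e ⟩
    𝐐 ⊗ (F ⊖ κ 1ℚ) ⊖ (κ 1ℚ ⊕ k) ⊗ (X ⊗ 𝐁) ⊕ X ⊗ F ⊗ (𝐁 ⊗ e)
      ≈⟨ ⊕-cong (⊕-cong ≋-refl (⊝-cong (⊗-cong k-suc ≋-refl)))
          (⊗-cong (⊗-cong (≋-sym 𝐁-functional) ≋-refl) 𝐁-shift) ⟩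
    𝐐 ⊗ (F ⊖ κ 1ℚ) ⊖ k′ ⊗ (X ⊗ 𝐁) ⊕ 𝐁 ⊗ (e ⊖ κ 1ℚ) ⊗ F ⊗ (𝐁 ⊕ X)
      ≈⟨ S.solve 5 (λ f k x b e → b S.:* (b S.:+ x) S.:* (f S.:- S.con 1ℚ) S.:- k S.:* (x S.:* b) S.:+ b S.:*
          (e S.:- S.con 1ℚ) S.:* f S.:* (b S.:+ x) S.:=
           b S.:* (b S.:+ x) S.:* (f S.:* e S.:- S.con 1ℚ) S.:- k S.:* (x S.:* b)) ≋-refl F k′ X 𝐁 e ⟩
    𝐐 ⊗ (F ⊗ e ⊖ κ 1ℚ) ⊖ k′ ⊗ (X ⊗ 𝐁)
      ≈⟨ ⊕-cong (⊗-cong ≋-refl (⊕-cong (≋-sym (E-suc d)) ≋-refl)) ≋-refl ⟩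
    𝐐 ⊗ (E (ι (suc d)) ⊖ κ 1ℚ) ⊖ k′ ⊗ (X ⊗ 𝐁) ∎
    where
    F k k′ : Series
    F = E (ι d)
    k = κ (ι d)
    k′ = κ (ι (suc d))
    k-suc : κ 1ℚ ⊕ k ≋ k′
    k-suc = mk λ { zero → sym (ι-suc d) ; (suc n) → refl }

  -- cosh (a √x)
  ch ch° : ℚ → Series
  ch a = ev (E a)
  ch° a ! zero = 0ℚ
  ch° a ! suc n = ch a ! suc n

  ch-ch° : ∀ a → ev (E a ⊖ κ 1ℚ) ≋ ch° a
  ch-ch° a = mk λ { zero → refl ; (suc n) → +-identityʳ (ch a ! suc n) }

  𝐐-𝐁 : 𝐐 ≋ 𝐁 ⊖ θ 𝐁
  𝐐-𝐁 = begin
    𝐁 ⊗ (𝐁 ⊕ X)                        ≈⟨ S.solve 2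
        (λ b x → b S.:* (b S.:+ x) S.:= b S.:- (b S.:- x S.:* b S.:- b S.:* b)) ≋-refl 𝐁 X ⟩
    𝐁 ⊖ (𝐁 ⊖ X ⊗ 𝐁 ⊖ 𝐁 ⊗ 𝐁)            ≈⟨ ⊕-cong ≋-refl (⊝-cong 𝐁-Riccati) ⟨
    𝐁 ⊖ θ 𝐁                            ∎

  𝐁-odd : ∀ i → 𝐁 ! suc (dbl (suc i)) ≡ 0ℚ
  𝐁-odd i = trans (sym (+-identityʳ (𝐁 ! suc (dbl (suc i)))))
      (trans (cong (𝐁 ! suc (dbl (suc i)) +_) (sym (κ-⊗ ½ X (suc (dbl (suc i)))))) (𝐘-odd (suc i)))

  𝐐-odd : ∀ i → 𝐐 ! suc (dbl i) ≡ 0ℚ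
  𝐐-odd zero = trans (at 𝐐-𝐁 1)
      (trans (cong (λ u → 𝐁 ! 1 - u * 𝐁 ! 1) ι1)
      (trans (cong (λ u → 𝐁 ! 1 - u) (*-identityˡ (𝐁 ! 1))) (+-inverseʳ (𝐁 ! 1))))
  𝐐-odd (suc i) = trans (at 𝐐-𝐁 n)
      (trans (cong (λ u → u - ι n * u) (𝐁-odd i)) (trans (cong (λ u → 0ℚ - u) (*-zeroʳ (ι n))) refl))
    where n = suc (dbl (suc i))

  𝐐-even : ev 𝐐 ≋ ℘₀ ⊖ κ 1/12 ⊗ X
  𝐐-even = begin
    ev 𝐐                                             ≈⟨
        (mk λ n → trans (at 𝐐-𝐁 (dbl n)) (trans (cong₂ (λ b i → b - i * b) (sym (y-𝐁 n)) (ι-dbl n))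
       (trans (solve 2 (λ y i → y :- (i :+ i) :* y := y :- con 2ℚ :* (i :* y)) refl (y ! n) (ι n))
           (cong (λ u → y ! n - u) (sym (κ-⊗ 2ℚ (θ y) n)))))) ⟩
    y ⊖ κ 2ℚ ⊗ θ y                                   ≈⟨ S.solve 3
        (λ y t x → y S.:- S.con 2ℚ S.:* t S.:= y S.:- S.con 2ℚ S.:* t S.:+ S.con 1/12 S.:* x S.:- S.con 1/12
        S.:* x) ≋-refl y (θ y) X ⟩
    y ⊖ κ 2ℚ ⊗ θ y ⊕ κ 1/12 ⊗ X ⊖ κ 1/12 ⊗ X         ≈⟨ ⊕-cong ℘₀-y ≋-refl ⟨
    ℘₀ ⊖ κ 1/12 ⊗ X                                  ∎

  ℘° : Series
  ℘° = tail² ℘₀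

  ℘₀-split : ℘₀ ≋ ℘° ⊕ κ 1ℚ
  ℘₀-split = mk λ { zero → Weierstrass.Q-0 ℘₀-Weierstrass ; (suc zero) → Weierstrass.Q-1 ℘₀-Weierstrass ;
      (suc (suc n)) → sym (+-identityʳ _) }

  -- In even degree the term d x 𝐁 of `W-closed` involves only odd Bernoulli numbers of index at
  -- least 3 and vanishes, while 𝐐 is even. The degree read off is 2N + 4, as `W-closed` carries the
  -- factor x².
  W-even : ∀ N d → W d ! dbl (suc N) ≡ (℘° ⊗ ch° (ι d)) ! suc (suc N) + ch (ι d) ! suc (suc N) - 1/12 * ch
      (ι d) ! suc N
  W-even N d = trans (sym (trans (X-⊗ (X ⊗ W d) (suc M)) (X-⊗ (W d) M))) (trans (at (W-closed d) (suc (suc M)))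
    (trans (cong₂ _-_ (⊗-ev 𝐐 (E (ι d) ⊖ κ 1ℚ) (suc (suc N)) 𝐐-odd)
        (trans (κ-⊗ (ι d) (X ⊗ 𝐁) (suc (suc M)))
            (trans (cong (ι d *_) (trans (X-⊗ 𝐁 (suc M)) (𝐁-odd N))) (*-zeroʳ (ι d)))))
    (trans (+-identityʳ _) (trans (at even (suc (suc N)))
      (cong (λ u → (℘° ⊗ c) ! suc (suc N) + c ! suc (suc N) - u)
          (trans (κ-⊗ 1/12 (X ⊗ c) (suc (suc N))) (cong (1/12 *_) (X-⊗ c (suc N)))))))))
    where
    M = dbl (suc N)
    c = ch° (ι d)
    even : ev 𝐐 ⊗ ev (E (ι d) ⊖ κ 1ℚ) ≋ ℘° ⊗ c ⊕ c ⊖ κ 1/12 ⊗ (X ⊗ c)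
    even = begin
      ev 𝐐 ⊗ ev (E (ι d) ⊖ κ 1ℚ)           ≈⟨ ⊗-cong (≋-trans 𝐐-even (⊕-cong ℘₀-split ≋-refl)) (ch-ch° (ι d)) ⟩
      (℘° ⊕ κ 1ℚ ⊖ κ 1/12 ⊗ X) ⊗ c         ≈⟨ S.solve 3
          (λ p x c → (p S.:+ S.con 1ℚ S.:- S.con 1/12 S.:* x) S.:* c S.:= p S.:* c S.:+ c S.:- S.con 1/12 S.:*
          (x S.:* c)) ≋-refl ℘° X c ⟩
      ℘° ⊗ c ⊕ c ⊖ κ 1/12 ⊗ (X ⊗ c)        ∎

-- A Liouville-type identity for sums over divisors.

module DivisorIdentity where

  open import Data.Rational.Base
  open import Data.Rational.Properties
  open import Data.Rational.Solver using (module +-*-Solver)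
  open RationalArithmetic
  open +-*-Solver using (solve; _:+_; _:*_; _:-_; :-_; _:=_; con)
  open ≡-Reasoning

  opaque
    Σ₁ : ℕ → (ℕ → ℚ) → ℚ
    Σ₁ M f = Σ< M (λ i → f (suc i))

    Σ₁-def : ∀ M f → Σ₁ M f ≡ Σ< M (λ i → f (suc i))
    Σ₁-def M f = refl

    Σ₁-cong : ∀ M {f g} → (∀ i → f (suc i) ≡ g (suc i)) → Σ₁ M f ≡ Σ₁ M g
    Σ₁-cong M = Σ-cong M

    Σ₁-0 : ∀ M {f} → (∀ i → f (suc i) ≡ 0ℚ) → Σ₁ M f ≡ 0ℚ
    Σ₁-0 M eq = Σ-0 M (λ i _ → eq i)

    Σ₁-+ : ∀ M f g → Σ₁ M (λ i → f i + g i) ≡ Σ₁ M f + Σ₁ M g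
    Σ₁-+ M f g = Σ-+ M _ _

    Σ₁-neg : ∀ M f → Σ₁ M (λ i → - f i) ≡ - Σ₁ M f
    Σ₁-neg M f = Σ-neg M _

    Σ₁-*ˡ : ∀ M c f → Σ₁ M (λ i → c * f i) ≡ c * Σ₁ M f
    Σ₁-*ˡ M c f = Σ-*ˡ M c _

    Σ₁-*ʳ : ∀ M c f → Σ₁ M (λ i → f i * c) ≡ Σ₁ M f * c
    Σ₁-*ʳ M c f = Σ-*ʳ M c _

    Σ₁-swap : ∀ M N (F : ℕ → ℕ → ℚ) → Σ₁ M (λ i → Σ₁ N (F i)) ≡ Σ₁ N (λ j → Σ₁ M (λ i → F i j))
    Σ₁-swap M N F = Σ-swap M N _

  Σ⁴ : ℕ → (ℕ → ℕ → ℕ → ℕ → ℚ) → ℚ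
  Σ⁴ M F = Σ₁ M λ a → Σ₁ M λ b → Σ₁ M λ x → Σ₁ M λ z → F a b x z

  Σ²-cong : ∀ M {F G : ℕ → ℕ → ℚ} → (∀ a b → F (suc a) (suc b) ≡ G (suc a) (suc b)) → Σ₁ M
      (λ a → Σ₁ M (F a)) ≡ Σ₁ M (λ a → Σ₁ M (G a))
  Σ²-cong M eq = Σ₁-cong M λ a → Σ₁-cong M λ b → eq a b

  Σ⁴-cong : ∀ M {F G} → (∀ a b x z → F (suc a) (suc b) (suc x) (suc z) ≡ G (suc a) (suc b) (suc x) (suc z)) →
      Σ⁴ M F ≡ Σ⁴ M G
  Σ⁴-cong M eq = Σ²-cong M λ a b → Σ²-cong M λ x z → eq a b x z

  Σ²-+ : ∀ M (F G : ℕ → ℕ → ℚ) → Σ₁ M (λ a → Σ₁ M (λ b → F a b + G a b)) ≡ Σ₁ M (λ a → Σ₁ M (F a)) + Σ₁ M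
      (λ a → Σ₁ M (G a))
  Σ²-+ M F G = trans (Σ₁-cong M (λ a → Σ₁-+ M (F (suc a)) (G (suc a)))) (Σ₁-+ M _ _)

  Σ²-swap : ∀ M (F : ℕ → ℕ → ℕ → ℕ → ℚ) → Σ⁴ M F ≡ Σ⁴ M (λ x z a b → F a b x z)
  Σ²-swap M F = begin
    (Σ₁ M λ a → Σ₁ M λ b → Σ₁ M λ x → Σ₁ M λ z → F a b x z) ≡⟨ Σ₁-cong M (λ a → Σ₁-swap M M _) ⟩
    (Σ₁ M λ a → Σ₁ M λ x → Σ₁ M λ b → Σ₁ M λ z → F a b x z) ≡⟨ Σ₁-swap M M _ ⟩
    (Σ₁ M λ x → Σ₁ M λ a → Σ₁ M λ b → Σ₁ M λ z → F a b x z) ≡⟨ Σ₁-cong M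
        (λ x → Σ₁-cong M (λ a → Σ₁-swap M M _)) ⟩
    (Σ₁ M λ x → Σ₁ M λ a → Σ₁ M λ z → Σ₁ M λ b → F a b x z) ≡⟨ Σ₁-cong M (λ x → Σ₁-swap M M _) ⟩
    (Σ₁ M λ x → Σ₁ M λ z → Σ₁ M λ a → Σ₁ M λ b → F a b x z) ∎

  Σ⁴-+ : ∀ M (F G : ℕ → ℕ → ℕ → ℕ → ℚ) → Σ⁴ M (λ a b x z → F a b x z + G a b x z) ≡ Σ⁴ M F + Σ⁴ M G
  Σ⁴-+ M F G = trans (Σ²-cong M λ a b → Σ²-+ M (F (suc a) (suc b)) (G (suc a) (suc b)))
    (Σ²-+ M (λ a b → Σ₁ M λ x → Σ₁ M (F a b x)) (λ a b → Σ₁ M λ x → Σ₁ M (G a b x)))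

  Σ⁴-neg : ∀ M (F : ℕ → ℕ → ℕ → ℕ → ℚ) → Σ⁴ M (λ a b x z → - F a b x z) ≡ - Σ⁴ M F
  Σ⁴-neg M F = trans (Σ₁-cong M λ a → trans (Σ₁-cong M λ b → trans (Σ₁-cong M λ x → Σ₁-neg M _) (Σ₁-neg M _))
      (Σ₁-neg M _)) (Σ₁-neg M _)

  δ : ℕ → ℕ → ℚ
  δ zero    zero    = 1ℚ
  δ (suc m) (suc n) = δ m n
  δ zero    (suc n) = 0ℚ
  δ (suc m) zero    = 0ℚ

  δ-≢ : ∀ {m n} → m ≢ n → δ m n ≡ 0ℚ
  δ-≢ {zero} {zero} ne = ⊥-elim (ne refl)
  δ-≢ {zero} {suc n} ne = refl
  δ-≢ {suc m} {zero} ne = refl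
  δ-≢ {suc m} {suc n} ne = δ-≢ (λ eq → ne (cong suc eq))

  δ-refl : ∀ n → δ n n ≡ 1ℚ
  δ-refl zero = refl
  δ-refl (suc n) = δ-refl n

  Σ-shift : ∀ M k (g : ℕ → ℚ) → (∀ i → M ℕ.≤ i → g i ≡ 0ℚ) → Σ< M (λ i → g (k ℕ.+ i)) ≡ Σ< M g - Σ< k g
  Σ-shift M k g vanish = begin
    s                                      ≡⟨ solve 2 (λ s t → s := t :+ s :- t) refl s (Σ< k g) ⟩
    Σ< k g + s - Σ< k g                    ≡⟨ cong (λ u → u - Σ< k g) (Σ-split k M g) ⟨
    Σ< (k ℕ.+ M) g - Σ< k g                ≡⟨ cong (λ u → Σ< u g - Σ< k g) (ℕ.+-comm k M) ⟩
    Σ< (M ℕ.+ k) g - Σ< k g                ≡⟨ cong (λ u → u - Σ< k g) (Σ-split M k g) ⟩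
    Σ< M g + Σ< k (λ i → g (M ℕ.+ i)) - Σ< k g
      ≡⟨ cong (λ u → Σ< M g + u - Σ< k g) (Σ-0 k (λ i _ → vanish (M ℕ.+ i) (ℕ.m≤m+n M i))) ⟩
    Σ< M g + 0ℚ - Σ< k g                   ≡⟨ cong (λ u → u - Σ< k g) (+-identityʳ (Σ< M g)) ⟩
    Σ< M g - Σ< k g                        ∎
    where s = Σ< M (λ i → g (k ℕ.+ i))

  -- The two closed triangles cover the square once and its diagonal a second time.
  triangles : ∀ M (F : ℕ → ℕ → ℚ) →
    Σ< M (λ j → Σ< (suc j) (λ i → F i j)) + Σ< M (λ i → Σ< (suc i) (F i)) ≡
    Σ< M (λ i → Σ< M (F i)) + Σ< M (λ i → F i i)
  triangles zero F = refl
  triangles (suc M) F = begin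
    t₁ + (c + x) + (t₂ + (r + x))           ≡⟨ solve 5
        (λ t₁ t₂ c r x → t₁ :+ (c :+ x) :+ (t₂ :+ (r :+ x)) := (t₁ :+ t₂) :+ (c :+ x :+ (r :+ x))) refl t₁ t₂ c
        r x ⟩
    t₁ + t₂ + (c + x + (r + x))             ≡⟨ cong (_+ (c + x + (r + x))) (triangles M F) ⟩
    b + d + (c + x + (r + x))               ≡⟨ solve 5
        (λ b d c r x → b :+ d :+ (c :+ x :+ (r :+ x)) := b :+ c :+ (r :+ x) :+ (d :+ x)) refl b d c r x ⟩
    b + c + (r + x) + (d + x)               ≡⟨ cong (λ u → u + (r + x) + (d + x))
        (Σ-+ M (λ i → Σ< M (F i)) (λ i → F i M)) ⟨
    Σ< M (λ i → Σ< M (F i) + F i M) + (r + x) + (d + x) ∎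
    where
    t₁ = Σ< M (λ j → Σ< (suc j) (λ i → F i j))
    t₂ = Σ< M (λ i → Σ< (suc i) (F i))
    b = Σ< M (λ i → Σ< M (F i))
    d = Σ< M (λ i → F i i)
    c = Σ< M (λ i → F i M)
    r = Σ< M (F M)
    x = F M M

  -- Splits the pairs into x > y, x < y and x = y and takes the difference as a new variable. As F
  -- vanishes beyond M, the difference may run up to M.
  Σ<-trichotomy : ∀ M (F : ℕ → ℕ → ℚ) → (∀ x y → M ℕ.< x → F x y ≡ 0ℚ) → (∀ x y → M ℕ.< y → F x y ≡ 0ℚ) →
    Σ< M (λ i → Σ< M (λ j → F (suc i) (suc j))) ≡
    Σ< M (λ i → Σ< M (λ j → F (suc j ℕ.+ suc i) (suc j))) + Σ< M
        (λ i → Σ< M (λ j → F (suc i) (suc i ℕ.+ suc j))) + Σ< M (λ i → F (suc i) (suc i))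
  Σ<-trichotomy M F vanishˡ vanishʳ = begin
    b                                       ≡⟨ solve 4
        (λ b t₁ t₂ d → b := b :- t₁ :+ (b :- t₂) :+ ((t₁ :+ t₂) :- b)) refl b t₁ t₂ d ⟩
    b - t₁ + (b - t₂) + (t₁ + t₂ - b)       ≡⟨ cong (λ u → b - t₁ + (b - t₂) + (u - b)) (triangles M G) ⟩
    b - t₁ + (b - t₂) + (b + d - b)         ≡⟨ cong₂ _+_ (cong₂ _+_ left right)
        (solve 2 (λ b d → b :+ d :- b := d) refl b d) ⟩
    Σ< M (λ i → Σ< M (λ j → F (suc j ℕ.+ suc i) (suc j))) + Σ< M
        (λ i → Σ< M (λ j → F (suc i) (suc i ℕ.+ suc j))) + d ∎
    where
    G : ℕ → ℕ → ℚ
    G i j = F (suc i) (suc j)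
    b = Σ< M (λ i → Σ< M (G i))
    t₁ = Σ< M (λ j → Σ< (suc j) (λ i → G i j))
    t₂ = Σ< M (λ i → Σ< (suc i) (G i))
    d = Σ< M (λ i → G i i)
    right : b - t₂ ≡ Σ< M (λ i → Σ< M (λ j → F (suc i) (suc i ℕ.+ suc j)))
    right = trans (sym (Σ-- M (λ i → Σ< M (G i)) (λ i → Σ< (suc i) (G i))))
      (Σ-cong M λ i → trans (sym (Σ-shift M (suc i) (G i) (λ j M≤j → vanishʳ (suc i) (suc j) (ℕ.s≤s M≤j))))
        (Σ-cong M λ j → cong (F (suc i)) (cong suc (sym (ℕ.+-suc i j)))))
    left : b - t₁ ≡ Σ< M (λ i → Σ< M (λ j → F (suc j ℕ.+ suc i) (suc j)))
    left = trans (cong (_- t₁) (Σ-swap M M G))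
        (trans (sym (Σ-- M (λ j → Σ< M (λ i → G i j)) (λ j → Σ< (suc j) (λ i → G i j))))
      (trans (Σ-cong M λ j → trans
          (sym (Σ-shift M (suc j) (λ i → G i j) (λ i M≤i → vanishˡ (suc i) (suc j) (ℕ.s≤s M≤i))))
        (Σ-cong M λ i → cong (λ k → F k (suc j)) (cong suc (sym (ℕ.+-suc j i)))))
      (Σ-swap M M (λ j i → F (suc j ℕ.+ suc i) (suc j)))))

  opaque
    unfolding Σ₁

    Σ₁-trichotomy : ∀ M (F : ℕ → ℕ → ℚ) → (∀ x y → M ℕ.< x → F x y ≡ 0ℚ) → (∀ x y → M ℕ.< y → F x y ≡ 0ℚ) →
      Σ₁ M (λ x → Σ₁ M (F x)) ≡
      Σ₁ M (λ x → Σ₁ M (λ y → F (y ℕ.+ x) y)) + Σ₁ M (λ x → Σ₁ M (λ y → F x (x ℕ.+ y))) + Σ₁ M (λ x → F x x)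
    Σ₁-trichotomy = Σ<-trichotomy

  module _ (w : ℚ → ℚ) where
    -- With c = -(a + b) and w even this is bc w(a) + ca w(b) + ab w(c): symmetric in a, b, c and
    -- unchanged under a common change of sign. Both invariances below are instances.
    p : ℚ → ℚ → ℚ
    p a b = a * b * w (a + b) - (a + b) * b * w a - (a + b) * a * w b

    P : ℚ → ℚ → ℚ
    P a b = a * b * (w (a + b) + w (a - b) - (w a + w a) - (w b + w b))

  module _ (w : ℚ → ℚ) (w-even : ∀ u → w (- u) ≡ w u) (w-0 : w 0ℚ ≡ 0ℚ) where
    P-p : ∀ a b → P w a b ≡ p w a b - p w a (- b)
    P-p a b = trans (solve 6 (λ a b wp wm wa wb → a :* b :* (wp :+ wm :- (wa :+ wa) :- (wb :+ wb)) :=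
        a :* b :* wp :- (a :+ b) :* b :* wa :- (a :+ b) :* a :* wb :-
        (a :* (:- b) :* wm :- (a :- b) :* (:- b) :* wa :- (a :- b) :* a :* wb))
        refl a b (w (a + b)) (w (a - b)) (w a) (w b))
      (cong (λ u → p w a b - (a * (- b) * w (a - b) - (a - b) * (- b) * w a - (a - b) * a * u))
          (sym (w-even b)))

    p-invariantˡ : ∀ a b → p w (b + a) (- b) ≡ p w a b
    p-invariantˡ a b = trans (cong₂
        (λ u v → (b + a) * (- b) * u - (b + a - b) * (- b) * w (b + a) - (b + a - b) * (b + a) * v)
        (cong w (solve 2 (λ a b → b :+ a :- b := a) refl a b)) (w-even b))
      (trans (cong (λ u → (b + a) * (- b) * w a - (b + a - b) * (- b) * u - (b + a - b) * (b + a) * w b)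
          (cong w (+-comm b a)))
      (solve 5 (λ a b wp wa wb → (b :+ a) :* (:- b) :* wa :- (b :+ a :- b) :* (:- b) :* wp :- (b :+ a :- b) :*
          (b :+ a) :* wb :=
         a :* b :* wp :- (a :+ b) :* b :* wa :- (a :+ b) :* a :* wb) refl a b (w (a + b)) (w a) (w b)))

    p-invariantʳ : ∀ a b → p w a (- (a + b)) ≡ p w a b
    p-invariantʳ a b = trans (cong₂
        (λ u v → a * (- (a + b)) * u - (a - (a + b)) * (- (a + b)) * w a - (a - (a + b)) * a * v)
        (trans (cong w (solve 2 (λ a b → a :- (a :+ b) := :- b) refl a b)) (w-even b)) (w-even (a + b)))
      (solve 5 (λ a b wp wa wb → a :* (:- (a :+ b)) :* wb :- (a :- (a :+ b)) :* (:- (a :+ b)) :* wa :-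
          (a :- (a :+ b)) :* a :* wp :=
         a :* b :* wp :- (a :+ b) :* b :* wa :- (a :+ b) :* a :* wb) refl a b (w (a + b)) (w a) (w b))

    p-diagonal : ∀ a → p w a (- a) ≡ 0ℚ
    p-diagonal a = trans (cong (λ u → a * (- a) * u - (a - a) * (- a) * w a - (a - a) * a * w (- a))
        (trans (cong w (+-inverseʳ a)) w-0))
      (solve 3 (λ a wa wb → a :* (:- a) :* con 0ℚ :- (a :- a) :* (:- a) :* wa :- (a :- a) :* a :* wb := con 0ℚ)
          refl a (w a) (w (- a)))

    module _ {m M : ℕ} (m≤M : m ℕ.≤ M) where
      private
        far : ∀ s → M ℕ.< s → δ s m ≡ 0ℚ
        far s M<s = δ-≢ {s} {m} λ { refl → ℕ.<⇒≱ M<s m≤M }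

        f₁ f₂ : ℕ → ℕ → ℕ → ℕ → ℚ
        f₁ a b x z = δ (a ℕ.* (z ℕ.+ x) ℕ.+ b ℕ.* z) m * p w (ι a) (ι b)
        f₂ a b x z = δ (a ℕ.* x ℕ.+ b ℕ.* (x ℕ.+ z)) m * p w (ι a) (ι b)

      -- The sum over ax + bz = m is split by comparing x with z.
      divisors-p : Σ⁴ M (λ a b x z → δ (a ℕ.* x ℕ.+ b ℕ.* z) m * p w (ι a) (ι b)) ≡
        Σ⁴ M f₁ + Σ⁴ M f₂ + (Σ₁ M λ a → Σ₁ M λ b → Σ₁ M λ x → δ (a ℕ.* x ℕ.+ b ℕ.* x) m * p w (ι a) (ι b))
      divisors-p = trans
        (Σ²-cong M λ a b → Σ₁-trichotomy M
            (λ x z → δ (suc a ℕ.* x ℕ.+ suc b ℕ.* z) m * p w (ι (suc a)) (ι (suc b)))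
          (λ x z M<x → trans (cong (_* p w (ι (suc a)) (ι (suc b)))
              (far _ (ℕ.<-≤-trans M<x (ℕ.≤-trans (ℕ.m≤m+n x (a ℕ.* x)) (ℕ.m≤m+n (suc a ℕ.* x) (suc b ℕ.* z))))))
              (*-zeroˡ (p w (ι (suc a)) (ι (suc b)))))
          (λ x z M<z → trans (cong (_* p w (ι (suc a)) (ι (suc b)))
              (far _ (ℕ.<-≤-trans M<z (ℕ.≤-trans (ℕ.m≤m+n z (b ℕ.* z)) (ℕ.m≤n+m (suc b ℕ.* z) (suc a ℕ.* x))))))
              (*-zeroˡ (p w (ι (suc a)) (ι (suc b))))))
        (trans (Σ²-+ M _ (λ a b → Σ₁ M λ x → δ (a ℕ.* x ℕ.+ b ℕ.* x) m * p w (ι a) (ι b)))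
          (cong (_+ (Σ₁ M λ a → Σ₁ M λ b → Σ₁ M λ x → δ (a ℕ.* x ℕ.+ b ℕ.* x) m * p w (ι a) (ι b)))
            (Σ²-+ M (λ a b → Σ₁ M λ x → Σ₁ M (f₁ a b x)) (λ a b → Σ₁ M λ x → Σ₁ M (f₂ a b x)))))

      -- Here a is compared with b instead. As (a + b)x + bz = ax + b(x + z), the invariances of `p`
      -- carry the two unequal cases to those of `divisors-p` in the opposite order, and the case a
      -- = b vanishes by `p-diagonal`.
      divisors-p⁻ : Σ⁴ M (λ a b x z → δ (a ℕ.* x ℕ.+ b ℕ.* z) m * p w (ι a) (- ι b)) ≡ Σ⁴ M f₁ + Σ⁴ M f₂
      divisors-p⁻ = begin
        Σ⁴ M (λ a b x z → G a b x z) ≡⟨ Σ²-swap M G ⟩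
        Σ⁴ M (λ x z a b → G a b x z) ≡⟨ Σ²-cong M (λ x z → Σ₁-trichotomy M (λ a b → G a b (suc x) (suc z))
          (λ a b M<a → trans (cong (_* p w (ι a) (- ι b))
              (far _ (ℕ.<-≤-trans M<a (ℕ.≤-trans (ℕ.m≤m*n a (suc x)) (ℕ.m≤m+n (a ℕ.* suc x) (b ℕ.* suc z))))))
              (*-zeroˡ (p w (ι a) (- ι b))))
          (λ a b M<b → trans (cong (_* p w (ι a) (- ι b))
              (far _ (ℕ.<-≤-trans M<b (ℕ.≤-trans (ℕ.m≤m*n b (suc z)) (ℕ.m≤n+m (b ℕ.* suc z) (a ℕ.* suc x))))))
              (*-zeroˡ (p w (ι a) (- ι b))))) ⟩
        (Σ₁ M λ x → Σ₁ M λ z → (Σ₁ M λ a → Σ₁ M λ b → G (b ℕ.+ a) b x z) +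
            (Σ₁ M λ a → Σ₁ M λ b → G a (a ℕ.+ b) x z) + (Σ₁ M λ a → G a a x z))
          ≡⟨ Σ²-cong M (λ x z → trans (cong₂ _+_ (cong₂ _+_
               (Σ²-cong M λ a b → cong₂ _*_ (cong (λ k → δ k m) (reindex₂ (suc a) (suc b) (suc x) (suc z)))
                  (trans (cong (λ u → p w u (- ι (suc b))) (ι-+ (suc b) (suc a)))
                      (p-invariantˡ (ι (suc a)) (ι (suc b)))))
               (Σ²-cong M λ a b → cong₂ _*_ (cong (λ k → δ k m) (reindex₁ (suc a) (suc b) (suc x) (suc z)))
                  (trans (cong (λ u → p w (ι (suc a)) (- u)) (ι-+ (suc a) (suc b)))
                      (p-invariantʳ (ι (suc a)) (ι (suc b))))))
               (Σ₁-0 M λ a → trans (cong (δ (suc a ℕ.* suc x ℕ.+ suc a ℕ.* suc z) m *_)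
                   (p-diagonal (ι (suc a)))) (*-zeroʳ (δ (suc a ℕ.* suc x ℕ.+ suc a ℕ.* suc z) m))))
               (+-identityʳ _)) ⟩
        (Σ₁ M λ x → Σ₁ M λ z → (Σ₁ M λ a → Σ₁ M λ b → f₂ a b x z) + (Σ₁ M λ a → Σ₁ M λ b → f₁ a b x z))
          ≡⟨ trans (Σ²-+ M (λ x z → Σ₁ M λ a → Σ₁ M λ b → f₂ a b x z)
              (λ x z → Σ₁ M λ a → Σ₁ M λ b → f₁ a b x z))
              (+-comm (Σ⁴ M (λ x z a b → f₂ a b x z)) (Σ⁴ M (λ x z a b → f₁ a b x z))) ⟩
        Σ⁴ M (λ x z a b → f₁ a b x z) + Σ⁴ M (λ x z a b → f₂ a b x z) ≡⟨ cong₂ _+_ (Σ²-swap M f₁)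
            (Σ²-swap M f₂) ⟨
        Σ⁴ M f₁ + Σ⁴ M f₂ ∎
        where
        G : ℕ → ℕ → ℕ → ℕ → ℚ
        G a b x z = δ (a ℕ.* x ℕ.+ b ℕ.* z) m * p w (ι a) (- ι b)
        reindex₁ : ∀ a b x z → a ℕ.* x ℕ.+ (a ℕ.+ b) ℕ.* z ≡ a ℕ.* (z ℕ.+ x) ℕ.+ b ℕ.* z
        reindex₁ = ℕS.solve 4 (λ a b x z → a ℕS.:* x ℕS.:+ (a ℕS.:+ b) ℕS.:* z ℕS.:= a ℕS.:*
            (z ℕS.:+ x) ℕS.:+ b ℕS.:* z) refl
        reindex₂ : ∀ a b x z → (b ℕ.+ a) ℕ.* x ℕ.+ b ℕ.* z ≡ a ℕ.* x ℕ.+ b ℕ.* (x ℕ.+ z)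
        reindex₂ = ℕS.solve 4 (λ a b x z → (b ℕS.:+ a) ℕS.:* x ℕS.:+ b ℕS.:* z ℕS.:= a ℕS.:* x ℕS.:+ b ℕS.:*
            (x ℕS.:+ z)) refl

      -- P(a, b) is p(a, b) - p(a, -b), so everything cancels except the case x = z, where m = (a +
      -- b)x leads back to a sum over divisors.
      divisors : Σ⁴ M (λ a b x z → δ (a ℕ.* x ℕ.+ b ℕ.* z) m * P w (ι a) (ι b)) ≡
        (Σ₁ M λ a → Σ₁ M λ b → Σ₁ M λ x → δ (a ℕ.* x ℕ.+ b ℕ.* x) m * p w (ι a) (ι b))
      divisors = begin
        Σ⁴ M (λ a b x z → D a b x z * P w (ι a) (ι b))
          ≡⟨ Σ⁴-cong M (λ a b x z → trans
              (cong (D (suc a) (suc b) (suc x) (suc z) *_) (P-p (ι (suc a)) (ι (suc b))))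
               (solve 3 (λ d u v → d :* (u :- v) := d :* u :+ :- (d :* v)) refl
                   (D (suc a) (suc b) (suc x) (suc z)) (p w (ι (suc a)) (ι (suc b)))
                   (p w (ι (suc a)) (- ι (suc b))))) ⟩
        Σ⁴ M (λ a b x z → D a b x z * p w (ι a) (ι b) + - (D a b x z * p w (ι a) (- ι b)))
          ≡⟨ trans (Σ⁴-+ M (λ a b x z → D a b x z * p w (ι a) (ι b))
              (λ a b x z → - (D a b x z * p w (ι a) (- ι b))))
              (cong (Σ⁴ M (λ a b x z → D a b x z * p w (ι a) (ι b)) +_)
              (Σ⁴-neg M (λ a b x z → D a b x z * p w (ι a) (- ι b)))) ⟩
        Σ⁴ M (λ a b x z → D a b x z * p w (ι a) (ι b)) - Σ⁴ M (λ a b x z → D a b x z * p w (ι a) (- ι b))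
          ≡⟨ cong₂ _-_ divisors-p divisors-p⁻ ⟩
        Σ⁴ M f₁ + Σ⁴ M f₂ + s - (Σ⁴ M f₁ + Σ⁴ M f₂)
          ≡⟨ solve 2 (λ u s → u :+ s :- u := s) refl (Σ⁴ M f₁ + Σ⁴ M f₂) s ⟩
        s ∎
        where
        D : ℕ → ℕ → ℕ → ℕ → ℚ
        D a b x z = δ (a ℕ.* x ℕ.+ b ℕ.* z) m
        s = Σ₁ M λ a → Σ₁ M λ b → Σ₁ M λ x → δ (a ℕ.* x ℕ.+ b ℕ.* x) m * p w (ι a) (ι b)

-- The ℘-recurrence for the q-expansions of Eisenstein series.

module EisensteinRecurrence where

  open import Data.Rational.Base
  open import Data.Rational.Properties
  open import Data.Rational.Solver using (module +-*-Solver)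
  open RationalArithmetic
  open PowerSeries hiding (module Reasoning)
  open BernoulliSeries
  open EvenSeries
  open DivisorIdentity
  open +-*-Solver using (solve; _:+_; _:*_; _:-_; :-_; _:=_; con)
  private
    module S = SeriesSolver
    module SR = PowerSeries.Reasoning
  open ≡-Reasoning

  opaque
    unfolding Σ₁

    anti-Σ₁ : ∀ n M (F : ℕ → ℕ → ℕ → ℚ) → anti (λ i j → Σ₁ M (F i j)) n ≡ Σ₁ M (λ k → anti (λ i j → F i j k) n)
    anti-Σ₁ n M F = anti-Σ n M (λ i j k → F i j (suc k))

  anti-δ : ∀ m s t → anti (λ u v → δ s u * δ t v) m ≡ δ (s ℕ.+ t) m
  anti-δ zero zero t = *-identityˡ (δ t 0)
  anti-δ zero (suc s) t = *-zeroˡ (δ t 0)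
  anti-δ (suc m) zero t = trans (cong₂ _+_ (*-identityˡ (δ t (suc m))) (anti-0 m (λ i j _ → *-zeroˡ (δ t j))))
      (+-identityʳ (δ t (suc m)))
  anti-δ (suc m) (suc s) t = trans (cong₂ _+_ (*-zeroˡ (δ t (suc m))) (anti-δ m s t))
      (+-identityˡ (δ (s ℕ.+ t) m))

  -- D M g m = Σ_{a ∣ m} g a, when 1 ≤ m ≤ M
  D : ℕ → (ℕ → ℚ) → ℕ → ℚ
  D M g m = Σ₁ M λ a → Σ₁ M λ x → δ (a ℕ.* x) m * g a

  D-cong : ∀ M {g h} m → (∀ a → g (suc a) ≡ h (suc a)) → D M g m ≡ D M h m
  D-cong M m eq = Σ²-cong M λ a x → cong (δ (suc a ℕ.* suc x) m *_) (eq a)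

  D-+ : ∀ M g h m → D M (λ a → g a + h a) m ≡ D M g m + D M h m
  D-+ M g h m = trans (Σ²-cong M λ a x → *-distribˡ-+ (δ (suc a ℕ.* suc x) m) (g (suc a)) (h (suc a)))
    (Σ²-+ M (λ a x → δ (a ℕ.* x) m * g a) (λ a x → δ (a ℕ.* x) m * h a))

  D-*ˡ : ∀ M c g m → D M (λ a → c * g a) m ≡ c * D M g m
  D-*ˡ M c g m = trans (Σ₁-cong M λ a → trans (Σ₁-cong M λ x →
      solve 3 (λ d c g → d :* (c :* g) := c :* (d :* g)) refl (δ (suc a ℕ.* suc x) m) c (g (suc a)))
    (Σ₁-*ˡ M c (λ x → δ (suc a ℕ.* x) m * g (suc a)))) (Σ₁-*ˡ M c (λ a → Σ₁ M λ x → δ (a ℕ.* x) m * g a))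

  D-0 : ∀ M g → D M g 0 ≡ 0ℚ
  D-0 M g = Σ₁-0 M λ a → Σ₁-0 M λ x → *-zeroˡ (g (suc a))

  D-anti : ∀ n M (g : ℕ → ℕ → ℕ → ℚ) m → anti (λ i j → D M (g i j) m) n ≡ D M (λ a → anti (λ i j → g i j a) n) m
  D-anti n M g m = trans (anti-Σ₁ n M _) (Σ₁-cong M λ a → trans (anti-Σ₁ n M _) (Σ₁-cong M λ x →
    anti-*ˡ n (δ (suc a ℕ.* suc x) m) (λ i j → g i j (suc a))))

  D-product : ∀ M g h m → anti (λ u v → D M g u * D M h v) m ≡ Σ⁴ M
      (λ a b x z → δ (a ℕ.* x ℕ.+ b ℕ.* z) m * (g a * h b))
  D-product M g h m = begin
    anti (λ u v → D M g u * D M h v) m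
      ≡⟨ anti-cong m (λ u v → expand u v) ⟩
    anti (λ u v → Σ₁ M λ a → Σ₁ M λ x → Σ₁ M λ b → Σ₁ M λ z → F u v a x b z) m
      ≡⟨ trans (anti-Σ₁ m M _) (Σ₁-cong M λ a → trans (anti-Σ₁ m M _)
          (Σ₁-cong M λ x → trans (anti-Σ₁ m M _) (Σ₁-cong M λ b → trans (anti-Σ₁ m M _) (Σ₁-cong M λ z →
           trans (anti-cong m (λ u v → solve 4 (λ p g q h → p :* g :* (q :* h) := p :* q :* (g :* h)) refl
               (δ (suc a ℕ.* suc x) u) (g (suc a)) (δ (suc b ℕ.* suc z) v) (h (suc b))))
           (trans (anti-*ʳ m (g (suc a) * h (suc b)) _)
               (cong (_* (g (suc a) * h (suc b))) (anti-δ m (suc a ℕ.* suc x) (suc b ℕ.* suc z)))))))) ⟩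
    (Σ₁ M λ a → Σ₁ M λ x → Σ₁ M λ b → Σ₁ M λ z → G a b x z)
      ≡⟨ Σ₁-cong M (λ a → Σ₁-swap M M _) ⟩
    Σ⁴ M G ∎
    where
    F : ℕ → ℕ → ℕ → ℕ → ℕ → ℕ → ℚ
    F u v a x b z = δ (a ℕ.* x) u * g a * (δ (b ℕ.* z) v * h b)
    G : ℕ → ℕ → ℕ → ℕ → ℚ
    G a b x z = δ (a ℕ.* x ℕ.+ b ℕ.* z) m * (g a * h b)
    expand : ∀ u v → D M g u * D M h v ≡ Σ₁ M λ a → Σ₁ M λ x → Σ₁ M λ b → Σ₁ M λ z → F u v a x b z
    expand u v = trans (sym (Σ₁-*ʳ M (D M h v) _))
        (Σ₁-cong M λ a → trans (sym (Σ₁-*ʳ M (D M h v) _)) (Σ₁-cong M λ x →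
      trans (sym (Σ₁-*ˡ M (δ (suc a ℕ.* suc x) u * g (suc a)) _))
          (Σ₁-cong M λ b → sym (Σ₁-*ˡ M (δ (suc a ℕ.* suc x) u * g (suc a)) _))))

  D-products : ∀ n M (g : ℕ → ℕ → ℚ) m → anti (λ i j → (ser (D M (g i)) ⊗ ser (D M (g j))) ! m) n ≡
    Σ⁴ M (λ a b x z → δ (a ℕ.* x ℕ.+ b ℕ.* z) m * anti (λ i j → g i a * g j b) n)
  D-products n M g m = trans (anti-cong n (λ i j → D-product M (g i) (g j) m))
    (trans (anti-Σ₁ n M _) (Σ₁-cong M λ a → trans (anti-Σ₁ n M _)
        (Σ₁-cong M λ b → trans (anti-Σ₁ n M _) (Σ₁-cong M λ x → trans (anti-Σ₁ n M _) (Σ₁-cong M λ z →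
      anti-*ˡ n (δ (suc a ℕ.* suc x ℕ.+ suc b ℕ.* suc z) m) _)))))

  anti-+₄ : ∀ n (F G H K : ℕ → ℕ → ℚ) → anti (λ i j → F i j + G i j + H i j + K i j) n ≡ anti F n + anti G n +
      anti H n + anti K n
  anti-+₄ n F G H K = trans (anti-+ n _ K)
      (cong (_+ anti K n) (trans (anti-+ n _ H) (cong (_+ anti H n) (anti-+ n F G))))

  Σ-δ : ∀ M n (f : ℕ → ℚ) → n ℕ.< M → Σ< M (λ b → δ b n * f b) ≡ f n
  Σ-δ (suc M) zero f _ = trans (Σ-head M _)
      (trans (cong₂ _+_ (*-identityˡ (f 0)) (Σ-0 M (λ i _ → *-zeroˡ (f (suc i))))) (+-identityʳ (f 0)))
  Σ-δ (suc M) (suc n) f (ℕ.s≤s n<M) = trans (Σ-head M _)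
      (trans (cong₂ _+_ (*-zeroˡ (f 0)) (Σ-δ M n (λ i → f (suc i)) n<M)) (+-identityˡ (f (suc n))))

  Σ-antidiagonal : ∀ d M N (F : ℕ → ℕ → ℚ) → d ℕ.≤ M → d ℕ.≤ N →
    Σ< (suc M) (λ a → Σ< (suc N) (λ b → δ (a ℕ.+ b) d * F a b)) ≡ anti F d
  Σ-antidiagonal zero M N F _ _ = trans (Σ-head M _) (trans (cong₂ _+_ (Σ-δ (suc N) 0 (F 0) (ℕ.s≤s ℕ.z≤n))
    (Σ-0 M (λ a _ → Σ-0 (suc N) (λ b _ → *-zeroˡ (F (suc a) b))))) (+-identityʳ (F 0 0)))
  Σ-antidiagonal (suc d) (suc M) N F (ℕ.s≤s d≤M) d<N = trans (Σ-head (suc M) _)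
      (cong₂ _+_ (Σ-δ (suc N) (suc d) (F 0) (ℕ.s≤s d<N))
    (Σ-antidiagonal d M N (λ a → F (suc a)) d≤M (ℕ.<⇒≤ d<N)))

  Σ-antidiagonal₁ : ∀ d M (F : ℕ → ℕ → ℚ) → d ℕ.≤ M → (∀ b → F 0 b ≡ 0ℚ) → (∀ a → F a 0 ≡ 0ℚ) →
    Σ< M (λ a → Σ< M (λ b → δ (suc a ℕ.+ suc b) d * F (suc a) (suc b))) ≡ anti F d
  Σ-antidiagonal₁ d M F d≤M F0 0F = sym (trans (sym (Σ-antidiagonal d M M F d≤M d≤M)) (trans (Σ-head M _)
    (trans (cong₂ _+_ (Σ-0 (suc M) (λ b _ → zeroed b d (F0 b)))
      (Σ-cong M (λ a → trans (Σ-head M _)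
          (trans (cong (_+ Σ< M (λ b → δ (suc a ℕ.+ suc b) d * F (suc a) (suc b)))
          (zeroed (suc a ℕ.+ 0) d (0F (suc a)))) (+-identityˡ _)))))
    (+-identityˡ _))))
    where
    zeroed : ∀ {x} a d → x ≡ 0ℚ → δ a d * x ≡ 0ℚ
    zeroed a d eq = trans (cong (δ a d *_) eq) (*-zeroʳ (δ a d))

  δ-expand : ∀ M c (f : ℕ → ℚ) → (∀ s → M ℕ.< s → f s ≡ 0ℚ) → f (suc c) ≡ Σ< M
      (λ d → δ (suc c) (suc d) * f (suc d))
  δ-expand M c f vanish with ℕ.≤-<-connex (suc c) M
  ... | inj₁ c<M = sym (trans (Σ-cong M (λ d → cong (_* f (suc d)) (δ-sym c d)))
      (Σ-δ M c (λ d → f (suc d)) c<M))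
    where
    δ-sym : ∀ m n → δ m n ≡ δ n m
    δ-sym zero zero = refl
    δ-sym zero (suc n) = refl
    δ-sym (suc m) zero = refl
    δ-sym (suc m) (suc n) = δ-sym m n
  ... | inj₂ M<c = trans (vanish (suc c) M<c)
      (sym (Σ-0 M λ d d<M → trans (cong (_* f (suc d)) (δ-≢ {c} {d} λ { refl → ℕ.<⇒≱ M<c d<M }))
      (*-zeroˡ (f (suc d)))))

  opaque
    unfolding Σ₁

    -- Groups the pairs by d = a + b. As F vanishes on the axes, the terms with a = 0 or b = 0 in
    -- `anti` cost nothing.
    Σ₁-by-sum : ∀ M (f : ℕ → ℚ) (F : ℕ → ℕ → ℚ) → (∀ s → M ℕ.< s → f s ≡ 0ℚ) → (∀ b → F 0 b ≡ 0ℚ) →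
        (∀ a → F a 0 ≡ 0ℚ) →
      Σ₁ M (λ a → Σ₁ M (λ b → f (a ℕ.+ b) * F a b)) ≡ Σ₁ M (λ d → f d * anti F d)
    Σ₁-by-sum M f F vanish F0 0F = begin
      Σ< M (λ a → Σ< M (λ b → f (suc a ℕ.+ suc b) * F (suc a) (suc b)))
        ≡⟨ Σ-cong M (λ a → trans (Σ-cong M
            (λ b → trans (cong (_* F (suc a) (suc b)) (δ-expand M (a ℕ.+ suc b) f vanish))
             (sym (Σ-*ʳ M (F (suc a) (suc b)) _)))) (Σ-swap M M _)) ⟩
      Σ< M (λ a → Σ< M (λ d → Σ< M (λ b → δ (suc a ℕ.+ suc b) (suc d) * f (suc d) * F (suc a) (suc b))))
        ≡⟨ Σ-swap M M _ ⟩
      Σ< M (λ d → Σ< M (λ a → Σ< M (λ b → δ (suc a ℕ.+ suc b) (suc d) * f (suc d) * F (suc a) (suc b))))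
        ≡⟨ Σ-cong< M (λ d d<M → trans (Σ-cong M (λ a → trans (Σ-cong M (λ b →
             solve 3 (λ p f F → p :* f :* F := f :* (p :* F)) refl (δ (suc a ℕ.+ suc b) (suc d)) (f (suc d))
                 (F (suc a) (suc b))))
             (Σ-*ˡ M (f (suc d)) _))) (trans (Σ-*ˡ M (f (suc d)) _)
                 (cong (f (suc d) *_) (Σ-antidiagonal₁ (suc d) M F d<M F0 0F)))) ⟩
      Σ< M (λ d → f (suc d) * anti F (suc d)) ∎

  anti-id : ∀ d → anti (λ a b → ι a) d ≡ ½ * (ι d * (ι d + 1ℚ))
  anti-id zero = trans ι0 (cong (λ u → ½ * (u * (u + 1ℚ))) (sym ι0))
  anti-id (suc d) = trans (anti-last d (λ a b → ι a)) (trans (cong₂ _+_ (anti-id d) (ι-suc d))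
    (trans (solve 1 (λ d → con ½ :* (d :* (d :+ con 1ℚ)) :+ (con 1ℚ :+ d) := con ½ :*
        ((con 1ℚ :+ d) :* (con 1ℚ :+ d :+ con 1ℚ))) refl (ι d))
      (cong (λ u → ½ * (u * (u + 1ℚ))) (sym (ι-suc d)))))

  anti-product : ∀ d → anti (λ a b → ι a * ι b) d ≡ ⅙ * (ι d * ι d * ι d - ι d)
  anti-product zero = trans (cong (λ u → u * u) ι0) (cong (λ u → ⅙ * (u * u * u - u)) (sym ι0))
  anti-product (suc d) = trans (anti-last d (λ a b → ι a * ι b)) (trans (cong₂ _+_
      (trans (anti-cong d (λ a b → trans (cong (ι a *_) (ι-suc b))
          (solve 2 (λ a b → a :* (con 1ℚ :+ b) := a :* b :+ a) refl (ι a) (ι b))))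
        (trans (anti-+ d (λ a b → ι a * ι b) (λ a b → ι a)) (cong₂ _+_ (anti-product d) (anti-id d))))
      (trans (cong (ι (suc d) *_) ι0) (*-zeroʳ (ι (suc d)))))
    (trans (solve 1 (λ d → con ⅙ :* (d :* d :* d :- d) :+ con ½ :* (d :* (d :+ con 1ℚ)) :+ con 0ℚ :=
        (let s = con 1ℚ :+ d in con ⅙ :* (s :* s :* s :- s))) refl (ι d))
      (cong (λ u → ⅙ * (u * u * u - u)) (sym (ι-suc d)))))

  E-even : ∀ N a → E (- a) ! dbl N ≡ E a ! dbl N
  E-even N a = trans (E-neg a (dbl N)) (trans (cong (_* E a ! dbl N) (-1^even N)) (*-identityˡ (E a ! dbl N)))
    where
    -1^even : ∀ N → (- 1ℚ) ^ dbl N ≡ 1ℚ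
    -1^even zero = refl
    -1^even (suc N) = trans (sym (*-assoc (- 1ℚ) (- 1ℚ) ((- 1ℚ) ^ dbl N))) (trans (*-identityˡ _) (-1^even N))

  ch-product : ∀ N a b → 2ℚ * (ch a ⊗ ch b) ! N ≡ ch (a + b) ! N + ch (a - b) ! N
  ch-product N a b = sym (begin
    ch (a + b) ! N + ch (a - b) ! N                ≡⟨ cong₂ _+_ (at (E-+ a b) (dbl N))
        (at (E-+ a (- b)) (dbl N)) ⟨
    (E a ⊗ E b ⊕ E a ⊗ E (- b)) ! dbl N            ≡⟨ at
        (S.solve 3 (λ a b c → a S.:* b S.:+ a S.:* c S.:= (b S.:+ c) S.:* a) ≋-refl (E a) (E b) (E (- b)))
        (dbl N) ⟩
    ((E b ⊕ E (- b)) ⊗ E a) ! dbl N                ≡⟨ ⊗-ev (E b ⊕ E (- b)) (E a) N odd ⟩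
    (ev (E b ⊕ E (- b)) ⊗ ch a) ! N                ≡⟨ at
        (⊗-cong {ev (E b ⊕ E (- b))} {κ 2ℚ ⊗ ch b} {ch a} (mk λ n → trans (cong (ch b ! n +_) (E-even n b))
                                                        (trans (solve 1 (λ c → c :+ c := con 2ℚ :* c) refl
                                                            (ch b ! n)) (sym (κ-⊗ 2ℚ (ch b) n)))) ≋-refl) N ⟩
    (κ 2ℚ ⊗ ch b ⊗ ch a) ! N                       ≡⟨ at
        (S.solve 3 (λ k a b → k S.:* b S.:* a S.:= k S.:* (a S.:* b)) ≋-refl (κ 2ℚ) (ch a) (ch b)) N ⟩
    (κ 2ℚ ⊗ (ch a ⊗ ch b)) ! N                     ≡⟨ κ-⊗ 2ℚ (ch a ⊗ ch b) N ⟩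
    2ℚ * (ch a ⊗ ch b) ! N                         ∎)
    where
    odd : ∀ i → E b ! suc (dbl i) + E (- b) ! suc (dbl i) ≡ 0ℚ
    odd i = trans (cong (E b ! suc (dbl i) +_)
        (trans (E-neg b (suc (dbl i))) (cong (_* E b ! suc (dbl i)) (-1^odd i))))
      (solve 1 (λ c → c :+ con (- 1ℚ) :* c := con 0ℚ) refl (E b ! suc (dbl i)))

  ch-ch°′ : ∀ a → ch a ≋ ch° a ⊕ κ 1ℚ
  ch-ch°′ a = mk λ { zero → refl ; (suc n) → sym (+-identityʳ (ch a ! suc n)) }

  -- n ↦ 2 a²ⁿ⁻¹ / (2n - 2)!, for n ≥ 2
  G : ℚ → Series
  G a = κ (a + a) ⊗ (X ⊗ ch° a)

  -- A M n is the q-expansion of (2n - 1) G_{2n} / (2πi)²ⁿ, up to order M, for n ≥ 2.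
  A : ℕ → ℕ → Series
  A M n ! m = κ (℘° ! n) ! m + D M (λ a → G (ι a) ! n) m

  module _ (k : ℕ) where
    private
      N n : ℕ
      N = suc k
      n = suc (suc N)
      w : ℚ → ℚ
      w u = ch u ! N

    ch°-product : ∀ a b → 2ℚ * (ch° a ⊗ ch° b) ! N ≡ w (a + b) + w (a - b) - (w a + w a) - (w b + w b)
    ch°-product a b = trans (solve 3
        (λ t u v → con 2ℚ :* t := con 2ℚ :* (t :+ u :+ v :+ con 0ℚ) :- (u :+ u) :- (v :+ v)) refl
        ((ch° a ⊗ ch° b) ! N) (w a) (w b))
      (cong (λ u → u - (w a + w a) - (w b + w b)) (trans (cong (2ℚ *_) (sym (at expand N))) (ch-product N a b)))
      where
      expand : ch a ⊗ ch b ≋ ch° a ⊗ ch° b ⊕ ch° a ⊕ ch° b ⊕ κ 1ℚ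
      expand = ≋-trans (⊗-cong (ch-ch°′ a) (ch-ch°′ b))
          (S.solve 2 (λ a b → (a S.:+ S.con 1ℚ) S.:*
          (b S.:+ S.con 1ℚ) S.:= a S.:* b S.:+ a S.:+ b S.:+ S.con 1ℚ) ≋-refl (ch° a) (ch° b))

    -- Here w u = u²ᴺ / (2N)!. The sum over i + j = n is a coefficient of a product of two cosh, to
    -- which the addition formula applies. The terms w a and w b in `P` account for the constant
    -- terms that `ch°` lacks.
    G-product : ∀ a b → (G a ⊗ G b) ! n ≡ 2ℚ * P w a b
    G-product a b = begin
      (G a ⊗ G b) ! n  ≡⟨ at (S.solve 5
          (λ a b x c d → a S.:* (x S.:* c) S.:* (b S.:* (x S.:* d)) S.:= (a S.:* b) S.:*
          (x S.:* (x S.:* (c S.:* d)))) ≋-refl (κ (a + a)) (κ (b + b)) X (ch° a) (ch° b)) n ⟩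
      (κ (a + a) ⊗ κ (b + b) ⊗ (X ⊗ (X ⊗ (ch° a ⊗ ch° b)))) ! n ≡⟨ at
          (⊗-cong {κ (a + a) ⊗ κ (b + b)} {κ ((a + a) * (b + b))} {X ⊗ (X ⊗ (ch° a ⊗ ch° b))}
          (≋-sym (mk λ { zero → refl ; (suc i) → sym
          (trans (κ-⊗ (a + a) (κ (b + b)) (suc i)) (*-zeroʳ (a + a))) })) ≋-refl) n ⟩
      (κ ((a + a) * (b + b)) ⊗ (X ⊗ (X ⊗ (ch° a ⊗ ch° b)))) ! n ≡⟨ κ-⊗ ((a + a) * (b + b))
          (X ⊗ (X ⊗ (ch° a ⊗ ch° b))) n ⟩
      (a + a) * (b + b) * (X ⊗ (X ⊗ (ch° a ⊗ ch° b))) ! n ≡⟨ cong ((a + a) * (b + b) *_)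
          (trans (X-⊗ (X ⊗ (ch° a ⊗ ch° b)) (suc N)) (X-⊗ (ch° a ⊗ ch° b) N)) ⟩
      (a + a) * (b + b) * (ch° a ⊗ ch° b) ! N ≡⟨ solve 3
          (λ a b c → (a :+ a) :* (b :+ b) :* c := con 2ℚ :* (a :* b :* (con 2ℚ :* c))) refl a b
          ((ch° a ⊗ ch° b) ! N) ⟩
      2ℚ * (a * b * (2ℚ * (ch° a ⊗ ch° b) ! N)) ≡⟨ cong (λ u → 2ℚ * (a * b * u)) (ch°-product a b) ⟩
      2ℚ * P w a b ∎

    w-0 : w 0ℚ ≡ 0ℚ
    w-0 = at E-0 (dbl N)

    T : ℕ → ℚ
    T d = anti (λ a b → p w (ι a) (ι b)) d

    -- By the symmetry in a and b the two mixed sums coincide, and each is a coefficient of `W d`.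
    T-closed : ∀ d → let a = ι d in T d ≡ w a * (⅙ * (a * a * a - a)) - 2ℚ * a * ((℘° ⊗ ch° a) ! suc N + ch a ! suc N - 1/12 * w a)
    T-closed d = begin
      T d ≡⟨ anti-cong⁺ d (λ i j i+j≡d → trans
          (cong₂ (λ u v → ι i * ι j * w u - v * ι j * w (ι i) - v * ι i * w (ι j)) (ι-sum i j i+j≡d)
          (ι-sum i j i+j≡d))
               (solve 6 (λ i j d wd wi wj → i :* j :* wd :- d :* j :* wi :- d :* i :* wj :=
                  wd :* (i :* j) :+ (:- d) :* (j :* wi :+ i :* wj)) refl (ι i) (ι j) (ι d) (w (ι d)) (w (ι i))
                      (w (ι j)))) ⟩
      anti (λ i j → w (ι d) * (ι i * ι j) + - ι d * (ι j * w (ι i) + ι i * w (ι j))) d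
        ≡⟨ trans (anti-+ d _ _) (cong₂ _+_ (anti-*ˡ d (w (ι d)) _)
            (trans (anti-*ˡ d (- ι d) _) (cong (- ι d *_) (anti-+ d _ _)))) ⟩
      w (ι d) * anti (λ i j → ι i * ι j) d + - ι d *
          (anti (λ i j → ι j * w (ι i)) d + anti (λ i j → ι i * w (ι j)) d)
        ≡⟨ cong₂ (λ u v → w (ι d) * u + - ι d * (anti (λ i j → ι j * w (ι i)) d + v)) (anti-product d)
            (anti-comm d (λ i j → ι i * w (ι j))) ⟩
      w (ι d) * s + - ι d * (W d ! dbl N + W d ! dbl N) ≡⟨ cong (λ u → w (ι d) * s + - ι d * (u + u))
          (W-even k d) ⟩
      w (ι d) * s + - ι d * (u + u) ≡⟨ solve 4
          (λ w s d u → w :* s :+ (:- d) :* (u :+ u) := w :* s :- con 2ℚ :* d :* u) refl (w (ι d)) s (ι d) u ⟩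
      w (ι d) * s - 2ℚ * ι d * u ∎
      where
      s u : ℚ
      s = ⅙ * (ι d * ι d * ι d - ι d)
      u = (℘° ⊗ ch° (ι d)) ! suc N + ch (ι d) ! suc N - 1/12 * w (ι d)
      ι-sum : ∀ i j → i ℕ.+ j ≡ d → ι i + ι j ≡ ι d
      ι-sum i j refl = sym (ι-+ i j)

    ch-suc : ∀ a → ι (suc (suc (dbl N))) * ι (suc (dbl N)) * ch a ! suc N ≡ a * a * w a
    ch-suc a = begin
      ι (suc (suc (dbl N))) * ι (suc (dbl N)) * ch a ! suc N   ≡⟨ solve 3
          (λ i j c → i :* j :* c := j :* (i :* c)) refl (ι (suc (suc (dbl N)))) (ι (suc (dbl N)))
          (ch a ! suc N) ⟩
      ι (suc (dbl N)) * (ι (suc (suc (dbl N))) * ch a ! suc N) ≡⟨ cong (ι (suc (dbl N)) *_)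
          (ι*E a (suc (dbl N))) ⟩
      ι (suc (dbl N)) * (a * E a ! suc (dbl N))                ≡⟨ solve 3
          (λ i a c → i :* (a :* c) := a :* (i :* c)) refl (ι (suc (dbl N))) a (E a ! suc (dbl N)) ⟩
      a * (ι (suc (dbl N)) * E a ! suc (dbl N))                ≡⟨ cong (a *_) (ι*E a (dbl N)) ⟩
      a * (a * w a)                                            ≡⟨ *-assoc a a (w a) ⟨
      a * a * w a ∎

    G-! : ∀ a → G a ! n ≡ (a + a) * ch a ! suc N
    G-! a = trans (κ-⊗ (a + a) (X ⊗ ch° a) n) (cong ((a + a) *_) (X-⊗ (ch° a) (suc N)))

    ℘G : ∀ a → (℘° ⊗ G a) ! n ≡ (a + a) * (℘° ⊗ ch° a) ! suc N
    ℘G a = trans (at (S.solve 4 (λ p k x c → p S.:* (k S.:* (x S.:* c)) S.:= k S.:* (x S.:* (p S.:* c))) ≋-refl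
        ℘° (κ (a + a)) X (ch° a)) n)
      (trans (κ-⊗ (a + a) (X ⊗ (℘° ⊗ ch° a)) n) (cong ((a + a) *_) (X-⊗ (℘° ⊗ ch° a) (suc N))))

    -- The recurrence for the contribution of a single divisor d. The products of ℘° with `ch°`
    -- cancel, the terms a w cancel as well, and (2k + 4)(2k + 3) - 12 = 2k(2k + 7) gives the factor
    -- on the left.
    pointwise : ∀ d → ι (suc (dbl n)) * ι k * G (ι d) ! n ≡ ι 3 * (2ℚ * (℘° ⊗ G (ι d)) ! n + 2ℚ * T d)
    pointwise d = begin
      ι (suc (dbl n)) * ι k * G a ! n ≡⟨ cong₂ (λ u v → u * ι k * v) (ι-n) (G-! a) ⟩
      (7ℚ + (ι k + ι k)) * ι k * ((a + a) * c) ≡⟨ solve 3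
          (λ k a c → (con 7ℚ :+ (k :+ k)) :* k :* ((a :+ a) :* c) :=
            a :* ((con 4ℚ :+ (k :+ k)) :* (con 3ℚ :+ (k :+ k)) :* c) :- con 12ℚ :* a :* c) refl (ι k) a c ⟩
      a * ((4ℚ + (ι k + ι k)) * (3ℚ + (ι k + ι k)) * c) - 12ℚ * a * c ≡⟨ cong (λ u → a * u - 12ℚ * a * c)
          (trans (cong₂ (λ u v → u * v * c) (sym ι-4) (sym ι-3)) (ch-suc a)) ⟩
      a * (a * a * w a) - 12ℚ * a * c ≡⟨ solve 4 (λ a w c r → a :* (a :* a :* w) :- con 12ℚ :* a :* c :=
           con 3ℚ :* (con 2ℚ :* ((a :+ a) :* r) :+ con 2ℚ :*
               (w :* (con ⅙ :* (a :* a :* a :- a)) :- con 2ℚ :* a :* (r :+ c :- con 1/12 :* w)))) refl a (w a) c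
               ((℘° ⊗ ch° a) ! suc N) ⟩
      3ℚ * (2ℚ * ((a + a) * (℘° ⊗ ch° a) ! suc N) + 2ℚ *
          (w a * (⅙ * (a * a * a - a)) - 2ℚ * a * ((℘° ⊗ ch° a) ! suc N + c - 1/12 * w a)))
        ≡⟨ cong₂ (λ u v → 3ℚ * (2ℚ * u + 2ℚ * v)) (℘G a) (T-closed d) ⟨
      3ℚ * (2ℚ * (℘° ⊗ G a) ! n + 2ℚ * T d) ≡⟨ cong (_* (2ℚ * (℘° ⊗ G a) ! n + 2ℚ * T d)) (ι-def 3) ⟨
      ι 3 * (2ℚ * (℘° ⊗ G a) ! n + 2ℚ * T d) ∎
      where
      a c 4ℚ 7ℚ 12ℚ : ℚ
      a = ι d
      c = ch a ! suc N
      4ℚ = ℤ.+ 4 / 1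
      7ℚ = ℤ.+ 7 / 1
      12ℚ = ℤ.+ 12 / 1
      ι-shift : ∀ c → ι (c ℕ.+ dbl k) ≡ ι c + (ι k + ι k)
      ι-shift c = trans (ι-+ c (dbl k)) (cong (ι c +_) (ι-dbl k))
      ι-n : ι (suc (dbl n)) ≡ 7ℚ + (ι k + ι k)
      ι-n = trans (ι-shift 7) (cong (_+ (ι k + ι k)) (ι-def 7))
      ι-4 : ι (suc (suc (dbl N))) ≡ 4ℚ + (ι k + ι k)
      ι-4 = trans (ι-shift 4) (cong (_+ (ι k + ι k)) (ι-def 4))
      ι-3 : ι (suc (dbl N)) ≡ 3ℚ + (ι k + ι k)
      ι-3 = trans (ι-shift 3) (cong (_+ (ι k + ι k)) (ι-def 3))

    module _ (M : ℕ) where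
      A-product : ∀ m → m ℕ.≤ M → anti
          (λ i j → (ser (D M (λ a → G (ι a) ! i)) ⊗ ser (D M (λ a → G (ι a) ! j))) ! m) n ≡ D M
          (λ d → 2ℚ * T d) m
      A-product m m≤M = begin
        anti (λ i j → (ser (D M (λ a → G (ι a) ! i)) ⊗ ser (D M (λ a → G (ι a) ! j))) ! m) n
          ≡⟨ D-products n M (λ i a → G (ι a) ! i) m ⟩
        Σ⁴ M (λ a b x z → δ (a ℕ.* x ℕ.+ b ℕ.* z) m * (G (ι a) ⊗ G (ι b)) ! n)
          ≡⟨ Σ⁴-cong M (λ a b x z → trans
              (cong (δ (suc a ℕ.* suc x ℕ.+ suc b ℕ.* suc z) m *_) (G-product (ι (suc a)) (ι (suc b))))
                 (solve 2 (λ d p → d :* (con 2ℚ :* p) := con 2ℚ :* (d :* p)) refl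
                     (δ (suc a ℕ.* suc x ℕ.+ suc b ℕ.* suc z) m) (P w (ι (suc a)) (ι (suc b))))) ⟩
        Σ⁴ M (λ a b x z → 2ℚ * (δ (a ℕ.* x ℕ.+ b ℕ.* z) m * P w (ι a) (ι b)))
          ≡⟨ trans (Σ₁-cong M (λ a → trans
              (Σ₁-cong M (λ b → trans (Σ₁-cong M (λ x → Σ₁-*ˡ M 2ℚ _)) (Σ₁-*ˡ M 2ℚ _))) (Σ₁-*ˡ M 2ℚ _)))
              (Σ₁-*ˡ M 2ℚ _) ⟩
        2ℚ * Σ⁴ M (λ a b x z → δ (a ℕ.* x ℕ.+ b ℕ.* z) m * P w (ι a) (ι b))
          ≡⟨ cong (2ℚ *_) (divisors w (E-even N) w-0 m≤M) ⟩
        2ℚ * (Σ₁ M λ a → Σ₁ M λ b → Σ₁ M λ x → δ (a ℕ.* x ℕ.+ b ℕ.* x) m * p w (ι a) (ι b))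
          ≡⟨ cong (2ℚ *_) (Σ₁-cong M λ a → Σ₁-swap M M _) ⟩
        2ℚ * (Σ₁ M λ a → Σ₁ M λ x → Σ₁ M λ b → δ (a ℕ.* x ℕ.+ b ℕ.* x) m * p w (ι a) (ι b))
          ≡⟨ cong (2ℚ *_) (Σ₁-swap M M _) ⟩
        2ℚ * (Σ₁ M λ x → Σ₁ M λ a → Σ₁ M λ b → δ (a ℕ.* x ℕ.+ b ℕ.* x) m * p w (ι a) (ι b))
          -- On the diagonal ax + bx = (a + b)x, so for every x the pairs are grouped by d = a + b,
          -- a divisor of m.
          ≡⟨ cong (2ℚ *_) (Σ₁-cong M λ x → trans
              (Σ²-cong M λ a b → cong (λ s → δ s m * p w (ι (suc a)) (ι (suc b)))
              (sym (ℕ.*-distribʳ-+ (suc x) (suc a) (suc b))))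
              (Σ₁-by-sum M (λ d → δ (d ℕ.* suc x) m) (λ a b → p w (ι a) (ι b))
                (λ s M<s → δ-≢ {s ℕ.* suc x} {m} λ eq → ℕ.<⇒≱ M<s
                    (ℕ.≤-trans (ℕ.m≤m*n s (suc x)) (subst (ℕ._≤ M) (sym eq) m≤M)))
                p-0ˡ p-0ʳ)) ⟩
        2ℚ * (Σ₁ M λ x → Σ₁ M λ d → δ (d ℕ.* x) m * T d)
          ≡⟨ cong (2ℚ *_) (Σ₁-swap M M _) ⟩
        2ℚ * D M T m
          ≡⟨ D-*ˡ M 2ℚ T m ⟨
        D M (λ d → 2ℚ * T d) m ∎
        where
        p-0ˡ : ∀ b → p w (ι 0) (ι b) ≡ 0ℚ
        p-0ˡ b = trans (cong (λ z → p w z (ι b)) ι0)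
            (trans (cong (λ u → 0ℚ * ι b * w (0ℚ + ι b) - (0ℚ + ι b) * ι b * u - (0ℚ + ι b) * 0ℚ * w (ι b)) w-0)
          (solve 3 (λ b u v → con 0ℚ :* b :* u :- (con 0ℚ :+ b) :* b :* con 0ℚ :-
              (con 0ℚ :+ b) :* con 0ℚ :* v := con 0ℚ) refl (ι b) (w (0ℚ + ι b)) (w (ι b))))
        p-0ʳ : ∀ a → p w (ι a) (ι 0) ≡ 0ℚ
        p-0ʳ a = trans (cong (λ z → p w (ι a) z) ι0)
            (trans (cong (λ u → ι a * 0ℚ * w (ι a + 0ℚ) - (ι a + 0ℚ) * 0ℚ * w (ι a) - (ι a + 0ℚ) * ι a * u) w-0)
          (solve 3 (λ b u v → b :* con 0ℚ :* u :- (b :+ con 0ℚ) :* con 0ℚ :* v :-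
              (b :+ con 0ℚ) :* b :* con 0ℚ := con 0ℚ) refl (ι a) (w (ι a + 0ℚ)) (w (ι a))))

      A-split : ∀ i → A M i ≋ κ (℘° ! i) ⊕ ser (D M (λ a → G (ι a) ! i))
      A-split i = mk λ m → refl

      -- Each `A M i` is a constant plus a divisor sum. Products of constants obey the recurrence of
      -- ℘₀. Mixed products and, by `A-product`, products of two divisor sums are divisor sums
      -- again, and `pointwise` matches them with the left side. The bound m ≤ M makes the
      -- truncation exact.
      A-recurrence : ∀ m → m ℕ.≤ M → ι (suc (dbl n)) * ι k * A M n ! m ≡ ι 3 * anti
          (λ i j → (A M i ⊗ A M j) ! m) n
      A-recurrence m m≤M = begin
        c * (κ (℘° ! n) ! m + D M (λ a → G (ι a) ! n) m)
          ≡⟨ *-distribˡ-+ c _ _ ⟩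
        c * κ (℘° ! n) ! m + c * D M (λ a → G (ι a) ! n) m
          ≡⟨ cong₂ _+_ (constant m)
              (trans (sym (D-*ˡ M c (λ a → G (ι a) ! n) m))
              (trans (D-cong M m (λ d → pointwise (suc d))) (D-*ˡ M (ι 3) _ m))) ⟩
        ι 3 * κ ((℘° ⊗ ℘°) ! n) ! m + ι 3 * D M (λ d → 2ℚ * (℘° ⊗ G (ι d)) ! n + 2ℚ * T d) m
          ≡⟨ cong (ι 3 * κ ((℘° ⊗ ℘°) ! n) ! m +_)
              (cong (ι 3 *_) (trans (D-+ M _ (λ d → 2ℚ * T d) m)
              (cong (_+ D M (λ d → 2ℚ * T d) m) (D-*ˡ M 2ℚ (λ d → (℘° ⊗ G (ι d)) ! n) m)))) ⟩
        ι 3 * κ ((℘° ⊗ ℘°) ! n) ! m + ι 3 * (2ℚ * D M (λ d → (℘° ⊗ G (ι d)) ! n) m + D M (λ d → 2ℚ * T d) m)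
          ≡⟨ solve 4 (λ i x y z → i :* x :+ i :* (con 2ℚ :* y :+ z) := i :* (x :+ y :+ y :+ z)) refl (ι 3)
              (κ ((℘° ⊗ ℘°) ! n) ! m) (D M (λ d → (℘° ⊗ G (ι d)) ! n) m) (D M (λ d → 2ℚ * T d) m) ⟩
        ι 3 * (κ ((℘° ⊗ ℘°) ! n) ! m + D M (λ d → (℘° ⊗ G (ι d)) ! n) m + D M (λ d → (℘° ⊗ G (ι d)) ! n) m + D M
            (λ d → 2ℚ * T d) m)
          ≡⟨ cong (ι 3 *_) (cong₂ _+_
              (cong₂ _+_ (cong₂ _+_ (constants m) mixed) (trans mixed (anti-comm n (λ i j → ℘° ! i * B j m))))
              (sym (A-product m m≤M))) ⟩
        ι 3 * (anti (λ i j → κ (℘° ! i * ℘° ! j) ! m) n + anti (λ i j → ℘° ! i * B j m) n + anti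
            (λ i j → ℘° ! j * B i m) n + anti (λ i j → (ser (B i) ⊗ ser (B j)) ! m) n)
          ≡⟨ cong (ι 3 *_) (anti-+₄ n (λ i j → κ (℘° ! i * ℘° ! j) ! m) (λ i j → ℘° ! i * B j m)
              (λ i j → ℘° ! j * B i m) (λ i j → (ser (B i) ⊗ ser (B j)) ! m)) ⟨
        ι 3 * anti (λ i j → κ (℘° ! i * ℘° ! j) ! m + ℘° ! i * B j m + ℘° ! j * B i m +
            (ser (B i) ⊗ ser (B j)) ! m) n
          ≡⟨ cong (ι 3 *_) (anti-cong n (λ i j → sym (expand i j))) ⟩
        ι 3 * anti (λ i j → (A M i ⊗ A M j) ! m) n ∎
        where
        c : ℚ
        c = ι (suc (dbl n)) * ι k
        B : ℕ → ℕ → ℚ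
        B i = D M (λ a → G (ι a) ! i)
        constant : ∀ m → c * κ (℘° ! n) ! m ≡ ι 3 * κ ((℘° ⊗ ℘°) ! n) ! m
        constant zero = recurrence ℘₀-Weierstrass k
        constant (suc m) = trans (*-zeroʳ c) (sym (*-zeroʳ (ι 3)))
        constants : ∀ m → κ ((℘° ⊗ ℘°) ! n) ! m ≡ anti (λ i j → κ (℘° ! i * ℘° ! j) ! m) n
        constants zero = refl
        constants (suc m) = sym (anti-0 n (λ _ _ _ → refl))
        mixed : D M (λ d → (℘° ⊗ G (ι d)) ! n) m ≡ anti (λ i j → ℘° ! i * B j m) n
        mixed = sym (trans (anti-cong n (λ i j → sym (D-*ˡ M (℘° ! i) (λ a → G (ι a) ! j) m)))
            (D-anti n M (λ i j a → ℘° ! i * G (ι a) ! j) m))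
        expand : ∀ i j → (A M i ⊗ A M j) ! m ≡ κ (℘° ! i * ℘° ! j) ! m + ℘° ! i * B j m + ℘° ! j * B i m +
            (ser (B i) ⊗ ser (B j)) ! m
        expand i j = trans (at (≋-trans (⊗-cong (A-split i) (A-split j))
            (S.solve 4 (λ p q b c → (p S.:+ b) S.:*
            (q S.:+ c) S.:= p S.:* q S.:+ p S.:* c S.:+ q S.:* b S.:+ b S.:* c) ≋-refl (κ (℘° ! i)) (κ (℘° ! j))
            (ser (B i)) (ser (B j)))) m)
          (cong₂ (λ u v → u + v + (ser (B i) ⊗ ser (B j)) ! m)
              (cong₂ _+_ (trans (κ-⊗ (℘° ! i) (κ (℘° ! j)) m) (κ-* m)) (κ-⊗ (℘° ! i) (ser (B j)) m))
              (κ-⊗ (℘° ! j) (ser (B i)) m))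
          where
          κ-* : ∀ m → ℘° ! i * κ (℘° ! j) ! m ≡ κ (℘° ! i * ℘° ! j) ! m
          κ-* zero = refl
          κ-* (suc m) = *-zeroʳ (℘° ! i)

-- 2-integral forms, and the uniformisation of the curve.

module IntegralWeierstrass where

  open import Data.Rational.Base
  open import Data.Rational.Properties
  open import Data.Rational.Solver using (module +-*-Solver)
  open RationalArithmetic
  open PowerSeries hiding (module Reasoning)
  open BernoulliSeries
  open +-*-Solver using (solve; _:+_; _:*_; _:-_; :-_; _:=_; con)
  private
    module S = SeriesSolver
    module SR = PowerSeries.Reasoning

  dbl-+ : ∀ n → dbl n ≡ n ℕ.+ n
  dbl-+ zero = refl
  dbl-+ (suc n) = cong suc (trans (cong suc (dbl-+ n)) (sym (ℕ.+-suc n n)))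

  -- the localisation ℤ₍₂₎
  data 2-Integral (q : ℚ) : Set where
    integral : ∀ d m n → q * ι (suc (dbl d)) ≡ ι m - ι n → 2-Integral q

  odd-* : ∀ d e → ι (suc (dbl d)) * ι (suc (dbl e)) ≡ ι (suc (dbl (d ℕ.+ e ℕ.+ (d ℕ.* e ℕ.+ d ℕ.* e))))
  odd-* d e = trans (sym (ι-* (suc (dbl d)) (suc (dbl e))))
      (cong ι (trans (cong₂ (λ u v → suc u ℕ.* suc v) (dbl-+ d) (dbl-+ e))
    (trans (ℕS.solve 2 (λ d e → (ℕS.con 1 ℕS.:+ (d ℕS.:+ d)) ℕS.:* (ℕS.con 1 ℕS.:+ (e ℕS.:+ e)) ℕS.:=
        (let f = d ℕS.:+ e ℕS.:+ (d ℕS.:* e ℕS.:+ d ℕS.:* e) in ℕS.con 1 ℕS.:+ (f ℕS.:+ f))) refl d e)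
      (cong suc (sym (dbl-+ (d ℕ.+ e ℕ.+ (d ℕ.* e ℕ.+ d ℕ.* e))))))))

  2-integral-ι : ∀ n → 2-Integral (ι n)
  2-integral-ι n = integral 0 n 0
      (trans (cong (ι n *_) ι1)
      (trans (*-identityʳ (ι n)) (sym (trans (cong (λ u → ι n - u) ι0) (+-identityʳ (ι n))))))

  2-integral-neg : ∀ {q} → 2-Integral q → 2-Integral (- q)
  2-integral-neg {q} (integral d m n eq) = integral d n m (trans (sym (neg-distribˡ-* q _)) (trans (cong -_ eq)
    (solve 2 (λ m n → :- (m :- n) := n :- m) refl (ι m) (ι n))))

  2-integral-inv : ∀ d → 2-Integral (inv (ι (suc (dbl d))))
  2-integral-inv d = integral d 1 0 (trans (inverseˡ (ι≢0 (dbl d))) (sym (cong₂ _-_ ι1 ι0)))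

  2-integral-* : ∀ {p q} → 2-Integral p → 2-Integral q → 2-Integral (p * q)
  2-integral-* {p} {q} (integral d m n eq) (integral e m′ n′ eq′) =
    integral _ (m ℕ.* m′ ℕ.+ n ℕ.* n′) (m ℕ.* n′ ℕ.+ n ℕ.* m′) (trans (cong (p * q *_) (sym (odd-* d e))) (trans
    (solve 4 (λ p q u v → p :* q :* (u :* v) := p :* u :* (q :* v)) refl p q (ι (suc (dbl d)))
        (ι (suc (dbl e))))
    (trans (cong₂ _*_ eq eq′) (trans
    (solve 4 (λ m n k l → (m :- n) :* (k :- l) := m :* k :+ n :* l :- (m :* l :+ n :* k)) refl (ι m) (ι n)
        (ι m′) (ι n′))
    (sym (cong₂ _-_ (trans (ι-+ (m ℕ.* m′) (n ℕ.* n′)) (cong₂ _+_ (ι-* m m′) (ι-* n n′)))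
        (trans (ι-+ (m ℕ.* n′) (n ℕ.* m′)) (cong₂ _+_ (ι-* m n′) (ι-* n m′)))))))))

  2-integral-+ : ∀ {p q} → 2-Integral p → 2-Integral q → 2-Integral (p + q)
  2-integral-+ {p} {q} (integral d m n eq) (integral e m′ n′ eq′) =
    integral _ (m ℕ.* suc (dbl e) ℕ.+ m′ ℕ.* suc (dbl d)) (n ℕ.* suc (dbl e) ℕ.+ n′ ℕ.* suc (dbl d))
        (trans (cong ((p + q) *_) (sym (odd-* d e))) (trans
    (solve 4 (λ p q u v → (p :+ q) :* (u :* v) := p :* u :* v :+ q :* v :* u) refl p q (ι (suc (dbl d)))
        (ι (suc (dbl e))))
    (trans (cong₂ (λ x y → x * ι (suc (dbl e)) + y * ι (suc (dbl d))) eq eq′) (trans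
    (solve 6 (λ m n k l u v → (m :- n) :* v :+ (k :- l) :* u := m :* v :+ k :* u :- (n :* v :+ l :* u)) refl
        (ι m) (ι n) (ι m′) (ι n′) (ι (suc (dbl d))) (ι (suc (dbl e))))
    (sym (cong₂ _-_ (trans (ι-+ (m ℕ.* suc (dbl e)) (m′ ℕ.* suc (dbl d)))
        (cong₂ _+_ (ι-* m (suc (dbl e))) (ι-* m′ (suc (dbl d)))))
                    (trans (ι-+ (n ℕ.* suc (dbl e)) (n′ ℕ.* suc (dbl d)))
                        (cong₂ _+_ (ι-* n (suc (dbl e))) (ι-* n′ (suc (dbl d)))))))))))

  -- polynomials in variables of weights 2 and 3, with 2-integral coefficients
  data Form : ℕ → (ℚ → ℚ → ℚ) → Set where
    monomial : ∀ {c} → 2-Integral c → ∀ a b → Form (2 ℕ.* a ℕ.+ 3 ℕ.* b) (λ x y → c * (x ^ a * y ^ b))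
    zeroᶠ : ∀ {n} → Form n (λ x y → 0ℚ)
    _+ᶠ_ : ∀ {n f g} → Form n f → Form n g → Form n (λ x y → f x y + g x y)
    ext : ∀ {n f g} → (∀ x y → f x y ≡ g x y) → Form n f → Form n g

  constant : ∀ {c} → 2-Integral c → Form 0 (λ _ _ → c)
  constant {c} c-int = ext (λ x y → trans (cong (c *_) (*-identityˡ 1ℚ)) (*-identityʳ c))
      (monomial {c} c-int 0 0)

  _*ᶠ_ : ∀ {m n f g} → Form m f → Form n g → Form (m ℕ.+ n) (λ x y → f x y * g x y)
  monomial {c} c-int a b *ᶠ monomial {c′} c′-int a′ b′ = subst
      (λ n → Form n (λ x y → c * (x ^ a * y ^ b) * (c′ * (x ^ a′ * y ^ b′)))) (ℕS.solve 4 (λ a b a′ b′ →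
      ℕS.con 2 ℕS.:* (a ℕS.:+ a′) ℕS.:+ ℕS.con 3 ℕS.:*
          (b ℕS.:+ b′) ℕS.:= ℕS.con 2 ℕS.:* a ℕS.:+ ℕS.con 3 ℕS.:* b ℕS.:+
          (ℕS.con 2 ℕS.:* a′ ℕS.:+ ℕS.con 3 ℕS.:* b′)) refl a b a′ b′)
    (ext (λ x y → trans (cong₂ (λ u v → c * c′ * (u * v)) (^-+ x a a′) (^-+ y b b′))
      (solve 6 (λ c c′ x y x′ y′ → c :* c′ :* (x :* x′ :* (y :* y′)) := c :* (x :* y) :* (c′ :* (x′ :* y′)))
          refl c c′ (x ^ a) (y ^ b) (x ^ a′) (y ^ b′)))
      (monomial {c * c′} (2-integral-* c-int c′-int) (a ℕ.+ a′) (b ℕ.+ b′)))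
  monomial {c} c-int a b *ᶠ zeroᶠ = ext (λ x y → sym (*-zeroʳ (c * (x ^ a * y ^ b)))) zeroᶠ
  monomial {c} c-int a b *ᶠ (G +ᶠ H) = ext (λ x y → sym (*-distribˡ-+ (c * (x ^ a * y ^ b)) _ _))
      ((monomial {c} c-int a b *ᶠ G) +ᶠ (monomial {c} c-int a b *ᶠ H))
  monomial {c} c-int a b *ᶠ ext eq G = ext (λ x y → cong (c * (x ^ a * y ^ b) *_) (eq x y))
      (monomial {c} c-int a b *ᶠ G)
  _*ᶠ_ {g = g} zeroᶠ G = ext (λ x y → sym (*-zeroˡ (g x y))) zeroᶠ
  _*ᶠ_ {g = g} (_+ᶠ_ {f = f} {g = f′} F F′) G = ext (λ x y → sym (*-distribʳ-+ (g x y) (f x y) (f′ x y)))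
      ((F *ᶠ G) +ᶠ (F′ *ᶠ G))
  _*ᶠ_ {g = g} (ext eq F) G = ext (λ x y → cong (_* g x y) (eq x y)) (F *ᶠ G)

  _·ᶠ_ : ∀ {n c f} → 2-Integral c → Form n f → Form n (λ x y → c * f x y)
  c ·ᶠ F = constant c *ᶠ F

  -ᶠ_ : ∀ {n f} → Form n f → Form n (λ x y → - f x y)
  -ᶠ_ {f = f} F = ext (λ x y → trans (sym (neg-distribˡ-* 1ℚ (f x y))) (cong -_ (*-identityˡ (f x y))))
      (2-integral-neg (subst 2-Integral ι1 (2-integral-ι 1)) ·ᶠ F)

  antiᶠ : ∀ {n} m {F : ℕ → ℕ → ℚ → ℚ → ℚ} → (∀ i j → i ℕ.+ j ≡ m → Form n (F i j)) → Form n
      (λ x y → anti (λ i j → F i j x y) m)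
  antiᶠ zero F = F 0 0 refl
  antiᶠ (suc m) F = F 0 (suc m) refl +ᶠ antiᶠ m (λ i j eq → F (suc i) j (cong suc eq))

  -- Solves a recursion in which the value at n depends on the values below n only: after n + 1
  -- iterations the value at n no longer changes.
  module Fix {P : Set} (p₀ : P) (Φ : (ℕ → P) → ℕ → P)
    (causal : ∀ n s t → (∀ i → i ℕ.< n → s i ≡ t i) → Φ s n ≡ Φ t n) where

    iterate : ℕ → ℕ → P
    iterate zero _ = p₀
    iterate (suc k) = Φ (iterate k)

    fix : ℕ → P
    fix n = iterate (suc n) n

    stable : ∀ k n → n ℕ.< k → iterate k n ≡ iterate (suc k) n
    stable (suc k) n (ℕ.s≤s n≤k) = causal n (iterate k) (iterate (suc k))
        (λ i i<n → stable k i (ℕ.<-≤-trans i<n n≤k))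

    iterate-fix : ∀ k n → n ℕ.< k → iterate k n ≡ fix n
    iterate-fix (suc k) n (ℕ.s≤s n≤k) with ℕ.m≤n⇒m<n∨m≡n n≤k
    ... | inj₁ n<k = trans (sym (stable k n n<k)) (iterate-fix k n n<k)
    ... | inj₂ refl = refl

    fix-eq : ∀ n → fix n ≡ Φ fix n
    fix-eq n = causal n (iterate n) fix (λ i i<n → iterate-fix n i i<n)

  record Agree (n : ℕ) (a b : Series) : Set where
    constructor agree
    field agree-at : ∀ i → i ℕ.< n → a ! i ≡ b ! i
  open Agree

  agree-refl : ∀ {n a} → Agree n a a
  agree-refl = agree λ _ _ → refl

  agree-⊗ : ∀ {n a a′ b b′} → Agree n a a′ → Agree n b b′ → Agree n (a ⊗ b) (a′ ⊗ b′)
  agree-⊗ (agree p) (agree q) = agree λ i i<n → anti-cong⁺ i (λ j k j+k≡i → cong₂ _*_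
    (p j (ℕ.≤-<-trans (subst (j ℕ.≤_) j+k≡i (ℕ.m≤m+n j k)) i<n))
        (q k (ℕ.≤-<-trans (subst (k ℕ.≤_) j+k≡i (ℕ.m≤n+m k j)) i<n)))

  agree-X : ∀ {n a b} → Agree n a b → Agree (suc n) (X ⊗ a) (X ⊗ b)
  agree-X {n} {a} {b} (agree p) = agree go
    where
    go : ∀ i → i ℕ.< suc n → (X ⊗ a) ! i ≡ (X ⊗ b) ! i
    go zero _ = trans (*-zeroˡ (a ! 0)) (sym (*-zeroˡ (b ! 0)))
    go (suc i) (ℕ.s≤s i<n) = trans (X-⊗ a i) (trans (p i i<n) (sym (X-⊗ b i)))

  agree-κ : ∀ {n a b} c → Agree n a b → Agree n (κ c ⊗ a) (κ c ⊗ b)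
  agree-κ {a = a} {b} c (agree p) = agree λ i i<n → trans (κ-⊗ c a i)
      (trans (cong (c *_) (p i i<n)) (sym (κ-⊗ c b i)))

  agree-⊕ : ∀ {n a a′ b b′} → Agree n a a′ → Agree n b b′ → Agree n (a ⊕ b) (a′ ⊕ b′)
  agree-⊕ (agree p) (agree q) = agree λ i i<n → cong₂ _+_ (p i i<n) (q i i<n)

  agree-weaken : ∀ {n a b} → Agree (suc n) a b → Agree n a b
  agree-weaken (agree p) = agree λ i i<n → p i (ℕ.m≤n⇒m≤1+n i<n)

  15ℚ 30ℚ 35ℚ 105ℚ 5ℚ : ℚ
  15ℚ = ℤ.+ 15 / 1
  30ℚ = ℤ.+ 30 / 1
  35ℚ = ℤ.+ 35 / 1
  105ℚ = ℤ.+ 105 / 1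
  5ℚ = ℤ.+ 5 / 1

  -- On the curve y² = x³ + A x + B with A = -15 G₄ and B = -35 G₆, uniformised by x = ℘, y = ℘′/2,
  -- the functions t = x/y and w = 1/y satisfy t′ = -1 + 2Atw + 3Bw² and w′ = -3t² - Aw².
  -- Below t = -zτ(z²), w = -z³ω(z²), and the coefficient of z²ⁿ comes with an odd denominator.
  module Curve (G₄ G₆ : ℚ) where
    A B : ℚ
    A = - (15ℚ * G₄)
    B = - (35ℚ * G₆)

    τ-rhs ω-rhs : Series → Series → Series
    τ-rhs τ ω = κ 1ℚ ⊕ κ (30ℚ * G₄) ⊗ (X ⊗ (X ⊗ (τ ⊗ ω))) ⊕ κ (105ℚ * G₆) ⊗ (X ⊗ (X ⊗ (X ⊗ (ω ⊗ ω))))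
    ω-rhs τ ω = κ 3ℚ ⊗ (τ ⊗ τ) ⊕ κ A ⊗ (X ⊗ (X ⊗ (ω ⊗ ω)))

    -- 1 + 2θ and 3 + 2θ multiply coefficient n by 2n + 1 and 2n + 3. No other number is divided by
    -- in building `Q`.
    τ-step ω-step : Series → Series → Series
    τ-step τ ω ! n = inv (ι (suc (dbl n))) * τ-rhs τ ω ! n
    ω-step τ ω ! n = inv (ι (suc (dbl (suc n)))) * ω-rhs τ ω ! n

    τ-agree : ∀ {n τ τ′ ω ω′} → Agree n τ τ′ → Agree n ω ω′ → Agree (suc n) (τ-step τ ω) (τ-step τ′ ω′)
    τ-agree p q = agree λ i i<n → cong (inv (ι (suc (dbl i))) *_)
        (agree-at (agree-⊕ (agree-⊕ (agree-refl {a = κ 1ℚ})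
      (agree-κ (30ℚ * G₄) (agree-weaken (agree-X (agree-X (agree-⊗ p q))))))
      (agree-κ (105ℚ * G₆) (agree-weaken (agree-weaken (agree-X (agree-X (agree-X (agree-⊗ q q)))))))) i i<n)

    ω-agree : ∀ {n τ τ′ ω ω′} → Agree (suc n) τ τ′ → Agree n ω ω′ → Agree (suc n) (ω-step τ ω) (ω-step τ′ ω′)
    ω-agree p q = agree λ i i<n → cong (inv (ι (suc (dbl (suc i)))) *_)
        (agree-at (agree-⊕ (agree-κ 3ℚ (agree-⊗ p p))
      (agree-κ A (agree-weaken (agree-X (agree-X (agree-⊗ q q)))))) i i<n)

    fst snd : (ℕ → ℚ × ℚ) → Series
    fst s ! n = proj₁ (s n)
    snd s ! n = proj₂ (s n)

    -- The square 3 τ² is not multiplied by X, so ω at n needs τ at n; this is why `ω-step` receives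
    -- the new τ.
    step : (ℕ → ℚ × ℚ) → ℕ → ℚ × ℚ
    step s n = τ-step (fst s) (snd s) ! n , ω-step (τ-step (fst s) (snd s)) (snd s) ! n

    step-causal : ∀ n s t → (∀ i → i ℕ.< n → s i ≡ t i) → step s n ≡ step t n
    step-causal n s t eq = cong₂ _,_ (agree-at τs n (ℕ.n<1+n n)) (agree-at (ω-agree τs p₂) n (ℕ.n<1+n n))
      where
      p₁ : Agree n (fst s) (fst t)
      p₁ = agree λ i i<n → cong proj₁ (eq i i<n)
      p₂ : Agree n (snd s) (snd t)
      p₂ = agree λ i i<n → cong proj₂ (eq i i<n)
      τs : Agree (suc n) (τ-step (fst s) (snd s)) (τ-step (fst t) (snd t))
      τs = τ-agree p₁ p₂

    module F = Fix (0ℚ , 0ℚ) step step-causal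

    τ ω : Series
    τ = fst F.fix
    ω = snd F.fix

    τ-eq : τ ≋ τ-step τ ω
    τ-eq = mk λ n → cong proj₁ (F.fix-eq n)

    ω-eq : ω ≋ ω-step τ ω
    ω-eq = mk λ n → trans (cong proj₂ (F.fix-eq n))
        (agree-at (ω-agree {n} {τ-step τ ω} {τ} {ω} {ω} (agree λ i _ → sym (at τ-eq i)) agree-refl) n
        (ℕ.n<1+n n))

    -- The inverse of ω: with ω = 1 + X ω′, the equation ω ρ = 1 becomes ρ = 1 - X ω′ ρ, a recursion
    -- without division. On the curve y = -z⁻³ ρ.
    ρ-rhs : Series → Series
    ρ-rhs ρ = κ 1ℚ ⊕ ⊝ (X ⊗ (ser (λ i → ω ! suc i) ⊗ ρ))

    ρ-causal : ∀ n s t → (∀ i → i ℕ.< n → s i ≡ t i) → ρ-rhs (ser s) ! n ≡ ρ-rhs (ser t) ! n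
    ρ-causal n s t eq = cong (λ u → κ 1ℚ ! n - u) (agree-at shifted n (ℕ.n<1+n n))
      where
      ω′ : Series
      ω′ = ser (λ i → ω ! suc i)
      st : Agree n (ser s) (ser t)
      st = agree eq
      shifted : Agree (suc n) (X ⊗ (ω′ ⊗ ser s)) (X ⊗ (ω′ ⊗ ser t))
      shifted = agree-X (agree-⊗ agree-refl st)

    module R = Fix 0ℚ (λ s → ρ-rhs (ser s) !_) ρ-causal

    ρ : Series
    ρ = ser R.fix

    odd-cancel : ∀ n x → ι (suc (dbl n)) * (inv (ι (suc (dbl n))) * x) ≡ x
    odd-cancel n x = trans (sym (*-assoc (ι (suc (dbl n))) _ x))
        (trans (cong (_* x) (inverseʳ (ι≢0 (dbl n)))) (*-identityˡ x))

    τ-ode : τ ⊕ κ 2ℚ ⊗ θ τ ≋ τ-rhs τ ω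
    τ-ode = mk λ n → trans (trans (cong (τ ! n +_) (κ-⊗ 2ℚ (θ τ) n))
      (trans (solve 2 (λ t i → t :+ con 2ℚ :* (i :* t) := (con 1ℚ :+ (i :+ i)) :* t) refl (τ ! n) (ι n))
        (cong (_* τ ! n) (sym (trans (ι-suc (dbl n)) (cong (1ℚ +_) (ι-dbl n)))))))
      (trans (cong (ι (suc (dbl n)) *_) (at τ-eq n)) (odd-cancel n (τ-rhs τ ω ! n)))

    ω-ode : κ 3ℚ ⊗ ω ⊕ κ 2ℚ ⊗ θ ω ≋ ω-rhs τ ω
    ω-ode = mk λ n → trans (trans (cong₂ _+_ (κ-⊗ 3ℚ ω n) (κ-⊗ 2ℚ (θ ω) n))
      (trans (solve 2 (λ t i → con 3ℚ :* t :+ con 2ℚ :* (i :* t) :=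
          (con 1ℚ :+ (con 1ℚ :+ i :+ (con 1ℚ :+ i))) :* t) refl (ω ! n) (ι n))
        (cong (_* ω ! n) (sym (trans (ι-suc (dbl (suc n)))
            (cong (1ℚ +_) (trans (ι-dbl (suc n)) (cong₂ _+_ (ι-suc n) (ι-suc n)))))))))
      (trans (cong (ι (suc (dbl (suc n))) *_) (at ω-eq n)) (odd-cancel (suc n) (ω-rhs τ ω ! n)))

    τ-0 : τ ! 0 ≡ 1ℚ
    τ-0 = trans (at τ-eq 0) (trans
        (cong₂ _*_ (cong inv ι1)
        (cong₂ (λ u v → 1ℚ + u + v) (lem (30ℚ * G₄) (X ⊗ (τ ⊗ ω))) (lem (105ℚ * G₆) (X ⊗ (X ⊗ (ω ⊗ ω)))))) refl)
      where
      lem : ∀ c a → (κ c ⊗ (X ⊗ a)) ! 0 ≡ 0ℚ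
      lem c a = trans (cong (c *_) (*-zeroˡ (a ! 0))) (*-zeroʳ c)

    ω-0 : ω ! 0 ≡ 1ℚ
    ω-0 = *-cancelˡ {p = 3ℚ} (λ ())
        (trans (trans (cong (_* ω ! 0) (sym (ι-def 3)))
        (trans (cong (ι 3 *_) (at ω-eq 0)) (odd-cancel 1 (ω-rhs τ ω ! 0))))
      (cong₂ _+_ (cong (λ u → 3ℚ * (u * u)) τ-0)
          (trans (cong (A *_) (*-zeroˡ ((X ⊗ (ω ⊗ ω)) ! 0))) (*-zeroʳ A))))

    ωρ : ω ⊗ ρ ≋ κ 1ℚ
    ωρ = ≋-trans (⊗-cong split ≋-refl)
        (≋-trans (S.solve 3 (λ x w r → (S.con 1ℚ S.:+ x S.:* w) S.:* r S.:= r S.:+ x S.:* (w S.:* r)) ≋-refl X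
        ω′ ρ)
      (≋-trans (⊕-cong (mk R.fix-eq) ≋-refl)
          (S.solve 1 (λ z → S.con 1ℚ S.:+ S.:- z S.:+ z S.:= S.con 1ℚ) ≋-refl (X ⊗ (ω′ ⊗ ρ)))))
      where
      ω′ : Series
      ω′ = ser (λ i → ω ! suc i)
      split : ω ≋ κ 1ℚ ⊕ X ⊗ ω′
      split = mk λ { zero → trans ω-0 (sym (trans (cong (1ℚ +_) (*-zeroˡ (ω ! 1))) (+-identityʳ 1ℚ)))
                   ; (suc n) → sym (trans (+-identityˡ _) (X-⊗ ω′ n)) }

    a b dτ dω dρ : Series
    a = κ A
    b = κ B
    dτ = θ τ
    dω = θ ω
    dρ = θ ρ

    -- Expressions that vanish on the solution, written as polynomials in τ, ω, ρ and their
    -- derivatives. The later equations are solver identities with an explicit combination of them.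
    -- H is the curve itself: w = t³ + A t w² + B w³ after scaling.
    Zτ Zω Zρ Zd H : Series
    Zτ = τ ⊕ κ 2ℚ ⊗ dτ ⊖ κ 1ℚ ⊕ κ 2ℚ ⊗ a ⊗ (X ⊗ (X ⊗ (τ ⊗ ω))) ⊕ κ 3ℚ ⊗ b ⊗ (X ⊗ (X ⊗ (X ⊗ (ω ⊗ ω))))
    Zω = κ 3ℚ ⊗ ω ⊕ κ 2ℚ ⊗ dω ⊖ κ 3ℚ ⊗ (τ ⊗ τ) ⊖ a ⊗ (X ⊗ (X ⊗ (ω ⊗ ω)))
    Zρ = ω ⊗ ρ ⊖ κ 1ℚ
    Zd = dω ⊗ ρ ⊕ ω ⊗ dρ
    H = ω ⊖ τ ⊗ τ ⊗ τ ⊖ a ⊗ (X ⊗ (X ⊗ (τ ⊗ (ω ⊗ ω)))) ⊖ b ⊗ (X ⊗ (X ⊗ (X ⊗ (ω ⊗ (ω ⊗ ω)))))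

    module _ where
      open SR
      Zτ≋0 : Zτ ≋ κ 0ℚ
      Zτ≋0 = begin
        Zτ ≈⟨ ⊕-cong (⊕-cong (⊕-cong τ-ode ≋-refl) (⊗-cong κA ≋-refl)) (⊗-cong κB ≋-refl) ⟩
        τ-rhs τ ω ⊖ κ 1ℚ ⊕ ⊝ κ (30ℚ * G₄) ⊗ (X ⊗ (X ⊗ (τ ⊗ ω))) ⊕ ⊝ κ (105ℚ * G₆) ⊗ (X ⊗ (X ⊗ (X ⊗ (ω ⊗ ω))))
          ≈⟨ S.solve 4 (λ g h u v → S.con 1ℚ S.:+ g S.:* u S.:+ h S.:* v S.:- S.con 1ℚ S.:+ S.:- g S.:* u S.:+
              S.:- h S.:* v S.:= S.con 0ℚ) ≋-refl (κ (30ℚ * G₄)) (κ (105ℚ * G₆)) (X ⊗ (X ⊗ (τ ⊗ ω)))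
              (X ⊗ (X ⊗ (X ⊗ (ω ⊗ ω)))) ⟩
        κ 0ℚ ∎
        where
        κA : κ 2ℚ ⊗ a ≋ ⊝ κ (30ℚ * G₄)
        κA = mk λ { zero → solve 1 (λ g → con 2ℚ :* (:- (con 15ℚ :* g)) := :- (con 30ℚ :* g)) refl G₄ ;
            (suc n) → trans (κ-⊗ 2ℚ (κ A) (suc n)) refl }
        κB : κ 3ℚ ⊗ b ≋ ⊝ κ (105ℚ * G₆)
        κB = mk λ { zero → solve 1 (λ g → con 3ℚ :* (:- (con 35ℚ :* g)) := :- (con 105ℚ :* g)) refl G₆ ;
            (suc n) → trans (κ-⊗ 3ℚ (κ B) (suc n)) refl }

      Zω≋0 : Zω ≋ κ 0ℚ
      Zω≋0 = ≋-trans (⊕-cong (⊕-cong ω-ode ≋-refl) ≋-refl)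
          (S.solve 2 (λ u v → u S.:+ v S.:- u S.:- v S.:= S.con 0ℚ) ≋-refl (κ 3ℚ ⊗ (τ ⊗ τ))
          (a ⊗ (X ⊗ (X ⊗ (ω ⊗ ω)))))

      Zρ≋0 : Zρ ≋ κ 0ℚ
      Zρ≋0 = ≋-trans (⊕-cong ωρ ≋-refl) (S.solve 0 (S.con 1ℚ S.:- S.con 1ℚ S.:= S.con 0ℚ) ≋-refl)

      Zd≋0 : Zd ≋ κ 0ℚ
      Zd≋0 = ≋-trans (≋-sym (θ-⊗ ω ρ)) (≋-trans (θ-cong ωρ) (θ-κ 1ℚ))

      -- H is constant along the flow because the system is Hamiltonian.
      H-ode : κ 3ℚ ⊗ H ⊕ κ 2ℚ ⊗ θ H ≋ κ 0ℚ
      H-ode = begin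
        κ 3ℚ ⊗ H ⊕ κ 2ℚ ⊗ θ H ≈⟨ ⊕-cong ≋-refl (⊗-cong ≋-refl θH) ⟩
        _ ≈⟨ S.solve 7 (λ t w dt dw x a b →
            let zt = t S.:+ S.con 2ℚ S.:* dt S.:- S.con 1ℚ S.:+ S.con 2ℚ S.:* a S.:*
                  (x S.:* (x S.:* (t S.:* w))) S.:+ S.con 3ℚ S.:* b S.:* (x S.:* (x S.:* (x S.:* (w S.:* w))))
                zw = S.con 3ℚ S.:* w S.:+ S.con 2ℚ S.:* dw S.:- S.con 3ℚ S.:* (t S.:* t) S.:- a S.:*
                    (x S.:* (x S.:* (w S.:* w)))
                h = w S.:- t S.:* t S.:* t S.:- a S.:* (x S.:* (x S.:* (t S.:* (w S.:* w)))) S.:- b S.:*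
                    (x S.:* (x S.:* (x S.:* (w S.:* (w S.:* w)))))
            in S.con 3ℚ S.:* h S.:+ S.con 2ℚ S.:*
                (dw S.:- (dt S.:* t S.:* t S.:+ t S.:* dt S.:* t S.:+ t S.:* t S.:* dt)
                 S.:- a S.:* (x S.:* (x S.:* (t S.:* (w S.:* w))) S.:+ x S.:*
                     (x S.:* (t S.:* (w S.:* w)) S.:+ x S.:*
                     (dt S.:* (w S.:* w) S.:+ t S.:* (dw S.:* w S.:+ w S.:* dw))))
                 S.:- b S.:* (x S.:* (x S.:* (x S.:* (w S.:* (w S.:* w)))) S.:+ x S.:*
                     (x S.:* (x S.:* (w S.:* (w S.:* w))) S.:+ x S.:*
                     (x S.:* (w S.:* (w S.:* w)) S.:+ x S.:*
                     (dw S.:* (w S.:* w) S.:+ w S.:* (dw S.:* w S.:+ w S.:* dw))))))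
               S.:= (S.con 1ℚ S.:- S.con 2ℚ S.:* a S.:* (x S.:* (x S.:* (t S.:* w))) S.:- S.con 3ℚ S.:* b S.:*
                   (x S.:* (x S.:* (x S.:* (w S.:* w))))) S.:* zw
                    S.:- (S.con 3ℚ S.:* (t S.:* t) S.:+ a S.:* (x S.:* (x S.:* (w S.:* w)))) S.:* zt)
            ≋-refl τ ω dτ dω X a b ⟩
        -- The cofactors u and -v are the partial derivatives of H in ω and τ.
        u ⊗ Zω ⊖ v ⊗ Zτ ≈⟨ ⊕-cong (⊗-cong ≋-refl Zω≋0) (⊝-cong (⊗-cong ≋-refl Zτ≋0)) ⟩
        u ⊗ κ 0ℚ ⊖ v ⊗ κ 0ℚ ≈⟨ S.solve 2 (λ u v → u S.:* S.con 0ℚ S.:- v S.:* S.con 0ℚ S.:= S.con 0ℚ) ≋-refl u v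
            ⟩
        κ 0ℚ ∎
        where
        u v : Series
        u = κ 1ℚ ⊖ κ 2ℚ ⊗ a ⊗ (X ⊗ (X ⊗ (τ ⊗ ω))) ⊖ κ 3ℚ ⊗ b ⊗ (X ⊗ (X ⊗ (X ⊗ (ω ⊗ ω))))
        v = κ 3ℚ ⊗ (τ ⊗ τ) ⊕ a ⊗ (X ⊗ (X ⊗ (ω ⊗ ω)))
        θX : ∀ {f f′} → θ f ≋ f′ → θ (X ⊗ f) ≋ X ⊗ f ⊕ X ⊗ f′
        θX {f} eq = ≋-trans (θ-⊗ X f) (⊕-cong (⊗-cong θ-X ≋-refl) (⊗-cong ≋-refl eq))
        θ⊗ : ∀ {f f′ g g′} → θ f ≋ f′ → θ g ≋ g′ → θ (f ⊗ g) ≋ f′ ⊗ g ⊕ f ⊗ g′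
        θ⊗ {f} {g = g} p q = ≋-trans (θ-⊗ f g) (⊕-cong (⊗-cong p ≋-refl) (⊗-cong ≋-refl q))
        θ⊖ : ∀ {f f′ g g′} → θ f ≋ f′ → θ g ≋ g′ → θ (f ⊖ g) ≋ f′ ⊖ g′
        θ⊖ {f} {g = g} p q = ≋-trans (θ-⊕ f (⊝ g)) (⊕-cong p (≋-trans (θ-⊝ g) (⊝-cong q)))
        θκ : ∀ {f f′} c → θ f ≋ f′ → θ (κ c ⊗ f) ≋ κ c ⊗ f′
        θκ {f} c p = ≋-trans (θ-· c f) (⊗-cong ≋-refl p)
        dω² : θ (ω ⊗ ω) ≋ dω ⊗ ω ⊕ ω ⊗ dω
        dω² = θ-⊗ ω ω
        θτ³ : θ (τ ⊗ τ ⊗ τ) ≋ dτ ⊗ τ ⊗ τ ⊕ τ ⊗ dτ ⊗ τ ⊕ τ ⊗ τ ⊗ dτ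
        θτ³ = ≋-trans (θ⊗ (θ-⊗ τ τ) ≋-refl)
            (S.solve 2 (λ t d → (d S.:* t S.:+ t S.:* d) S.:* t S.:+ t S.:* t S.:* d S.:= d S.:* t S.:* t S.:+ t
            S.:* d S.:* t S.:+ t S.:* t S.:* d) ≋-refl τ dτ)
        θH : θ H ≋ dω ⊖ (dτ ⊗ τ ⊗ τ ⊕ τ ⊗ dτ ⊗ τ ⊕ τ ⊗ τ ⊗ dτ)
          ⊖ a ⊗ (X ⊗ (X ⊗ (τ ⊗ (ω ⊗ ω))) ⊕ X ⊗ (X ⊗ (τ ⊗ (ω ⊗ ω)) ⊕ X ⊗ (dτ ⊗ (ω ⊗ ω) ⊕ τ ⊗ (dω ⊗ ω ⊕ ω ⊗ dω))))
          ⊖ b ⊗ (X ⊗ (X ⊗ (X ⊗ (ω ⊗ (ω ⊗ ω)))) ⊕ X ⊗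
              (X ⊗ (X ⊗ (ω ⊗ (ω ⊗ ω))) ⊕ X ⊗ (X ⊗ (ω ⊗ (ω ⊗ ω)) ⊕ X ⊗ (dω ⊗ (ω ⊗ ω) ⊕ ω ⊗ (dω ⊗ ω ⊕ ω ⊗ dω)))))
        θH = θ⊖ (θ⊖ (θ⊖ ≋-refl θτ³) (θκ A (θX (θX (θ⊗ ≋-refl dω²))))) (θκ B (θX (θX (θX (θ⊗ ≋-refl dω²)))))

      -- 3 + 2θ multiplies coefficient n by 2n + 3, which is never zero, so `H-ode` already forces
      -- all coefficients to vanish.
      H≋0 : H ≋ κ 0ℚ
      H≋0 = mk λ n → trans (*≡0⇒≡0 (ι≢0 (dbl (suc n)))
          (trans (cong (_* H ! n)
          (trans (ι-suc (dbl (suc n))) (cong (1ℚ +_) (trans (ι-dbl (suc n)) (cong₂ _+_ (ι-suc n) (ι-suc n))))))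
        (trans (solve 2 (λ h i → (con 1ℚ :+ (con 1ℚ :+ i :+ (con 1ℚ :+ i))) :* h := con 3ℚ :* h :+ con 2ℚ :*
            (i :* h)) refl (H ! n) (ι n))
        (trans (sym (cong₂ _+_ (κ-⊗ 3ℚ H n) (κ-⊗ 2ℚ (θ H) n))) (trans (at H-ode n) (κ0 n)))))) (sym (κ0 n))
        where
        κ0 : ∀ n → κ 0ℚ ! n ≡ 0ℚ
        κ0 zero = refl
        κ0 (suc n) = refl

      -- As x = t / w, this is z² ℘(z) as a series in z².
      Q : Series
      Q = τ ⊗ ρ

      -- The equation x′ = 2y, with x = z⁻² Q and y = -z⁻³ ρ. It is the only one of the three that
      -- uses the curve equation H = 0.
      θQ : θ Q ≋ Q ⊖ ρ
      θQ = mk λ n → *-cancelˡ {p = 2ℚ} (λ ())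
          (trans (sym (κ-⊗ 2ℚ (θ Q) n)) (trans (at doubled n) (κ-⊗ 2ℚ (Q ⊖ ρ) n)))
        where
        cρ : Series
        cρ = κ 3ℚ ⊗ (τ ⊗ ρ) ⊖ κ 3ℚ ⊗ ρ ⊖ κ 2ℚ ⊗ (τ ⊗ dρ) ⊕ κ 2ℚ ⊗ (a ⊗ X ⊗ X ⊗ τ ⊗ ω ⊗ ρ) ⊕ κ 3ℚ ⊗
            (b ⊗ X ⊗ X ⊗ X ⊗ ω ⊗ ω ⊗ ρ)
        doubled : κ 2ℚ ⊗ θ Q ≋ κ 2ℚ ⊗ (Q ⊖ ρ)
        doubled = begin
          κ 2ℚ ⊗ θ Q ≈⟨ ⊗-cong ≋-refl (θ-⊗ τ ρ) ⟩
          κ 2ℚ ⊗ (dτ ⊗ ρ ⊕ τ ⊗ dρ) ≈⟨ S.solve 9 (λ t w r dt dw dr x a b →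
            let zt = t S.:+ S.con 2ℚ S.:* dt S.:- S.con 1ℚ S.:+ S.con 2ℚ S.:* a S.:*
                  (x S.:* (x S.:* (t S.:* w))) S.:+ S.con 3ℚ S.:* b S.:* (x S.:* (x S.:* (x S.:* (w S.:* w))))
                zw = S.con 3ℚ S.:* w S.:+ S.con 2ℚ S.:* dw S.:- S.con 3ℚ S.:* (t S.:* t) S.:- a S.:*
                    (x S.:* (x S.:* (w S.:* w)))
                zr = w S.:* r S.:- S.con 1ℚ
                zd = dw S.:* r S.:+ w S.:* dr
                h = w S.:- t S.:* t S.:* t S.:- a S.:* (x S.:* (x S.:* (t S.:* (w S.:* w)))) S.:- b S.:*
                    (x S.:* (x S.:* (x S.:* (w S.:* (w S.:* w)))))
                c = S.con 3ℚ S.:* (t S.:* r) S.:- S.con 3ℚ S.:* r S.:- S.con 2ℚ S.:*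
                    (t S.:* dr) S.:+ S.con 2ℚ S.:* (a S.:* x S.:* x S.:* t S.:* w S.:* r) S.:+ S.con 3ℚ S.:*
                    (b S.:* x S.:* x S.:* x S.:* w S.:* w S.:* r)
            in S.con 2ℚ S.:* (dt S.:* r S.:+ t S.:* dr) S.:=
               S.con 2ℚ S.:* (t S.:* r S.:- r) S.:+
                   (S.con 2ℚ S.:* t S.:* r S.:* zd S.:- t S.:* r S.:* r S.:* zw S.:+ r S.:* zt S.:+ S.con 3ℚ
                   S.:* r S.:* r S.:* h S.:+ c S.:* zr))
            ≋-refl τ ω ρ dτ dω dρ X a b ⟩
          κ 2ℚ ⊗ (Q ⊖ ρ) ⊕ (κ 2ℚ ⊗ τ ⊗ ρ ⊗ Zd ⊖ τ ⊗ ρ ⊗ ρ ⊗ Zω ⊕ ρ ⊗ Zτ ⊕ κ 3ℚ ⊗ ρ ⊗ ρ ⊗ H ⊕ cρ ⊗ Zρ)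
            ≈⟨ ⊕-cong ≋-refl (⊕-cong (⊕-cong
                (⊕-cong (⊕-cong (⊗-cong ≋-refl Zd≋0) (⊝-cong (⊗-cong ≋-refl Zω≋0))) (⊗-cong ≋-refl Zτ≋0))
                (⊗-cong ≋-refl H≋0)) (⊗-cong ≋-refl Zρ≋0)) ⟩
          κ 2ℚ ⊗ (Q ⊖ ρ) ⊕ (κ 2ℚ ⊗ τ ⊗ ρ ⊗ κ 0ℚ ⊖ τ ⊗ ρ ⊗ ρ ⊗ κ 0ℚ ⊕ ρ ⊗ κ 0ℚ ⊕ κ 3ℚ ⊗ ρ ⊗ ρ ⊗ κ 0ℚ ⊕ cρ ⊗ κ 0ℚ)
            ≈⟨ S.solve 4 (λ g t r c → g S.:+
                (S.con 2ℚ S.:* t S.:* r S.:* S.con 0ℚ S.:- t S.:* r S.:* r S.:* S.con 0ℚ S.:+ r S.:* S.con 0ℚ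
                S.:+ S.con 3ℚ S.:* r S.:* r S.:* S.con 0ℚ S.:+ c S.:* S.con 0ℚ) S.:= g)
               ≋-refl (κ 2ℚ ⊗ (Q ⊖ ρ)) τ ρ cρ ⟩
          κ 2ℚ ⊗ (Q ⊖ ρ) ∎

      -- The equation y′ = 3x² + A, obtained from the one for ω by differentiating ω ρ = 1.
      ρ-ode : κ 2ℚ ⊗ dρ ≋ κ 3ℚ ⊗ ρ ⊖ κ 3ℚ ⊗ (Q ⊗ Q) ⊖ a ⊗ (X ⊗ X)
      ρ-ode = begin
        κ 2ℚ ⊗ dρ ≈⟨ S.solve 7 (λ t w r dw dr x a →
            let zw = S.con 3ℚ S.:* w S.:+ S.con 2ℚ S.:* dw S.:- S.con 3ℚ S.:* (t S.:* t) S.:- a S.:*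
                  (x S.:* (x S.:* (w S.:* w)))
                zr = w S.:* r S.:- S.con 1ℚ
                zd = dw S.:* r S.:+ w S.:* dr
            in S.con 2ℚ S.:* dr S.:= S.con 3ℚ S.:* r S.:- S.con 3ℚ S.:* (t S.:* r S.:* (t S.:* r)) S.:- a S.:*
                (x S.:* x) S.:+
              (S.con 2ℚ S.:* r S.:* zd S.:- r S.:* r S.:* zw S.:+
                  (S.con 3ℚ S.:* r S.:- S.con 2ℚ S.:* dr S.:- a S.:* x S.:* x S.:* (w S.:* r S.:+ S.con 1ℚ))
                  S.:* zr))
            ≋-refl τ ω ρ dω dρ X a ⟩
        g ⊕ (κ 2ℚ ⊗ ρ ⊗ Zd ⊖ ρ ⊗ ρ ⊗ Zω ⊕ c ⊗ Zρ) ≈⟨ ⊕-cong ≋-refl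
            (⊕-cong (⊕-cong (⊗-cong ≋-refl Zd≋0) (⊝-cong (⊗-cong ≋-refl Zω≋0))) (⊗-cong ≋-refl Zρ≋0)) ⟩
        g ⊕ (κ 2ℚ ⊗ ρ ⊗ κ 0ℚ ⊖ ρ ⊗ ρ ⊗ κ 0ℚ ⊕ c ⊗ κ 0ℚ) ≈⟨ S.solve 3
            (λ g r c → g S.:+ (S.con 2ℚ S.:* r S.:* S.con 0ℚ S.:- r S.:* r S.:* S.con 0ℚ S.:+ c S.:* S.con 0ℚ)
            S.:= g) ≋-refl g ρ c ⟩
        g ∎
        where
        g c : Series
        g = κ 3ℚ ⊗ ρ ⊖ κ 3ℚ ⊗ (Q ⊗ Q) ⊖ a ⊗ (X ⊗ X)
        c = κ 3ℚ ⊗ ρ ⊖ κ 2ℚ ⊗ dρ ⊖ a ⊗ X ⊗ X ⊗ (ω ⊗ ρ ⊕ κ 1ℚ)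

      -- x′ = 2y and y′ = 3x² + A give x″ = 6x² + 2A.
      Q-ode : κ (2ℚ * 2ℚ) ⊗ θ (θ Q) ⊖ κ 10ℚ ⊗ θ Q ⊕ κ 6ℚ ⊗ Q ≋ κ 6ℚ ⊗ (Q ⊗ Q) ⊕ κ (2ℚ * A) ⊗ (X ⊗ X)
      Q-ode = begin
        κ (2ℚ * 2ℚ) ⊗ θ (θ Q) ⊖ κ 10ℚ ⊗ θ Q ⊕ κ 6ℚ ⊗ Q
          ≈⟨ ⊕-cong (⊕-cong (⊗-cong ≋-refl (≋-trans (θ-cong θQ) (≋-trans (θ-⊕ Q (⊝ ρ)) (⊕-cong θQ (θ-⊝ ρ)))))
              (⊝-cong (⊗-cong ≋-refl θQ))) ≋-refl ⟩
        κ (2ℚ * 2ℚ) ⊗ (Q ⊖ ρ ⊖ dρ) ⊖ κ 10ℚ ⊗ (Q ⊖ ρ) ⊕ κ 6ℚ ⊗ Q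
          ≈⟨ S.solve 3 (λ q r d → S.con (2ℚ * 2ℚ) S.:* (q S.:- r S.:- d) S.:- S.con 10ℚ S.:*
              (q S.:- r) S.:+ S.con 6ℚ S.:* q S.:= S.con 6ℚ S.:* r S.:- S.con 2ℚ S.:* (S.con 2ℚ S.:* d)) ≋-refl
              Q ρ dρ ⟩
        κ 6ℚ ⊗ ρ ⊖ κ 2ℚ ⊗ (κ 2ℚ ⊗ dρ)
          ≈⟨ ⊕-cong ≋-refl (⊝-cong (⊗-cong ≋-refl ρ-ode)) ⟩
        κ 6ℚ ⊗ ρ ⊖ κ 2ℚ ⊗ (κ 3ℚ ⊗ ρ ⊖ κ 3ℚ ⊗ (Q ⊗ Q) ⊖ a ⊗ (X ⊗ X))
          ≈⟨ S.solve 4 (λ r q a x → S.con 6ℚ S.:* r S.:- S.con 2ℚ S.:*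
              (S.con 3ℚ S.:* r S.:- S.con 3ℚ S.:* (q S.:* q) S.:- a S.:* (x S.:* x)) S.:= S.con 6ℚ S.:*
              (q S.:* q) S.:+ S.con 2ℚ S.:* a S.:* (x S.:* x)) ≋-refl ρ Q a X ⟩
        κ 6ℚ ⊗ (Q ⊗ Q) ⊕ κ 2ℚ ⊗ a ⊗ (X ⊗ X)
          ≈⟨ ⊕-cong ≋-refl (⊗-cong (mk λ { zero → refl ; (suc n) → κ-⊗ 2ℚ (κ A) (suc n) }) ≋-refl) ⟩
        κ 6ℚ ⊗ (Q ⊗ Q) ⊕ κ (2ℚ * A) ⊗ (X ⊗ X) ∎

-- The coefficients of the ℘-function as isobaric 2-integral forms.

module WeierstrassForms where

  open import Data.Nat.Induction using (<-rec)
  open import Data.Rational.Base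
  open import Data.Rational.Properties
  open import Data.Rational.Solver using (module +-*-Solver)
  open RationalArithmetic
  open PowerSeries hiding (module Reasoning)
  open BernoulliSeries
  open IntegralWeierstrass
  open +-*-Solver using (solve; _:+_; _:*_; _:-_; :-_; _:=_; con)
  open Curve

  family : Set
  family = ℚ → ℚ → Series

  HasForm : family → ℕ → Set
  HasForm s n = Form n (λ x y → s x y ! n)

  2-integral-ℚ : ∀ n {q} → ι n ≡ q → 2-Integral q
  2-integral-ℚ n eq = subst 2-Integral eq (2-integral-ι n)

  1-int : 2-Integral 1ℚ
  1-int = 2-integral-ℚ 1 ι1

  xᶠ : ∀ {c} → 2-Integral c → Form 2 (λ x y → c * x)
  xᶠ {c} c-int = ext (λ x y → cong (c *_) (trans (*-identityʳ (x * 1ℚ)) (*-identityʳ x)))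
      (monomial {c} c-int 1 0)

  yᶠ : ∀ {c} → 2-Integral c → Form 3 (λ x y → c * y)
  yᶠ {c} c-int = ext (λ x y → cong (c *_) (trans (*-identityˡ (y * 1ℚ)) (*-identityʳ y)))
      (monomial {c} c-int 0 1)

  product-form : ∀ m {s t : family} → (∀ i → i ℕ.≤ m → HasForm s i) → (∀ i → i ℕ.≤ m → HasForm t i) → HasForm
      (λ x y → s x y ⊗ t x y) m
  product-form m {s} {t} S T = antiᶠ m (λ i j i+j≡m → subst (λ n → Form n (λ x y → s x y ! i * t x y ! j)) i+j≡m
    (S i (subst (i ℕ.≤_) i+j≡m (ℕ.m≤m+n i j)) *ᶠ T j (subst (j ℕ.≤_) i+j≡m (ℕ.m≤n+m j i))))

  X-0 : ∀ c a → (κ c ⊗ (X ⊗ a)) ! 0 ≡ 0ℚ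
  X-0 c a = trans (cong (c *_) (*-zeroˡ (a ! 0))) (*-zeroʳ c)

  κX : ∀ c a n → (κ c ⊗ (X ⊗ a)) ! suc n ≡ c * a ! n
  κX c a n = trans (κ-⊗ c (X ⊗ a) (suc n)) (cong (c *_) (X-⊗ a n))

  X0 : ∀ a → (X ⊗ a) ! 0 ≡ 0ℚ
  X0 a = *-zeroˡ (a ! 0)

  κX-0 : ∀ c a → c * (X ⊗ a) ! 0 ≡ 0ℚ
  κX-0 c a = trans (cong (c *_) (X0 a)) (*-zeroʳ c)

  -- The weights fit: the parameter of weight 2 comes with X² and that of weight 3 with X³, so
  -- coefficient n is isobaric of weight n. The shift also leaves only smaller indices to the
  -- recursion.
  shift₂ : ∀ {c : ℚ → ℚ → ℚ} {s : family} → Form 2 c → ∀ n → (∀ m → m ℕ.< n → HasForm s m) → HasForm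
      (λ x y → κ (c x y) ⊗ (X ⊗ (X ⊗ s x y))) n
  shift₂ {c} {s} C zero S = ext (λ x y → sym (X-0 (c x y) (X ⊗ s x y))) zeroᶠ
  shift₂ {c} {s} C (suc zero) S = ext (λ x y → sym (trans (κX (c x y) (X ⊗ s x y) 0) (κX-0 (c x y) (s x y))))
      zeroᶠ
  shift₂ {c} {s} C (suc (suc m)) S = ext
      (λ x y → sym (trans (κX (c x y) (X ⊗ s x y) (suc m)) (cong (c x y *_) (X-⊗ (s x y) m))))
    (C *ᶠ S m (ℕ.m≤n⇒m≤1+n (ℕ.n<1+n m)))

  shift₃ : ∀ {c : ℚ → ℚ → ℚ} {s : family} → Form 3 c → ∀ n → (∀ m → m ℕ.< n → HasForm s m) → HasForm
      (λ x y → κ (c x y) ⊗ (X ⊗ (X ⊗ (X ⊗ s x y)))) n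
  shift₃ {c} {s} C zero S = ext (λ x y → sym (X-0 (c x y) (X ⊗ (X ⊗ s x y)))) zeroᶠ
  shift₃ {c} {s} C (suc zero) S = ext
      (λ x y → sym (trans (κX (c x y) (X ⊗ (X ⊗ s x y)) 0) (κX-0 (c x y) (X ⊗ s x y)))) zeroᶠ
  shift₃ {c} {s} C (suc (suc zero)) S = ext
      (λ x y → sym (trans (κX (c x y) (X ⊗ (X ⊗ s x y)) 1)
      (trans (cong (c x y *_) (X-⊗ (X ⊗ s x y) 0)) (κX-0 (c x y) (s x y))))) zeroᶠ
  shift₃ {c} {s} C (suc (suc (suc m))) S = ext (λ x y → sym (trans (κX (c x y) (X ⊗ (X ⊗ s x y)) (suc (suc m)))
      (cong (c x y *_) (trans (X-⊗ (X ⊗ s x y) (suc m)) (X-⊗ (s x y) m)))))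
    (C *ᶠ S m (ℕ.m≤n⇒m≤1+n (ℕ.m≤n⇒m≤1+n (ℕ.n<1+n m))))

  κ1-form : ∀ n → Form n (λ x y → κ 1ℚ ! n)
  κ1-form zero = constant 1-int
  κ1-form (suc n) = zeroᶠ

  -- Follows the order of the recursion: coefficient n of τ first, then that of ω, which involves τ
  -- up to n.
  τω-form : ∀ n → HasForm τ n × HasForm ω n
  τω-form = <-rec _ λ n rec →
    let T : ∀ i → i ℕ.< n → HasForm τ i
        T i i<n = proj₁ (rec i<n)
        O : ∀ i → i ℕ.< n → HasForm ω i
        O i i<n = proj₂ (rec i<n)
        ωω : ∀ m → m ℕ.< n → HasForm (λ x y → ω x y ⊗ ω x y) m
        ωω m m<n = product-form m {ω} {ω} (λ i i≤m → O i (ℕ.≤-<-trans i≤m m<n))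
            (λ i i≤m → O i (ℕ.≤-<-trans i≤m m<n))
        τω : ∀ m → m ℕ.< n → HasForm (λ x y → τ x y ⊗ ω x y) m
        τω m m<n = product-form m {τ} {ω} (λ i i≤m → T i (ℕ.≤-<-trans i≤m m<n))
            (λ i i≤m → O i (ℕ.≤-<-trans i≤m m<n))
        Tn : HasForm τ n
        Tn = ext (λ x y → sym (at (τ-eq x y) n)) (2-integral-inv n ·ᶠ
          ((κ1-form n +ᶠ shift₂ {λ x y → 30ℚ * x} {λ x y → τ x y ⊗ ω x y}
              (xᶠ (2-integral-ℚ 30 (ι-def 30))) n τω)
            +ᶠ shift₃ {λ x y → 105ℚ * y} {λ x y → ω x y ⊗ ω x y} (yᶠ (2-integral-ℚ 105 (ι-def 105))) n ωω))
        T≤ : ∀ i → i ℕ.≤ n → HasForm τ i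
        T≤ i i≤n = ≤-case i i≤n T Tn
        On : HasForm ω n
        On = ext (λ x y → sym (at (ω-eq x y) n)) (2-integral-inv (suc n) ·ᶠ
          (ext (λ x y → sym (κ-⊗ 3ℚ (τ x y ⊗ τ x y) n))
              (2-integral-ℚ 3 (ι-def 3) ·ᶠ product-form n {τ} {τ} T≤ T≤)
            +ᶠ shift₂ {λ x y → A x y} {λ x y → ω x y ⊗ ω x y}
                (ext (λ x y → sym (neg-distribˡ-* 15ℚ x)) (xᶠ (2-integral-neg (2-integral-ℚ 15 (ι-def 15))))) n
                ωω))
    in Tn , On
    where
    ≤-case : ∀ {n} {P : ℕ → Set} i → i ℕ.≤ n → (∀ i → i ℕ.< n → P i) → P n → P i
    ≤-case i i≤n below here with ℕ.m≤n⇒m<n∨m≡n i≤n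
    ... | inj₁ i<n = below i i<n
    ... | inj₂ refl = here

  ρ-form : ∀ n → HasForm ρ n
  ρ-form = <-rec _ go
    where
    go : ∀ n → (∀ {i} → i ℕ.< n → HasForm ρ i) → HasForm ρ n
    go zero rec = ext (λ x y → sym
        (trans (R.fix-eq x y 0) (cong (λ u → 1ℚ - u) (X0 (ser (λ i → ω x y ! suc i) ⊗ ρ x y)))))
        (constant 1-int)
    go (suc m) rec = ext (λ x y → sym
        (trans (R.fix-eq x y (suc m))
        (trans (cong (λ u → 0ℚ - u) (X-⊗ (ser (λ i → ω x y ! suc i) ⊗ ρ x y) m)) (+-identityˡ _))))
      (-ᶠ antiᶠ m (λ i j i+j≡m → subst (λ n → Form n (λ x y → ω x y ! suc i * ρ x y ! j)) (cong suc i+j≡m)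
        (proj₂ (τω-form (suc i)) *ᶠ rec (ℕ.s≤s (subst (j ℕ.≤_) i+j≡m (ℕ.m≤n+m j i))))))

  -- Only sums, products, integers and reciprocals of odd numbers went into Q.
  Q-form : ∀ n → HasForm Q n
  Q-form n = product-form n {τ} {ρ} (λ i _ → proj₁ (τω-form i)) (λ i _ → ρ-form i)

  module _ {a b : Series} (a0 : a ! 0 ≡ 1ℚ) (a1 : a ! 1 ≡ 0ℚ) (b0 : b ! 0 ≡ 1ℚ) (b1 : b ! 1 ≡ 0ℚ) where
    ⊗-1 : (a ⊗ b) ! 1 ≡ 0ℚ
    ⊗-1 = cong₂ _+_ (trans (cong (a ! 0 *_) b1) (*-zeroʳ (a ! 0)))
        (trans (cong (_* b ! 0) a1) (*-zeroˡ (b ! 0)))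

    ⊗-2 : (a ⊗ b) ! 2 ≡ b ! 2 + a ! 2
    ⊗-2 = trans (cong₂ (λ u v → u * b ! 2 + (v * b ! 1 + a ! 2 * b ! 0)) a0 a1)
        (trans (cong (λ u → 1ℚ * b ! 2 + (0ℚ * b ! 1 + a ! 2 * u)) b0)
      (solve 3 (λ b1 b2 a2 → con 1ℚ :* b2 :+ (con 0ℚ :* b1 :+ a2 :* con 1ℚ) := b2 :+ a2) refl (b ! 1) (b ! 2)
          (a ! 2)))

    ⊗-3 : (a ⊗ b) ! 3 ≡ b ! 3 + a ! 3
    ⊗-3 = trans (cong₂ (λ u v → u * b ! 3 + (v * b ! 2 + (a ! 2 * b ! 1 + a ! 3 * b ! 0))) a0 a1)
        (trans (cong₂ (λ u v → 1ℚ * b ! 3 + (0ℚ * b ! 2 + (a ! 2 * u + a ! 3 * v))) b1 b0)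
      (solve 4 (λ b2 b3 a2 a3 → con 1ℚ :* b3 :+ (con 0ℚ :* b2 :+ (a2 :* con 0ℚ :+ a3 :* con 1ℚ)) := b3 :+ a3)
          refl (b ! 2) (b ! 3) (a ! 2) (a ! 3)))

  module _ (x y : ℚ) where
    private
      t w r q : Series
      t = τ x y
      w = ω x y
      r = ρ x y
      q = Q x y

    private
      cancel : ∀ n {u v} → ι n ≡ u → u ≢ 0ℚ → ∀ {z} → ι n * z ≡ u * v → z ≡ v
      cancel n eq ne {z} h = *-cancelˡ ne (trans (cong (_* z) (sym eq)) h)

    τ-odd : ∀ n → ι (suc (dbl n)) * t ! n ≡ τ-rhs x y t w ! n
    τ-odd n = trans (cong (ι (suc (dbl n)) *_) (at (τ-eq x y) n)) (odd-cancel x y n (τ-rhs x y t w ! n))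

    ω-odd : ∀ n → ι (suc (dbl (suc n))) * w ! n ≡ ω-rhs x y t w ! n
    ω-odd n = trans (cong (ι (suc (dbl (suc n))) *_) (at (ω-eq x y) n))
        (odd-cancel x y (suc n) (ω-rhs x y t w ! n))

    ρ-0 : r ! 0 ≡ 1ℚ
    ρ-0 = trans (R.fix-eq x y 0) (cong (λ u → 1ℚ - u) (X0 (ser (λ i → w ! suc i) ⊗ r)))

    τ-1 : t ! 1 ≡ 0ℚ
    τ-1 = cancel 3 (ι-def 3) (λ ()) (trans (τ-odd 1) (trans (cong₂ (λ u v → 0ℚ + u + v)
      (trans (κX (30ℚ * x) (X ⊗ (t ⊗ w)) 0) (κX-0 (30ℚ * x) (t ⊗ w)))
      (trans (κX (105ℚ * y) (X ⊗ (X ⊗ (w ⊗ w))) 0) (κX-0 (105ℚ * y) (X ⊗ (w ⊗ w))))) refl))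

    ω-1 : w ! 1 ≡ 0ℚ
    ω-1 = cancel 5 (ι-def 5) (λ ()) (trans (ω-odd 1) (trans (cong₂ _+_
      (trans (κ-⊗ 3ℚ (t ⊗ t) 1) (cong (3ℚ *_) (⊗-1 {t} {t} (τ-0 x y) τ-1 (τ-0 x y) τ-1)))
      (trans (κX (A x y) (X ⊗ (w ⊗ w)) 0) (κX-0 (A x y) (w ⊗ w)))) refl))

    ρ-1 : r ! 1 ≡ 0ℚ
    ρ-1 = trans (R.fix-eq x y 1)
        (trans (cong (λ u → 0ℚ - u)
        (trans (X-⊗ (ser (λ i → w ! suc i) ⊗ r) 0) (trans (cong (_* r ! 0) ω-1) (*-zeroˡ (r ! 0))))) refl)

    Q-0 : q ! 0 ≡ 1ℚ
    Q-0 = cong₂ _*_ (τ-0 x y) ρ-0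

    Q-1 : q ! 1 ≡ 0ℚ
    Q-1 = ⊗-1 {t} {r} (τ-0 x y) τ-1 ρ-0 ρ-1

    -- Read off from the differential equation in degree 2, where it says -10 Q₂ = 2A. In degree 3
    -- it says nothing, because of the factor n - 3, so `Q-3` is computed from τ and ρ instead.
    Q-2 : q ! 2 ≡ 3ℚ * x
    Q-2 = *-cancelˡ {p = - 10ℚ} (λ ()) (trans (trans (solve 1 (λ q → con (- 10ℚ) :* q :=
          con (2ℚ * 2ℚ) :* (con 2ℚ :* (con 2ℚ :* q)) :- con 10ℚ :* (con 2ℚ :* q) :+ con 6ℚ :* q :- con 6ℚ :*
              (q :+ q)) refl (q ! 2))
        (cong (λ u → u - 6ℚ * (q ! 2 + q ! 2)) coefficient))
      (solve 2 (λ q x → con 6ℚ :* (q :+ q) :+ con 2ℚ :* (:- (con 15ℚ :* x)) :* con 1ℚ :- con 6ℚ :*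
          (q :+ q) := con (- 10ℚ) :* (con 3ℚ :* x)) refl (q ! 2) x))
      where
      coefficient : 2ℚ * 2ℚ * (2ℚ * (2ℚ * q ! 2)) - 10ℚ * (2ℚ * q ! 2) + 6ℚ * q ! 2 ≡ 6ℚ *
          (q ! 2 + q ! 2) + 2ℚ * A x y * 1ℚ
      coefficient = trans (cong (λ i → 2ℚ * 2ℚ * (i * (i * q ! 2)) - 10ℚ * (i * q ! 2) + 6ℚ * q ! 2)
          (sym (ι-def 2)))
        (trans (sym (cong₂ _+_ (cong₂ _-_ (κ-⊗ (2ℚ * 2ℚ) (θ (θ q)) 2) (κ-⊗ 10ℚ (θ q) 2)) (κ-⊗ 6ℚ q 2)))
        (trans (at (Q-ode x y) 2)
            (cong₂ _+_ (trans (κ-⊗ 6ℚ (q ⊗ q) 2) (cong (6ℚ *_) (⊗-2 {q} {q} Q-0 Q-1 Q-0 Q-1)))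
          (trans (κ-⊗ (2ℚ * A x y) (X ⊗ X) 2) (cong (2ℚ * A x y *_) (X-⊗ X 1))))))

    τ-3 : t ! 3 ≡ 15ℚ * y
    τ-3 = cancel 7 (ι-def 7) (λ ()) (trans (τ-odd 3) (trans (cong₂ (λ u v → 0ℚ + u + v)
      (trans (κX (30ℚ * x) (X ⊗ (t ⊗ w)) 2)
          (trans (cong (30ℚ * x *_) (trans (X-⊗ (t ⊗ w) 1) (⊗-1 {t} {w} (τ-0 x y) τ-1 (ω-0 x y) ω-1)))
          (*-zeroʳ (30ℚ * x))))
      (trans (κX (105ℚ * y) (X ⊗ (X ⊗ (w ⊗ w))) 2)
          (cong (105ℚ * y *_) (trans (X-⊗ (X ⊗ (w ⊗ w)) 1)
          (trans (X-⊗ (w ⊗ w) 0) (cong₂ _*_ (ω-0 x y) (ω-0 x y)))))))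
      (solve 1 (λ y → con 0ℚ :+ con 0ℚ :+ con 105ℚ :* y :* con 1ℚ := con 7ℚ :* (con 15ℚ :* y)) refl y)))
      where
      7ℚ : ℚ
      7ℚ = ℤ.+ 7 / 1

    ω-3 : w ! 3 ≡ 10ℚ * y
    ω-3 = cancel 9 (ι-def 9) (λ ()) (trans (ω-odd 3) (trans (cong₂ _+_
      (trans (κ-⊗ 3ℚ (t ⊗ t) 3)
          (cong (3ℚ *_) (trans (⊗-3 {t} {t} (τ-0 x y) τ-1 (τ-0 x y) τ-1) (cong₂ _+_ τ-3 τ-3))))
      (trans (κX (A x y) (X ⊗ (w ⊗ w)) 2)
          (trans (cong (A x y *_) (trans (X-⊗ (w ⊗ w) 1) (⊗-1 {w} {w} (ω-0 x y) ω-1 (ω-0 x y) ω-1)))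
          (*-zeroʳ (A x y)))))
      (solve 1 (λ y → con 3ℚ :* (con 15ℚ :* y :+ con 15ℚ :* y) :+ con 0ℚ := con 9ℚ :* (con 10ℚ :* y)) refl y)))
      where
      9ℚ : ℚ
      9ℚ = ℤ.+ 9 / 1

    ρ-3 : r ! 3 ≡ - (10ℚ * y)
    ρ-3 = trans (solve 2 (λ r w → r := r :+ w :- w) refl (r ! 3) (w ! 3)) (trans (cong (λ u → u - w ! 3)
      (trans (sym (⊗-3 {w} {r} (ω-0 x y) ω-1 ρ-0 ρ-1)) (at (ωρ x y) 3)))
          (trans (+-identityˡ (- w ! 3)) (cong -_ ω-3)))

    Q-3 : q ! 3 ≡ 5ℚ * y
    Q-3 = trans (⊗-3 {t} {r} (τ-0 x y) τ-1 ρ-0 ρ-1) (trans (cong₂ _+_ ρ-3 τ-3)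
      (solve 1 (λ y → :- (con 10ℚ :* y) :+ con 15ℚ :* y := con 5ℚ :* y) refl y))

    Q-Weierstrass : Weierstrass q (2ℚ * A x y)
    Q-Weierstrass = record { Q-0 = Q-0 ; Q-1 = Q-1 ; ode = Q-ode x y }

-- Monomials of a given weight.

module Monomials where

  open import Data.Fin.Base using (fromℕ<)
  open import Data.Fin.Patterns
  open import Data.Fin.Properties using (toℕ-fromℕ<)
  open import Data.List.Base using (_++_; foldr; map; filter; cartesianProduct)
  open import Data.Nat.DivMod using (_/_; _%_; m≡m%n+[m/n]*n; m%n<n; [m+kn]%n≡m%n)
  open import Data.Rational.Base hiding (_/_)
  open import Data.Rational.Properties
  open import Data.Rational.Solver using (module +-*-Solver)
  open import Relation.Unary using (Decidable)
  open import Defs using (exponents)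
  open RationalArithmetic
  open PowerSeries using (anti; anti-cong; anti-cong⁺; anti-0; anti-+; anti-Σ; anti-*ʳ)
  open BernoulliSeries using (foldr-upTo)
  open DivisorIdentity using (δ; δ-≢; δ-refl)
  open EisensteinRecurrence using (anti-δ; Σ-δ)
  open IntegralWeierstrass
  open +-*-Solver using (solve; _:+_; _:*_; _:-_; :-_; _:=_; con)

  ΣL : {A : Set} → List A → (A → ℚ) → ℚ
  ΣL xs f = foldr (λ x acc → f x + acc) 0ℚ xs

  ΣL-++ : ∀ {A : Set} (xs ys : List A) f → ΣL (xs ++ ys) f ≡ ΣL xs f + ΣL ys f
  ΣL-++ [] ys f = sym (+-identityˡ _)
  ΣL-++ (x ∷ xs) ys f = trans (cong (f x +_) (ΣL-++ xs ys f)) (sym (+-assoc (f x) _ _))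

  ΣL-map : ∀ {A B : Set} (g : A → B) xs f → ΣL (map g xs) f ≡ ΣL xs (f ∘ g)
  ΣL-map g [] f = refl
  ΣL-map g (x ∷ xs) f = cong (f (g x) +_) (ΣL-map g xs f)

  ΣL-cong : ∀ {A : Set} xs {f g : A → ℚ} → (∀ x → f x ≡ g x) → ΣL xs f ≡ ΣL xs g
  ΣL-cong [] eq = refl
  ΣL-cong (x ∷ xs) eq = cong₂ _+_ (eq x) (ΣL-cong xs eq)

  ΣL-filter : ∀ {A : Set} {P : A → Set} (P? : Decidable P) xs f → ΣL (filter P? xs) f ≡ ΣL xs
      (λ x → if does (P? x) then f x else 0ℚ)
  ΣL-filter P? [] f = refl
  ΣL-filter P? (x ∷ xs) f with does (P? x)
  ... | true = cong (f x +_) (ΣL-filter P? xs f)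
  ... | false = trans (ΣL-filter P? xs f) (sym (+-identityˡ _))

  ΣL-× : ∀ {A B : Set} (xs : List A) (ys : List B) f → ΣL (cartesianProduct xs ys) f ≡ ΣL xs
      (λ x → ΣL ys (λ y → f (x , y)))
  ΣL-× [] ys f = refl
  ΣL-× (x ∷ xs) ys f = trans (ΣL-++ (map (x ,_) ys) (cartesianProduct xs ys) f)
      (cong₂ _+_ (ΣL-map (x ,_) ys f) (ΣL-× xs ys f))

  ΣL-upTo : ∀ n f → ΣL (upTo n) f ≡ Σ< n f
  ΣL-upTo n f = foldr-upTo f (λ i → i) n

  δ-indicator : ∀ {m n} (d : Dec (m ≡ n)) x → (if does d then x else 0ℚ) ≡ δ m n * x
  δ-indicator {m} (yes refl) x = sym (trans (cong (_* x) (δ-refl m)) (*-identityˡ x))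
  δ-indicator {m} {n} (no m≢n) x = sym (trans (cong (_* x) (δ-≢ m≢n)) (*-zeroˡ x))

  Σ-exponents : ∀ k F → ΣL (exponents k) F ≡ Σ< (suc k)
      (λ a → Σ< (suc k) (λ b → δ (4 ℕ.* a ℕ.+ 6 ℕ.* b) k * F (a , b)))
  Σ-exponents k F = trans (ΣL-filter (λ (a , b) → 4 ℕ.* a ℕ.+ 6 ℕ.* b ℕ.≟ k)
      (cartesianProduct (upTo (suc k)) (upTo (suc k))) F)
    (trans (ΣL-cong (cartesianProduct (upTo (suc k)) (upTo (suc k)))
        (λ (a , b) → δ-indicator (4 ℕ.* a ℕ.+ 6 ℕ.* b ℕ.≟ k) (F (a , b))))
    (trans (ΣL-× (upTo (suc k)) (upTo (suc k)) G)
        (trans (ΣL-cong (upTo (suc k)) (λ a → ΣL-upTo (suc k) (λ b → G (a , b))))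
        (ΣL-upTo (suc k) (λ a → Σ< (suc k) (λ b → G (a , b)))))))
    where
    G : ℕ × ℕ → ℚ
    G (a , b) = δ (4 ℕ.* a ℕ.+ 6 ℕ.* b) k * F (a , b)

  -- The Chinese remainder theorem: 2r + 3s modulo 6 determines r modulo 3 and s modulo 2.
  residues : ∀ (r r′ : Fin 3) (s s′ : Fin 2) →
    (2 ℕ.* toℕ r ℕ.+ 3 ℕ.* toℕ s) % 6 ≡ (2 ℕ.* toℕ r′ ℕ.+ 3 ℕ.* toℕ s′) % 6 → r ≡ r′ × s ≡ s′
  residues 0F 0F 0F 0F _ = refl , refl
  residues 0F 0F 0F 1F ()
  residues 0F 0F 1F 0F ()
  residues 0F 0F 1F 1F _ = refl , refl
  residues 0F 1F 0F 0F ()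
  residues 0F 1F 0F 1F ()
  residues 0F 1F 1F 0F ()
  residues 0F 1F 1F 1F ()
  residues 0F 2F 0F 0F ()
  residues 0F 2F 0F 1F ()
  residues 0F 2F 1F 0F ()
  residues 0F 2F 1F 1F ()
  residues 1F 0F 0F 0F ()
  residues 1F 0F 0F 1F ()
  residues 1F 0F 1F 0F ()
  residues 1F 0F 1F 1F ()
  residues 1F 1F 0F 0F _ = refl , refl
  residues 1F 1F 0F 1F ()
  residues 1F 1F 1F 0F ()
  residues 1F 1F 1F 1F _ = refl , refl
  residues 1F 2F 0F 0F ()
  residues 1F 2F 0F 1F ()
  residues 1F 2F 1F 0F ()
  residues 1F 2F 1F 1F ()
  residues 2F 0F 0F 0F ()
  residues 2F 0F 0F 1F ()
  residues 2F 0F 1F 0F ()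
  residues 2F 0F 1F 1F ()
  residues 2F 1F 0F 0F ()
  residues 2F 1F 0F 1F ()
  residues 2F 1F 1F 0F ()
  residues 2F 1F 1F 1F ()
  residues 2F 2F 0F 0F _ = refl , refl
  residues 2F 2F 0F 1F ()
  residues 2F 2F 1F 0F ()
  residues 2F 2F 1F 1F _ = refl , refl

  module _ (r : Fin 3) (s : Fin 2) where
    -- The monomials of weight 2r + 3s + 6J in variables of weights 2 and 3 are xʳ yˢ (x³)^q (y²)^p
    -- with q + p = J, so a form is a sum over an antidiagonal.
    xᵉ yᵉ : ℕ → ℕ
    xᵉ q = toℕ r ℕ.+ 3 ℕ.* q
    yᵉ p = toℕ s ℕ.+ 2 ℕ.* p

  weight-split : ∀ r s q p → 2 ℕ.* xᵉ r s q ℕ.+ 3 ℕ.* yᵉ r s p ≡ (2 ℕ.* toℕ r ℕ.+ 3 ℕ.* toℕ s) ℕ.+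
      (q ℕ.+ p) ℕ.* 6
  weight-split r s q p = ℕS.solve 4
      (λ r s q p → ℕS.con 2 ℕS.:* (r ℕS.:+ ℕS.con 3 ℕS.:* q) ℕS.:+ ℕS.con 3 ℕS.:*
      (s ℕS.:+ ℕS.con 2 ℕS.:* p) ℕS.:=
    (ℕS.con 2 ℕS.:* r ℕS.:+ ℕS.con 3 ℕS.:* s) ℕS.:+ (q ℕS.:+ p) ℕS.:* ℕS.con 6) refl (toℕ r) (toℕ s) q p

  decompose : ∀ a b → ∃ λ r → ∃ λ s → ∃ λ q → ∃ λ p → a ≡ xᵉ r s q × b ≡ yᵉ r s p
  decompose a b = fromℕ< (m%n<n a 3) , fromℕ< (m%n<n b 2) , a / 3 , b / 2 ,
    trans (m≡m%n+[m/n]*n a 3) (cong₂ ℕ._+_ (sym (toℕ-fromℕ< (m%n<n a 3))) (ℕ.*-comm (a / 3) 3)) ,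
    trans (m≡m%n+[m/n]*n b 2) (cong₂ ℕ._+_ (sym (toℕ-fromℕ< (m%n<n b 2))) (ℕ.*-comm (b / 2) 2))

  solutions : ∀ r s J a b → 2 ℕ.* a ℕ.+ 3 ℕ.* b ≡ (2 ℕ.* toℕ r ℕ.+ 3 ℕ.* toℕ s) ℕ.+ J ℕ.* 6 →
    ∃ λ q → ∃ λ p → a ≡ xᵉ r s q × b ≡ yᵉ r s p × q ℕ.+ p ≡ J
  solutions r s J a b eq with decompose a b
  ... | r′ , s′ , q , p , refl , refl with residues r′ r s′ s
         (trans (sym ([m+kn]%n≡m%n (2 ℕ.* toℕ r′ ℕ.+ 3 ℕ.* toℕ s′) (q ℕ.+ p) 6))
             (trans (cong (_% 6) (trans (sym (weight-split r′ s′ q p)) eq))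
             ([m+kn]%n≡m%n (2 ℕ.* toℕ r ℕ.+ 3 ℕ.* toℕ s) J 6)))
  ... | refl , refl = q , p , refl , refl , ℕ.*-cancelʳ-≡ (q ℕ.+ p) J 6
      (ℕ.+-cancelˡ-≡ (2 ℕ.* toℕ r ℕ.+ 3 ℕ.* toℕ s) _ _ (trans (sym (weight-split r s q p)) eq))

  δ-injective : ∀ (f : ℕ → ℕ) → (∀ {m n} → f m ≡ f n → m ≡ n) → ∀ m n → δ (f m) (f n) ≡ δ m n
  δ-injective f inj m n with m ℕ.≟ n
  ... | yes refl = trans (δ-refl (f m)) (sym (δ-refl m))
  ... | no m≢n = trans (δ-≢ (λ eq → m≢n (inj eq))) (sym (δ-≢ m≢n))

  module _ (r : Fin 3) (s : Fin 2) (J : ℕ) where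
    private
      x y : ℕ → ℕ
      x = xᵉ r s
      y = yᵉ r s
      n : ℕ
      n = (2 ℕ.* toℕ r ℕ.+ 3 ℕ.* toℕ s) ℕ.+ J ℕ.* 6

      x-injective : ∀ {q q′} → x q ≡ x q′ → q ≡ q′
      x-injective {q} {q′} eq = ℕ.*-cancelˡ-≡ q q′ 3 (ℕ.+-cancelˡ-≡ (toℕ r) _ _ eq)
      y-injective : ∀ {q q′} → y q ≡ y q′ → q ≡ q′
      y-injective {q} {q′} eq = ℕ.*-cancelˡ-≡ q q′ 2 (ℕ.+-cancelˡ-≡ (toℕ s) _ _ eq)

    δ-weight : ∀ a b → δ (2 ℕ.* a ℕ.+ 3 ℕ.* b) n ≡ anti (λ q p → δ a (x q) * δ b (y p)) J
    δ-weight a b with 2 ℕ.* a ℕ.+ 3 ℕ.* b ℕ.≟ n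
    ... | yes eq = let q , p , a≡ , b≡ , q+p≡J = solutions r s J a b eq in
      trans (trans (cong (λ m → δ m n) eq) (δ-refl n)) (sym (trans (anti-cong J (λ i j →
        cong₂ _*_ (trans (cong (λ u → δ u (x i)) a≡) (δ-injective x x-injective q i))
            (trans (cong (λ u → δ u (y j)) b≡) (δ-injective y y-injective p j))))
        (trans (anti-δ J q p) (trans (cong (λ m → δ m J) q+p≡J) (δ-refl J)))))
    ... | no ne = trans (δ-≢ ne) (sym (anti-0 J λ i j i+j≡J → go i j i+j≡J (a ℕ.≟ x i) (b ℕ.≟ y j)))
      where
      go : ∀ i j → i ℕ.+ j ≡ J → Dec (a ≡ x i) → Dec (b ≡ y j) → δ a (x i) * δ b (y j) ≡ 0ℚ
      go i j i+j≡J (no a≢) _ = trans (cong (_* δ b (y j)) (δ-≢ a≢)) (*-zeroˡ (δ b (y j)))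
      go i j i+j≡J (yes _) (no b≢) = trans (cong (δ a (x i) *_) (δ-≢ b≢)) (*-zeroʳ (δ a (x i)))
      go i j refl (yes a≡) (yes b≡) = ⊥-elim
          (ne (trans (cong₂ (λ u v → 2 ℕ.* u ℕ.+ 3 ℕ.* v) a≡ b≡) (weight-split r s i j)))

    -- The weights 4 and 6 in the list are twice 2 and 3. The bound k of the list exceeds no
    -- exponent that occurs, so the list contains the whole antidiagonal.
    anti-weights : ∀ k F → k ≡ 2 ℕ.* n → ΣL (exponents k) F ≡ anti (λ q p → F (x q , y p)) J
    anti-weights .(2 ℕ.* n) F refl = begin
      ΣL (exponents k) F
        ≡⟨ Σ-exponents k F ⟩
      Σ< (suc k) (λ a → Σ< (suc k) (λ b → δ (4 ℕ.* a ℕ.+ 6 ℕ.* b) k * F (a , b)))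
        ≡⟨ Σ-cong (suc k) (λ a → Σ-cong (suc k)
            (λ b → trans (cong (_* F (a , b)) (indicator a b))
            (sym (anti-*ʳ′ J (F (a , b)) (λ q p → δ a (x q) * δ b (y p)))))) ⟩
      Σ< (suc k) (λ a → Σ< (suc k) (λ b → anti (λ q p → δ a (x q) * δ b (y p) * F (a , b)) J))
        ≡⟨ Σ-cong (suc k) (λ a → sym (anti-Σ J (suc k) (λ q p b → δ a (x q) * δ b (y p) * F (a , b)))) ⟩
      Σ< (suc k) (λ a → anti (λ q p → Σ< (suc k) (λ b → δ a (x q) * δ b (y p) * F (a , b))) J)
        ≡⟨ anti-Σ J (suc k) (λ q p a → Σ< (suc k) (λ b → δ a (x q) * δ b (y p) * F (a , b))) ⟨
      anti (λ q p → Σ< (suc k) (λ a → Σ< (suc k) (λ b → δ a (x q) * δ b (y p) * F (a , b)))) J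
        ≡⟨ anti-cong⁺ J (λ q p q+p≡J → trans
            (Σ-cong (suc k) (λ a → trans (Σ-cong (suc k) (λ b → trans (*-assoc (δ a (x q)) _ _) refl))
             (trans (Σ-*ˡ (suc k) (δ a (x q)) (λ b → δ b (y p) * F (a , b)))
                 (cong (δ a (x q) *_) (Σ-δ (suc k) (y p) (λ b → F (a , b)) (ℕ.s≤s (y≤ q p q+p≡J)))))))
             (Σ-δ (suc k) (x q) (λ a → F (a , y p)) (ℕ.s≤s (x≤ q p q+p≡J)))) ⟩
      anti (λ q p → F (x q , y p)) J ∎
      where
      open ≡-Reasoning
      k : ℕ
      k = 2 ℕ.* n
      anti-*ʳ′ : ∀ m c G → anti (λ i j → G i j * c) m ≡ anti G m * c
      anti-*ʳ′ = anti-*ʳ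
      indicator : ∀ a b → δ (4 ℕ.* a ℕ.+ 6 ℕ.* b) k ≡ anti (λ q p → δ a (x q) * δ b (y p)) J
      indicator a b = trans (cong (λ m → δ m k)
          (ℕS.solve 2 (λ a b → ℕS.con 4 ℕS.:* a ℕS.:+ ℕS.con 6 ℕS.:* b ℕS.:= ℕS.con 2 ℕS.:*
          (ℕS.con 2 ℕS.:* a ℕS.:+ ℕS.con 3 ℕS.:* b)) refl a b))
        (trans (δ-injective (2 ℕ.*_) (λ {m} {n} → ℕ.*-cancelˡ-≡ m n 2) (2 ℕ.* a ℕ.+ 3 ℕ.* b) n) (δ-weight a b))
      n≤k : n ℕ.≤ k
      n≤k = ℕ.m≤m+n n _
      x≤ : ∀ q p → q ℕ.+ p ≡ J → x q ℕ.≤ k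
      x≤ q p refl = ℕ.≤-trans (ℕ.≤-trans (ℕ.m≤n*m (x q) 2) (ℕ.m≤m+n (2 ℕ.* x q) (3 ℕ.* y p)))
          (ℕ.≤-trans (ℕ.≤-reflexive (weight-split r s q p)) n≤k)
      y≤ : ∀ q p → q ℕ.+ p ≡ J → y p ℕ.≤ k
      y≤ q p refl = ℕ.≤-trans (ℕ.≤-trans (ℕ.m≤n*m (y p) 3) (ℕ.m≤n+m (3 ℕ.* y p) (2 ℕ.* x q)))
          (ℕ.≤-trans (ℕ.≤-reflexive (weight-split r s q p)) n≤k)

    anti-pick : ∀ q p (F : ℕ → ℕ → ℚ) → anti (λ i j → δ q i * F i j) (q ℕ.+ p) ≡ F q p
    anti-pick zero zero F = *-identityˡ (F 0 0)
    anti-pick zero (suc p) F = trans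
        (cong₂ _+_ (*-identityˡ (F 0 (suc p))) (anti-0 p (λ i j _ → *-zeroˡ (F (suc i) j))))
        (+-identityʳ (F 0 (suc p)))
    anti-pick (suc q) p F = trans (cong₂ _+_ (*-zeroˡ (F 0 (suc (q ℕ.+ p)))) (anti-pick q p (λ i → F (suc i))))
        (+-identityˡ (F (suc q) p))

    -- The monomials of weight n are numbered by q, so the terms of a form can be collected; `δ q`
    -- places a single monomial.
    form-coefficients : ∀ {m f} → m ≡ n → Form m f → ∃ λ (c : ℕ → ℚ) → (∀ q → 2-Integral (c q)) ×
      (∀ u v → f u v ≡ anti (λ q p → c q * (u ^ x q * v ^ y p)) J)
    form-coefficients eq (monomial {c} c-int a b) with solutions r s J a b eq
    ... | q , p , refl , refl , refl = (λ i → δ q i * c) , (λ i → 2-integral-* (δ-integral q i) c-int) , λ u v →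
      sym (trans (anti-cong J (λ i j → *-assoc (δ q i) c _)) (anti-pick q p (λ i j → c * (u ^ x i * v ^ y j))))
      where
      δ-integral : ∀ q i → 2-Integral (δ q i)
      δ-integral zero zero = subst 2-Integral ι1 (2-integral-ι 1)
      δ-integral zero (suc i) = subst 2-Integral ι0 (2-integral-ι 0)
      δ-integral (suc q) zero = subst 2-Integral ι0 (2-integral-ι 0)
      δ-integral (suc q) (suc i) = δ-integral q i
    form-coefficients eq zeroᶠ = (λ _ → 0ℚ) , (λ _ → subst 2-Integral ι0 (2-integral-ι 0)) , λ u v → sym
        (anti-0 J (λ i j _ → *-zeroˡ (u ^ x i * v ^ y j)))
    form-coefficients eq (F +ᶠ G) = let c , c-int , c-eq = form-coefficients eq F ; d , d-int , d-eq = form-coefficients eq G in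
      (λ q → c q + d q) , (λ q → 2-integral-+ (c-int q) (d-int q)) , λ u v → trans
          (cong₂ _+_ (c-eq u v) (d-eq u v))
        (sym (trans (anti-cong J (λ i j → *-distribʳ-+ (u ^ x i * v ^ y j) (c i) (d i)))
            (anti-+ J (λ i j → c i * (u ^ x i * v ^ y j)) (λ i j → d i * (u ^ x i * v ^ y j)))))
    form-coefficients eq (ext h F) = let c , c-int , c-eq = form-coefficients eq F in c , c-int , λ u v → trans (sym (h u v)) (c-eq u v)

-- Null sequences and Euler's formula for ζ(2n).

module ZetaRecurrence where

  open import Data.Nat.Induction using (<-rec)
  open import Data.Rational.Base
  open import Data.Rational.Properties
  open import Data.Rational.Solver using (module +-*-Solver)
  open import Data.Rational.Unnormalised.Base as ℚᵘ using (*≤*)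
  import Data.Rational.Unnormalised.Properties as ℚᵘ
  open RationalArithmetic
  open PowerSeries using (anti; anti-cong; anti-cong⁺; anti-Σ; anti-*ˡ; anti-*ʳ; anti-last; dbl; κ-⊗; X; _⊗_; θ; at; _!_)
  open DivisorIdentity using (δ; δ-refl; δ-≢)
  open EisensteinRecurrence using (Σ-δ)
  open BernoulliSeries using (y; y-Riccati; y-0; y-1; ¼; 2ℚ; 1/12; ι-dbl)
  open +-*-Solver using (solve; _:+_; _:*_; _:-_; :-_; _:=_; con)

  archimedean : ∀ x → ∃ λ N → x ≤ ι N
  archimedean x@(mkℚ n d c) = ℤ.∣ n ∣ , toℚᵘ-cancel-≤
      (ℚᵘ.≤-respʳ-≃ (ℚᵘ.≃-sym (ι⇒ℚᵘ ℤ.∣ n ∣)) (*≤* (ℤ.≤-trans (ℤ.≤-reflexive (ℤ.*-identityʳ n)) (bound n))))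
    where
    bound : ∀ n → n ℤ.≤ ℤ.+ ℤ.∣ n ∣ ℤ.* ℤ.+ suc d
    bound (ℤ.+ m) = ℤ.≤-trans (ℤ.+≤+ (ℕ.m≤m*n m (suc d))) (ℤ.≤-reflexive (ℤ.pos-* m (suc d)))
    bound ℤ.-[1+ m ] = ℤ.-≤+

  archimedean-inv : ∀ ε → 0ℚ < ε → ∃ λ N → inv (ι (suc N)) ≤ ε
  archimedean-inv ε 0<ε with archimedean (inv ε)
  ... | N , le = N , (begin
    inv (ι (suc N))                 ≡⟨ *-identityʳ _ ⟨
    inv (ι (suc N)) * 1ℚ            ≡⟨ cong (inv (ι (suc N)) *_) (inverseˡ (<⇒≢0 0<ε)) ⟨
    inv (ι (suc N)) * (inv ε * ε)   ≤⟨ *-monoˡ (0≤inv (0<ι N))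
        (*-monoʳ (<⇒≤ 0<ε) (≤-trans le (ι-mono-≤ (ℕ.n≤1+n N)))) ⟩
    inv (ι (suc N)) * (ι (suc N) * ε) ≡⟨ *-assoc (inv (ι (suc N))) _ ε ⟨
    inv (ι (suc N)) * ι (suc N) * ε ≡⟨ cong (_* ε) (inverseˡ (ι≢0 N)) ⟩
    1ℚ * ε                          ≡⟨ *-identityˡ ε ⟩
    ε                               ∎)
    where open ≤-Reasoning

  infix 4 _~_
  -- Neither side has to converge. Equality of two complex numbers with real approximations becomes
  -- this relation between the approximations.
  record _~_ (a b : ℕ → ℚ) : Set where
    constructor asym
    field close : ∀ ε → 0ℚ < ε → ∃ λ N → ∀ n → N ℕ.≤ n → ∣ a n - b n ∣ ≤ ε
  open _~_ public

  record Bounded (a : ℕ → ℚ) : Set where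
    constructor bounded
    field
      bound : ℚ
      from : ℕ
      0<bound : 0ℚ < bound
      holds : ∀ n → from ℕ.≤ n → ∣ a n ∣ ≤ bound

  ∣0∣≤ : ∀ {x ε} → x ≡ 0ℚ → 0ℚ < ε → ∣ x ∣ ≤ ε
  ∣0∣≤ refl 0<ε = <⇒≤ 0<ε

  ~-reflexive : ∀ {a b} → (∀ n → a n ≡ b n) → a ~ b
  ~-reflexive {a} {b} eq = asym λ ε 0<ε → 0 , λ n _ → ∣0∣≤ (trans (cong (_- b n) (eq n)) (+-inverseʳ (b n))) 0<ε

  ~-refl : ∀ {a} → a ~ a
  ~-refl = ~-reflexive (λ _ → refl)

  ~-sym : ∀ {a b} → a ~ b → b ~ a
  ~-sym {a} {b} (asym p) = asym λ ε 0<ε → proj₁ (p ε 0<ε) , λ n N≤n → subst (_≤ ε) (∣-∣-sym (a n) (b n))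
      (proj₂ (p ε 0<ε) n N≤n)

  0<½* : ∀ {ε} → 0ℚ < ε → 0ℚ < ½ * ε
  0<½* 0<ε = 0<* (positive⁻¹ ½) 0<ε

  ½+½ : ∀ ε → ½ * ε + ½ * ε ≡ ε
  ½+½ = solve 1 (λ ε → con ½ :* ε :+ con ½ :* ε := ε) refl

  ⊔-left : ∀ M {N n} → M ℕ.⊔ N ℕ.≤ n → M ℕ.≤ n
  ⊔-left M {N} = ℕ.m⊔n≤o⇒m≤o M N
  ⊔-right : ∀ M {N n} → M ℕ.⊔ N ℕ.≤ n → N ℕ.≤ n
  ⊔-right M {N} = ℕ.m⊔n≤o⇒n≤o M N

  ~-+ : ∀ {a a′ b b′} → a ~ a′ → b ~ b′ → (λ n → a n + b n) ~ (λ n → a′ n + b′ n)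
  ~-+ {a} {a′} {b} {b′} (asym p) (asym q) = asym λ ε 0<ε →
    let M , pM = p (½ * ε) (0<½* 0<ε) ; N , qN = q (½ * ε) (0<½* 0<ε) in
    M ℕ.⊔ N , λ n le → subst₂ _≤_
        (cong ∣_∣ (solve 4 (λ a a′ b b′ → a :- a′ :+ (b :- b′) := a :+ b :- (a′ :+ b′)) refl (a n) (a′ n) (b n)
        (b′ n)))
      (½+½ ε) (∣+∣≤ (pM n (⊔-left M le)) (qN n (⊔-right M le)))

  ~-trans : ∀ {a b c} → a ~ b → b ~ c → a ~ c
  ~-trans {a} {b} {c} (asym p) (asym q) = asym λ ε 0<ε →
    let M , pM = p (½ * ε) (0<½* 0<ε) ; N , qN = q (½ * ε) (0<½* 0<ε) in
    M ℕ.⊔ N , λ n le → subst₂ _≤_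
        (cong ∣_∣ (solve 3 (λ a b c → a :- b :+ (b :- c) := a :- c) refl (a n) (b n) (c n)))
      (½+½ ε) (∣+∣≤ (pM n (⊔-left M le)) (qN n (⊔-right M le)))

  ~-neg : ∀ {a b} → a ~ b → (λ n → - a n) ~ (λ n → - b n)
  ~-neg {a} {b} (asym p) = asym λ ε 0<ε → proj₁ (p ε 0<ε) , λ n le → subst (_≤ ε)
    (trans (sym (∣-p∣≡∣p∣ (a n - b n)))
        (cong ∣_∣ (solve 2 (λ a b → :- (a :- b) := (:- a) :- (:- b)) refl (a n) (b n)))) (proj₂ (p ε 0<ε) n le)

  divide-bound : ∀ ε B → 0ℚ < B → B * (inv B * ε) ≡ ε
  divide-bound ε B 0<B = trans (sym (*-assoc B _ ε)) (trans (cong (_* ε) (inverseʳ (<⇒≢0 0<B))) (*-identityˡ ε))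

  ~-scale : ∀ {a b c} → Bounded c → a ~ b → (λ n → c n * a n) ~ (λ n → c n * b n)
  ~-scale {a} {b} {c} (bounded B M 0<B cB) (asym p) = asym λ ε 0<ε →
    let N , pN = p (inv B * ε) (0<* (0<inv 0<B) 0<ε) in
    M ℕ.⊔ N , λ n le → subst₂ _≤_
        (cong ∣_∣ (solve 3 (λ c a b → c :* (a :- b) := c :* a :- c :* b) refl (c n) (a n) (b n)))
      (divide-bound ε B 0<B) (∣*∣≤ (cB n (⊔-left M le)) (pN n (⊔-right M le)))

  bounded-const : ∀ c → Bounded (λ _ → c)
  bounded-const c = bounded (∣ c ∣ + 1ℚ) 0
      (≤-<-trans (0≤∣p∣ c) (subst (_< ∣ c ∣ + 1ℚ) (+-identityʳ ∣ c ∣) (+-monoʳ-< ∣ c ∣ 0<1)))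
    (λ n _ → subst (_≤ ∣ c ∣ + 1ℚ) (+-identityʳ ∣ c ∣) (+-monoʳ-≤ ∣ c ∣ (<⇒≤ 0<1)))

  bounded-≤ : ∀ {a} B → 0ℚ < B → (∀ n → ∣ a n ∣ ≤ B) → Bounded a
  bounded-≤ B 0<B h = bounded B 0 0<B (λ n _ → h n)

  bounded-+ : ∀ {a b} → Bounded a → Bounded b → Bounded (λ n → a n + b n)
  bounded-+ (bounded B M 0<B p) (bounded D N 0<D q) = bounded (B + D) (M ℕ.⊔ N) (+-mono-< 0<B 0<D)
    (λ n le → ∣+∣≤ (p n (⊔-left M le)) (q n (⊔-right M le)))

  bounded-* : ∀ {a b} → Bounded a → Bounded b → Bounded (λ n → a n * b n)
  bounded-* (bounded B M 0<B p) (bounded D N 0<D q) = bounded (B * D) (M ℕ.⊔ N) (0<* 0<B 0<D)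
    (λ n le → ∣*∣≤ (p n (⊔-left M le)) (q n (⊔-right M le)))

  bounded-^ : ∀ {a} k → Bounded a → Bounded (λ n → a n ^ k)
  bounded-^ zero _ = bounded-const 1ℚ
  bounded-^ (suc k) p = bounded-* p (bounded-^ k p)

  bounded-~ : ∀ {a b} → a ~ b → Bounded b → Bounded a
  bounded-~ {a} {b} (asym p) (bounded B M 0<B q) = let N , pN = p 1ℚ 0<1 in
    bounded (1ℚ + B) (N ℕ.⊔ M) (+-mono-< 0<1 0<B)
        (λ n le → subst (_≤ 1ℚ + B) (cong ∣_∣ (solve 2 (λ a b → a :- b :+ b := a) refl (a n) (b n)))
      (∣+∣≤ (pN n (⊔-left N le)) (q n (⊔-right N le))))

  ~-* : ∀ {a a′ b b′} → Bounded a → Bounded b′ → a ~ a′ → b ~ b′ → (λ n → a n * b n) ~ (λ n → a′ n * b′ n)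
  ~-* {a} {a′} {b} {b′} A B′ p q = ~-trans (~-scale A q)
    (~-trans (~-reflexive (λ n → *-comm (a n) (b′ n)))
        (~-trans (~-scale B′ p) (~-reflexive (λ n → *-comm (b′ n) (a′ n)))))

  ~-^ : ∀ {a b} k → Bounded b → a ~ b → (λ n → a n ^ k) ~ (λ n → b n ^ k)
  ~-^ zero _ _ = ~-refl
  ~-^ (suc k) B p = ~-* (bounded-~ p B) (bounded-^ k B) p (~-^ k B p)

  ~-*ˡ : ∀ {a b} c → a ~ b → (λ n → c * a n) ~ (λ n → c * b n)
  ~-*ˡ c p = ~-scale (bounded-const c) p

  ~-anti : ∀ m {F G : ℕ → ℕ → ℕ → ℚ} → (∀ i j → i ℕ.+ j ≡ m → F i j ~ G i j) →
      (λ n → anti (λ i j → F i j n) m) ~ (λ n → anti (λ i j → G i j n) m)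
  ~-anti zero p = p 0 0 refl
  ~-anti (suc m) p = ~-+ (p 0 (suc m) refl) (~-anti m (λ i j eq → p (suc i) j (cong suc eq)))

  ~-cancel : ∀ {a b} (c : ℕ → ℚ) δ → 0ℚ < δ → (∃ λ N → ∀ n → N ℕ.≤ n → δ ≤ ∣ c n ∣) → (λ n → c n * a n) ~
      (λ n → c n * b n) → a ~ b
  ~-cancel {a} {b} c δ 0<δ (M , δ≤c) (asym p) = asym λ ε 0<ε →
    let N , pN = p (δ * ε) (0<* 0<δ 0<ε) in
    M ℕ.⊔ N , λ n le → *-cancelˡ-≤-pos δ {{positive 0<δ}}
        (≤-trans (*-monoʳ (0≤∣p∣ (a n - b n)) (δ≤c n (⊔-left M le)))
      (≤-trans (≤-reflexive (trans (sym (∣p*q∣≡∣p∣*∣q∣ (c n) (a n - b n)))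
          (cong ∣_∣ (solve 3 (λ c a b → c :* (a :- b) := c :* a :- c :* b) refl (c n) (a n) (b n)))))
        (pN n (⊔-right M le))))

  ~-cancel-const : ∀ {a b} c → c ≢ 0ℚ → (λ n → c * a n) ~ (λ n → c * b n) → a ~ b
  ~-cancel-const {a} {b} c c≢0 p = ~-trans (~-reflexive (λ n → sym (cancel (a n))))
      (~-trans (~-*ˡ (inv c) p) (~-reflexive (λ n → cancel (b n))))
    where
    cancel : ∀ x → inv c * (c * x) ≡ x
    cancel x = trans (sym (*-assoc (inv c) c x)) (trans (cong (_* x) (inverseˡ c≢0)) (*-identityˡ x))

  ~-by-inv : ∀ {a b} C → 0ℚ < C → (∀ n → ∣ a n - b n ∣ ≤ C * inv (ι (suc n))) → a ~ b
  ~-by-inv {a} {b} C 0<C h = asym λ ε 0<ε →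
    let N , le = archimedean-inv (inv C * ε) (0<* (0<inv 0<C) 0<ε) in
    N , λ n N≤n → ≤-trans (h n)
        (≤-trans (*-monoˡ (<⇒≤ 0<C) (≤-trans (inv-antimono (0<ι N) (ι-mono-≤ (ℕ.s≤s N≤n))) le))
        (≤-reflexive (divide-bound ε C 0<C)))

  inv-neg : ∀ x → inv (- x) ≡ - inv x
  inv-neg x with x ≟ 0ℚ
  ... | yes refl = refl
  ... | no x≢0 = sym (inv-unique (- x)
      (trans (solve 2 (λ x v → (:- x) :* (:- v) := x :* v) refl x _) (*-inverseʳ x {{≢-nonZero x≢0}})))

  ι-injective : ∀ {m n} → ι m ≡ ι n → m ≡ n
  ι-injective {zero} {zero} eq = refl
  ι-injective {zero} {suc n} eq = ⊥-elim (ι≢0 n (trans (sym eq) ι0))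
  ι-injective {suc m} {zero} eq = ⊥-elim (ι≢0 m (trans eq ι0))
  ι-injective {suc m} {suc n} eq = cong suc
      (ι-injective (+-cancelˡ {1ℚ} (trans (sym (ι-suc m)) (trans eq (ι-suc n)))))
    where
    +-cancelˡ : ∀ {a b c} → a + b ≡ a + c → b ≡ c
    +-cancelˡ {a} {b} {c} eq = trans (solve 2 (λ a b → b := a :+ b :- a) refl a b)
        (trans (cong (_- a) eq) (solve 2 (λ a b → a :+ b :- a := b) refl a c))

  inv-0 : inv (ι 0) ≡ 0ℚ
  inv-0 = cong inv ι0

  u r : ℕ → ℚ
  u l = inv (ι (suc l))
  r l = u l * u l

  0≤u : ∀ l → 0ℚ ≤ u l
  0≤u l = 0≤inv (0<ι l)

  u≤1 : ∀ l → u l ≤ 1ℚ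
  u≤1 l = subst (u l ≤_) refl (inv-antimono 0<1 (1≤ι l))

  0≤r : ∀ l → 0ℚ ≤ r l
  0≤r l = 0≤* (0≤u l) (0≤u l)

  r≤1 : ∀ l → r l ≤ 1ℚ
  r≤1 l = *-mono-≤ (0≤u l) (0≤u l) (u≤1 l) (u≤1 l)

  r^≤r : ∀ j l → r l ^ suc j ≤ r l
  r^≤r j l = ≤-trans (*-monoˡ (0≤r l) (subst (r l ^ j ≤_) (1^ j) (^-mono-≤ j (0≤r l) (r≤1 l))))
      (≤-reflexive (*-identityʳ (r l)))

  r-telescope : ∀ l → r (suc l) ≤ u l - u (suc l)
  r-telescope l = ≤-trans (*-monoʳ (0≤u (suc l)) (inv-antimono (0<ι l) (ι-mono-≤ (ℕ.n≤1+n (suc l)))))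
      (≤-reflexive (begin
    u l * u (suc l)                     ≡⟨ *-identityˡ _ ⟨
    1ℚ * (u l * u (suc l))              ≡⟨ cong (_* (u l * u (suc l)))
        (trans (cong (_- ι (suc l)) (ι-suc (suc l)))
        (solve 1 (λ l → con 1ℚ :+ l :- l := con 1ℚ) refl (ι (suc l)))) ⟨
    (ι (suc (suc l)) - ι (suc l)) * (u l * u (suc l)) ≡⟨ solve 4
        (λ b a u v → (b :- a) :* (u :* v) := u :* (b :* v) :- v :* (a :* u)) refl (ι (suc (suc l))) (ι (suc l))
        (u l) (u (suc l)) ⟩
    u l * (ι (suc (suc l)) * u (suc l)) - u (suc l) * (ι (suc l) * u l) ≡⟨ cong₂
        (λ s t → u l * s - u (suc l) * t) (inverseʳ (ι≢0 (suc l))) (inverseʳ (ι≢0 l)) ⟩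
    u l * 1ℚ - u (suc l) * 1ℚ           ≡⟨ cong₂ _-_ (*-identityʳ (u l)) (*-identityʳ (u (suc l))) ⟩
    u l - u (suc l)                     ∎))
    where open ≡-Reasoning

  Σr-tail : ∀ M t → Σ< t (λ i → r (suc M ℕ.+ i)) ≤ u M
  Σr-tail M t = ≤-trans (Σ-mono t (λ i _ → r-telescope (M ℕ.+ i)))
      (≤-trans (≤-reflexive
      (trans (trans (Σ-cong t
      (λ i → trans (solve 2 (λ a b → a :- b := :- (b :- a)) refl (u (M ℕ.+ i)) (u (suc (M ℕ.+ i))))
     (cong (λ k → - (u k - u (M ℕ.+ i))) (sym (ℕ.+-suc M i))))) (Σ-neg t _))
         (cong -_ (Σ-telescope t (λ i → u (M ℕ.+ i))))))
    (≤-fromDiff (trans (cong (λ k → u M - - (u (M ℕ.+ t) - u k)) (ℕ.+-identityʳ M))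
        (solve 2 (λ a b → a :- (:- (b :- a)) := b) refl (u M) (u (M ℕ.+ t)))) (0≤u (M ℕ.+ t))))

  Z : ℕ → ℕ → ℚ
  Z j N = Σ< N (λ l → r l ^ j)

  0≤Z : ∀ j N → 0ℚ ≤ Z j N
  0≤Z j N = 0≤Σ N (λ l _ → 0≤^ j (0≤r l))

  Z₁≤2 : ∀ N → Z 1 N ≤ 2ℚ
  Z₁≤2 zero = <⇒≤ (positive⁻¹ 2ℚ)
  Z₁≤2 (suc N) = ≤-trans (≤-reflexive (Σ-head N (λ l → r l ^ 1))) (+-mono-≤ (≤-trans (r^≤r 0 0) (r≤1 0))
    (≤-trans (Σ-mono N (λ i _ → r^≤r 0 (suc i))) (≤-trans (Σr-tail 0 N) (u≤1 0))))

  Z≤2 : ∀ j N → Z (suc j) N ≤ 2ℚ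
  Z≤2 j N = ≤-trans (Σ-mono N (λ l _ → ≤-trans (r^≤r j l) (≤-reflexive (sym (*-identityʳ (r l)))))) (Z₁≤2 N)

  Z-bounded : ∀ j → Bounded (Z (suc j))
  Z-bounded j = bounded-≤ 2ℚ (positive⁻¹ 2ℚ) (λ N → subst (_≤ 2ℚ) (sym (0≤p⇒∣p∣≡p (0≤Z (suc j) N))) (Z≤2 j N))

  1≤Z : ∀ j N → 1ℚ ≤ Z j (suc N)
  1≤Z j N = ≤-trans (≤-reflexive
      (trans (sym (trans (cong (λ i → (inv i * inv i) ^ j) ι1) (1^ j))) (sym (+-identityʳ (r 0 ^ j)))))
    (≤-trans (+-monoʳ-≤ (r 0 ^ j) (0≤Σ N (λ l _ → 0≤^ j (0≤r (suc l)))))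
        (≤-reflexive (sym (Σ-head N (λ l → r l ^ j)))))

  module _ (N : ℕ) where
    -- Here inv 0 = 0, so the term with suc k = l is left out of `T`. `R` collects the end terms
    -- caused by truncation at N.
    T S R : ℕ → ℚ
    T l = Σ< N (λ k → inv (ι (suc k) - ι l))
    S l = Σ< N (λ k → inv (ι (suc k) + ι l))
    R l = Σ< l (λ j → inv (ι N - ι j) + inv (ι (suc N) + ι j))

    Σ-rotate : ∀ (f : ℕ → ℚ) → Σ< N (λ k → f (suc k)) ≡ Σ< N f - f 0 + f N
    Σ-rotate f = trans (solve 2 (λ a b → b := (a :+ b) :- a) refl (f 0) (Σ< N (λ k → f (suc k))))
        (trans (cong (_- f 0) (sym (Σ-head N f)))
      (solve 3 (λ s a b → s :+ b :- a := s :- a :+ b) refl (Σ< N f) (f 0) (f N)))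

    T-suc : ∀ l → T (suc l) ≡ T l - inv (ι l) - inv (ι N - ι l)
    T-suc l = trans (Σ-cong N
        (λ k → cong inv (trans (cong₂ _-_ (ι-suc k) (ι-suc l))
        (solve 2 (λ k l → con 1ℚ :+ k :- (con 1ℚ :+ l) := k :- l) refl (ι k) (ι l)))))
      (trans (solve 3 (λ s a b → s := s :- a :+ b :+ a :- b) refl (Σ< N (λ k → inv (ι k - ι l)))
          (inv (ι 0 - ι l)) (inv (ι N - ι l)))
      (cong₂ (λ t a → t + a - inv (ι N - ι l)) (sym (Σ-rotate (λ k → inv (ι k - ι l))))
        (trans (cong inv (trans (cong (_- ι l) ι0) (+-identityˡ (- ι l)))) (inv-neg (ι l)))))

    S-suc : ∀ l → S (suc l) ≡ S l - inv (ι (suc l)) + inv (ι (suc N) + ι l)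
    S-suc l = trans (Σ-cong N
        (λ k → cong inv (trans (cong (ι (suc k) +_) (ι-suc l))
        (trans (solve 2 (λ k l → k :+ (con 1ℚ :+ l) := con 1ℚ :+ k :+ l) refl (ι (suc k)) (ι l))
        (cong (_+ ι l) (sym (ι-suc (suc k))))))))
      (trans (Σ-rotate (λ k → inv (ι (suc k) + ι l)))
          (cong (λ v → S l - inv v + inv (ι (suc N) + ι l)) (trans (cong (_+ ι l) ι1) (sym (ι-suc l)))))

    -- From l to l + 1 the range of summation moves by one place, so only end terms change; at l = 0
    -- the two sums coincide. For N → ∞ the difference tends to 1/l.
    T-S : ∀ l → T l - S l ≡ inv (ι l) - R l
    T-S zero = trans (trans (cong₂ _-_
        (Σ-cong N (λ k → cong inv (trans (cong (λ v → ι (suc k) - v) ι0) (+-identityʳ (ι (suc k))))))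
       (Σ-cong N (λ k → cong inv (trans (cong (ι (suc k) +_) ι0) (+-identityʳ (ι (suc k)))))))
           (+-inverseʳ (Σ< N u))) (sym (cong (_- 0ℚ) inv-0))
    T-S (suc l) = trans (cong₂ _-_ (T-suc l) (S-suc l)) (trans
      (solve 6 (λ t s a b c d → t :- a :- b :- (s :- c :+ d) := t :- s :- a :+ c :- (b :+ d)) refl (T l) (S l)
          (inv (ι l)) (inv (ι N - ι l)) (inv (ι (suc l))) (inv (ι (suc N) + ι l)))
      (trans (cong (λ v → v - inv (ι l) + inv (ι (suc l)) - (inv (ι N - ι l) + inv (ι (suc N) + ι l))) (T-S l))
      (solve 4 (λ a c r e → a :- r :- a :+ c :- e := c :- (r :+ e)) refl (inv (ι l)) (inv (ι (suc l))) (R l)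
          (inv (ι N - ι l) + inv (ι (suc N) + ι l)))))

    ι-∸ : ∀ {j} → j ℕ.< N → ι N - ι j ≡ ι (suc (N ℕ.∸ suc j))
    ι-∸ {j} j<N = trans (cong (λ M → ι M - ι j) (sym (trans (ℕ.+-suc j (N ℕ.∸ suc j)) (ℕ.m+[n∸m]≡n j<N))))
        (trans (cong (_- ι j) (ι-+ j (suc (N ℕ.∸ suc j))))
      (solve 2 (λ j m → j :+ m :- j := m) refl (ι j) (ι (suc (N ℕ.∸ suc j)))))

    0<N-j : ∀ {j} → j ℕ.< N → 0ℚ < ι N - ι j
    0<N-j {j} j<N = subst (0ℚ <_) (sym (ι-∸ j<N)) (0<ι (N ℕ.∸ suc j))

    0<N+j : ∀ j → 0ℚ < ι (suc N) + ι j
    0<N+j j = subst (0ℚ <_) (ι-+ (suc N) j) (0<ι (N ℕ.+ j))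

    0≤R : ∀ {l} → l ℕ.≤ N → 0ℚ ≤ R l
    0≤R {l} l≤N = 0≤Σ l (λ j j<l → 0≤+ (0≤inv (0<N-j (ℕ.<-≤-trans j<l l≤N))) (0≤inv (0<N+j j)))

    R≤ : ∀ l → l ℕ.< N → R (suc l) ≤ ι (suc l) * (2ℚ * inv (ι N - ι l))
    R≤ l l<N = ≤-trans (Σ-mono (suc l) (λ j j≤l → +-mono-≤
        (inv-antimono (0<N-j l<N) (+-monoʳ-≤ (ι N) (neg-antimono-≤ (ι-mono-≤ (ℕ.s≤s⁻¹ j≤l)))))
        (inv-antimono (0<N-j l<N)
            (≤-trans (+-mono-≤ (ι-mono-≤ (ℕ.n≤1+n N)) (≤-trans (neg-antimono-≤ (0≤ι l)) (0≤ι j))) ≤-refl))))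
      (≤-trans (≤-reflexive (Σ-const (suc l) _))
          (≤-reflexive (cong (ι (suc l) *_) (solve 1 (λ v → v :+ v := con 2ℚ :* v) refl (inv (ι N - ι l))))))

    Δ : ℕ → ℕ → ℚ
    Δ l k = ι (suc k) * ι (suc k) - ι (suc l) * ι (suc l)

    2L : ℕ → ℚ
    2L l = ι (suc l) + ι (suc l)

    0<2L : ∀ l → 0ℚ < 2L l
    0<2L l = +-mono-< (0<ι l) (0<ι l)

    inv-2L : ∀ l → inv (2L l) ≡ ½ * u l
    inv-2L l = sym (inv-unique (2L l)
        (trans (solve 2 (λ l u → (l :+ l) :* (con ½ :* u) := l :* u) refl (ι (suc l)) (u l))
        (inverseʳ (ι≢0 l))))

    -- Partial fractions. At k = l the left side is the default value inv 0 = 0, and the term with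
    -- `δ` restores equality there.
    inv-Δ : ∀ l k → inv (Δ l k) ≡ inv (2L l) *
        (inv (ι (suc k) - ι (suc l)) - inv (ι (suc k) + ι (suc l)) + δ k l * inv (2L l))
    inv-Δ l k with k ℕ.≟ l
    ... | yes refl = trans (cong inv (+-inverseʳ (ι (suc k) * ι (suc k))))
        (sym (trans (cong₂ (λ z d → inv (2L k) * (z - inv (2L k) + d * inv (2L k)))
        (cong inv (+-inverseʳ (ι (suc k)))) (δ-refl k))
        (solve 1 (λ v → v :* (con 0ℚ :- v :+ con 1ℚ :* v) := con 0ℚ) refl (inv (2L k)))))
    ... | no k≢l = begin
        inv (Δ l k)                                  ≡⟨ cong inv
            (solve 2 (λ k l → k :* k :- l :* l := (k :- l) :* (k :+ l)) refl K L) ⟩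
        inv ((K - L) * (K + L))                      ≡⟨ inv-* K-L≢0 K+L≢0 ⟩
        v * w                                        ≡⟨ *-identityˡ (v * w) ⟨
        1ℚ * (v * w)                                 ≡⟨ cong (_* (v * w)) (inverseˡ (<⇒≢0 (0<2L l))) ⟨
        inv (2L l) * 2L l * (v * w)                  ≡⟨ solve 5
            (λ i k l v w → i :* (l :+ l) :* (v :* w) := i :*
            (((k :+ l) :* w) :* v :- ((k :- l) :* v) :* w :+ con 0ℚ :* i)) refl (inv (2L l)) K L v w ⟩
        inv (2L l) * (((K + L) * w) * v - ((K - L) * v) * w + 0ℚ * inv (2L l))
          ≡⟨ cong₂ (λ x y → inv (2L l) * (x * v - y * w + 0ℚ * inv (2L l))) (inverseʳ K+L≢0) (inverseʳ K-L≢0) ⟩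
        inv (2L l) * (1ℚ * v - 1ℚ * w + 0ℚ * inv (2L l)) ≡⟨ cong (λ d → inv (2L l) * (d + 0ℚ * inv (2L l)))
            (cong₂ _-_ (*-identityˡ v) (*-identityˡ w)) ⟩
        inv (2L l) * (v - w + 0ℚ * inv (2L l))       ≡⟨ cong (λ d → inv (2L l) * (v - w + d * inv (2L l)))
            (δ-≢ k≢l) ⟨
        inv (2L l) * (v - w + δ k l * inv (2L l)) ∎
      where
      open ≡-Reasoning
      K L v w : ℚ
      K = ι (suc k)
      L = ι (suc l)
      v = inv (K - L)
      w = inv (K + L)
      K-L≢0 : K - L ≢ 0ℚ
      K-L≢0 eq = k≢l (ℕ.suc-injective
          (ι-injective (trans (solve 2 (λ k l → k := k :- l :+ l) refl K L)
          (trans (cong (_+ L) eq) (+-identityˡ L)))))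
      K+L≢0 : K + L ≢ 0ℚ
      K+L≢0 = <⇒≢0 (+-mono-< (0<ι k) (0<ι l))

    -- Finite form of the classical sum of 1/(k² - l²) over k ≠ l, which is 3/(4l²); the role of l
    -- is played by suc l.
    Σ-inv-Δ : ∀ l → l ℕ.< N → Σ< N (λ k → inv (Δ l k)) ≡ ½ * u l * (ℤ.+ 3 / 2 * u l - R (suc l))
    Σ-inv-Δ l l<N = begin
      Σ< N (λ k → inv (Δ l k)) ≡⟨ Σ-cong N (inv-Δ l) ⟩
      Σ< N (λ k → i * (inv (ι (suc k) - L) - inv (ι (suc k) + L) + δ k l * i)) ≡⟨ Σ-*ˡ N i _ ⟩
      i * Σ< N (λ k → inv (ι (suc k) - L) - inv (ι (suc k) + L) + δ k l * i)
        ≡⟨ cong (i *_) (trans (Σ-+ N _ _) (cong₂ _+_ (trans (Σ-- N _ _) (T-S (suc l))) (Σ-δ N l (λ _ → i) l<N)))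
            ⟩
      i * (u l - R (suc l) + i) ≡⟨ cong (λ i → i * (u l - R (suc l) + i)) (inv-2L l) ⟩
      ½ * u l * (u l - R (suc l) + ½ * u l) ≡⟨ solve 2
          (λ u r → con ½ :* u :* (u :- r :+ con ½ :* u) := con ½ :* u :* (con (ℤ.+ 3 / 2) :* u :- r)) refl (u l)
          (R (suc l)) ⟩
      ½ * u l * (ℤ.+ 3 / 2 * u l - R (suc l)) ∎
      where
      open ≡-Reasoning
      i L : ℚ
      i = inv (2L l)
      L = ι (suc l)

    module _ (m : ℕ) where
      error : ℚ
      error = Σ< N (λ l → r l ^ suc m * (u l * R (suc l)))

      pair : ℕ → ℕ → ℚ
      pair l k = anti (λ i j → r l ^ suc i * r k ^ suc j) m

      -- A finite geometric sum: with A = 1/l² and B = 1/k² the difference k² - l² is 1/B - 1/A, and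
      -- multiplication by it telescopes the sum. On the diagonal all m + 1 terms are equal.
      pair-≢ : ∀ l k → pair l k ≡ inv (Δ l k) * r l ^ suc m - inv (Δ l k) * r k ^ suc m + δ k l *
          (ι (suc m) * r l ^ suc (suc m))
      pair-≢ l k with k ℕ.≟ l
      ... | yes refl = trans (diagonal (r k) m)
          (sym (trans (cong (λ d → inv (Δ k k) * r k ^ suc m - inv (Δ k k) * r k ^ suc m + d *
          (ι (suc m) * r k ^ suc (suc m))) (δ-refl k))
          (solve 2 (λ x y → x :- x :+ con 1ℚ :* y := y) refl (inv (Δ k k) * r k ^ suc m)
              (ι (suc m) * r k ^ suc (suc m)))))
        where
        diagonal : ∀ a m → anti (λ i j → a ^ suc i * a ^ suc j) m ≡ ι (suc m) * a ^ suc (suc m)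
        diagonal a zero = trans (solve 1 (λ a → a :* con 1ℚ :* (a :* con 1ℚ) := con 1ℚ :* (a :* (a :* con 1ℚ)))
            refl a) (cong (_* a ^ 2) (sym ι1))
        diagonal a (suc m) = trans
            (cong (a ^ 1 * a ^ suc (suc m) +_)
            (trans (anti-cong m (λ i j → *-assoc a (a ^ suc i) (a ^ suc j)))
            (trans (anti-*ˡ m a _) (cong (a *_) (diagonal a m)))))
          (trans (solve 3 (λ a p i → a :* con 1ℚ :* p :+ a :* (i :* p) := (con 1ℚ :+ i) :* (a :* p)) refl a
              (a ^ suc (suc m)) (ι (suc m)))
            (cong (_* (a * a ^ suc (suc m))) (sym (ι-suc (suc m)))))
      ... | no k≢l = trans (trans (sym (*-identityˡ (pair l k)))
          (trans (cong (_* pair l k) (sym (inverseˡ Δ≢0)))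
          (trans (*-assoc (inv (Δ l k)) (Δ l k) (pair l k)) (cong (inv (Δ l k) *_) (geometric m)))))
          (sym (trans (cong (λ d → inv (Δ l k) * r l ^ suc m - inv (Δ l k) * r k ^ suc m + d *
              (ι (suc m) * r l ^ suc (suc m))) (δ-≢ k≢l))
            (solve 4 (λ i x y z → i :* x :- i :* y :+ con 0ℚ :* z := i :* (x :- y)) refl (inv (Δ l k))
                (r l ^ suc m) (r k ^ suc m) (ι (suc m) * r l ^ suc (suc m)))))
        where
        K L A B : ℚ
        K = ι (suc k)
        L = ι (suc l)
        A = r l
        B = r k
        LA : L * L * A ≡ 1ℚ
        LA = trans (solve 2 (λ l u → l :* l :* (u :* u) := (l :* u) :* (l :* u)) refl L (u l))
            (cong₂ _*_ (inverseʳ (ι≢0 l)) (inverseʳ (ι≢0 l)))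
        KB : K * K * B ≡ 1ℚ
        KB = trans (solve 2 (λ l u → l :* l :* (u :* u) := (l :* u) :* (l :* u)) refl K (u k))
            (cong₂ _*_ (inverseʳ (ι≢0 k)) (inverseʳ (ι≢0 k)))
        Δ≢0 : Δ l k ≢ 0ℚ
        Δ≢0 eq = *-≢0 {K - L} {K + L}
          (λ eq → k≢l (ℕ.suc-injective
              (ι-injective (trans (solve 2 (λ k l → k := k :- l :+ l) refl K L)
              (trans (cong (_+ L) eq) (+-identityˡ L))))))
          (<⇒≢0 (+-mono-< (0<ι k) (0<ι l)))
              (trans (solve 2 (λ k l → (k :- l) :* (k :+ l) := k :* k :- l :* l) refl K L) eq)
        geometric : ∀ m → Δ l k * anti (λ i j → A ^ suc i * B ^ suc j) m ≡ A ^ suc m - B ^ suc m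
        geometric zero = trans (solve 4
            (λ k l a b → (k :- l) :* (a :* con 1ℚ :* (b :* con 1ℚ)) := (k :* b) :* a :- (l :* a) :* b) refl
            (K * K) (L * L) A B)
          (trans (cong₂ (λ x y → x * A - y * B) KB LA)
              (solve 2 (λ a b → con 1ℚ :* a :- con 1ℚ :* b := a :* con 1ℚ :- b :* con 1ℚ) refl A B))
        geometric (suc m) = begin
          Δ l k * (A ^ 1 * (B * B ^ suc m) + anti (λ i j → A * A ^ suc i * B ^ suc j) m)
            ≡⟨ cong (λ z → Δ l k * (A ^ 1 * (B * B ^ suc m) + z))
                (trans (anti-cong m (λ i j → *-assoc A (A ^ suc i) (B ^ suc j))) (anti-*ˡ m A _)) ⟩
          Δ l k * (A ^ 1 * (B * B ^ suc m) + A * g)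
            ≡⟨ solve 6 (λ k l a b p g → (k :- l) :* (a :* con 1ℚ :* (b :* p) :+ a :* g) := (k :* b) :*
                (a :* p) :- (l :* a) :* (b :* p) :+ a :* ((k :- l) :* g)) refl (K * K) (L * L) A B
                (B ^ suc m) g ⟩
          (K * K * B) * (A * B ^ suc m) - (L * L * A) * (B * B ^ suc m) + A * (Δ l k * g)
            ≡⟨ cong₂ _+_ (cong₂ (λ x y → x * (A * B ^ suc m) - y * (B * B ^ suc m)) KB LA)
                (cong (A *_) (geometric m)) ⟩
          1ℚ * (A * B ^ suc m) - 1ℚ * (B * B ^ suc m) + A * (A ^ suc m - B ^ suc m)
            ≡⟨ solve 4 (λ a b p q → con 1ℚ :* (a :* q) :- con 1ℚ :* (b :* q) :+ a :*
                (p :- q) := a :* p :- b :* q) refl A B (A ^ suc m) (B ^ suc m) ⟩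
          A ^ suc (suc m) - B ^ suc (suc m) ∎
          where
          open ≡-Reasoning
          g : ℚ
          g = anti (λ i j → A ^ suc i * B ^ suc j) m

      -- Finite form of Euler's identity: the sum of ζ(2i) ζ(2n - 2i) over 0 < i < n is (n + 1/2)
      -- ζ(2n), with n = m + 2. The diagonal contributes m + 1; the two parts of `pair-≢` are equal
      -- by the antisymmetry of 1/(k² - l²) and contribute 3/4 each.
      Z-convolution : anti (λ i j → Z (suc i) N * Z (suc j) N) m ≡ (ι (suc m) + ℤ.+ 3 / 2) * Z
          (suc (suc m)) N - error
      Z-convolution = begin
        anti (λ i j → Z (suc i) N * Z (suc j) N) m
          ≡⟨ anti-cong m (λ i j → trans (sym (Σ-*ʳ N (Z (suc j) N) _))
              (Σ-cong N (λ l → sym (Σ-*ˡ N (r l ^ suc i) _)))) ⟩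
        anti (λ i j → Σ< N (λ l → Σ< N (λ k → r l ^ suc i * r k ^ suc j))) m
          ≡⟨ trans (anti-Σ m N (λ i j l → Σ< N (λ k → r l ^ suc i * r k ^ suc j)))
              (Σ-cong N (λ l → anti-Σ m N (λ i j k → r l ^ suc i * r k ^ suc j))) ⟩
        Σ< N (λ l → Σ< N (λ k → pair l k))
          ≡⟨ Σ-cong N (λ l → trans (Σ-cong N (pair-≢ l))
              (trans (Σ-+ N _ _) (cong (_+ Σ< N (λ k → δ k l * D l))
              (Σ-- N (λ k → inv (Δ l k) * r l ^ suc m) (λ k → inv (Δ l k) * r k ^ suc m))))) ⟩
        Σ< N (λ l → Σ< N (λ k → inv (Δ l k) * r l ^ suc m) - Σ< N (λ k → inv (Δ l k) * r k ^ suc m) + Σ< N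
            (λ k → δ k l * D l))
          ≡⟨ trans (Σ-+ N _ _) (cong₂ _+_
              (Σ-- N (λ l → Σ< N (λ k → inv (Δ l k) * r l ^ suc m))
              (λ l → Σ< N (λ k → inv (Δ l k) * r k ^ suc m)))
              (trans (Σ-cong< N (λ l l<N → Σ-δ N l (λ _ → D l) l<N)) (Σ-*ˡ N (ι (suc m)) _))) ⟩
        s - Σ< N (λ l → Σ< N (λ k → inv (Δ l k) * r k ^ suc m)) + ι (suc m) * z
          ≡⟨ cong (λ t → s - t + ι (suc m) * z)
              (trans (Σ-swap N N (λ l k → inv (Δ l k) * r k ^ suc m))
              (trans (Σ-cong N (λ k → trans
              (Σ-cong N (λ l → trans (cong (_* r k ^ suc m) (Δ-sym k l))
              (sym (neg-distribˡ-* (inv (Δ k l)) (r k ^ suc m))))) (Σ-neg N _))) (Σ-neg N _))) ⟩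
        s - - s + ι (suc m) * z
          ≡⟨ cong (λ s → s - - s + ι (suc m) * z)
              (trans (Σ-cong< N (λ l l<N → trans (Σ-*ʳ N (r l ^ suc m) _)
              (trans (cong (_* r l ^ suc m) (Σ-inv-Δ l l<N))
               (solve 3 (λ u R p → con ½ :* u :* (con (ℤ.+ 3 / 2) :* u :- R) :* p := con ½ :*
                   (con (ℤ.+ 3 / 2) :* (u :* u :* p) :- p :* (u :* R))) refl (u l) (R (suc l)) (r l ^ suc m)))))
               (trans (Σ-*ˡ N ½ _) (cong (½ *_)
                   (trans (Σ-- N (λ l → ℤ.+ 3 / 2 * r l ^ suc (suc m)) (λ l → r l ^ suc m * (u l * R (suc l))))
                   (cong (_- error) (Σ-*ˡ N (ℤ.+ 3 / 2) _)))))) ⟩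
        ½ * (ℤ.+ 3 / 2 * z - error) - - (½ * (ℤ.+ 3 / 2 * z - error)) + ι (suc m) * z
          ≡⟨ solve 3 (λ z e m → (let h = con ½ :* (con (ℤ.+ 3 / 2) :* z :- e) in h :- :- h :+ m :* z) := (m :+ con (ℤ.+ 3 / 2)) :* z :- e) refl z error (ι (suc m)) ⟩
        (ι (suc m) + ℤ.+ 3 / 2) * z - error ∎
        where
        open ≡-Reasoning
        D : ℕ → ℚ
        D l = ι (suc m) * r l ^ suc (suc m)
        s z : ℚ
        s = Σ< N (λ l → Σ< N (λ k → inv (Δ l k) * r l ^ suc m))
        z = Z (suc (suc m)) N
        Δ-sym : ∀ k l → inv (Δ l k) ≡ - inv (Δ k l)
        Δ-sym k l = trans (cong inv
            (solve 2 (λ a b → a :- b := :- (b :- a)) refl (ι (suc k) * ι (suc k)) (ι (suc l) * ι (suc l))))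
            (inv-neg (Δ k l))

      0≤error : 0ℚ ≤ error
      0≤error = 0≤Σ N (λ l l<N → 0≤* (0≤^ (suc m) (0≤r l)) (0≤* (0≤u l) (0≤R l<N)))

      -- With u = 1/(l + 1) and v = 1/(N - l) a term is at most 2u²v. Since (l + 1) + (N - l) = N +
      -- 1, one has u v = (u + v)/(N + 1); used twice, this bounds the sum by a multiple of 1/(N +
      -- 1).
      error≤ : error ≤ ℤ.+ 8 / 1 * u N
      error≤ = begin
        error ≤⟨ Σ-mono N term ⟩
        Σ< N (λ l → 2ℚ * u N * (r l + 2ℚ * u N)) ≡⟨ trans (Σ-*ˡ N (2ℚ * u N) _)
            (cong (2ℚ * u N *_) (trans (Σ-+ N r _) (cong (Σ< N r +_) (Σ-const N (2ℚ * u N))))) ⟩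
        2ℚ * u N * (Σ< N r + ι N * (2ℚ * u N)) ≤⟨ *-monoˡ (0≤* (<⇒≤ (positive⁻¹ 2ℚ)) (0≤u N))
            (+-mono-≤ (≤-trans (≤-reflexive (Σ-cong N (λ l → sym (*-identityʳ (r l))))) (Z₁≤2 N)) Nu≤) ⟩
        2ℚ * u N * (2ℚ + 2ℚ) ≡⟨ solve 1 (λ u → con 2ℚ :* u :* con (2ℚ + 2ℚ) := con (ℤ.+ 8 / 1) :* u) refl
            (u N) ⟩
        ℤ.+ 8 / 1 * u N ∎
        where
        open ≤-Reasoning
        Nu≤ : ι N * (2ℚ * u N) ≤ 2ℚ
        Nu≤ = ≤-trans (*-monoʳ (0≤* (<⇒≤ (positive⁻¹ 2ℚ)) (0≤u N)) (ι-mono-≤ (ℕ.n≤1+n N)))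
          (≤-reflexive (trans (solve 2 (λ n u → n :* (con 2ℚ :* u) := con 2ℚ :* (n :* u)) refl (ι (suc N))
              (u N)) (cong (2ℚ *_) (inverseʳ (ι≢0 N)))))
        term : ∀ l → l ℕ.< N → r l ^ suc m * (u l * R (suc l)) ≤ 2ℚ * u N * (r l + 2ℚ * u N)
        term l l<N = begin
          r l ^ suc m * (u l * R (suc l)) ≤⟨ *-mono-≤ (0≤^ (suc m) (0≤r l)) (0≤* (0≤u l) (0≤R l<N)) (r^≤r m l)
              (*-monoˡ (0≤u l) (R≤ l l<N)) ⟩
          r l * (u l * (ι (suc l) * (2ℚ * v))) ≡⟨ solve 3
              (λ u l v → (u :* u) :* (u :* (l :* (con 2ℚ :* v))) := con 2ℚ :* (u :* (u :* v :* (l :* u)))) refl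
              (u l) (ι (suc l)) v ⟩
          2ℚ * (u l * (u l * v * (ι (suc l) * u l))) ≡⟨ cong (λ z → 2ℚ * (u l * z))
              (trans (cong (u l * v *_) (inverseʳ (ι≢0 l))) (trans (*-identityʳ (u l * v)) uv)) ⟩
          2ℚ * (u l * (u N * (u l + v))) ≡⟨ solve 3
              (λ u w v → con 2ℚ :* (u :* (w :* (u :+ v))) := con 2ℚ :* w :* (u :* u :+ u :* v)) refl (u l)
              (u N) v ⟩
          2ℚ * u N * (r l + u l * v) ≡⟨ cong (λ z → 2ℚ * u N * (r l + z)) uv ⟩
          2ℚ * u N * (r l + u N * (u l + v)) ≤⟨ *-monoˡ (0≤* (<⇒≤ (positive⁻¹ 2ℚ)) (0≤u N))
              (+-monoʳ-≤ (r l) (≤-trans (*-monoˡ (0≤u N) (+-mono-≤ (u≤1 l) v≤1))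
              (≤-reflexive (*-comm (u N) 2ℚ)))) ⟩
          2ℚ * u N * (r l + 2ℚ * u N) ∎
          where
          v : ℚ
          v = inv (ι N - ι l)
          v≤1 : v ≤ 1ℚ
          v≤1 = ≤-trans (≤-reflexive (cong inv (ι-∸ l<N))) (u≤1 (N ℕ.∸ suc l))
          uv : u l * v ≡ u N * (u l + v)
          uv = *-cancelˡ (ι≢0 N) (trans
              (trans (cong (_* (u l * v))
              (trans (ι-suc N) (trans
              (solve 2 (λ n l → con 1ℚ :+ n := (n :- l) :+ (con 1ℚ :+ l)) refl (ι N) (ι l))
              (cong (ι N - ι l +_) (sym (ι-suc l))))))
            (trans (solve 4 (λ a b u v → (a :+ b) :* (u :* v) := (a :* v) :* u :+ (b :* u) :* v) refl
                (ι N - ι l) (ι (suc l)) (u l) v)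
              (trans (cong₂ (λ x y → x * u l + y * v) (inverseʳ (<⇒≢0 (0<N-j l<N))) (inverseʳ (ι≢0 l)))
                  (cong₂ _+_ (*-identityˡ (u l)) (*-identityˡ v)))))
            (trans (sym (*-identityˡ (u l + v)))
                (trans (cong (_* (u l + v)) (sym (inverseʳ (ι≢0 N)))) (*-assoc (ι (suc N)) (u N) (u l + v)))))

  Euler-convolution : ∀ m → (λ N → anti (λ i j → Z (suc i) N * Z (suc j) N) m) ~
      (λ N → (ι (suc m) + ℤ.+ 3 / 2) * Z (suc (suc m)) N)
  Euler-convolution m = ~-by-inv (ℤ.+ 8 / 1) (positive⁻¹ (ℤ.+ 8 / 1)) (λ N → subst (_≤ ℤ.+ 8 / 1 * u N)
    (trans (sym (trans (∣-p∣≡∣p∣ (error N m)) (0≤p⇒∣p∣≡p (0≤error N m))))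
        (cong ∣_∣ (sym (trans (cong (_- (ι (suc m) + ℤ.+ 3 / 2) * Z (suc (suc m)) N) (Z-convolution N m))
      (solve 2 (λ z e → z :- e :- z := :- e) refl ((ι (suc m) + ℤ.+ 3 / 2) * Z (suc (suc m)) N) (error N m))))))
          (error≤ N m))

  -- B_{2n}/(2n)! satisfies the same convolution, up to sign.
  y-convolution : ∀ m → anti (λ i j → y ! suc i * y ! suc j) m ≡ -
      (ι (suc (dbl (suc (suc m)))) * y ! suc (suc m))
  y-convolution m = trans (solve 2 (λ s z → s := (z :+ (s :+ z)) :- (z :+ z)) refl s z) (trans
    (cong (_- (z + z)) (sym square))
        (trans (solve 2 (λ q z → q :- (z :+ z) := :- (z :- q :+ con 0ℚ) :- z) refl ((y ⊗ y) ! n) z)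
    (trans (cong (λ t → - t - z)
        (trans (cong (z - (y ⊗ y) ! n +_) (sym (trans (κ-⊗ ¼ X n) (*-zeroʳ ¼))))
        (trans (sym (at y-Riccati n)) (κ-⊗ 2ℚ (θ y) n))))
    (trans (solve 2 (λ n z → :- (con 2ℚ :* (n :* z)) :- z := :- ((con 1ℚ :+ (n :+ n)) :* z)) refl (ι n) z)
      (cong (λ k → - (k * z)) (sym (trans (ι-suc (dbl n)) (cong (1ℚ +_) (ι-dbl n)))))))))
    where
    n : ℕ
    n = suc (suc m)
    s z : ℚ
    s = anti (λ i j → y ! suc i * y ! suc j) m
    z = y ! n
    square : (y ⊗ y) ! n ≡ z + (s + z)
    square = cong₂ _+_ (trans (cong (_* z) y-0) (*-identityˡ z))
        (trans (anti-last m (λ i j → y ! suc i * y ! j))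
        (cong (s +_) (trans (cong (z *_) y-0) (*-identityʳ z))))

  24ℚ : ℚ
  24ℚ = ℤ.+ 24 / 1

  -- (2πi)²
  Λ : ℕ → ℚ
  Λ N = - (24ℚ * Z 1 N)

  Λ-bounded : Bounded Λ
  Λ-bounded = bounded-≤ (24ℚ * 2ℚ) (positive⁻¹ (24ℚ * 2ℚ))
      (λ N → subst (_≤ 24ℚ * 2ℚ)
      (sym (trans (∣-p∣≡∣p∣ (24ℚ * Z 1 N)) (0≤p⇒∣p∣≡p (0≤* (<⇒≤ (positive⁻¹ 24ℚ)) (0≤Z 1 N)))))
    (*-monoˡ (<⇒≤ (positive⁻¹ 24ℚ)) (Z₁≤2 N)))

  -- ζ(2n) = -B₂ₙ (2πi)²ⁿ / (2 (2n)!), where (2πi)² is defined through ζ(2): the case of ζ(2) is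
  -- then an identity, and the others follow because both sides satisfy the same convolution.
  Euler : ∀ n → (λ N → 2ℚ * Z (suc n) N) ~ (λ N → - y ! suc n * Λ N ^ suc n)
  Euler = <-rec _ go
    where
    go : ∀ n → (∀ {i} → i ℕ.< n → (λ N → 2ℚ * Z (suc i) N) ~ (λ N → - y ! suc i * Λ N ^ suc i)) →
        (λ N → 2ℚ * Z (suc n) N) ~ (λ N → - y ! suc n * Λ N ^ suc n)
    go zero _ = ~-reflexive (λ N → sym
        (trans (cong (λ v → - v * Λ N ^ 1) y-1)
        (solve 1 (λ z → con (- 1/12) :* (:- (con 24ℚ :* z) :* con 1ℚ) := con 2ℚ :* z) refl (Z 1 N))))
    go (suc m) rec = ~-cancel-const (ι (suc (dbl (suc (suc m))))) (ι≢0 (dbl (suc (suc m))))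
        (~-trans (~-reflexive left)
      (~-trans (~-sym (~-*ˡ (2ℚ * 2ℚ) (Euler-convolution m)))
          (~-trans (~-reflexive distribute) (~-trans products (~-reflexive right)))))
      where
      left : ∀ N → ι (suc (dbl (suc (suc m)))) * (2ℚ * Z (suc (suc m)) N) ≡ 2ℚ * 2ℚ *
          ((ι (suc m) + ℤ.+ 3 / 2) * Z (suc (suc m)) N)
      left N = trans (cong (_* (2ℚ * Z (suc (suc m)) N))
          (trans (ι-suc (dbl (suc (suc m))))
          (cong (1ℚ +_) (trans (ι-dbl (suc (suc m))) (cong₂ _+_ (ι-suc (suc m)) (ι-suc (suc m)))))))
        (solve 2 (λ m z → (con 1ℚ :+ (con 1ℚ :+ m :+ (con 1ℚ :+ m))) :* (con 2ℚ :* z) := con (2ℚ * 2ℚ) :*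
            ((m :+ con (ℤ.+ 3 / 2)) :* z)) refl (ι (suc m)) (Z (suc (suc m)) N))
      distribute : ∀ N → 2ℚ * 2ℚ * anti (λ i j → Z (suc i) N * Z (suc j) N) m ≡ anti
          (λ i j → 2ℚ * Z (suc i) N * (2ℚ * Z (suc j) N)) m
      distribute N = trans (sym (anti-*ˡ m (2ℚ * 2ℚ) _))
          (anti-cong m (λ i j → solve 2 (λ a b → con (2ℚ * 2ℚ) :* (a :* b) := con 2ℚ :* a :* (con 2ℚ :* b)) refl
          (Z (suc i) N) (Z (suc j) N)))
      products : (λ N → anti (λ i j → 2ℚ * Z (suc i) N * (2ℚ * Z (suc j) N)) m) ~
          (λ N → anti (λ i j → - y ! suc i * Λ N ^ suc i * (- y ! suc j * Λ N ^ suc j)) m)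
      products = ~-anti m (λ i j i+j≡m → ~-* (bounded-* (bounded-const 2ℚ) (Z-bounded i))
          (bounded-* (bounded-const (- y ! suc j)) (bounded-^ (suc j) Λ-bounded))
        (rec (ℕ.s≤s (subst (i ℕ.≤_) i+j≡m (ℕ.m≤m+n i j)))) (rec (ℕ.s≤s (subst (j ℕ.≤_) i+j≡m (ℕ.m≤n+m j i)))))
      right : ∀ N → anti (λ i j → - y ! suc i * Λ N ^ suc i * (- y ! suc j * Λ N ^ suc j)) m ≡ ι
          (suc (dbl (suc (suc m)))) * (- y ! suc (suc m) * Λ N ^ suc (suc m))
      right N = trans (anti-cong⁺ m (λ { i j refl → trans
          (solve 4 (λ a b p q → (:- a) :* p :* ((:- b) :* q) := a :* b :* (p :* q)) refl (y ! suc i) (y ! suc j)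
              (Λ N ^ suc i) (Λ N ^ suc j))
          (cong (y ! suc i * y ! suc j *_)
              (trans (sym (^-+ (Λ N) (suc i) (suc j))) (cong (λ e → Λ N ^ suc e) (ℕ.+-suc i j)))) }))
        (trans (anti-*ʳ m (Λ N ^ suc (suc m)) _) (trans (cong (_* Λ N ^ suc (suc m)) (y-convolution m))
          (solve 3 (λ n z p → (:- (n :* z)) :* p := n :* ((:- z) :* p)) refl (ι (suc (dbl (suc (suc m)))))
              (y ! suc (suc m)) (Λ N ^ suc (suc m)))))

  -- If B₂ₙ were zero, Euler's formula would make the partial sums of 2ζ(2n), which are at least 2,
  -- a null sequence.
  y≢0 : ∀ n → y ! suc n ≢ 0ℚ
  y≢0 n eq =
    let N , h = close (Euler n) 1ℚ 0<1
    in <-irrefl refl (<-≤-trans (toWitness {a? = 1ℚ <? 2ℚ} _) (2≤1 N (h (suc N) (ℕ.n≤1+n N))))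
    where
    open ≤-Reasoning
    2≤1 : ∀ N → ∣ 2ℚ * Z (suc n) (suc N) - - y ! suc n * Λ (suc N) ^ suc n ∣ ≤ 1ℚ → 2ℚ ≤ 1ℚ
    2≤1 N h = begin
      2ℚ                                              ≤⟨ *-monoˡ (<⇒≤ (positive⁻¹ 2ℚ)) (1≤Z (suc n) N) ⟩
      2ℚ * Z (suc n) (suc N)                          ≡⟨ solve 2 (λ z p → z := z :- (:- con 0ℚ) :* p) refl
          (2ℚ * Z (suc n) (suc N)) (Λ (suc N) ^ suc n) ⟩
      2ℚ * Z (suc n) (suc N) - - 0ℚ * Λ (suc N) ^ suc n ≡⟨ cong
          (λ v → 2ℚ * Z (suc n) (suc N) - - v * Λ (suc N) ^ suc n) eq ⟨
      2ℚ * Z (suc n) (suc N) - - y ! suc n * Λ (suc N) ^ suc n ≤⟨ ≤∣∣ _ ⟩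
      ∣ 2ℚ * Z (suc n) (suc N) - - y ! suc n * Λ (suc N) ^ suc n ∣ ≤⟨ h ⟩
      1ℚ                                              ∎

-- Geometric bounds, Cauchy products and the exponential series.

module Estimates where

  open import Data.Nat.Base using (_!)
  open import Data.Nat.Divisibility using (_∣_)
  open import Data.Rational.Base
  open import Data.Rational.Properties
  open import Data.Rational.Solver using (module +-*-Solver)
  open RationalArithmetic
  open PowerSeries hiding (module Reasoning)
  open BernoulliSeries using (¼; 2ℚ; E-!)
  open EisensteinRecurrence using (A)
  open ZetaRecurrence
  open +-*-Solver using (solve; _:+_; _:*_; _:-_; :-_; _:=_; con)

  0≤¼ : 0ℚ ≤ ¼
  0≤¼ = <⇒≤ (positive⁻¹ ¼)

  0≤¼^ : ∀ n → 0ℚ ≤ ¼ ^ n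
  0≤¼^ n = 0≤^ n 0≤¼

  4ℚ : ℚ
  4ℚ = ℤ.+ 4 / 1

  ¼^*4^ : ∀ n → ¼ ^ n * 4ℚ ^ n ≡ 1ℚ
  ¼^*4^ n = trans (sym (^-*-distrib ¼ 4ℚ n)) (1^ n)

  suc≤2^ : ∀ n → suc n ℕ.≤ 2 ℕ.^ n
  suc≤2^ zero = ℕ.≤-refl
  suc≤2^ (suc n) = ℕ.≤-trans
      (ℕ.s≤s (ℕ.≤-trans (ℕ.m≤n+m (suc n) n) (ℕ.≤-reflexive (cong (n ℕ.+_) (sym (ℕ.+-identityʳ (suc n)))))))
    (ℕ.*-monoʳ-≤ 2 (suc≤2^ n))

  n*¼^≤ : ∀ n → ι (suc n) * ¼ ^ n ≤ u n
  n*¼^≤ n = *-cancelˡ-≤-pos (4ℚ ^ n) {{positive (<-≤-trans 0<1 (1≤^ n (toWitness {a? = 1ℚ ≤? 4ℚ} _)))}} (begin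
    4ℚ ^ n * (ι (suc n) * ¼ ^ n) ≡⟨ solve 3 (λ a b c → a :* (b :* c) := b :* (c :* a)) refl (4ℚ ^ n) (ι (suc n))
        (¼ ^ n) ⟩
    ι (suc n) * (¼ ^ n * 4ℚ ^ n) ≡⟨ trans (cong (ι (suc n) *_) (¼^*4^ n)) (*-identityʳ (ι (suc n))) ⟩
    ι (suc n)                    ≡⟨ trans (sym (*-identityʳ (ι (suc n))))
        (cong (ι (suc n) *_) (sym (inverseʳ (ι≢0 n)))) ⟩
    ι (suc n) * (ι (suc n) * u n) ≡⟨ *-assoc (ι (suc n)) (ι (suc n)) (u n) ⟨
    ι (suc n) * ι (suc n) * u n  ≤⟨ *-monoʳ (0≤u n)
        (*-mono-≤ (0≤ι (suc n)) (0≤ι (suc n)) (ι-mono-≤ (suc≤2^ n)) (ι-mono-≤ (suc≤2^ n))) ⟩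
    ι (2 ℕ.^ n) * ι (2 ℕ.^ n) * u n ≡⟨ cong (_* u n)
        (trans (cong₂ _*_ (ι-^ 2 n) (ι-^ 2 n))
        (trans (sym (^-*-distrib (ι 2) (ι 2) n)) (cong (λ x → (x * x) ^ n) (ι-def 2)))) ⟩
    4ℚ ^ n * u n ∎)
    where
    open ≤-Reasoning

  ¼^≤ : ∀ n → ¼ ^ n ≤ u n
  ¼^≤ n = ≤-trans (≤-trans (≤-reflexive (sym (*-identityˡ (¼ ^ n)))) (*-monoʳ (0≤¼^ n) (1≤ι n))) (n*¼^≤ n)

  geometric-tail : ∀ n t → Σ< t (λ j → ¼ ^ (n ℕ.+ j)) ≤ 2ℚ * ¼ ^ n
  geometric-tail n t = ≤-fromDiff
      (solve 3 (λ s p e → con 2ℚ :* p :- s := (con 2ℚ :* p :- s :- con 2ℚ :* e) :+ con 2ℚ :* e) refl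
      (Σ< t (λ j → ¼ ^ (n ℕ.+ j))) (¼ ^ n) (¼ ^ (n ℕ.+ t)))
    (0≤+ (go t) (0≤* (<⇒≤ (positive⁻¹ 2ℚ)) (0≤¼^ (n ℕ.+ t))))
    where
    go : ∀ t → 0ℚ ≤ 2ℚ * ¼ ^ n - Σ< t (λ j → ¼ ^ (n ℕ.+ j)) - 2ℚ * ¼ ^ (n ℕ.+ t)
    go zero = ≤-reflexive (sym
        (trans (cong (λ k → 2ℚ * ¼ ^ n - 0ℚ - 2ℚ * ¼ ^ k) (ℕ.+-identityʳ n))
        (solve 1 (λ p → p :- con 0ℚ :- p := con 0ℚ) refl (2ℚ * ¼ ^ n))))
    go (suc t) = subst (0ℚ ≤_)
        (trans (solve 3 (λ p s e → (con 2ℚ :* p :- s :- con 2ℚ :* e) :+ con ½ :* e := con 2ℚ :* p :-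
        (s :+ e) :- con 2ℚ :* (con ¼ :* e)) refl (¼ ^ n) (Σ< t (λ j → ¼ ^ (n ℕ.+ j))) (¼ ^ (n ℕ.+ t)))
        (cong (λ k → 2ℚ * ¼ ^ n - Σ< (suc t) (λ j → ¼ ^ (n ℕ.+ j)) - 2ℚ * ¼ ^ k) (sym (ℕ.+-suc n t))))
      (0≤+ (go t) (0≤* (<⇒≤ (positive⁻¹ ½)) (0≤¼^ (n ℕ.+ t))))

  -- The ratio 1/4 is small enough that even (n + 1) 4⁻ⁿ is at most 1/(n + 1), so truncation errors
  -- become multiples of `u n`.
  Geometric : ℚ → (ℕ → ℚ) → Set
  Geometric A a = ∀ m → ∣ a m ∣ ≤ A * ¼ ^ m

  geometric-Σ : ∀ {A a} → 0ℚ ≤ A → Geometric A a → ∀ n t → ∣ Σ< t (λ j → a (n ℕ.+ j)) ∣ ≤ 2ℚ * A * ¼ ^ n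
  geometric-Σ {A} {a} 0≤A h n t = begin
    ∣ Σ< t (λ j → a (n ℕ.+ j)) ∣     ≤⟨ ∣Σ∣≤ t _ ⟩
    Σ< t (λ j → ∣ a (n ℕ.+ j) ∣)     ≤⟨ Σ-mono t (λ j _ → h (n ℕ.+ j)) ⟩
    Σ< t (λ j → A * ¼ ^ (n ℕ.+ j))   ≡⟨ Σ-*ˡ t A _ ⟩
    A * Σ< t (λ j → ¼ ^ (n ℕ.+ j))   ≤⟨ *-monoˡ 0≤A (geometric-tail n t) ⟩
    A * (2ℚ * ¼ ^ n)                 ≡⟨ solve 2 (λ a p → a :* (con 2ℚ :* p) := con 2ℚ :* a :* p) refl A
        (¼ ^ n) ⟩
    2ℚ * A * ¼ ^ n                   ∎
    where open ≤-Reasoning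

  geometric-difference : ∀ {A a} → 0ℚ ≤ A → Geometric A a → ∀ {n i} → n ℕ.≤ i →
      ∣ Σ< n a - Σ< i a ∣ ≤ 2ℚ * A * ¼ ^ n
  geometric-difference {A} {a} 0≤A h {n} {i} n≤i = subst (_≤ 2ℚ * A * ¼ ^ n)
      (trans (sym (∣-p∣≡∣p∣ _)) (cong ∣_∣ (trans
      (solve 2 (λ x y → :- y := x :- (x :+ y)) refl (Σ< n a) (Σ< (i ℕ.∸ n) (λ j → a (n ℕ.+ j))))
      (cong (λ s → Σ< n a - s) (trans (sym (Σ-split n (i ℕ.∸ n) a)) (cong (λ k → Σ< k a) (ℕ.m+[n∸m]≡n n≤i)))))))
    (geometric-Σ 0≤A h n (i ℕ.∸ n))

  -- Induction by removing the first coefficient of `a`, which gains a factor 1/4 for the rest. The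
  -- new error is a shifted partial sum of `a` times the last coefficient of `b`.
  Cauchy-error : ∀ N {A B} (a b : Series) → 0ℚ ≤ A → 0ℚ ≤ B → Geometric A (a !_) → Geometric B (b !_) →
    ∣ Σ< N (a !_) * Σ< N (b !_) - Σ< N ((a ⊗ b) !_) ∣ ≤ 2ℚ * (A * B) * (ι N * ¼ ^ N)
  Cauchy-error zero {A} {B} a b 0≤A 0≤B _ _ = ≤-reflexive
      (sym (trans (cong (λ z → 2ℚ * (A * B) * (z * 1ℚ)) ι0) (*-zeroʳ (2ℚ * (A * B)))))
  Cauchy-error (suc N) {A} {B} a b 0≤A 0≤B ga gb = begin
    ∣ Σ< (suc N) (a !_) * Σ< (suc N) (b !_) - Σ< (suc N) ((a ⊗ b) !_) ∣
      ≡⟨ cong ∣_∣ (trans (cong₂ (λ s t → s * Σ< (suc N) (b !_) - t) (Σ-head N (a !_)) product-head)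
          (solve 5 (λ a₀ s t b p → (a₀ :+ s) :* (t :+ b) :- (a₀ :* (t :+ b) :+ p) := (s :* t :- p) :+ s :* b)
              refl (a ! 0) s (Σ< N (b !_)) (b ! N) (Σ< N ((a′ ⊗ b) !_)))) ⟩
    ∣ (s * Σ< N (b !_) - Σ< N ((a′ ⊗ b) !_)) + s * b ! N ∣
      ≤⟨ ∣+∣≤ (Cauchy-error N a′ b (0≤* 0≤A 0≤¼) 0≤B ga′ gb) (∣*∣≤ (geometric-Σ {a = a !_} 0≤A ga 1 N) (gb N)) ⟩
    2ℚ * (A * ¼ * B) * (ι N * ¼ ^ N) + 2ℚ * A * ¼ ^ 1 * (B * ¼ ^ N)
      ≡⟨ solve 4 (λ a b n p → con 2ℚ :* (a :* con ¼ :* b) :* (n :* p) :+ con 2ℚ :* a :* con (¼ * 1ℚ) :*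
          (b :* p) := con 2ℚ :* (a :* b) :* ((con 1ℚ :+ n) :* (con ¼ :* p))) refl A B (ι N) (¼ ^ N) ⟩
    2ℚ * (A * B) * ((1ℚ + ι N) * ¼ ^ suc N) ≡⟨ cong (λ k → 2ℚ * (A * B) * (k * ¼ ^ suc N)) (ι-suc N) ⟨
    2ℚ * (A * B) * (ι (suc N) * ¼ ^ suc N) ∎
    where
    open ≤-Reasoning
    a′ : Series
    a′ = ser (λ m → a ! suc m)
    s : ℚ
    s = Σ< N (λ m → a ! suc m)
    ga′ : Geometric (A * ¼) (a′ !_)
    ga′ m = ≤-trans (ga (suc m)) (≤-reflexive (sym (*-assoc A ¼ (¼ ^ m))))
    product-head : Σ< (suc N) ((a ⊗ b) !_) ≡ a ! 0 * Σ< (suc N) (b !_) + Σ< N ((a′ ⊗ b) !_)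
    product-head = trans (Σ-head N ((a ⊗ b) !_))
        (trans (cong (a ! 0 * b ! 0 +_)
        (trans (Σ-+ N (λ m → a ! 0 * b ! suc m) ((a′ ⊗ b) !_))
        (cong (_+ Σ< N ((a′ ⊗ b) !_)) (Σ-*ˡ N (a ! 0) (λ m → b ! suc m)))))
      (trans (solve 4 (λ a b s p → a :* b :+ (a :* s :+ p) := a :* (b :+ s) :+ p) refl (a ! 0) (b ! 0)
          (Σ< N (λ m → b ! suc m)) (Σ< N ((a′ ⊗ b) !_)))
        (cong (λ t → a ! 0 * t + Σ< N ((a′ ⊗ b) !_)) (sym (Σ-head N (b !_))))))

  -- For n beyond m every further factor m is at most the corresponding factor of n!.
  n^≤ : ∀ m n → m ℕ.^ n ℕ.≤ m ℕ.^ m ℕ.* n !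
  n^≤ zero zero = ℕ.≤-refl
  n^≤ zero (suc n) = ℕ.z≤n
  n^≤ (suc m) zero = ℕ.≤-trans (ℕ.m^n>0 (suc m) (suc m)) (ℕ.≤-reflexive (sym (ℕ.*-identityʳ (suc m ℕ.^ suc m))))
  n^≤ (suc m) (suc n) with ℕ.≤-total (suc n) (suc m)
  ... | inj₁ n≤m = ℕ.≤-trans (ℕ.^-monoʳ-≤ (suc m) n≤m) (ℕ.m≤m*n (suc m ℕ.^ suc m) (suc n !) {{ℕ._!≢0 (suc n)}})
  ... | inj₂ m≤n = ℕ.≤-trans (ℕ.*-mono-≤ m≤n (n^≤ (suc m) n)) (ℕ.≤-reflexive (begin
      suc n ℕ.* (suc m ℕ.^ suc m ℕ.* n !) ≡⟨ ℕ.*-assoc (suc n) (suc m ℕ.^ suc m) (n !) ⟨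
      suc n ℕ.* suc m ℕ.^ suc m ℕ.* n !   ≡⟨ cong (ℕ._* n !) (ℕ.*-comm (suc n) (suc m ℕ.^ suc m)) ⟩
      suc m ℕ.^ suc m ℕ.* suc n ℕ.* n !   ≡⟨ ℕ.*-assoc (suc m ℕ.^ suc m) (suc n) (n !) ⟩
      suc m ℕ.^ suc m ℕ.* (suc n ℕ.* n !) ∎))
    where open ≡-Reasoning

  0<ι! : ∀ n → 0ℚ < ι (n !)
  0<ι! n = <-≤-trans 0<1 (subst (_≤ ι (n !)) ι1 (ι-mono-≤ (ℕ.>-nonZero⁻¹ (n !) {{ℕ._!≢0 n}})))

  module Exp (R : ℕ) where
    -- From (4R)ⁿ ≤ (4R)^(4R) n! the coefficient Rⁿ / n! is at most this constant times 4⁻ⁿ.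
    expBound : ℚ
    expBound = ι ((4 ℕ.* R) ℕ.^ (4 ℕ.* R))

    0≤expBound : 0ℚ ≤ expBound
    0≤expBound = 0≤ι _

    0≤E : ∀ n → 0ℚ ≤ E (ι R) ! n
    0≤E zero = <⇒≤ 0<1
    0≤E (suc n) = 0≤* (0≤* (0≤ι R) (0≤E n)) (0≤inv (0<ι n))

    E-geometric : Geometric expBound (E (ι R) !_)
    E-geometric n = subst (_≤ expBound * ¼ ^ n) (sym (0≤p⇒∣p∣≡p (0≤E n)))
      (*-cancelˡ-≤-pos (4ℚ ^ n * ι (n !))
          {{positive (0<* (<-≤-trans 0<1 (1≤^ n (toWitness {a? = 1ℚ ≤? 4ℚ} _))) (0<ι! n))}} (begin
        4ℚ ^ n * ι (n !) * E (ι R) ! n        ≡⟨ solve 3 (λ p f e → p :* f :* e := p :* (e :* f)) refl (4ℚ ^ n)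
            (ι (n !)) (E (ι R) ! n) ⟩
        4ℚ ^ n * (E (ι R) ! n * ι (n !))      ≡⟨ cong (4ℚ ^ n *_) (E-! (ι R) n) ⟩
        4ℚ ^ n * ι R ^ n                      ≡⟨ ^-*-distrib 4ℚ (ι R) n ⟨
        (4ℚ * ι R) ^ n                        ≡⟨ cong (_^ n) (trans (ι-* 4 R) (cong (_* ι R) (ι-def 4))) ⟨
        ι (4 ℕ.* R) ^ n                       ≡⟨ ι-^ (4 ℕ.* R) n ⟨
        ι ((4 ℕ.* R) ℕ.^ n)                   ≤⟨ ι-mono-≤ (n^≤ (4 ℕ.* R) n) ⟩
        ι ((4 ℕ.* R) ℕ.^ (4 ℕ.* R) ℕ.* n !)   ≡⟨ ι-* ((4 ℕ.* R) ℕ.^ (4 ℕ.* R)) (n !) ⟩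
        expBound * ι (n !)                    ≡⟨ *-identityˡ _ ⟨
        1ℚ * (expBound * ι (n !))             ≡⟨ cong (_* (expBound * ι (n !))) (¼^*4^ n) ⟨
        ¼ ^ n * 4ℚ ^ n * (expBound * ι (n !)) ≡⟨ solve 4
            (λ q p b f → q :* p :* (b :* f) := p :* f :* (b :* q)) refl (¼ ^ n) (4ℚ ^ n) expBound (ι (n !)) ⟩
        4ℚ ^ n * ι (n !) * (expBound * ¼ ^ n) ∎))
      where
      open ≤-Reasoning

    E⁻-geometric : Geometric expBound (E (- ι R) !_)
    E⁻-geometric n = subst (_≤ expBound * ¼ ^ n)
        (sym (trans (cong ∣_∣ (E-neg (ι R) n))
        (trans (∣p*q∣≡∣p∣*∣q∣ ((- 1ℚ) ^ n) _) (trans (cong (_* ∣ E (ι R) ! n ∣) (sign n)) (*-identityˡ _)))))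
      (E-geometric n)
      where
      sign : ∀ n → ∣ (- 1ℚ) ^ n ∣ ≡ 1ℚ
      sign zero = refl
      sign (suc n) = trans (∣p*q∣≡∣p∣*∣q∣ (- 1ℚ) ((- 1ℚ) ^ n)) (trans (*-identityˡ _) (sign n))

    exp⁺ : ℕ → ℚ
    exp⁺ n = Σ< n (E (ι R) !_)

    -- e⁻ᴿ is approximated by reciprocals of partial sums of eᴿ, which makes positivity and bounds
    -- immediate. The first two terms are always present and give e i ≥ 1 + R.
    e q : ℕ → ℚ
    e i = exp⁺ (suc (suc i))
    q i = inv (e i)

    exp⁺-mono : ∀ n t → exp⁺ n ≤ exp⁺ (n ℕ.+ t)
    exp⁺-mono n t = ≤-trans (≤-trans (≤-reflexive (sym (+-identityʳ (exp⁺ n))))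
        (+-monoʳ-≤ (exp⁺ n) (0≤Σ t (λ j _ → 0≤E (n ℕ.+ j))))) (≤-reflexive (sym (Σ-split n t (E (ι R) !_))))

    1≤exp⁺ : ∀ n → 1ℚ ≤ exp⁺ (suc n)
    1≤exp⁺ n = ≤-trans (≤-reflexive (sym (+-identityˡ 1ℚ))) (exp⁺-mono 1 n)

    1+R≤e : ∀ i → ι (suc R) ≤ e i
    1+R≤e i = ≤-trans (≤-reflexive
        (trans (ι-suc R) (trans
        (cong (1ℚ +_) (trans (sym (*-identityʳ (ι R)))
        (sym (trans (cong (λ v → ι R * 1ℚ * inv v) ι1) (trans (*-identityʳ _) refl)))))
       (cong (_+ E (ι R) ! 1) (sym (+-identityˡ 1ℚ)))))) (exp⁺-mono 2 i)

    0<e : ∀ i → 0ℚ < e i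
    0<e i = <-≤-trans 0<1 (1≤exp⁺ (suc i))

    0<q : ∀ i → 0ℚ < q i
    0<q i = 0<inv (0<e i)

    q≤ : ∀ i → q i ≤ u R
    q≤ i = inv-antimono (0<ι R) (1+R≤e i)

    e≤ : ∀ i → e i ≤ 2ℚ * expBound
    e≤ i = ≤-trans (≤∣∣ (e i))
        (≤-trans (geometric-Σ {a = E (ι R) !_} 0≤expBound E-geometric 0 (suc (suc i)))
        (≤-reflexive (*-identityʳ (2ℚ * expBound))))

    q-low : ℚ
    q-low = inv (2ℚ * expBound)

    0<2expBound : 0ℚ < 2ℚ * expBound
    0<2expBound = <-≤-trans (0<e 0) (e≤ 0)

    0<q-low : 0ℚ < q-low
    0<q-low = 0<inv 0<2expBound

    q-low≤q : ∀ i → q-low ≤ q i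
    q-low≤q i = inv-antimono (0<e i) (e≤ i)

    exp-bound : ∀ n → ℚ
    exp-bound n = (2ℚ * (expBound * expBound) + 2ℚ * expBound) * u n

    -- e⁻ᴿ eᴿ = 1, at the level of partial sums
    exp-converges : ∀ n i → n ℕ.≤ i → ∣ Σ< (suc n) (E (- ι R) !_) - q i ∣ ≤ exp-bound n
    exp-converges n i n≤i = begin
      ∣ s⁻ - q i ∣                                    ≡⟨ cong ∣_∣
          (solve 3 (λ s p q → s :- q := (s :- p) :+ (p :- q)) refl s⁻ p (q i)) ⟩
      ∣ (s⁻ - p) + (p - q i) ∣                        ≤⟨ ∣+∣≤ first second ⟩
      2ℚ * (expBound * expBound) * u n + 2ℚ * expBound * u n ≡⟨ *-distribʳ-+ (u n) (2ℚ * (expBound * expBound))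
          (2ℚ * expBound) ⟨
      exp-bound n                                     ∎
      where
      open ≤-Reasoning
      -- `p` is an intermediate value: s⁻ is compared with it through the product e⁻ᴿ eᴿ = 1, and q
      -- i through the tail of eᴿ.
      s⁻ s⁺ p : ℚ
      s⁻ = Σ< (suc n) (E (- ι R) !_)
      s⁺ = exp⁺ (suc n)
      p = inv s⁺
      0<s⁺ : 0ℚ < s⁺
      0<s⁺ = <-≤-trans 0<1 (1≤exp⁺ n)
      0≤p : 0ℚ ≤ p
      0≤p = 0≤inv 0<s⁺
      p≤1 : p ≤ 1ℚ
      p≤1 = inv-antimono 0<1 (1≤exp⁺ n)
      inverse : Σ< (suc n) ((E (- ι R) ⊗ E (ι R)) !_) ≡ 1ℚ
      inverse = trans (Σ-cong (suc n)
          (at (≋-trans (E-+ (- ι R) (ι R)) (≋-trans (mk λ m → cong (λ a → E a ! m) (+-inverseˡ (ι R))) E-0))))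
        (trans (Σ-head n (κ 1ℚ !_)) (trans (cong (1ℚ +_) (Σ-0 n (λ _ _ → refl))) (+-identityʳ 1ℚ)))
      first : ∣ s⁻ - p ∣ ≤ 2ℚ * (expBound * expBound) * u n
      first = begin
        ∣ s⁻ - p ∣                ≡⟨ cong ∣_∣
            (trans (cong₂ (λ x y → x - y)
            (trans (sym (*-identityʳ s⁻)) (cong (s⁻ *_) (sym (inverseʳ (<⇒≢0 0<s⁺))))) (sym (*-identityˡ p)))
                                       (solve 3 (λ a b p → a :* (b :* p) :- con 1ℚ :* p := p :*
                                           (a :* b :- con 1ℚ)) refl s⁻ s⁺ p)) ⟩
        ∣ p * (s⁻ * s⁺ - 1ℚ) ∣    ≤⟨ ∣*∣≤ (subst (_≤ 1ℚ) (sym (0≤p⇒∣p∣≡p 0≤p)) p≤1)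
            (subst (λ z → ∣ s⁻ * s⁺ - z ∣ ≤ 2ℚ * (expBound * expBound) * (ι (suc n) * ¼ ^ suc n)) inverse
                                       (Cauchy-error (suc n) (E (- ι R))
                                           (E (ι R)) 0≤expBound 0≤expBound E⁻-geometric E-geometric)) ⟩
        1ℚ * (2ℚ * (expBound * expBound) * (ι (suc n) * ¼ ^ suc n)) ≡⟨ *-identityˡ _ ⟩
        2ℚ * (expBound * expBound) * (ι (suc n) * ¼ ^ suc n) ≤⟨ *-monoˡ
            (0≤* (<⇒≤ (positive⁻¹ 2ℚ)) (0≤* 0≤expBound 0≤expBound))
           (≤-trans (*-monoˡ (0≤ι (suc n))
               (≤-trans (*-monoʳ (0≤¼^ n) (toWitness {a? = ¼ ≤? 1ℚ} _)) (≤-reflexive (*-identityˡ (¼ ^ n)))))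
               (n*¼^≤ n)) ⟩
        2ℚ * (expBound * expBound) * u n ∎
      second : ∣ p - q i ∣ ≤ 2ℚ * expBound * u n
      second = begin
        ∣ p - q i ∣               ≡⟨ cong ∣_∣
            (trans (cong₂ (λ x y → x - y)
            (trans (sym (*-identityʳ p)) (cong (p *_) (sym (inverseʳ (<⇒≢0 (0<e i))))))
            (trans (sym (*-identityʳ (q i))) (cong (q i *_) (sym (inverseʳ (<⇒≢0 0<s⁺))))))
                                       (solve 4 (λ p q s e → p :* (e :* q) :- q :* (s :* p) := (p :* q) :*
                                           (e :- s)) refl p (q i) s⁺ (e i))) ⟩
        ∣ p * q i * (e i - s⁺) ∣  ≤⟨ ∣*∣≤ {p * q i} {1ℚ}
            (∣*∣≤ {p} {1ℚ} (subst (_≤ 1ℚ) (sym (0≤p⇒∣p∣≡p 0≤p)) p≤1)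
            (subst (_≤ 1ℚ) (sym (0≤p⇒∣p∣≡p (<⇒≤ (0<q i)))) (inv-antimono 0<1 (1≤exp⁺ (suc i)))))
                                       (subst (_≤ 2ℚ * expBound * ¼ ^ suc n) (∣-∣-sym s⁺ (e i))
                                           (geometric-difference {a = E (ι R) !_} 0≤expBound E-geometric
                                           (ℕ.s≤s (ℕ.m≤n⇒m≤1+n n≤i)))) ⟩
        1ℚ * (2ℚ * expBound * ¼ ^ suc n) ≡⟨ *-identityˡ _ ⟩
        2ℚ * expBound * ¼ ^ suc n ≤⟨ *-monoˡ (0≤* (<⇒≤ (positive⁻¹ 2ℚ)) 0≤expBound)
            (≤-trans (*-monoʳ (0≤¼^ n) (toWitness {a? = ¼ ≤? 1ℚ} _))
            (≤-trans (≤-reflexive (*-identityˡ (¼ ^ n))) (¼^≤ n))) ⟩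
        2ℚ * expBound * u n       ∎

-- Values of the q-expansions at small q.

module EisensteinEvaluation where

  open import Data.List.Base using (map; filter)
  open import Data.Nat.Base using (_!)
  open import Data.Nat.Divisibility using (_∣_; divides; _∣?_; ∣⇒≤)
  open import Data.Rational.Base
  open import Data.Rational.Properties
  open import Data.Rational.Solver using (module +-*-Solver)
  open import Defs using (σ)
  open RationalArithmetic
  open PowerSeries hiding (module Reasoning)
  open BernoulliSeries using (¼; 2ℚ; E-!; ι!≢0)
  open EvenSeries using (ch°; ℘°)
  open DivisorIdentity using (δ; δ-≢; δ-refl; Σ₁; Σ₁-def; Σ₁-cong; Σ₁-*ʳ)
  open EisensteinRecurrence using (D; D-0; D-*ˡ; D-cong; G; A; A-recurrence; Σ-δ)
  open Monomials using (ΣL; ΣL-filter; ΣL-map; ΣL-upTo)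
  open ZetaRecurrence hiding (S; T; R; r)
  open Estimates
  open +-*-Solver using (solve; _:+_; _:*_; _:-_; :-_; _:=_; con)

  𝟙 : ∀ {P : Set} → Dec P → ℚ
  𝟙 d = if does d then 1ℚ else 0ℚ

  ι-sum : ∀ xs → ι (ℕ.sum xs) ≡ ΣL xs ι
  ι-sum [] = ι0
  ι-sum (x ∷ xs) = trans (ι-+ x (ℕ.sum xs)) (cong (ι x +_) (ι-sum xs))

  if-* : ∀ {P : Set} (d : Dec P) x → (if does d then x else 0ℚ) ≡ 𝟙 d * x
  if-* (yes _) x = sym (*-identityˡ x)
  if-* (no _) x = sym (*-zeroˡ x)

  σ-Σ : ∀ k n → ι (σ k n) ≡ Σ< n (λ i → 𝟙 (suc i ∣? n) * ι (suc i) ^ k)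
  σ-Σ k n = trans (ι-sum (map (ℕ._^ k) (filter (_∣? n) (map suc (upTo n)))))
      (trans (ΣL-map (ℕ._^ k) (filter (_∣? n) (map suc (upTo n))) ι)
    (trans (ΣL-filter (_∣? n) (map suc (upTo n)) (λ a → ι (a ℕ.^ k)))
        (trans (ΣL-map suc (upTo n) (λ a → if does (a ∣? n) then ι (a ℕ.^ k) else 0ℚ))
    (trans (ΣL-upTo n (λ i → if does (suc i ∣? n) then ι (suc i ℕ.^ k) else 0ℚ))
        (Σ-cong n (λ i → trans (if-* (suc i ∣? n) _) (cong (𝟙 (suc i ∣? n) *_) (ι-^ (suc i) k))))))))

  Σ₁-δ-∣ : ∀ M n a → n ℕ.< M → (d : Dec (suc a ∣ suc n)) → Σ₁ M (λ x → δ (suc a ℕ.* x) (suc n)) ≡ 𝟙 d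
  Σ₁-δ-∣ M n a n<M (no ∤n) = trans (Σ₁-def M _)
      (Σ-0 M (λ x _ → δ-≢ {suc a ℕ.* suc x} {suc n}
      (λ eq → ∤n (divides (suc x) (trans (sym eq) (ℕ.*-comm (suc a) (suc x)))))))
  Σ₁-δ-∣ M n a n<M (yes (divides (suc c) eq)) = trans (Σ₁-def M _)
      (trans (Σ-cong M (λ x → trans (cong (δ (suc a ℕ.* suc x)) eq)
      (trans (δ-scale x) (sym (*-identityʳ (δ x c))))))
      (Σ-δ M c (λ _ → 1ℚ) (ℕ.≤-<-trans (ℕ.s≤s⁻¹ (ℕ.≤-trans (ℕ.m≤m*n (suc c) (suc a)) (ℕ.≤-reflexive (sym eq))))
          n<M)))
    where
    δ-scale : ∀ x → δ (suc a ℕ.* suc x) (suc c ℕ.* suc a) ≡ δ x c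
    δ-scale x with x ℕ.≟ c
    ... | yes refl = trans (cong (λ k → δ k (suc x ℕ.* suc a)) (ℕ.*-comm (suc a) (suc x)))
        (trans (δ-refl (suc x ℕ.* suc a)) (sym (δ-refl x)))
    ... | no x≢c = trans (δ-≢ {suc a ℕ.* suc x} {suc c ℕ.* suc a}
        (λ eq → x≢c (ℕ.suc-injective
        (ℕ.*-cancelʳ-≡ (suc x) (suc c) (suc a) (trans (ℕ.*-comm (suc x) (suc a)) eq))))) (sym (δ-≢ x≢c))

  D-σ : ∀ M n k → n ℕ.< M → D M (λ a → ι a ^ k) (suc n) ≡ ι (σ k (suc n))
  D-σ M n k n<M = trans (Σ₁-cong M {g = g}
      (λ a → trans (Σ₁-*ʳ M (ι (suc a) ^ k) _) (cong (_* ι (suc a) ^ k) (Σ₁-δ-∣ M n a n<M (suc a ∣? suc n)))))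
    (trans (Σ₁-def M g) (trans (cong (λ N → Σ< N (λ i → g (suc i))) (sym (ℕ.m+[n∸m]≡n n<M)))
    (trans (Σ-split (suc n) (M ℕ.∸ suc n) _)
        (trans (cong (Σ< (suc n) (λ i → g (suc i)) +_) (Σ-0 (M ℕ.∸ suc n) (λ i _ → large i)))
        (trans (+-identityʳ _) (sym (σ-Σ k (suc n))))))))
    where
    g : ℕ → ℚ
    g zero = 0ℚ
    g (suc a) = 𝟙 (suc a ∣? suc n) * ι (suc a) ^ k
    large : ∀ i → g (suc (suc n ℕ.+ i)) ≡ 0ℚ
    large i = vanish (suc (suc n ℕ.+ i) ∣? suc n)
      where
      vanish : (d : Dec (suc (suc n ℕ.+ i) ∣ suc n)) → 𝟙 d * ι (suc (suc n ℕ.+ i)) ^ k ≡ 0ℚ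
      vanish (no _) = *-zeroˡ (ι (suc (suc n ℕ.+ i)) ^ k)
      vanish (yes ∣n) = ⊥-elim (ℕ.<⇒≱ (ℕ.s≤s (ℕ.m≤m+n (suc n) i)) (∣⇒≤ ∣n))

  -- There are at most n divisors, and none exceeds n.
  σ≤ : ∀ k n → ι (σ k n) ≤ ι n ^ suc k
  σ≤ k n = ≤-trans (≤-reflexive (σ-Σ k n)) (≤-trans (Σ-mono n term) (≤-reflexive (Σ-const n (ι n ^ k))))
    where
    term : ∀ i → i ℕ.< n → 𝟙 (suc i ∣? n) * ι (suc i) ^ k ≤ ι n ^ k
    term i i<n = ≤-trans (*-monoʳ (0≤^ k (0≤ι (suc i))) (𝟙≤1 (suc i ∣? n)))
        (≤-trans (≤-reflexive (*-identityˡ (ι (suc i) ^ k))) (^-mono-≤ k (0≤ι (suc i)) (ι-mono-≤ i<n)))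
      where
      𝟙≤1 : ∀ {P : Set} (d : Dec P) → 𝟙 d ≤ 1ℚ
      𝟙≤1 (yes _) = ≤-refl
      𝟙≤1 (no _) = <⇒≤ 0<1

  -- In weight 2n with n = N + 2 this is 2n - 1, and `factor` is 2 / (2n - 2)!.
  index : ℕ → ℕ
  index N = suc (dbl (suc N))

  factor : ℕ → ℚ
  factor N = 2ℚ * inv (ι (dbl (suc N) !))

  0≤factor : ∀ N → 0ℚ ≤ factor N
  0≤factor N = 0≤* (<⇒≤ (positive⁻¹ 2ℚ)) (0≤inv (0<ι! (dbl (suc N))))

  factor≤2 : ∀ N → factor N ≤ 2ℚ
  factor≤2 N = ≤-trans (*-monoˡ (<⇒≤ (positive⁻¹ 2ℚ))
      (inv-antimono 0<1 (subst (_≤ ι (dbl (suc N) !)) ι1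
      (ι-mono-≤ (ℕ.>-nonZero⁻¹ (dbl (suc N) !) {{ℕ._!≢0 (dbl (suc N))}}))))) ≤-refl

  -- A M n for M = ∞
  Â : ℕ → Series
  Â (suc (suc N)) ! zero  = ℘° ! suc (suc N)
  Â (suc (suc N)) ! suc m = factor N * ι (σ (index N) (suc m))
  Â _             ! m     = 0ℚ

  A-Â : ∀ M n m → m ℕ.≤ M → A M n ! m ≡ Â n ! m
  A-Â M zero zero _ = trans (cong (0ℚ +_) (D-0 M _)) refl
  A-Â M zero (suc m) _ = trans
      (cong (0ℚ +_) (trans (D-cong M {h = λ a → 0ℚ * 1ℚ} (suc m) (λ a → G-0 (ι (suc a))))
      (trans (D-*ˡ M 0ℚ (λ _ → 1ℚ) (suc m)) (*-zeroˡ (D M (λ _ → 1ℚ) (suc m)))))) refl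
    where
    G-0 : ∀ a → G a ! 0 ≡ 0ℚ * 1ℚ
    G-0 a = trans (cong ((a + a) *_) (*-zeroˡ (ch° a ! 0))) (*-zeroʳ (a + a))
  A-Â M (suc zero) zero _ = trans (cong (0ℚ +_) (D-0 M _)) refl
  A-Â M (suc zero) (suc m) _ = trans
      (cong (0ℚ +_) (trans (D-cong M {h = λ a → 0ℚ * 1ℚ} (suc m) (λ a → G-1 (ι (suc a))))
      (trans (D-*ˡ M 0ℚ (λ _ → 1ℚ) (suc m)) (*-zeroˡ (D M (λ _ → 1ℚ) (suc m)))))) refl
    where
    G-1 : ∀ a → G a ! 1 ≡ 0ℚ * 1ℚ
    G-1 a = trans (κ-⊗ (a + a) (X ⊗ ch° a) 1) (trans (cong ((a + a) *_) (X-⊗ (ch° a) 0)) (*-zeroʳ (a + a)))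
  A-Â M (suc (suc N)) zero _ = trans (cong (℘° ! suc (suc N) +_) (D-0 M _)) (+-identityʳ _)
  A-Â M (suc (suc N)) (suc m) m<M = trans (+-identityˡ _)
      (trans (D-cong M (suc m) (λ a → power (ι (suc a))))
      (trans (D-*ˡ M (factor N) (λ a → ι a ^ index N) (suc m)) (cong (factor N *_) (D-σ M m (index N) m<M))))
    where
    power : ∀ a → G a ! suc (suc N) ≡ factor N * a ^ index N
    power a = trans (trans (κ-⊗ (a + a) (X ⊗ ch° a) (suc (suc N))) (cong ((a + a) *_) (X-⊗ (ch° a) (suc N))))
      (trans (cong ((a + a) *_)
          (trans (sym (*-identityʳ (E a ! dbl (suc N))))
          (trans (cong (E a ! dbl (suc N) *_) (sym (inverseʳ (ι!≢0 (dbl (suc N))))))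
          (trans (sym (*-assoc (E a ! dbl (suc N)) _ _))
          (cong (_* inv (ι (dbl (suc N) !))) (E-! a (dbl (suc N))))))))
      (solve 3 (λ a p i → (a :+ a) :* (p :* i) := con 2ℚ :* i :* (a :* p)) refl a (a ^ dbl (suc N))
          (inv (ι (dbl (suc N) !)))))

  -- Coefficient m is taken from the truncation at M = m, which agrees with Â up to degree m.
  Â-recurrence : ∀ k m → let n = suc (suc (suc k)) in ι (suc (dbl n)) * ι k * Â n ! m ≡ ι 3 * anti (λ i j → (Â i ⊗ Â j) ! m) n
  Â-recurrence k m = trans (cong (ι (suc (dbl (suc (suc (suc k))))) * ι k *_)
      (sym (A-Â m (suc (suc (suc k))) m ℕ.≤-refl))) (trans (A-recurrence k m m ℕ.≤-refl)
    (cong (ι 3 *_) (anti-cong (suc (suc (suc k))) (λ i j → anti-cong⁺ m (λ u v u+v≡m → cong₂ _*_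
      (A-Â m i u (subst (u ℕ.≤_) u+v≡m (ℕ.m≤m+n u v))) (A-Â m j v (subst (v ℕ.≤_) u+v≡m (ℕ.m≤n+m v u))))))))

  module Evaluation (q : ℕ → ℚ) (0≤q : ∀ i → 0ℚ ≤ q i) (K : ℕ) (small : ∀ i → ι 2 ^ K * q i ≤ ¼) where

    0≤2^ : 0ℚ ≤ ι 2 ^ K
    0≤2^ = 0≤^ K (0≤ι 2)

    0≤σ : ∀ k n → 0ℚ ≤ ι (σ k n)
    0≤σ k n = 0≤ι (σ k n)

    -- The index i is both the number of terms and the index of the approximation of q: a diagonal
    -- sequence.
    S : ℕ → ℕ → ℚ
    S k i = Σ< i (λ j → ι (σ k (suc j)) * q i ^ suc j)

    -- σ_k(n + 1) ≤ (n + 1)^K ≤ 2^((n + 1)K), so the smallness of 2^K q gives a geometric bound with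
    -- ratio 1/4 for all k < K at once.
    power-bound : ∀ k n i → suc k ℕ.≤ K → ι (σ k (suc n)) * q i ^ n ≤ ι 2 ^ K * ¼ ^ n
    power-bound k n i k<K = begin
      ι (σ k (suc n)) * q i ^ n             ≤⟨ *-monoʳ (0≤^ n (0≤q i))
          (≤-trans (σ≤ k (suc n))
          (≤-trans (^-monoʳ k<K)
          (^-mono-≤ K (0≤ι (suc n))
          (≤-trans (ι-mono-≤ (ℕ.≤-trans (ℕ.n≤1+n (suc n)) (suc≤2^ (suc n)))) (≤-reflexive (ι-^ 2 (suc n))))))) ⟩
      (ι 2 ^ suc n) ^ K * q i ^ n           ≡⟨ cong (_* q i ^ n) (^-comm (ι 2) (suc n) K) ⟩
      (ι 2 ^ K) ^ suc n * q i ^ n           ≡⟨ trans (*-assoc (ι 2 ^ K) _ _)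
          (cong (ι 2 ^ K *_) (sym (^-*-distrib (ι 2 ^ K) (q i) n))) ⟩
      ι 2 ^ K * (ι 2 ^ K * q i) ^ n         ≤⟨ *-monoˡ 0≤2^ (^-mono-≤ n (0≤* 0≤2^ (0≤q i)) (small i)) ⟩
      ι 2 ^ K * ¼ ^ n                       ∎
      where
      open ≤-Reasoning
      ^-comm : ∀ x m n → (x ^ m) ^ n ≡ (x ^ n) ^ m
      ^-comm x m n = trans (^-*-assoc x m n) (trans (cong (x ^_) (ℕ.*-comm m n)) (sym (^-*-assoc x n m)))
      ^-monoʳ : ∀ {a b} → a ℕ.≤ b → ι (suc n) ^ a ≤ ι (suc n) ^ b
      ^-monoʳ {a} {b} a≤b = ≤-trans (≤-reflexive (sym (ι-^ (suc n) a)))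
          (≤-trans (ι-mono-≤ (ℕ.^-monoʳ-≤ (suc n) a≤b)) (≤-reflexive (ι-^ (suc n) b)))

    term-bound : ∀ k n i → suc k ℕ.≤ K → ι (σ k (suc n)) * q i ^ suc n ≤ ¼ ^ suc n
    term-bound k n i k<K = begin
      ι (σ k (suc n)) * (q i * q i ^ n)     ≡⟨ solve 3 (λ s q p → s :* (q :* p) := q :* (s :* p)) refl
          (ι (σ k (suc n))) (q i) (q i ^ n) ⟩
      q i * (ι (σ k (suc n)) * q i ^ n)     ≤⟨ *-monoˡ (0≤q i) (power-bound k n i k<K) ⟩
      q i * (ι 2 ^ K * ¼ ^ n)               ≡⟨ solve 3 (λ q t p → q :* (t :* p) := t :* q :* p) refl (q i)
          (ι 2 ^ K) (¼ ^ n) ⟩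
      ι 2 ^ K * q i * ¼ ^ n                 ≤⟨ *-monoʳ (0≤¼^ n) (small i) ⟩
      ¼ * ¼ ^ n                             ∎
      where open ≤-Reasoning

    0≤term : ∀ k n i → 0ℚ ≤ ι (σ k (suc n)) * q i ^ suc n
    0≤term k n i = 0≤* (0≤σ k (suc n)) (0≤^ (suc n) (0≤q i))

    0≤S : ∀ k i → 0ℚ ≤ S k i
    0≤S k i = 0≤Σ i (λ j _ → 0≤term k j i)

    S-geometric : ∀ k i → suc k ℕ.≤ K → Geometric 1ℚ (λ j → ι (σ k (suc j)) * q i ^ suc j)
    S-geometric k i k<K j = subst (_≤ 1ℚ * ¼ ^ j) (sym (0≤p⇒∣p∣≡p (0≤term k j i)))
        (≤-trans (term-bound k j i k<K) (*-monoʳ (0≤¼^ j) (toWitness {a? = ¼ ≤? 1ℚ} _)))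

    S≤ : ∀ k i → suc k ℕ.≤ K → S k i ≤ q i * (2ℚ * ι 2 ^ K)
    S≤ k i k<K = begin
      S k i ≡⟨ Σ-cong i (λ j → solve 3 (λ s q p → s :* (q :* p) := q :* (s :* p)) refl (ι (σ k (suc j))) (q i)
          (q i ^ j)) ⟩
      Σ< i (λ j → q i * (ι (σ k (suc j)) * q i ^ j)) ≡⟨ Σ-*ˡ i (q i) _ ⟩
      q i * Σ< i (λ j → ι (σ k (suc j)) * q i ^ j) ≤⟨ *-monoˡ (0≤q i)
          (Σ-mono i (λ j _ → power-bound k j i k<K)) ⟩
      q i * Σ< i (λ j → ι 2 ^ K * ¼ ^ j) ≡⟨ cong (q i *_) (Σ-*ˡ i (ι 2 ^ K) _) ⟩
      q i * (ι 2 ^ K * Σ< i (λ j → ¼ ^ j)) ≤⟨ *-monoˡ (0≤q i) (*-monoˡ 0≤2^ (geometric-tail 0 i)) ⟩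
      q i * (ι 2 ^ K * (2ℚ * 1ℚ)) ≡⟨ cong (q i *_)
          (solve 1 (λ t → t :* (con 2ℚ :* con 1ℚ) := con 2ℚ :* t) refl (ι 2 ^ K)) ⟩
      q i * (2ℚ * ι 2 ^ K) ∎
      where open ≤-Reasoning

    q≤S : ∀ k i → q (suc i) ≤ S k (suc i)
    q≤S k i = ≤-trans (≤-trans
        (≤-reflexive (trans (sym (*-identityʳ (q (suc i))))
        (sym (trans (cong (_* (q (suc i) * 1ℚ)) σ1) (*-identityˡ (q (suc i) * 1ℚ))))))
        (≤-trans (≤-reflexive (sym (+-identityʳ _)))
      (+-monoʳ-≤ (ι (σ k 1) * q (suc i) ^ 1) (0≤Σ i (λ j _ → 0≤term k (suc j) (suc i))))))
          (≤-reflexive (sym (Σ-head i _)))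
      where
      σ1 : ι (σ k 1) ≡ 1ℚ
      σ1 = trans (σ-Σ k 1) (trans (+-identityˡ _)
          (trans (*-identityˡ (ι 1 ^ k)) (trans (cong (_^ k) ι1) (1^ k))))

    Ã : ℕ → ℕ → Series
    Ã n i ! m = Â n ! m * q i ^ m

    -- Approximations of (2n - 1) G₂ₙ / (2πi)²ⁿ at q. The constant term accounts for the one term
    -- more than in `S`.
    a : ℕ → ℕ → ℚ
    a n i = Σ< (suc i) (Ã n i !_)

    a-0 : ∀ i → a 0 i ≡ 0ℚ
    a-0 i = Σ-0 (suc i) (λ m _ → *-zeroˡ (q i ^ m))

    a-1 : ∀ i → a 1 i ≡ 0ℚ
    a-1 i = Σ-0 (suc i) (λ m _ → *-zeroˡ (q i ^ m))

    a-S : ∀ N i → a (suc (suc N)) i ≡ ℘° ! suc (suc N) + factor N * S (index N) i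
    a-S N i = trans (Σ-head i (Ã (suc (suc N)) i !_)) (cong₂ _+_ (*-identityʳ (℘° ! suc (suc N)))
      (trans (Σ-cong i (λ j → *-assoc (factor N) (ι (σ (index N) (suc j))) (q i ^ suc j)))
          (Σ-*ˡ i (factor N) _)))

    bound : ℕ → ℚ
    bound n = ∣ ℘° ! n ∣ + 2ℚ

    0≤bound : ∀ n → 0ℚ ≤ bound n
    0≤bound n = 0≤+ (0≤∣p∣ (℘° ! n)) (<⇒≤ (positive⁻¹ 2ℚ))

    Ã-geometric : ∀ n i → dbl n ℕ.≤ K → Geometric (bound n) (Ã n i !_)
    Ã-geometric zero i _ m = subst (_≤ bound 0 * ¼ ^ m) (sym (cong ∣_∣ (*-zeroˡ (q i ^ m))))
        (0≤* (0≤bound 0) (0≤¼^ m))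
    Ã-geometric (suc zero) i _ m = subst (_≤ bound 1 * ¼ ^ m) (sym (cong ∣_∣ (*-zeroˡ (q i ^ m))))
        (0≤* (0≤bound 1) (0≤¼^ m))
    Ã-geometric (suc (suc N)) i _ zero = ∣*∣≤ {℘° ! suc (suc N)} {bound (suc (suc N))} {1ℚ} {1ℚ}
        (≤-trans (≤-reflexive (sym (+-identityʳ ∣ ℘° ! suc (suc N) ∣)))
        (+-monoʳ-≤ ∣ ℘° ! suc (suc N) ∣ (<⇒≤ (positive⁻¹ 2ℚ)))) ≤-refl
    Ã-geometric (suc (suc N)) i le (suc m) = begin
      ∣ factor N * ι (σ (index N) (suc m)) * q i ^ suc m ∣   ≡⟨ cong ∣_∣
          (*-assoc (factor N) (ι (σ (index N) (suc m))) (q i ^ suc m)) ⟩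
      ∣ factor N * (ι (σ (index N) (suc m)) * q i ^ suc m) ∣ ≡⟨ 0≤p⇒∣p∣≡p
          (0≤* (0≤factor N) (0≤term (index N) m i)) ⟩
      factor N * (ι (σ (index N) (suc m)) * q i ^ suc m)     ≤⟨ *-mono-≤ (0≤factor N) (0≤term (index N) m i)
          (≤-trans (factor≤2 N)
          (≤-trans (≤-reflexive (sym (+-identityˡ 2ℚ))) (+-monoˡ-≤ 2ℚ (0≤∣p∣ (℘° ! suc (suc N))))))
          (term-bound (index N) m i le) ⟩
      bound (suc (suc N)) * ¼ ^ suc m                        ∎
      where open ≤-Reasoning

    a-bounded : ∀ n → dbl n ℕ.≤ K → Bounded (a n)
    a-bounded n le = bounded-≤ (2ℚ * bound n)
        (0<* (positive⁻¹ 2ℚ) (+-mono-≤-< (0≤∣p∣ (℘° ! n)) (positive⁻¹ 2ℚ)))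
      (λ i → ≤-trans (geometric-Σ {a = Ã n i !_} (0≤bound n) (Ã-geometric n i le) 0 (suc i))
          (≤-reflexive (*-identityʳ (2ℚ * bound n))))

    a-product : ∀ m n → dbl m ℕ.≤ K → dbl n ℕ.≤ K → (λ i → a m i * a n i) ~
        (λ i → Σ< (suc i) ((Ã m i ⊗ Ã n i) !_))
    a-product m n m≤ n≤ = ~-by-inv (2ℚ * (bound m * bound n))
        (0<* (positive⁻¹ 2ℚ) (0<* (0<bound m) (0<bound n))) (λ i →
      ≤-trans (Cauchy-error (suc i) (Ã m i) (Ã n i) (0≤bound m) (0≤bound n) (Ã-geometric m i m≤)
          (Ã-geometric n i n≤))
        (*-monoˡ (0≤* (<⇒≤ (positive⁻¹ 2ℚ)) (0≤* (0≤bound m) (0≤bound n)))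
          (≤-trans (*-monoˡ (0≤ι (suc i))
              (≤-trans (*-monoʳ (0≤¼^ i) (toWitness {a? = ¼ ≤? 1ℚ} _)) (≤-reflexive (*-identityˡ (¼ ^ i)))))
              (n*¼^≤ i))))
      where
      0<bound : ∀ n → 0ℚ < bound n
      0<bound n = +-mono-≤-< (0≤∣p∣ (℘° ! n)) (positive⁻¹ 2ℚ)

    dbl-mono : ∀ {m n} → m ℕ.≤ n → dbl m ℕ.≤ dbl n
    dbl-mono ℕ.z≤n = ℕ.z≤n
    dbl-mono (ℕ.s≤s m≤n) = ℕ.s≤s (ℕ.s≤s (dbl-mono m≤n))

    -- The recurrence holds exactly, coefficient by coefficient. Only the passage from truncated
    -- product series to products of truncated series costs an error, which is null by `a-product`.
    a-recurrence : ∀ k → let n = suc (suc (suc k)) in dbl n ℕ.≤ K →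
      (λ i → ι (suc (dbl n)) * ι k * a n i) ~ (λ i → ι 3 * anti (λ l m → a l i * a m i) n)
    a-recurrence k n≤K = ~-trans (~-reflexive exact) (~-*ˡ (ι 3) (~-sym (~-anti n (λ l m l+m≡n → a-product l m
        (ℕ.≤-trans (dbl-mono (subst (l ℕ.≤_) l+m≡n (ℕ.m≤m+n l m))) n≤K)
            (ℕ.≤-trans (dbl-mono (subst (m ℕ.≤_) l+m≡n (ℕ.m≤n+m m l))) n≤K)))))
      where
      n : ℕ
      n = suc (suc (suc k))
      c : ℚ
      c = ι (suc (dbl n)) * ι k
      scaled : ∀ l m i t → (Ã l i ⊗ Ã m i) ! t ≡ (Â l ⊗ Â m) ! t * q i ^ t
      scaled l m i t = trans (anti-cong⁺ t
          (λ { v w refl → trans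
          (solve 4 (λ a b p r → a :* p :* (b :* r) := a :* b :* (p :* r)) refl (Â l ! v) (Â m ! w) (q i ^ v)
          (q i ^ w)) (cong (Â l ! v * Â m ! w *_) (sym (^-+ (q i) v w))) }))
        (anti-*ʳ t (q i ^ t) _)
      exact : ∀ i → c * a n i ≡ ι 3 * anti (λ l m → Σ< (suc i) ((Ã l i ⊗ Ã m i) !_)) n
      exact i = begin
        c * a n i ≡⟨ Σ-*ˡ (suc i) c (Ã n i !_) ⟨
        Σ< (suc i) (λ t → c * (Â n ! t * q i ^ t)) ≡⟨ Σ-cong (suc i)
            (λ t → trans (sym (*-assoc c (Â n ! t) (q i ^ t)))
            (trans (cong (_* q i ^ t) (Â-recurrence k t))
            (trans (*-assoc (ι 3) (anti (λ l m → (Â l ⊗ Â m) ! t) n) (q i ^ t))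
            (cong (ι 3 *_) (sym (anti-*ʳ n (q i ^ t) (λ l m → (Â l ⊗ Â m) ! t))))))) ⟩
        Σ< (suc i) (λ t → ι 3 * anti (λ l m → (Â l ⊗ Â m) ! t * q i ^ t) n) ≡⟨ Σ-*ˡ (suc i) (ι 3) _ ⟩
        ι 3 * Σ< (suc i) (λ t → anti (λ l m → (Â l ⊗ Â m) ! t * q i ^ t) n) ≡⟨ cong (ι 3 *_)
            (sym (anti-Σ n (suc i) (λ l m t → (Â l ⊗ Â m) ! t * q i ^ t))) ⟩
        ι 3 * anti (λ l m → Σ< (suc i) (λ t → (Â l ⊗ Â m) ! t * q i ^ t)) n ≡⟨ cong (ι 3 *_)
            (anti-cong n (λ l m → Σ-cong (suc i) (λ t → sym (scaled l m i t)))) ⟩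
        ι 3 * anti (λ l m → Σ< (suc i) ((Ã l i ⊗ Ã m i) !_)) n ∎
        where open ≡-Reasoning

-- Identification with the curve, and uniqueness of expansions.

module VanishingPolynomials where

  open import Data.Nat.Induction using (<-rec)
  open import Data.Rational.Base
  open import Data.Rational.Properties
  open import Data.Rational.Solver using (module +-*-Solver)
  open RationalArithmetic
  open PowerSeries hiding (module Reasoning)
  open BernoulliSeries using (¼; 2ℚ; 3ℚ; 1/12; tail²; recurrence; y; y-1; ℘₀-y)
  open EvenSeries using (℘°)
  open IntegralWeierstrass using (module Curve; 5ℚ)
  open WeierstrassForms using (Q-2; Q-3; Q-Weierstrass)
  open ZetaRecurrence hiding (S; T; R; r)
  open Estimates
  open EisensteinEvaluation
  open +-*-Solver using (solve; _:+_; _:*_; _:-_; :-_; _:=_; con)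

  ⅓ ⅕ : ℚ
  ⅓ = ℤ.+ 1 / 3
  ⅕ = ℤ.+ 1 / 5

  module Identification (q : ℕ → ℚ) (0≤q : ∀ i → 0ℚ ≤ q i) (K : ℕ) (small : ∀ i → ι 2 ^ K * q i ≤ ¼) where
    open Evaluation q 0≤q K small

    -- The curve is taken with G₄ = a₂/3 and G₆ = a₃/5, since Q has the coefficients 3G₄ and 5G₆ in
    -- degrees 2 and 3.
    Q° : ℕ → ℕ → ℚ
    Q° n i = tail² (Curve.Q (⅓ * a 2 i) (⅕ * a 3 i)) ! n

    -- Both sides satisfy the ℘-recurrence, whose factor (2n + 1)(n - 3) is nonzero for n ≥ 4 and is
    -- cancelled over ℚ, where its parity does not matter. Degrees 2 and 3 agree by the choice of
    -- the curve.
    a-polynomial : ∀ n → dbl n ℕ.≤ K → a n ~ Q° n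
    a-polynomial = <-rec _ go
      where
      go : ∀ n → (∀ {m} → m ℕ.< n → dbl m ℕ.≤ K → a m ~ Q° m) → dbl n ℕ.≤ K → a n ~ Q° n
      go 0 _ _ = ~-reflexive a-0
      go 1 _ _ = ~-reflexive a-1
      go 2 _ _ = ~-reflexive (λ i → sym
          (trans (Q-2 (⅓ * a 2 i) (⅕ * a 3 i)) (solve 1 (λ a → con 3ℚ :* (con ⅓ :* a) := a) refl (a 2 i))))
      go 3 _ _ = ~-reflexive (λ i → sym
          (trans (Q-3 (⅓ * a 2 i) (⅕ * a 3 i)) (solve 1 (λ a → con 5ℚ :* (con ⅕ :* a) := a) refl (a 3 i))))
      go (suc (suc (suc (suc k)))) rec n≤K = ~-cancel-const c (*-≢0 (ι≢0 (dbl n)) (ι≢0 k))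
          (~-trans (a-recurrence (suc k) n≤K)
        (~-trans (~-*ˡ (ι 3) (~-anti n pairs))
            (~-reflexive (λ i → sym (recurrence (Q-Weierstrass (⅓ * a 2 i) (⅕ * a 3 i)) (suc k))))))
        where
        n : ℕ
        n = suc (suc (suc (suc k)))
        c : ℚ
        c = ι (suc (dbl n)) * ι (suc k)
        ≤K : ∀ {m} → m ℕ.≤ n → dbl m ℕ.≤ K
        ≤K m≤n = ℕ.≤-trans (dbl-mono m≤n) n≤K
        -- An index 0 is paired with n itself, which the induction does not reach, but there both
        -- products vanish.
        pairs : ∀ l m → l ℕ.+ m ≡ n → (λ i → a l i * a m i) ~ (λ i → Q° l i * Q° m i)
        pairs zero m _ = ~-reflexive
            (λ i → trans (trans (cong (_* a m i) (a-0 i)) (*-zeroˡ (a m i))) (sym (*-zeroˡ (Q° m i))))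
        pairs l@(suc _) zero _ = ~-reflexive
            (λ i → trans (trans (cong (a l i *_) (a-0 i)) (*-zeroʳ (a l i))) (sym (*-zeroʳ (Q° l i))))
        pairs l@(suc l′) m@(suc m′) l+m≡n = ~-* (a-bounded l (≤K (ℕ.<⇒≤ l<n)))
            (bounded-~ (~-sym (rec m<n (≤K (ℕ.<⇒≤ m<n)))) (a-bounded m (≤K (ℕ.<⇒≤ m<n))))
          (rec l<n (≤K (ℕ.<⇒≤ l<n))) (rec m<n (≤K (ℕ.<⇒≤ m<n)))
          where
          l<n : l ℕ.< n
          l<n = subst (suc l ℕ.≤_) l+m≡n (ℕ.≤-trans (ℕ.s≤s (ℕ.m≤m+n l m′)) (ℕ.≤-reflexive (sym (ℕ.+-suc l m′))))
          m<n : m ℕ.< n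
          m<n = subst (suc m ℕ.≤_) l+m≡n (ℕ.s≤s (ℕ.m≤n+m m l′))

  small⇒0 : ∀ x → (∀ ε → 0ℚ < ε → ∣ x ∣ ≤ ε) → x ≡ 0ℚ
  small⇒0 x h with x ≟ 0ℚ
  ... | yes eq = eq
  ... | no x≢0 = ⊥-elim (<-irrefl refl (<-≤-trans half (h (½ * ∣ x ∣) (0<½* 0<∣x∣))))
    where
    0<∣x∣ : 0ℚ < ∣ x ∣
    0<∣x∣ = ≰⇒> (λ le → x≢0 (∣p∣≡0⇒p≡0 x (≤-antisym le (0≤∣p∣ x))))
    half : ½ * ∣ x ∣ < ∣ x ∣
    half = subst₂ _<_ (+-identityʳ (½ * ∣ x ∣)) (½+½ ∣ x ∣) (+-monoʳ-< (½ * ∣ x ∣) (0<½* 0<∣x∣))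

  -- A polynomial that vanishes in the limit along probes t R → 1 (R → ∞), each staying away from 1, is zero:
  -- its value at 1 is zero, so it is divisible by t - 1, and the quotient has the same property.
  module Uniqueness (t : ℕ → ℕ → ℚ) (0≤t : ∀ R i → 0ℚ ≤ t R i) (t≤1 : ∀ R i → t R i ≤ 1ℚ)
    (near : ℚ) (0<near : 0ℚ < near) (t-near : ∀ R i → 1ℚ - t R i ≤ near * u R)
    (away : ℕ → ℚ) (0<away : ∀ R → 0ℚ < away R) (t-away : ∀ R i → away R ≤ 1ℚ - t R (suc i)) where

    poly : ℕ → (ℕ → ℚ) → ℚ → ℚ
    poly N c x = Σ< N (λ p → c p * x ^ p)

    Abel : ∀ N c x → poly (suc N) c x + (x - 1ℚ) * Σ< N (λ p → Σ< (suc p) c * x ^ p) ≡ Σ< (suc N) c * x ^ N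
    Abel zero c x = solve 2 (λ c x → con 0ℚ :+ c :* con 1ℚ :+ (x :- con 1ℚ) :* con 0ℚ :=
        (con 0ℚ :+ c) :* con 1ℚ) refl (c 0) x
    Abel (suc N) c x = trans (solve 6
        (λ P s C d x e → (P :+ d :* (x :* e)) :+ (x :- con 1ℚ) :* (s :+ C :* e) := (P :+ (x :- con 1ℚ) :* s) :+
        (d :* (x :* e) :+ (x :- con 1ℚ) :* (C :* e))) refl
        (poly (suc N) c x) (Σ< N (λ p → Σ< (suc p) c * x ^ p)) (Σ< (suc N) c) (c (suc N)) x (x ^ N))
      (trans (cong (_+ (c (suc N) * (x * x ^ N) + (x - 1ℚ) * (Σ< (suc N) c * x ^ N))) (Abel N c x))
        (solve 4 (λ C d x e → C :* e :+ (d :* (x :* e) :+ (x :- con 1ℚ) :* (C :* e)) := (C :+ d) :* (x :* e))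
            refl (Σ< (suc N) c) (c (suc N)) x (x ^ N)))

    geometric-sum : ∀ N x → (x - 1ℚ) * Σ< N (x ^_) ≡ x ^ N - 1ℚ
    geometric-sum zero x = *-zeroʳ (x - 1ℚ)
    geometric-sum (suc N) x = trans (*-distribˡ-+ (x - 1ℚ) (Σ< N (x ^_)) (x ^ N))
        (trans (cong (_+ (x - 1ℚ) * x ^ N) (geometric-sum N x))
      (solve 2 (λ x e → e :- con 1ℚ :+ (x :- con 1ℚ) :* e := x :* e :- con 1ℚ) refl x (x ^ N)))

    -- The coefficients of the quotient by x - 1, which are the tail sums of `c`.
    quotient : ℕ → (ℕ → ℚ) → ℕ → ℚ
    quotient N c p = Σ< (suc N) c - Σ< (suc p) c

    division : ∀ N c x → poly (suc N) c x ≡ Σ< (suc N) c + (x - 1ℚ) * poly N (quotient N c) x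
    division N c x = begin
      poly (suc N) c x                       ≡⟨ solve 2 (λ P s → P := (P :+ s) :- s) refl (poly (suc N) c x)
          ((x - 1ℚ) * s) ⟩
      poly (suc N) c x + (x - 1ℚ) * s - (x - 1ℚ) * s ≡⟨ cong (_- (x - 1ℚ) * s) (Abel N c x) ⟩
      T * x ^ N - (x - 1ℚ) * s               ≡⟨ solve 3
          (λ T e s → T :* e :- s := T :+ T :* (e :- con 1ℚ) :- s) refl T (x ^ N) ((x - 1ℚ) * s) ⟩
      T + T * (x ^ N - 1ℚ) - (x - 1ℚ) * s    ≡⟨ cong (λ g → T + T * g - (x - 1ℚ) * s) (geometric-sum N x) ⟨
      T + T * ((x - 1ℚ) * Σ< N (x ^_)) - (x - 1ℚ) * s ≡⟨ solve 4
          (λ T x g s → T :+ T :* (x :* g) :- x :* s := T :+ x :* (T :* g :- s)) refl T (x - 1ℚ)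
          (Σ< N (x ^_)) s ⟩
      T + (x - 1ℚ) * (T * Σ< N (x ^_) - s)   ≡⟨ cong (λ z → T + (x - 1ℚ) * z)
          (trans (cong (_- s) (sym (Σ-*ˡ N T (x ^_))))
          (trans (sym (Σ-- N (λ p → T * x ^ p) (λ p → Σ< (suc p) c * x ^ p)))
           (Σ-cong N (λ p → solve 3 (λ T C e → T :* e :- C :* e := (T :- C) :* e) refl T (Σ< (suc p) c)
               (x ^ p))))) ⟩
      T + (x - 1ℚ) * poly N (quotient N c) x ∎
      where
      open ≡-Reasoning
      T s : ℚ
      T = Σ< (suc N) c
      s = Σ< N (λ p → Σ< (suc p) c * x ^ p)

    ∣poly∣≤ : ∀ N c R i → ∣ poly N c (t R i) ∣ ≤ Σ< N (λ p → ∣ c p ∣)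
    ∣poly∣≤ N c R i = ≤-trans (∣Σ∣≤ N _)
        (Σ-mono N (λ p _ → ≤-trans (∣*∣≤ {c p} {∣ c p ∣} {t R i ^ p} {1ℚ} ≤-refl
      (subst (_≤ 1ℚ) (sym (0≤p⇒∣p∣≡p (0≤^ p (0≤t R i))))
          (subst (t R i ^ p ≤_) (1^ p) (^-mono-≤ p (0≤t R i) (t≤1 R i))))) (≤-reflexive (*-identityʳ ∣ c p ∣))))

    0≤1-t : ∀ R i → 0ℚ ≤ 1ℚ - t R i
    0≤1-t R i = 0≤diff (t≤1 R i)

    -- P(1) = P(t) - (t - 1) Q(t), and the quotient Q is bounded on [0, 1]. First R is chosen to
    -- make t - 1 small, then an index M to make P(t) small.
    at-1 : ∀ N c → (∀ R → (λ i → poly (suc N) c (t R i)) ~ (λ _ → 0ℚ)) → Σ< (suc N) c ≡ 0ℚ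
    at-1 N c h = small⇒0 T λ ε 0<ε →
      let B = Σ< N (λ p → ∣ quotient N c p ∣) + 1ℚ
          0<B : 0ℚ < B
          0<B = +-mono-≤-< (0≤Σ N (λ p _ → 0≤∣p∣ (quotient N c p))) 0<1
          0<nB : 0ℚ < near * B
          0<nB = 0<* 0<near 0<B
          R , uR≤ = archimedean-inv (inv (near * B) * (½ * ε)) (0<* (0<inv 0<nB) (0<½* 0<ε))
          M , hM = close (h R) (½ * ε) (0<½* 0<ε)
          x = t R M
      in begin
        ∣ T ∣ ≡⟨ cong ∣_∣ (trans (solve 2 (λ T z → T := (T :+ z) :- con 0ℚ :+ (:- z)) refl T
            ((x - 1ℚ) * poly N (quotient N c) x))
            (cong (λ P → P - 0ℚ + - ((x - 1ℚ) * poly N (quotient N c) x)) (sym (division N c x)))) ⟩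
        ∣ poly (suc N) c x - 0ℚ + - ((x - 1ℚ) * poly N (quotient N c) x) ∣ ≤⟨ ∣+∣≤ (hM M ℕ.≤-refl)
            (≤-trans (≤-reflexive (∣-p∣≡∣p∣ ((x - 1ℚ) * poly N (quotient N c) x)))
            (∣*∣≤ {x - 1ℚ} {near * u R} {poly N (quotient N c) x} {B}
             (≤-trans (≤-reflexive (trans (∣-∣-sym x 1ℚ) (0≤p⇒∣p∣≡p (0≤1-t R M)))) (t-near R M))
             (≤-trans (∣poly∣≤ N (quotient N c) R M)
                 (≤-trans (≤-reflexive (sym (+-identityʳ _)))
                 (+-monoʳ-≤ (Σ< N (λ p → ∣ quotient N c p ∣)) (<⇒≤ 0<1)))))) ⟩
        ½ * ε + near * u R * B ≡⟨ cong (½ * ε +_)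
            (solve 3 (λ n u b → n :* u :* b := n :* b :* u) refl near (u R) B) ⟩
        ½ * ε + near * B * u R ≤⟨ +-monoʳ-≤ (½ * ε)
            (≤-trans (*-monoˡ (<⇒≤ 0<nB) uR≤) (≤-reflexive (divide-bound (½ * ε) (near * B) 0<nB))) ⟩
        ½ * ε + ½ * ε ≡⟨ ½+½ ε ⟩
        ε ∎
      where
      open ≤-Reasoning
      T : ℚ
      T = Σ< (suc N) c

    vanishing : ∀ N c → (∀ R → (λ i → poly N c (t R i)) ~ (λ _ → 0ℚ)) → ∀ p → p ℕ.< N → c p ≡ 0ℚ
    vanishing (suc N) c h p p<N = trans (solve 2 (λ s c → c := (s :+ c) :- s) refl (Σ< p c) (c p))
        (trans (cong₂ _-_ (partial (suc p) p<N) (partial p (ℕ.<⇒≤ p<N))) refl)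
      where
      T≡0 : Σ< (suc N) c ≡ 0ℚ
      T≡0 = at-1 N c h
      quotient-vanishes : ∀ p → p ℕ.< N → quotient N c p ≡ 0ℚ
      -- For fixed R the factor t - 1 stays away from zero and can be cancelled; the index starts at
      -- 1, where that lower bound begins.
      quotient-vanishes = vanishing N (quotient N c) λ R → ~-cancel (λ i → t R i - 1ℚ) (away R) (0<away R)
        (1 , λ { (suc i) _ → ≤-trans (t-away R i)
            (≤-trans (≤∣∣ (1ℚ - t R (suc i))) (≤-reflexive (∣-∣-sym 1ℚ (t R (suc i))))) })
        (~-trans (~-reflexive (λ i → trans (sym (+-identityˡ _))
            (trans (cong (_+ (t R i - 1ℚ) * poly N (quotient N c) (t R i)) (sym T≡0))
            (sym (division N c (t R i))))))
          (~-trans (h R) (~-reflexive (λ i → sym (*-zeroʳ (t R i - 1ℚ))))))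
      -- With T = 0 each quotient coefficient is minus a partial sum of `c`, so all partial sums
      -- vanish and with them their differences.
      partial : ∀ m → m ℕ.≤ suc N → Σ< m c ≡ 0ℚ
      partial zero _ = refl
      partial (suc m) (ℕ.s≤s m≤N) with ℕ.m≤n⇒m<n∨m≡n m≤N
      ... | inj₂ refl = T≡0
      ... | inj₁ m<N = trans (solve 2 (λ T s → s := T :- (T :- s)) refl (Σ< (suc N) c) (Σ< (suc m) c))
          (trans (cong₂ _-_ T≡0 (quotient-vanishes m m<N)) refl)

  -- E₄ = 1 + 240 Σ σ₃ qⁿ and E₆ = 1 - 504 Σ σ₅ qⁿ

  240ℚ 504ℚ : ℚ
  240ℚ = ℤ.+ 240 / 1
  504ℚ = ℤ.+ 504 / 1

  y-2 : y ! 2 ≡ - (ℤ.+ 1 / 720)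
  y-2 = *-cancelˡ {p = 5ℚ} (λ ())
      (trans (trans (solve 1 (λ z → con 5ℚ :* z := :- (:- (con 5ℚ :* z))) refl (y ! 2))
      (cong -_ (trans (cong (λ k → - (k * y ! 2)) (sym (ι-def 5))) (sym (y-convolution 0)))))
    (trans (cong (λ z → - (z * z)) y-1) refl))

  y-3 : y ! 3 ≡ ℤ.+ 1 / 30240
  y-3 = *-cancelˡ {p = ℤ.+ 7 / 1} (λ ())
      (trans (trans (solve 1 (λ z → con (ℤ.+ 7 / 1) :* z := :- (:- (con (ℤ.+ 7 / 1) :* z))) refl (y ! 3))
      (cong -_ (trans (cong (λ k → - (k * y ! 3)) (sym (ι-def 7))) (sym (y-convolution 1)))))
    (trans (cong₂ (λ z w → - (z * w + w * z)) y-1 y-2) refl))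

  ℘°-y : ∀ n → ℘° ! suc (suc n) ≡ (1ℚ - (ι (suc (suc n)) + ι (suc (suc n)))) * y ! suc (suc n)
  ℘°-y n = trans (at ℘₀-y (suc (suc n)))
      (trans (cong₂ (λ a b → y ! suc (suc n) - a + b) (κ-⊗ 2ℚ (θ y) (suc (suc n)))
      (trans (κ-⊗ 1/12 X (suc (suc n))) (*-zeroʳ 1/12)))
    (solve 2 (λ y n → y :- con 2ℚ :* (n :* y) :+ con 0ℚ := (con 1ℚ :- (n :+ n)) :* y) refl (y ! suc (suc n))
        (ι (suc (suc n)))))

  module Probe (K : ℕ) (6≤K : 6 ℕ.≤ K) (R : ℕ) where
    -- 2016 = 4 · 504: then S 3 and S 5 are at most 1/1008, hence E₆ ≥ 1/2 and E₄ ≤ 2. The summand R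
    -- moves the point towards i∞.
    radius : ℕ
    radius = 2016 ℕ.* 2 ℕ.^ K ℕ.+ R

    open Exp radius public using (q; 0<q; q≤; q-low; 0<q-low; q-low≤q)

    0≤q : ∀ i → 0ℚ ≤ q i
    0≤q i = <⇒≤ (0<q i)

    2016ℚ : ℚ
    2016ℚ = ℤ.+ 2016 / 1

    2016q : ∀ i → 2016ℚ * (ι 2 ^ K * q i) ≤ 1ℚ
    2016q i = begin
      2016ℚ * (ι 2 ^ K * q i)          ≡⟨ trans
          (cong₂ (λ a b → a * (b * q i)) (sym (ι-def 2016)) (sym (ι-^ 2 K)))
          (trans (sym (*-assoc (ι 2016) (ι (2 ℕ.^ K)) (q i))) (cong (_* q i) (sym (ι-* 2016 (2 ℕ.^ K))))) ⟩
      ι (2016 ℕ.* 2 ℕ.^ K) * q i       ≤⟨ *-mono-≤ (0≤ι _) (0≤q i)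
          (ι-mono-≤ (ℕ.m≤n⇒m≤1+n (ℕ.m≤m+n (2016 ℕ.* 2 ℕ.^ K) R))) (q≤ i) ⟩
      ι (suc radius) * u radius        ≡⟨ inverseʳ (ι≢0 radius) ⟩
      1ℚ                               ∎
      where open ≤-Reasoning

    2^q≤ : ∀ i → ι 2 ^ K * q i ≤ ℤ.+ 1 / 2016
    2^q≤ i = *-cancelˡ-≤-pos 2016ℚ (≤-trans (2016q i) (toWitness {a? = 1ℚ ≤? 2016ℚ * (ℤ.+ 1 / 2016)} _))

    small : ∀ i → ι 2 ^ K * q i ≤ ¼
    small i = ≤-trans (2^q≤ i) (toWitness {a? = ℤ.+ 1 / 2016 ≤? ¼} _)

    open Evaluation q 0≤q K small public

    4≤K : 4 ℕ.≤ K
    4≤K = ℕ.≤-trans (ℕ.m≤m+n 4 2) 6≤K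

    E₄ E₆ : ℕ → ℚ
    E₄ i = 1ℚ + 240ℚ * S 3 i
    E₆ i = 1ℚ - 504ℚ * S 5 i

    -- 1/720 is 2ζ(4) / (2πi)⁴; likewise -1/30240 in `a-3` is 2ζ(6) / (2πi)⁶.
    a-2 : ∀ i → ⅓ * a 2 i ≡ (ℤ.+ 1 / 720) * E₄ i
    a-2 i = trans (cong (⅓ *_)
        (trans (a-S 0 i) (cong₂ (λ p f → p + f * S 3 i)
        (trans (℘°-y 0) (cong₂ (λ n z → (1ℚ - (n + n)) * z) (ι-def 2) y-2))
        (cong (λ n → 2ℚ * inv n) (ι-def 2)))))
      (solve 1 (λ s → con ⅓ :* (con ((1ℚ - (2ℚ + 2ℚ)) * - (ℤ.+ 1 / 720)) :+ con (2ℚ * inv 2ℚ) :* s) := con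
          (ℤ.+ 1 / 720) :* (con 1ℚ :+ con 240ℚ :* s)) refl (S 3 i))

    a-3 : ∀ i → ⅕ * a 3 i ≡ - (ℤ.+ 1 / 30240) * E₆ i
    a-3 i = trans (cong (⅕ *_)
        (trans (a-S 1 i) (cong₂ (λ p f → p + f * S 5 i)
        (trans (℘°-y 1) (cong₂ (λ n z → (1ℚ - (n + n)) * z) (ι-def 3) y-3))
        (cong (λ n → 2ℚ * inv n) (ι-def 24)))))
      (solve 1 (λ s → con ⅕ :* (con ((1ℚ - (3ℚ + 3ℚ)) * (ℤ.+ 1 / 30240)) :+ con (2ℚ * inv 24ℚ) :* s) := con
          (- (ℤ.+ 1 / 30240)) :* (con 1ℚ :- con 504ℚ :* s)) refl (S 5 i))

    S≤′ : ∀ k i → suc k ℕ.≤ K → S k i ≤ ℤ.+ 1 / 1008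
    S≤′ k i k<K = ≤-trans (S≤ k i k<K)
        (≤-trans (≤-reflexive (solve 2 (λ q t → q :* (con 2ℚ :* t) := con 2ℚ :* (t :* q)) refl (q i) (ι 2 ^ K)))
      (≤-trans (*-monoˡ (<⇒≤ (positive⁻¹ 2ℚ)) (2^q≤ i))
          (toWitness {a? = 2ℚ * (ℤ.+ 1 / 2016) ≤? ℤ.+ 1 / 1008} _)))

    1≤E₄ : ∀ i → 1ℚ ≤ E₄ i
    1≤E₄ i = ≤-trans (≤-reflexive (sym (+-identityʳ 1ℚ))) (+-monoʳ-≤ 1ℚ (0≤* (<⇒≤ (positive⁻¹ 240ℚ)) (0≤S 3 i)))

    0<E₄ : ∀ i → 0ℚ < E₄ i
    0<E₄ i = <-≤-trans 0<1 (1≤E₄ i)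

    E₄≤2 : ∀ i → E₄ i ≤ 2ℚ
    E₄≤2 i = ≤-trans (+-monoʳ-≤ 1ℚ (*-monoˡ (<⇒≤ (positive⁻¹ 240ℚ)) (S≤′ 3 i 4≤K)))
        (toWitness {a? = 1ℚ + 240ℚ * (ℤ.+ 1 / 1008) ≤? 2ℚ} _)

    E₆≤1 : ∀ i → E₆ i ≤ 1ℚ
    E₆≤1 i = ≤-trans (+-monoʳ-≤ 1ℚ (neg-antimono-≤ (0≤* (<⇒≤ (positive⁻¹ 504ℚ)) (0≤S 5 i)))) ≤-refl

    ½≤E₆ : ∀ i → ½ ≤ E₆ i
    ½≤E₆ i = ≤-trans (toWitness {a? = ½ ≤? 1ℚ - 504ℚ * (ℤ.+ 1 / 1008)} _)
        (+-monoʳ-≤ 1ℚ (neg-antimono-≤ (*-monoˡ (<⇒≤ (positive⁻¹ 504ℚ)) (S≤′ 5 i 6≤K))))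

    0≤E₆ : ∀ i → 0ℚ ≤ E₆ i
    0≤E₆ i = ≤-trans (<⇒≤ (positive⁻¹ ½)) (½≤E₆ i)

    -- t approximates E₆² / E₄³ = 1 - 1728/j, which has weight 0 and turns forms into polynomials in
    -- one variable.
    E₄³ t : ℕ → ℚ
    E₄³ i = E₄ i ^ 3
    t i = E₆ i ^ 2 * inv (E₄³ i)

    1≤E₄³ : ∀ i → 1ℚ ≤ E₄³ i
    1≤E₄³ i = 1≤^ 3 (1≤E₄ i)

    0<E₄³ : ∀ i → 0ℚ < E₄³ i
    0<E₄³ i = <-≤-trans 0<1 (1≤E₄³ i)

    0≤t : ∀ i → 0ℚ ≤ t i
    0≤t i = 0≤* (0≤^ 2 (0≤E₆ i)) (0≤inv (0<E₄³ i))

    E₆²≤1 : ∀ i → E₆ i ^ 2 ≤ 1ℚ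
    E₆²≤1 i = ^-mono-≤ 2 (0≤E₆ i) (E₆≤1 i)

    inv≤1 : ∀ i → inv (E₄³ i) ≤ 1ℚ
    inv≤1 i = inv-antimono 0<1 (1≤E₄³ i)

    t≤1 : ∀ i → t i ≤ 1ℚ
    t≤1 i = *-mono-≤ (0≤^ 2 (0≤E₆ i)) (0≤inv (0<E₄³ i)) (E₆²≤1 i) (inv≤1 i)

    1-t : ∀ i → 1ℚ - t i ≡ (E₄³ i - E₆ i ^ 2) * inv (E₄³ i)
    1-t i = trans (cong (_- t i) (sym (inverseʳ (<⇒≢0 (0<E₄³ i)))))
        (solve 3 (λ a b v → a :* v :- b :* v := (a :- b) :* v) refl (E₄³ i) (E₆ i ^ 2) (inv (E₄³ i)))

    E₄-1≤ : ∀ i → E₄ i - 1ℚ ≤ E₄³ i - E₆ i ^ 2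
    E₄-1≤ i = +-mono-≤ (≤-trans (≤-reflexive (sym (*-identityʳ (E₄ i))))
        (*-monoˡ (<⇒≤ (0<E₄ i)) (1≤^ 2 (1≤E₄ i)))) (neg-antimono-≤ (E₆²≤1 i))

    0≤E₄-1 : ∀ i → 0ℚ ≤ E₄ i - 1ℚ
    0≤E₄-1 i = 0≤diff (1≤E₄ i)

    -- 2688 = 240 · 7 + 504 · 2: in E₄³ - 1 and 1 - E₆² the cofactors E₄² + E₄ + 1 and 1 + E₆ are at
    -- most 7 and 2.
    near-constant : ℚ
    near-constant = (ℤ.+ 2688 / 1) * (2ℚ * ι 2 ^ K)

    t-near : ∀ i → 1ℚ - t i ≤ near-constant * u R
    t-near i = begin
      1ℚ - t i                              ≡⟨ 1-t i ⟩
      (E₄³ i - E₆ i ^ 2) * inv (E₄³ i)      ≤⟨ *-monoˡ (≤-trans (0≤E₄-1 i) (E₄-1≤ i)) (inv≤1 i) ⟩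
      (E₄³ i - E₆ i ^ 2) * 1ℚ               ≡⟨ solve 2 (λ s z → (let e = con 1ℚ :+ con 240ℚ :* s ; f = con 1ℚ :- con 504ℚ :* z in
                                                 (e :* (e :* (e :* con 1ℚ)) :- f :* (f :* con 1ℚ)) :* con 1ℚ :=
                                                 con 240ℚ :* s :* (e :* e :+ e :+ con 1ℚ) :+ con 504ℚ :* z :*
                                                     (con 1ℚ :+ f))) refl (S 3 i) (S 5 i) ⟩
      240ℚ * S 3 i * (E₄ i * E₄ i + E₄ i + 1ℚ) + 504ℚ * S 5 i * (1ℚ + E₆ i)
        ≤⟨ +-mono-≤ (*-mono-≤ (0≤* (<⇒≤ (positive⁻¹ 240ℚ)) (0≤S 3 i))
            (0≤+ (0≤+ (0≤* (<⇒≤ (0<E₄ i)) (<⇒≤ (0<E₄ i))) (<⇒≤ (0<E₄ i))) (<⇒≤ 0<1))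
                      (*-monoˡ (<⇒≤ (positive⁻¹ 240ℚ)) (S≤ 3 i 4≤K))
                          (+-monoˡ-≤ 1ℚ (+-mono-≤ (*-mono-≤ (<⇒≤ (0<E₄ i)) (<⇒≤ (0<E₄ i)) (E₄≤2 i) (E₄≤2 i))
                          (E₄≤2 i))))
                    (*-mono-≤ (0≤* (<⇒≤ (positive⁻¹ 504ℚ)) (0≤S 5 i)) (0≤+ (<⇒≤ 0<1) (0≤E₆ i))
                        (*-monoˡ (<⇒≤ (positive⁻¹ 504ℚ)) (S≤ 5 i 6≤K)) (+-monoʳ-≤ 1ℚ (E₆≤1 i))) ⟩
      240ℚ * (q i * (2ℚ * ι 2 ^ K)) * (2ℚ * 2ℚ + 2ℚ + 1ℚ) + 504ℚ * (q i * (2ℚ * ι 2 ^ K)) * (1ℚ + 1ℚ)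
        ≡⟨ solve 2 (λ q t → con 240ℚ :* (q :* t) :* con (2ℚ * 2ℚ + 2ℚ + 1ℚ) :+ con 504ℚ :* (q :* t) :* con
            (1ℚ + 1ℚ) := con (ℤ.+ 2688 / 1) :* t :* q) refl (q i) (2ℚ * ι 2 ^ K) ⟩
      near-constant * q i                   ≤⟨ *-monoˡ
          (0≤* (<⇒≤ (positive⁻¹ (ℤ.+ 2688 / 1))) (0≤* (<⇒≤ (positive⁻¹ 2ℚ)) 0≤2^))
          (≤-trans (q≤ i) (inv-antimono (0<ι R) (ι-mono-≤ (ℕ.s≤s (ℕ.m≤n+m R (2016 ℕ.* 2 ℕ.^ K)))))) ⟩
      near-constant * u R                   ∎
      where open ≤-Reasoning

    -- 1 - t is at least (E₄ - 1)/8, as E₄³ ≤ 8, and E₄ - 1 = 240 S 3 is at least 240 q. The index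
    -- is a successor because S 3 0 is an empty sum.
    t-away : ∀ i → q-low ≤ 1ℚ - t (suc i)
    t-away i = begin
      q-low                                 ≤⟨ q-low≤q (suc i) ⟩
      q (suc i)                             ≤⟨ q≤S 3 i ⟩
      S 3 (suc i)                           ≤⟨ ≤-trans (≤-reflexive (sym (*-identityˡ (S 3 (suc i)))))
          (*-monoʳ (0≤S 3 (suc i)) (toWitness {a? = 1ℚ ≤? 240ℚ * (ℤ.+ 1 / 8)} _)) ⟩
      240ℚ * (ℤ.+ 1 / 8) * S 3 (suc i)      ≡⟨ solve 1
          (λ s → con (240ℚ * (ℤ.+ 1 / 8)) :* s := (con 1ℚ :+ con 240ℚ :* s :- con 1ℚ) :* con (ℤ.+ 1 / 8)) refl
          (S 3 (suc i)) ⟩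
      (E₄ (suc i) - 1ℚ) * (ℤ.+ 1 / 8)       ≤⟨ *-mono-≤ (0≤E₄-1 (suc i)) (<⇒≤ (positive⁻¹ (ℤ.+ 1 / 8)))
          (E₄-1≤ (suc i)) (inv-antimono (0<E₄³ (suc i)) (^-mono-≤ 3 (<⇒≤ (0<E₄ (suc i))) (E₄≤2 (suc i)))) ⟩
      (E₄³ (suc i) - E₆ (suc i) ^ 2) * inv (E₄³ (suc i)) ≡⟨ 1-t (suc i) ⟨
      1ℚ - t (suc i)                        ∎
      where open ≤-Reasoning

-- Comparison of an expansion with the 2-integral one.

module RationalCoefficients where

  open import Data.Nat.Base using (_!)
  open import Data.Rational.Base
  open import Data.Rational.Properties
  open import Data.Rational.Solver using (module +-*-Solver)
  open import Defs using (bernoulli; exponents)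
  open RationalArithmetic
  open PowerSeries hiding (module Reasoning)
  open BernoulliSeries using (2ℚ; y; y-𝐁; ι!≢0; ι-dbl; tail²; anti-Σ<)
  open IntegralWeierstrass
  open WeierstrassForms using (Q-form)
  open Monomials
  open ZetaRecurrence hiding (S; T; R; r)
  open EisensteinEvaluation using (index; factor)
  open VanishingPolynomials
  open +-*-Solver using (solve; _:+_; _:*_; _:-_; :-_; _:=_; con)

  -- the coefficient -2k/B_k of E_k, for k = 2n
  eisensteinFactor : ℕ → ℚ
  eisensteinFactor k = ℤ.+ (2 ℕ.* k) / 1 * inv (bernoulli k)

  -- (2n - 1) (B₂ₙ / (2n)!) (4n / B₂ₙ) = 2 / (2n - 2)! with n = N + 2. Cancelling B₂ₙ rests on
  -- `y≢0`.
  eisenstein-normalization : ∀ N → ι (index N) *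
      (y ! suc (suc N) * eisensteinFactor (dbl (suc (suc N)))) ≡ factor N
  eisenstein-normalization N = begin
    ι (suc m) * (y ! suc (suc N) * (ℤ.+ (2 ℕ.* suc (suc m)) / 1 * inv B))
      ≡⟨ cong₂ (λ z t → ι (suc m) * (z * (t * inv B))) (y-𝐁 (suc (suc N)))
          (trans (sym (ι-def (2 ℕ.* suc (suc m))))
          (trans (ι-* 2 (suc (suc m))) (cong (_* ι (suc (suc m))) (ι-def 2)))) ⟩
    ι (suc m) * (B * inv (ι (suc (suc m) !)) * (2ℚ * ι (suc (suc m)) * inv B))
      ≡⟨ solve 5 (λ i b f j v → i :* (b :* f :* (con 2ℚ :* j :* v)) := con 2ℚ :* (i :* j :* f :* (b :* v))) refl
          (ι (suc m)) B (inv (ι (suc (suc m) !))) (ι (suc (suc m))) (inv B) ⟩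
    2ℚ * (ι (suc m) * ι (suc (suc m)) * inv (ι (suc (suc m) !)) * (B * inv B))
      ≡⟨ cong (2ℚ *_) (trans (cong₂ _*_ cancel (inverseʳ B≢0)) (*-identityʳ (inv (ι (m !))))) ⟩
    2ℚ * inv (ι (m !)) ∎
    where
    open ≡-Reasoning
    m : ℕ
    m = dbl (suc N)
    B : ℚ
    B = bernoulli (suc (suc m))
    B≢0 : B ≢ 0ℚ
    B≢0 eq = y≢0 (suc N) (trans (y-𝐁 (suc (suc N)))
        (trans (cong (_* inv (ι (suc (suc m) !))) eq) (*-zeroˡ (inv (ι (suc (suc m) !))))))
    cancel : ι (suc m) * ι (suc (suc m)) * inv (ι (suc (suc m) !)) ≡ inv (ι (m !))
    cancel = inv-unique (ι (m !))
        (trans (solve 4 (λ f i j v → f :* (i :* j :* v) := j :* (i :* f) :* v) refl (ι (m !)) (ι (suc m))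
        (ι (suc (suc m))) (inv (ι (suc (suc m) !))))
      (trans (cong (_* inv (ι (suc (suc m) !)))
          (trans (cong (ι (suc (suc m)) *_) (sym (ι-* (suc m) (m !)))) (sym (ι-* (suc (suc m)) (suc m !)))))
          (inverseʳ (ι!≢0 (suc (suc m))))))

  module Eisenstein (K : ℕ) (6≤K : 6 ℕ.≤ K) (R : ℕ) where
    open Probe K 6≤K R public
    open Identification q 0≤q K small public using (a-polynomial; Q°)

    -- approximations of G_{2n}, and of G_{2n} / (2πi)²ⁿ
    G̃ γ : ℕ → ℕ → ℚ
    G̃ n i = 2ℚ * Z n i * (1ℚ - eisensteinFactor (dbl n) * S (dbl n ℕ.∸ 1) i)
    γ n i = inv (ι (dbl n ℕ.∸ 1)) * a n i

    γ-normalized : ∀ N i → γ (suc (suc N)) i ≡ - y ! suc (suc N) *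
        (1ℚ - eisensteinFactor (dbl (suc (suc N))) * S (index N) i)
    γ-normalized N i = *-cancelˡ (ι≢0 (dbl (suc N)))
        (trans (trans (sym (*-assoc (ι (index N)) _ _))
        (trans (cong (_* a (suc (suc N)) i) (inverseʳ (ι≢0 (dbl (suc N))))) (trans (*-identityˡ _) (a-S N i))))
      (trans (cong₂ (λ p f → p + f * S (index N) i) (trans (℘°-y N) (cong (_* y ! suc (suc N)) index-eq))
          (sym (eisenstein-normalization N)))
      (solve 4 (λ i y c s → (:- i) :* y :+ i :* (y :* c) :* s := i :* ((:- y) :* (con 1ℚ :- c :* s))) refl
          (ι (index N)) (y ! suc (suc N)) (eisensteinFactor (dbl (suc (suc N)))) (S (index N) i))))
      where
      index-eq : 1ℚ - (ι (suc (suc N)) + ι (suc (suc N))) ≡ - ι (index N)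
      index-eq = trans (cong (λ z → 1ℚ - z) (trans (sym (ι-dbl (suc (suc N)))) (ι-suc (index N))))
          (solve 1 (λ z → con 1ℚ :- (con 1ℚ :+ z) := :- z) refl (ι (index N)))

    S-bounded : ∀ k → suc k ℕ.≤ K → Bounded (S k)
    S-bounded k k<K = bounded-≤ 1ℚ 0<1
        (λ i → ≤-trans (≤-reflexive (0≤p⇒∣p∣≡p (0≤S k i)))
        (≤-trans (S≤′ k i k<K) (toWitness {a? = ℤ.+ 1 / 1008 ≤? 1ℚ} _)))

    -- Euler's formula replaces 2ζ(2n) by -B₂ₙ / (2n)! times a power of Λ, and `γ-normalized`
    -- recognises the remaining factors.
    G̃-γ : ∀ N → suc (index N) ℕ.≤ K → G̃ (suc (suc N)) ~ (λ i → Λ i ^ suc (suc N) * γ (suc (suc N)) i)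
    G̃-γ N le = ~-trans (~-* (bounded-* (bounded-const 2ℚ) (Z-bounded (suc N))) series-bounded
        (Euler (suc N)) ~-refl)
      (~-reflexive (λ i → trans
          (solve 3 (λ y l e → (:- y) :* l :* e := l :* ((:- y) :* e)) refl (y ! suc (suc N)) (Λ i ^ suc (suc N))
          (1ℚ - eisensteinFactor (dbl (suc (suc N))) * S (index N) i))
        (cong (Λ i ^ suc (suc N) *_) (sym (γ-normalized N i)))))
      where
      series-bounded : Bounded (λ i → 1ℚ - eisensteinFactor (dbl (suc (suc N))) * S (index N) i)
      series-bounded = bounded-~
          (~-reflexive (λ i → cong (1ℚ +_)
          (neg-distribˡ-* (eisensteinFactor (dbl (suc (suc N)))) (S (index N) i))))
        (bounded-+ (bounded-const 1ℚ)
            (bounded-* (bounded-const (- eisensteinFactor (dbl (suc (suc N))))) (S-bounded (index N) le)))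

    γ-2 : ∀ i → γ 2 i ≡ ⅓ * a 2 i
    γ-2 i = cong (λ v → inv v * a 2 i) (ι-def 3)

    γ-3 : ∀ i → γ 3 i ≡ ⅕ * a 3 i
    γ-3 i = cong (λ v → inv v * a 3 i) (ι-def 5)

    γ-bounded : ∀ n → dbl n ℕ.≤ K → Bounded (γ n)
    γ-bounded n le = bounded-* (bounded-const (inv (ι (dbl n ℕ.∸ 1)))) (a-bounded n le)

    -- The successor excludes the empty sum Z 1 0; from then on Z 1 is at least 1.
    1≤∣Λ^∣ : ∀ n i → 1ℚ ≤ ∣ Λ (suc i) ^ n ∣
    1≤∣Λ^∣ zero i = ≤-refl
    1≤∣Λ^∣ (suc n) i = ≤-trans (*-mono-≤ (<⇒≤ 0<1) (<⇒≤ 0<1) 1≤∣Λ∣ (1≤∣Λ^∣ n i))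
        (≤-reflexive (sym (∣p*q∣≡∣p∣*∣q∣ (Λ (suc i)) (Λ (suc i) ^ n))))
      where
      1≤∣Λ∣ : 1ℚ ≤ ∣ Λ (suc i) ∣
      1≤∣Λ∣ = ≤-trans (*-mono-≤ (<⇒≤ 0<1) (<⇒≤ 0<1) (toWitness {a? = 1ℚ ≤? 24ℚ} _) (1≤Z 1 i))
          (≤-trans (≤∣∣ _) (≤-reflexive (sym (∣-p∣≡∣p∣ (24ℚ * Z 1 (suc i))))))

  module Solve (r : Fin 3) (s : Fin 2) (J : ℕ) where
    x z : ℕ → ℕ
    x = xᵉ r s
    z = yᵉ r s

    α β : ℚ
    α = ℤ.+ 1 / 720
    β = - (ℤ.+ 1 / 30240)

    Relation : ∀ K → 6 ℕ.≤ K → (ℕ → ℚ) → Set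
    Relation K 6≤K d = ∀ R → let open Probe K 6≤K R in (λ i → anti (λ q p → d q * ((⅓ * a 2 i) ^ x q * (⅕ * a 3 i) ^ z p)) J) ~ (λ _ → 0ℚ)

    module _ (K : ℕ) (6≤K : 6 ℕ.≤ K) (d : ℕ → ℚ) (h : Relation K 6≤K d) where

      d′ : ℕ → ℕ → ℚ
      d′ q p = d q * (α ^ x q * β ^ z p)

      -- Numbered by the exponent p of t, so that q = J - p.
      c : ℕ → ℚ
      c p = d′ (J ℕ.∸ p) p

      module _ (R : ℕ) where
        open Probe K 6≤K R hiding (q)
        prefactor : ℕ → ℚ
        prefactor i = E₄ i ^ toℕ r * E₆ i ^ toℕ s * E₄³ i ^ J

        -- Because q + p = J, the power E₄^(3q) is E₄^(3J) divided by E₄^(3p), and E₆^(2p) divided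
        -- by the latter is tᵖ.
        E₄-power : ∀ i q p → q ℕ.+ p ≡ J → E₄ i ^ x q * E₆ i ^ z p ≡ prefactor i * t i ^ p
        E₄-power i q p q+p≡J = begin
          E₄ i ^ x q * E₆ i ^ z p ≡⟨ cong₂ _*_
              (trans (^-+ (E₄ i) (toℕ r) (3 ℕ.* q)) (cong (E₄ i ^ toℕ r *_) (sym (^-*-assoc (E₄ i) 3 q))))
              (trans (^-+ (E₆ i) (toℕ s) (2 ℕ.* p)) (cong (E₆ i ^ toℕ s *_) (sym (^-*-assoc (E₆ i) 2 p)))) ⟩
          E₄ i ^ toℕ r * w ^ q * (E₆ i ^ toℕ s * v ^ p) ≡⟨ solve 4
              (λ a b c d → a :* b :* (c :* d) := a :* c :* (b :* d :* con 1ℚ)) refl (E₄ i ^ toℕ r) (w ^ q)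
              (E₆ i ^ toℕ s) (v ^ p) ⟩
          E₄ i ^ toℕ r * E₆ i ^ toℕ s * (w ^ q * v ^ p * 1ℚ) ≡⟨ cong
              (λ o → E₄ i ^ toℕ r * E₆ i ^ toℕ s * (w ^ q * v ^ p * o))
              (trans (sym (1^ p)) (trans (cong (_^ p) (sym (inverseʳ (<⇒≢0 (0<E₄³ i)))))
              (^-*-distrib w (inv w) p))) ⟩
          E₄ i ^ toℕ r * E₆ i ^ toℕ s * (w ^ q * v ^ p * (w ^ p * inv w ^ p)) ≡⟨ solve 5
              (λ e a b c d → e :* (a :* b :* (c :* d)) := e :* (a :* c) :* (b :* d)) refl
              (E₄ i ^ toℕ r * E₆ i ^ toℕ s) (w ^ q) (v ^ p) (w ^ p) (inv w ^ p) ⟩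
          E₄ i ^ toℕ r * E₆ i ^ toℕ s * (w ^ q * w ^ p) * (v ^ p * inv w ^ p) ≡⟨ cong₂
              (λ a b → E₄ i ^ toℕ r * E₆ i ^ toℕ s * a * b) (trans (sym (^-+ w q p)) (cong (w ^_) q+p≡J))
              (sym (^-*-distrib v (inv w) p)) ⟩
          prefactor i * t i ^ p ∎
          where
          open ≡-Reasoning
          w v : ℚ
          w = E₄³ i
          v = E₆ i ^ 2

        factorization : ∀ i → anti (λ q p → d q * ((⅓ * a 2 i) ^ x q * (⅕ * a 3 i) ^ z p)) J ≡ prefactor i * Σ<
            (suc J) (λ p → c p * t i ^ p)
        factorization i = begin
          anti (λ q p → d q * ((⅓ * a 2 i) ^ x q * (⅕ * a 3 i) ^ z p)) J
            ≡⟨ anti-cong⁺ J (λ q p q+p≡J → trans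
                (cong (d q *_) (trans
                (cong₂ _*_ (trans (cong (_^ x q) (a-2 i)) (^-*-distrib α (E₄ i) (x q)))
                (trans (cong (_^ z p) (a-3 i)) (^-*-distrib β (E₆ i) (z p))))
                 (solve 4 (λ a b c d → a :* b :* (c :* d) := a :* c :* (b :* d)) refl (α ^ x q) (E₄ i ^ x q)
                     (β ^ z p) (E₆ i ^ z p))))
                 (trans (cong (λ e → d q * (α ^ x q * β ^ z p * e)) (E₄-power i q p q+p≡J))
                     (solve 4 (λ d a f t → d :* (a :* (f :* t)) := f :* (d :* a :* t)) refl (d q)
                     (α ^ x q * β ^ z p) (prefactor i) (t i ^ p)))) ⟩
          anti (λ q p → prefactor i * (d′ q p * t i ^ p)) J ≡⟨ anti-*ˡ J (prefactor i) _ ⟩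
          prefactor i * anti (λ q p → d′ q p * t i ^ p) J ≡⟨ cong (prefactor i *_)
              (trans (anti-comm J _) (anti-Σ< J _)) ⟩
          prefactor i * Σ< (suc J) (λ p → c p * t i ^ p) ∎
          where open ≡-Reasoning

        0<½^ : ∀ n → 0ℚ < ½ ^ n
        0<½^ zero = 0<1
        0<½^ (suc n) = 0<* (positive⁻¹ ½) (0<½^ n)

        prefactor-low : ∀ i → ½ ^ toℕ s ≤ ∣ prefactor i ∣
        prefactor-low i = ≤-trans
            (≤-reflexive (trans (sym (*-identityˡ (½ ^ toℕ s))) (sym (*-identityʳ (1ℚ * ½ ^ toℕ s)))))
          (≤-trans (*-mono-≤ (0≤* (<⇒≤ 0<1) (<⇒≤ (0<½^ (toℕ s)))) (<⇒≤ 0<1)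
              (*-mono-≤ (<⇒≤ 0<1) (<⇒≤ (0<½^ (toℕ s))) (1≤^ (toℕ r) (1≤E₄ i))
              (^-mono-≤ (toℕ s) (<⇒≤ (positive⁻¹ ½)) (½≤E₆ i))) (1≤^ J (1≤E₄³ i))) (≤∣∣ (prefactor i)))

        poly-null : (λ i → Σ< (suc J) (λ p → c p * t i ^ p)) ~ (λ _ → 0ℚ)
        poly-null = ~-cancel prefactor (½ ^ toℕ s) (0<½^ (toℕ s)) (0 , λ i _ → prefactor-low i)
          (~-trans (~-reflexive (λ i → sym (factorization i)))
              (~-trans (h R) (~-reflexive (λ i → sym (*-zeroʳ (prefactor i))))))

      vanish : ∀ q → q ℕ.≤ J → d q ≡ 0ℚ
      vanish q q≤J = *≡0⇒≡0 (*-≢0 (^-≢0 (x q) α≢0) (^-≢0 (z (J ℕ.∸ q)) β≢0))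
          (trans (*-comm (α ^ x q * β ^ z (J ℕ.∸ q)) (d q))
          (trans (cong (λ m → d′ m (J ℕ.∸ q)) (sym (ℕ.m∸[m∸n]≡n q≤J)))
        (vanishing (suc J) c poly-null (J ℕ.∸ q) (ℕ.s≤s (ℕ.m∸n≤m J q)))))
        where
        α≢0 : α ≢ 0ℚ
        α≢0 ()
        β≢0 : β ≢ 0ℚ
        β≢0 ()
        open Uniqueness (λ R → Probe.t K 6≤K R) (λ R → Probe.0≤t K 6≤K R) (λ R → Probe.t≤1 K 6≤K R) (Probe.near-constant K 6≤K 0)
          (0<* (positive⁻¹ (ℤ.+ 2688 / 1)) (0<* (positive⁻¹ 2ℚ) (<-≤-trans 0<1 (1≤^ K (1≤ι 1)))))
              (λ R → Probe.t-near K 6≤K R)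
          (λ R → Probe.q-low K 6≤K R) (λ R → Probe.0<q-low K 6≤K R) (λ R → Probe.t-away K 6≤K R)

    n : ℕ
    n = (2 ℕ.* toℕ r ℕ.+ 3 ℕ.* toℕ s) ℕ.+ J ℕ.* 6

    module _ (N : ℕ) (n≡ : n ≡ suc (suc N)) (w : ℕ → ℚ) where
      -- Large enough for the weights 4, 6 and 2n, whose Eisenstein series have to be bounded
      -- geometrically.
      K : ℕ
      K = dbl n ℕ.+ 6

      6≤K : 6 ℕ.≤ K
      6≤K = ℕ.m≤n+m 6 (dbl n)

      -- The given expansion and the one from the curve both represent `γ n`, so their difference is
      -- a null relation between monomials, and `vanish` makes its coefficients zero.
      integral-solution : (∀ R → let open Eisenstein K 6≤K R in
        G̃ n ~ (λ i → ΣL (exponents (dbl n)) (λ (a , b) → w a * (G̃ 2 i ^ a * G̃ 3 i ^ b)))) → ∀ q → q ℕ.≤ J →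
            2-Integral (w (x q))
      integral-solution expansion q q≤J = subst 2-Integral
          (sym (trans (solve 2 (λ w c → w := (w :- c) :+ c) refl (w (x q)) (coefficient q))
          (trans (cong (_+ coefficient q) (vanish K 6≤K d difference q q≤J)) (+-identityˡ (coefficient q)))))
          (proj₁ (proj₂ coefficients) q)
        where
        -- Passing from a n to γ n divides by 2n - 1, one more odd number.
        normalized-form : Form n (λ u v → inv (ι (dbl n ℕ.∸ 1)) * Curve.Q u v ! n)
        normalized-form = 2-integral-odd ·ᶠ Q-form n
          where
          2-integral-odd : 2-Integral (inv (ι (dbl n ℕ.∸ 1)))
          2-integral-odd = subst (λ m → 2-Integral (inv (ι (dbl m ℕ.∸ 1)))) (sym n≡) (2-integral-inv (suc N))
        coefficients : ∃ λ (c : ℕ → ℚ) → (∀ q → 2-Integral (c q)) ×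
            (∀ u v → inv (ι (dbl n ℕ.∸ 1)) * Curve.Q u v ! n ≡ anti (λ q p → c q * (u ^ x q * v ^ z p)) J)
        coefficients = form-coefficients r s J refl normalized-form
        coefficient d : ℕ → ℚ
        coefficient = proj₁ coefficients
        d q = w (x q) - coefficient q
        difference : ∀ R → let open Probe K 6≤K R in (λ i → anti (λ q p → d q * ((⅓ * a 2 i) ^ x q * (⅕ * a 3 i) ^ z p)) J) ~ (λ _ → 0ℚ)
        difference R = ~-trans (~-reflexive
            (λ i → trans (anti-cong J
            (λ q p → solve 3 (λ w c m → (w :- c) :* m := w :* m :+ :- (c :* m)) refl (w (x q)) (coefficient q)
            (m i q p))) (trans (anti-+ J _ _) (cong (anti (λ q p → w (x q) * m i q p) J +_) (anti-neg J _)))))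
          (~-trans (~-+ (~-sym left) (~-neg (~-sym right))) (~-reflexive (λ i → +-inverseʳ (γ n i))))
          where
          open Eisenstein K 6≤K R hiding (q)
          m : ℕ → ℕ → ℕ → ℚ
          m i q p = (⅓ * a 2 i) ^ x q * (⅕ * a 3 i) ^ z p
          n≤K : dbl n ℕ.≤ K
          n≤K = ℕ.m≤m+n (dbl n) 6
          right : γ n ~ (λ i → anti (λ q p → coefficient q * m i q p) J)
          right = ~-trans (~-*ˡ (inv (ι (dbl n ℕ.∸ 1))) (a-polynomial n n≤K))
              (~-reflexive (λ i → trans
              (cong (inv (ι (dbl n ℕ.∸ 1)) *_) (tail-n (Curve.Q (⅓ * a 2 i) (⅕ * a 3 i))))
              (proj₂ (proj₂ coefficients) (⅓ * a 2 i) (⅕ * a 3 i))))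
            where
            tail-n : ∀ Q → tail² Q ! n ≡ Q ! n
            tail-n Q = subst (λ m → tail² Q ! m ≡ Q ! m) (sym n≡) refl
          G̃γ : ∀ N → suc (index N) ℕ.≤ K → G̃ (suc (suc N)) ~ (λ i → Λ i ^ suc (suc N) * γ (suc (suc N)) i)
          G̃γ = G̃-γ
          γ2-bounded : Bounded (γ 2)
          γ2-bounded = γ-bounded 2 (ℕ.≤-trans (ℕ.m≤m+n 4 2) 6≤K)
          γ3-bounded : Bounded (γ 3)
          γ3-bounded = γ-bounded 3 6≤K
          powers : (λ i → anti (λ q p → w (x q) * (G̃ 2 i ^ x q * G̃ 3 i ^ z p)) J) ~
              (λ i → anti (λ q p → w (x q) * ((Λ i ^ 2 * γ 2 i) ^ x q * (Λ i ^ 3 * γ 3 i) ^ z p)) J)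
          powers = ~-anti J (λ q p _ → ~-*ˡ (w (x q))
              (~-* (bounded-^ (x q) (bounded-~ (G̃γ 0 (ℕ.≤-trans (ℕ.m≤m+n 4 2) 6≤K)) Λγ2)) (bounded-^ (z p) Λγ3)
            (~-^ (x q) Λγ2 (G̃γ 0 (ℕ.≤-trans (ℕ.m≤m+n 4 2) 6≤K))) (~-^ (z p) Λγ3 (G̃γ 1 6≤K))))
            where
            Λγ2 : Bounded (λ i → Λ i ^ 2 * γ 2 i)
            Λγ2 = bounded-* (bounded-^ 2 Λ-bounded) γ2-bounded
            Λγ3 : Bounded (λ i → Λ i ^ 3 * γ 3 i)
            Λγ3 = bounded-* (bounded-^ 3 Λ-bounded) γ3-bounded
          -- By homogeneity every monomial carries the power n of Λ, which `left` then cancels.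
          homogeneous : ∀ i → anti (λ q p → w (x q) * ((Λ i ^ 2 * γ 2 i) ^ x q * (Λ i ^ 3 * γ 3 i) ^ z p)) J ≡ Λ
              i ^ n * anti (λ q p → w (x q) * m i q p) J
          homogeneous i = trans (anti-cong⁺ J
              (λ q p q+p≡J → trans (cong (w (x q) *_)
              (trans (cong₂ _*_ (^-*-distrib (Λ i ^ 2) (γ 2 i) (x q)) (^-*-distrib (Λ i ^ 3) (γ 3 i) (z p)))
              (trans (solve 4 (λ a b c d → a :* b :* (c :* d) := a :* c :* (b :* d)) refl ((Λ i ^ 2) ^ x q)
                  (γ 2 i ^ x q) ((Λ i ^ 3) ^ z p) (γ 3 i ^ z p))
                (cong₂ _*_ (trans (cong₂ _*_ (^-*-assoc (Λ i) 2 (x q)) (^-*-assoc (Λ i) 3 (z p)))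
                    (trans (sym (^-+ (Λ i) (2 ℕ.* x q) (3 ℕ.* z p)))
                    (cong (Λ i ^_) (trans (weight-split r s q p)
                    (cong (λ j → 2 ℕ.* toℕ r ℕ.+ 3 ℕ.* toℕ s ℕ.+ j ℕ.* 6) q+p≡J)))))
                  (cong₂ (λ a b → a ^ x q * b ^ z p) (γ-2 i) (γ-3 i))))))
              (solve 3 (λ w l m → w :* (l :* m) := l :* (w :* m)) refl (w (x q)) (Λ i ^ n) (m i q p))))
                  (anti-*ˡ J (Λ i ^ n) _)
          left : γ n ~ (λ i → anti (λ q p → w (x q) * m i q p) J)
          left = ~-cancel (λ i → Λ i ^ n) 1ℚ 0<1 (1 , λ { (suc i) _ → 1≤∣Λ^∣ n i })
            (~-trans (~-sym G̃n) (~-trans (expansion R)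
                (~-trans (~-reflexive
                (λ i → anti-weights r s J (dbl n) (λ (a , b) → w a * (G̃ 2 i ^ a * G̃ 3 i ^ b)) dbl-2*))
                (~-trans powers (~-reflexive homogeneous)))))
            where
            dbl-2* : dbl n ≡ 2 ℕ.* n
            dbl-2* = trans (dbl-+ n) (cong (n ℕ.+_) (sym (ℕ.+-identityʳ n)))
            G̃n : G̃ n ~ (λ i → Λ i ^ n * γ n i)
            G̃n = subst (λ m → dbl m ℕ.≤ K → G̃ m ~ (λ i → Λ i ^ m * γ m i)) (sym n≡) (G̃-γ N) n≤K

-- Complex numbers with real approximations, and the series for π and ζ.

module ComplexSeries where

  open import Algebra.Definitions.RawSemiring using () renaming (_^_ to power)
  open import Data.Rational.Base
  open import Data.Rational.Properties
  open import Data.Rational.Solver using (module +-*-Solver)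
  open import Defs using (mkℝ; approx; cauchy; ℂ; _+i_; re; im; fromℚʳ; fromℚ; fromℕ; _+ᶜ_; _*ᶜ_; -ᶜ_; _-ᶜ_; ℂ-rawSemiring; _≈_; ∑; HasSum)
  open RationalArithmetic
  open PowerSeries using (dbl)
  open BernoulliSeries using (2ℚ)
  open Monomials using (ΣL; ΣL-upTo)
  open ZetaRecurrence hiding (S; T; R)
  open Estimates
  open RationalCoefficients
  open +-*-Solver using (solve; _:+_; _:*_; _:-_; :-_; _:=_; con)

  -- Only the approximations enter: the moduli of convergence carried by ℝ are irrelevant here.
  record RealSequence (a b f : ℕ → ℚ) : Set where
    constructor isReal
    field
      re-eq : ∀ i → a i ≡ f i
      im-eq : ∀ i → b i ≡ 0ℚ
  open RealSequence public

  IsReal : ℂ → (ℕ → ℚ) → Set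
  IsReal x f = RealSequence (approx (re x)) (approx (im x)) f

  real-ℚ : ∀ c → IsReal (fromℚ c) (λ _ → c)
  real-ℚ c = isReal (λ _ → refl) (λ _ → refl)

  real-+ : ∀ x y {f g} → IsReal x f → IsReal y g → IsReal (x +ᶜ y) (λ i → f i + g i)
  real-+ x y (isReal p p′) (isReal q q′) = isReal (λ i → cong₂ _+_ (p i) (q i)) (λ i → cong₂ _+_ (p′ i) (q′ i))

  real-neg : ∀ x {f} → IsReal x f → IsReal (-ᶜ x) (λ i → - f i)
  real-neg x (isReal p p′) = isReal (λ i → cong -_ (p i)) (λ i → cong -_ (p′ i))

  real-* : ∀ x y {f g} → IsReal x f → IsReal y g → IsReal (x *ᶜ y) (λ i → f i * g i)
  real-* x y {f} {g} (isReal p p′) (isReal q q′) = isReal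
    (λ i → trans (cong₂ _-_ (cong₂ _*_ (p i) (q i)) (cong₂ _*_ (p′ i) (q′ i))) (+-identityʳ (f i * g i)))
    (λ i → trans (cong₂ _+_ (cong₂ _*_ (p i) (q′ i)) (cong₂ _*_ (p′ i) (q i)))
        (solve 2 (λ a b → a :* con 0ℚ :+ con 0ℚ :* b := con 0ℚ) refl (f i) (g i)))

  -- The unapplied power is used instead of its instance _^ᶜ_, whose uses Agda unfolds before comparing them.
  real-^ : ∀ x {f} n → IsReal x f → IsReal (power ℂ-rawSemiring x n) (λ i → f i ^ n)
  real-^ x zero _ = real-ℚ 1ℚ
  real-^ x (suc n) p = real-* x (power ℂ-rawSemiring x n) p (real-^ x n p)

  real-∑ : ∀ {A : Set} (xs : List A) (F : A → ℂ) {g : A → ℕ → ℚ} → (∀ x → IsReal (F x) (g x)) → IsReal (∑ xs F)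
      (λ i → ΣL xs (λ x → g x i))
  real-∑ [] F _ = real-ℚ 0ℚ
  real-∑ (x ∷ xs) F p = real-+ (F x) (∑ xs F) (p x) (real-∑ xs F p)

  real-cong : ∀ x {f g} → (∀ i → f i ≡ g i) → IsReal x f → IsReal x g
  real-cong x eq (isReal p q) = isReal (λ i → trans (p i) (eq i)) q

  ≈-~ : ∀ x y {f g} → IsReal x f → IsReal y g → x ≈ y → f ~ g
  ≈-~ x y (isReal p _) (isReal q _) x≈y = asym λ ε 0<ε → let N , h = proj₁ (x≈y ε 0<ε) in
    N , λ n N≤n → subst (_≤ ε) (cong₂ (λ a b → ∣ a - b ∣) (p n) (q n)) (h n N≤n)

  ≈-refl : ∀ x → x ≈ x
  ≈-refl x ε 0<ε = (0 , λ n _ → ∣0∣≤ (+-inverseʳ (approx (re x) n)) 0<ε) ,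
      (0 , λ n _ → ∣0∣≤ (+-inverseʳ (approx (im x) n)) 0<ε)

  -- A series whose partial sums converge at a rate uniform in the index of the approximation
  -- has the diagonal of these approximations as its sum.
  module Limit (F : ℕ → ℂ) (g : ℕ → ℕ → ℚ) (real : ∀ n → IsReal (F n) (g n)) (s : ℕ → ℚ) (C : ℚ) (0<C : 0ℚ < C)
    (rate : ∀ n i → suc n ℕ.≤ i → ∣ Σ< (suc n) (λ j → g j i) - s i ∣ ≤ C * u n) where

    partial : ∀ n → IsReal (∑ (upTo n) F) (λ i → Σ< n (λ j → g j i))
    partial n = real-cong (∑ (upTo n) F) (λ i → ΣL-upTo n (λ j → g j i)) (real-∑ (upTo n) F real)

    rate-ε : ∀ ε → 0ℚ < ε → ∃ λ N → ∀ n i → N ℕ.≤ n → suc n ℕ.≤ i → ∣ Σ< (suc n) (λ j → g j i) - s i ∣ ≤ ε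
    rate-ε ε 0<ε = let N , le = archimedean-inv (inv C * ε) (0<* (0<inv 0<C) 0<ε) in
      N , λ n i N≤n n<i → ≤-trans (rate n i n<i)
          (≤-trans (*-monoˡ (<⇒≤ 0<C) (≤-trans (inv-antimono (0<ι N) (ι-mono-≤ (ℕ.s≤s N≤n))) le))
          (≤-reflexive (divide-bound ε C 0<C)))

    -- For fixed N the partial sum is a real number, hence Cauchy in the index; s m and s n are
    -- within a quarter of ε of its approximations.
    s-cauchy : ∀ ε → 0ℚ < ε → ∃ λ N → ∀ m n → N ℕ.≤ m → N ℕ.≤ n → ∣ s m - s n ∣ ≤ ε
    s-cauchy ε 0<ε =
      let N , h = rate-ε (½ * (½ * ε)) (0<½* (0<½* 0<ε))
          M , c = cauchy (re (∑ (upTo (suc N)) F)) (½ * ε) (0<½* 0<ε)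
          x = λ i → Σ< (suc N) (λ j → g j i)
      in M ℕ.⊔ suc N , λ m n lm ln → begin
        ∣ s m - s n ∣                                          ≡⟨ cong ∣_∣
            (solve 4 (λ a b c d → a :- d := (a :- b) :+ ((b :- c) :+ (c :- d))) refl (s m) (x m) (x n) (s n)) ⟩
        ∣ (s m - x m) + ((x m - x n) + (x n - s n)) ∣          ≤⟨ ∣+∣≤
            (subst (_≤ ½ * (½ * ε)) (∣-∣-sym (x m) (s m)) (h N m ℕ.≤-refl (⊔-right M lm)))
              (∣+∣≤ (subst (_≤ ½ * ε) (cong₂ (λ a b → ∣ a - b ∣) (re-eq (partial (suc N)) m)
                  (re-eq (partial (suc N)) n)) (c m n (⊔-left M lm) (⊔-left M ln)))
                  (h N n ℕ.≤-refl (⊔-right M ln))) ⟩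
        ½ * (½ * ε) + (½ * ε + ½ * (½ * ε))                    ≡⟨ solve 1
            (λ e → con ½ :* (con ½ :* e) :+ (con ½ :* e :+ con ½ :* (con ½ :* e)) := e) refl ε ⟩
        ε                                                      ∎
      where open ≤-Reasoning

    limit : ℂ
    limit = mkℝ s s-cauchy +i fromℚʳ 0ℚ

    limit-real : IsReal limit s
    limit-real = isReal (λ _ → refl) (λ _ → refl)

    limit-sum : HasSum F limit
    limit-sum ε 0<ε = let N , h = rate-ε ε 0<ε in
      suc N , λ { (suc n) (ℕ.s≤s N≤n) →
        (suc n , λ i n<i → subst (_≤ ε) (cong (λ a → ∣ a - s i ∣) (sym (re-eq (partial (suc n)) i)))
            (h n i N≤n n<i)) ,
        (0 , λ i _ → ∣0∣≤ (cong (_- 0ℚ) (im-eq (partial (suc n)) i)) 0<ε) }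

  leibniz : ℕ → ℚ
  leibniz n = inv (ι (suc (2 ℕ.* n)))

  alternating : ℕ → ℕ → ℚ
  alternating t n = Σ< t (λ j → (- 1ℚ) ^ j * leibniz (n ℕ.+ j))

  alternating-suc : ∀ t n → alternating (suc t) n ≡ leibniz n - alternating t (suc n)
  alternating-suc t n = trans (Σ-head t _) (cong₂ _+_ (trans (*-identityˡ _) (cong leibniz (ℕ.+-identityʳ n)))
    (trans (Σ-cong t (λ j → trans (cong (λ m → - 1ℚ * (- 1ℚ) ^ j * leibniz m) (ℕ.+-suc n j))
        (solve 2 (λ a b → con (- 1ℚ) :* a :* b := :- (a :* b)) refl ((- 1ℚ) ^ j) (leibniz (suc n ℕ.+ j)))))
        (Σ-neg t _)))

  leibniz-decreasing : ∀ n → leibniz (suc n) ≤ leibniz n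
  leibniz-decreasing n = inv-antimono (0<ι (2 ℕ.* n)) (ι-mono-≤ (ℕ.s≤s (ℕ.*-monoʳ-≤ 2 (ℕ.n≤1+n n))))

  -- Leibniz's criterion: by `alternating-suc` an alternating sum is its first term minus another
  -- such sum.
  alternating-bounds : ∀ t n → 0ℚ ≤ alternating t n × alternating t n ≤ leibniz n
  alternating-bounds zero n = ≤-refl , 0≤inv (0<ι (2 ℕ.* n))
  alternating-bounds (suc t) n = let low , high = alternating-bounds t (suc n) in
    subst (0ℚ ≤_) (sym (alternating-suc t n)) (0≤diff (≤-trans high (leibniz-decreasing n))) ,
    subst (_≤ leibniz n) (sym (alternating-suc t n))
        (≤-trans (+-monoʳ-≤ (leibniz n) (neg-antimono-≤ low)) (≤-reflexive (+-identityʳ (leibniz n))))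

  π-term : ℕ → ℚ
  π-term n = 4ℚ * (- 1ℚ) ^ n * (ℤ.+ 1 / suc (2 ℕ.* n))

  π̃ : ℕ → ℚ
  π̃ i = Σ< (suc i) π-term

  π-alternating : ∀ t n → Σ< t (λ j → π-term (n ℕ.+ j)) ≡ 4ℚ * (- 1ℚ) ^ n * alternating t n
  π-alternating t n = trans
      (Σ-cong t (λ j → trans (cong₂ (λ a b → 4ℚ * a * b) (^-+ (- 1ℚ) n j) (1/ι (suc (2 ℕ.* (n ℕ.+ j)))))
      (solve 4 (λ f a b c → f :* (a :* b) :* c := f :* a :* (b :* c)) refl 4ℚ ((- 1ℚ) ^ n) ((- 1ℚ) ^ j)
      (leibniz (n ℕ.+ j)))))
    (Σ-*ˡ t (4ℚ * (- 1ℚ) ^ n) _)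

  ∣-1^∣ : ∀ n → ∣ (- 1ℚ) ^ n ∣ ≡ 1ℚ
  ∣-1^∣ zero = refl
  ∣-1^∣ (suc n) = trans (∣p*q∣≡∣p∣*∣q∣ (- 1ℚ) ((- 1ℚ) ^ n)) (trans (*-identityˡ _) (∣-1^∣ n))

  π̃-alternating : ∀ i → π̃ i ≡ 4ℚ * alternating (suc i) 0
  π̃-alternating i = trans (π-alternating (suc i) 0) (cong (_* alternating (suc i) 0) (*-identityʳ 4ℚ))

  -- The first two terms of the series give 4(1 - 1/3) = 8/3. The bound makes 2π invertible,
  -- uniformly in the index.
  2≤π̃ : ∀ i → 2ℚ ≤ π̃ i
  2≤π̃ i = begin
    2ℚ                                     ≤⟨ toWitness {a? = 2ℚ ≤? 4ℚ * (1ℚ - ℤ.+ 1 / 3)} _ ⟩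
    4ℚ * (1ℚ - ℤ.+ 1 / 3)                  ≡⟨ cong₂ (λ a b → 4ℚ * (a - b)) (cong inv (sym ι1))
        (cong inv (sym (ι-def 3))) ⟩
    4ℚ * (leibniz 0 - leibniz 1)           ≤⟨ *-monoˡ (<⇒≤ (positive⁻¹ 4ℚ))
        (+-monoʳ-≤ (leibniz 0) (neg-antimono-≤ (proj₂ (alternating-bounds i 1)))) ⟩
    4ℚ * (leibniz 0 - alternating i 1)     ≡⟨ cong (4ℚ *_) (alternating-suc i 0) ⟨
    4ℚ * alternating (suc i) 0             ≡⟨ π̃-alternating i ⟨
    π̃ i                                    ∎
    where open ≤-Reasoning

  π̃≤4 : ∀ i → π̃ i ≤ 4ℚ
  π̃≤4 i = ≤-trans (≤-reflexive (π̃-alternating i))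
      (≤-trans (*-monoˡ (<⇒≤ (positive⁻¹ 4ℚ)) (proj₂ (alternating-bounds (suc i) 0)))
      (≤-reflexive (cong (λ z → 4ℚ * inv z) ι1)))

  π-rate : ∀ n i → suc n ℕ.≤ i → ∣ Σ< (suc n) π-term - π̃ i ∣ ≤ 4ℚ * u n
  π-rate n i n<i = begin
    ∣ a - π̃ i ∣                       ≡⟨ cong (λ z → ∣ a - z ∣)
        (trans (cong (λ m → Σ< m π-term) (sym (ℕ.m+[n∸m]≡n {suc n} {suc i} (ℕ.m≤n⇒m≤1+n n<i))))
        (Σ-split (suc n) t π-term)) ⟩
    ∣ a - (a + b) ∣                   ≡⟨ trans (cong ∣_∣ (solve 2 (λ a b → a :- (a :+ b) := :- b) refl a b))
        (∣-p∣≡∣p∣ b) ⟩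
    ∣ b ∣                             ≡⟨ cong ∣_∣ (π-alternating t (suc n)) ⟩
    ∣ 4ℚ * (- 1ℚ) ^ suc n * alternating t (suc n) ∣ ≤⟨ ∣*∣≤
        (≤-reflexive (trans (∣p*q∣≡∣p∣*∣q∣ 4ℚ ((- 1ℚ) ^ suc n)) (cong (4ℚ *_) (∣-1^∣ (suc n)))))
         (≤-trans (≤-reflexive (0≤p⇒∣p∣≡p (proj₁ (alternating-bounds t (suc n)))))
             (≤-trans (proj₂ (alternating-bounds t (suc n)))
             (inv-antimono (0<ι n) (ι-mono-≤ (ℕ.s≤s (ℕ.≤-trans (ℕ.n≤1+n n) (ℕ.m≤m+n (suc n) _))))))) ⟩
    4ℚ * 1ℚ * u n                     ≡⟨ cong (_* u n) (*-identityʳ 4ℚ) ⟩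
    4ℚ * u n                          ∎
    where
    open ≤-Reasoning
    t : ℕ
    t = suc i ℕ.∸ suc n
    a b : ℚ
    a = Σ< (suc n) π-term
    b = Σ< t (λ j → π-term (suc n ℕ.+ j))

  module Π = Limit (λ n → fromℕ 4 *ᶜ power ℂ-rawSemiring (-ᶜ fromℕ 1) n *ᶜ fromℚ (ℤ.+ 1 / suc (2 ℕ.* n)))
      (λ n _ → π-term n)
    (λ n → real-* (fromℕ 4 *ᶜ power ℂ-rawSemiring (-ᶜ fromℕ 1) n) (fromℚ (ℤ.+ 1 / suc (2 ℕ.* n)))
        (real-* (fromℕ 4) (power ℂ-rawSemiring (-ᶜ fromℕ 1) n) (real-ℚ 4ℚ)
        (real-^ (-ᶜ fromℕ 1) n (real-neg (fromℕ 1) (real-ℚ 1ℚ)))) (real-ℚ (ℤ.+ 1 / suc (2 ℕ.* n)))) π̃ 4ℚ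
        (positive⁻¹ 4ℚ) π-rate

  ^-dbl : ∀ x m → x ^ dbl m ≡ (x * x) ^ m
  ^-dbl x zero = refl
  ^-dbl x (suc m) = trans (cong (λ z → x * (x * z)) (^-dbl x m)) (sym (*-assoc x x ((x * x) ^ m)))

  inv-^ : ∀ {x} n → x ≢ 0ℚ → inv (x ^ n) ≡ inv x ^ n
  inv-^ zero _ = refl
  inv-^ {x} (suc n) x≢0 = trans (inv-* x≢0 (^-≢0 n x≢0)) (cong (inv x *_) (inv-^ n x≢0))

  ζ-term : ∀ m n → (ℤ.+ 1 / (suc n ℕ.^ dbl m)) {{ℕ.m^n≢0 (suc n) (dbl m)}} ≡ r n ^ m
  ζ-term m n = trans (1/ι (suc n ℕ.^ dbl m) {{ℕ.m^n≢0 (suc n) (dbl m)}})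
      (trans (cong inv (ι-^ (suc n) (dbl m))) (trans (inv-^ (dbl m) (ι≢0 n)) (^-dbl (u n) m)))

  -- The tail is at most that of the sum of 1/l², which telescopes.
  ζ-rate : ∀ m n i → suc n ℕ.≤ i → ∣ Σ< (suc n) (λ l → r l ^ suc m) - Z (suc m) i ∣ ≤ 1ℚ * u n
  ζ-rate m n i n<i = begin
    ∣ a - Z (suc m) i ∣  ≡⟨ cong (λ z → ∣ a - z ∣)
        (trans (cong (λ k → Z (suc m) k) (sym (ℕ.m+[n∸m]≡n n<i))) (Σ-split (suc n) t _)) ⟩
    ∣ a - (a + b) ∣      ≡⟨ trans (cong ∣_∣ (solve 2 (λ a b → a :- (a :+ b) := :- b) refl a b)) (∣-p∣≡∣p∣ b) ⟩
    ∣ b ∣                ≡⟨ 0≤p⇒∣p∣≡p (0≤Σ t (λ j _ → 0≤^ (suc m) (0≤r (suc n ℕ.+ j)))) ⟩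
    b                    ≤⟨ Σ-mono t (λ j _ → r^≤r m (suc n ℕ.+ j)) ⟩
    Σ< t (λ j → r (suc n ℕ.+ j)) ≤⟨ Σr-tail n t ⟩
    u n                  ≡⟨ *-identityˡ (u n) ⟨
    1ℚ * u n             ∎
    where
    open ≤-Reasoning
    t : ℕ
    t = i ℕ.∸ suc n
    a b : ℚ
    a = Σ< (suc n) (λ l → r l ^ suc m)
    b = Σ< t (λ j → r (suc n ℕ.+ j) ^ suc m)

  module ζ (m : ℕ) = Limit (λ n → fromℚ ((ℤ.+ 1 / (suc n ℕ.^ dbl (suc m))) {{ℕ.m^n≢0 (suc n) (dbl (suc m))}}))
      (λ n _ → r n ^ suc m)
    (λ n → real-cong (fromℚ ((ℤ.+ 1 / (suc n ℕ.^ dbl (suc m))) {{ℕ.m^n≢0 (suc n) (dbl (suc m))}}))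
        (λ _ → ζ-term (suc m) n) (real-ℚ _)) (Z (suc m)) 1ℚ 0<1 (ζ-rate m)

-- The points iρ / 2π and the Eisenstein series there.

module EisensteinPoint where

  open import Algebra.Definitions.RawSemiring using () renaming (_^_ to power)
  open import Data.Nat.Base using (_!)
  open import Data.Rational.Base
  open import Data.Rational.Properties
  open import Data.Rational.Solver using (module +-*-Solver)
  open import Defs using (mkℝ; approx; ℂ; _+i_; re; im; Positiveʳ; fromℚʳ; fromℚ; fromℕ; 𝕚; _*ᶜ_; -ᶜ_; _-ᶜ_; ℂ-rawSemiring; _≈_; ∑; HasSum; InUpperHalfPlane; IsExp; IsPi; IsZeta; IsG; IsExpansion; σ; exponents)
  open RationalArithmetic
  open PowerSeries using (E; dbl; _!_)
  open BernoulliSeries using (2ℚ; E-!; ι!≢0)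
  open Monomials using (ΣL)
  open ZetaRecurrence hiding (S; T; R)
  open Estimates
  open RationalCoefficients
  open ComplexSeries
  open +-*-Solver using (solve; _:+_; _:*_; _:-_; :-_; _:=_; con)

  πᶜ : ∃ λ p → IsPi p × IsReal p π̃
  πᶜ = Π.limit , Π.limit-sum , Π.limit-real

  ζᶜ : ∀ m → ∃ λ t → IsZeta (dbl (suc m)) t × IsReal t (Z (suc m))
  ζᶜ m = ζ.limit m , ζ.limit-sum m , ζ.limit-real m

  -- E and G are witnessed by the very expressions of their definitions, so that reflexivity
  -- suffices and the approximations are known exactly.
  eisenstein : ∀ k z p q s t {f g} → IsPi p → IsExp (fromℕ 2 *ᶜ p *ᶜ 𝕚 *ᶜ z) q → IsZeta k t →
    HasSum (λ n → fromℕ (σ (k ℕ.∸ 1) (suc n)) *ᶜ power ℂ-rawSemiring q (suc n)) s → IsReal t f → IsReal s g →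
    ∃ λ v → IsG k z v × IsReal v (λ i → 2ℚ * f i * (1ℚ - eisensteinFactor k * g i))
  eisenstein k z p q s t isPi isExp isZeta sum t-real s-real = fromℕ 2 *ᶜ t *ᶜ e ,
      (t , e , isZeta , (p , q , s , isPi , isExp , sum , ≈-refl e) , ≈-refl (fromℕ 2 *ᶜ t *ᶜ e)) ,
    real-* (fromℕ 2 *ᶜ t) e (real-* (fromℕ 2) t (real-ℚ 2ℚ) t-real)
        (real-+ (fromℕ 1) (-ᶜ (c *ᶜ s)) (real-ℚ 1ℚ)
        (real-neg (c *ᶜ s) (real-* c s (real-ℚ (eisensteinFactor k)) s-real)))
    where
    c e : ℂ
    c = fromℚ (eisensteinFactor k)
    e = fromℕ 1 -ᶜ c *ᶜ s

  module Point (K : ℕ) (6≤K : 6 ℕ.≤ K) (R : ℕ) where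
    open Eisenstein K 6≤K R

    open Exp radius using (expBound; 0≤expBound; 0<2expBound; exp-converges)

    ρ : ℚ
    ρ = ι radius

    0<ρ : 0ℚ < ρ
    0<ρ = <-≤-trans 0<1 (subst (_≤ ρ) ι1
        (ι-mono-≤ (ℕ.≤-trans (ℕ.*-mono-≤ {1} {2016} {1} (ℕ.s≤s ℕ.z≤n) (ℕ.m^n>0 2 K))
        (ℕ.m≤m+n (2016 ℕ.* 2 ℕ.^ K) R))))

    0<2π̃ : ∀ i → 0ℚ < 2ℚ * π̃ i
    0<2π̃ i = 0<* (positive⁻¹ 2ℚ) (<-≤-trans (positive⁻¹ 2ℚ) (2≤π̃ i))

    v height : ℕ → ℚ
    v i = inv (2ℚ * π̃ i)
    height i = ρ * v i

    1≤2π̃ : ∀ i → 1ℚ ≤ 2ℚ * π̃ i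
    1≤2π̃ i = ≤-trans (toWitness {a? = 1ℚ ≤? 2ℚ * 2ℚ} _) (*-monoˡ (<⇒≤ (positive⁻¹ 2ℚ)) (2≤π̃ i))

    ∣v∣≤1 : ∀ i → ∣ v i ∣ ≤ 1ℚ
    ∣v∣≤1 i = ≤-trans (≤-reflexive (0≤p⇒∣p∣≡p (0≤inv (0<2π̃ i)))) (inv-antimono 0<1 (1≤2π̃ i))

    -- 1/a - 1/b = (b - a)/(ab), and the approximations of 1/(2π) are at most 1.
    height-cauchy : ∀ ε → 0ℚ < ε → ∃ λ N → ∀ m n → N ℕ.≤ m → N ℕ.≤ n → ∣ height m - height n ∣ ≤ ε
    height-cauchy ε 0<ε =
      let N , c = Π.s-cauchy (inv (ρ * 2ℚ) * ε) (0<* (0<inv 0<2ρ) 0<ε) in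
      N , λ m n N≤m N≤n → begin
        ∣ height m - height n ∣                            ≡⟨ cong ∣_∣ (difference m n) ⟩
        ∣ ρ * 2ℚ * (π̃ n - π̃ m) * (v m * v n) ∣             ≤⟨ ∣*∣≤
            (∣*∣≤ (≤-reflexive (0≤p⇒∣p∣≡p (<⇒≤ 0<2ρ))) (c n m N≤n N≤m)) (∣*∣≤ (∣v∣≤1 m) (∣v∣≤1 n)) ⟩
        ρ * 2ℚ * (inv (ρ * 2ℚ) * ε) * (1ℚ * 1ℚ)            ≡⟨ trans (*-identityʳ _)
            (divide-bound ε (ρ * 2ℚ) 0<2ρ) ⟩
        ε                                                  ∎
      where
      open ≤-Reasoning
      0<2ρ : 0ℚ < ρ * 2ℚ
      0<2ρ = 0<* 0<ρ (positive⁻¹ 2ℚ)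
      difference : ∀ m n → height m - height n ≡ ρ * 2ℚ * (π̃ n - π̃ m) * (v m * v n)
      difference m n = trans (cong₂ (λ a b → ρ * a - ρ * b)
          (trans (sym (*-identityʳ (v m))) (cong (v m *_) (sym (inverseʳ (<⇒≢0 (0<2π̃ n))))))
          (trans (sym (*-identityʳ (v n))) (cong (v n *_) (sym (inverseʳ (<⇒≢0 (0<2π̃ m)))))))
        (solve 5 (λ ρ a b p q → ρ :* (a :* (con 2ℚ :* q :* b)) :- ρ :*
            (b :* (con 2ℚ :* p :* a)) := ρ :* con 2ℚ :* (q :- p) :* (a :* b)) refl ρ (v m) (v n) (π̃ m) (π̃ n))

    z-upper : Positiveʳ (mkℝ height height-cauchy)
    z-upper = ρ * inv (2ℚ * 4ℚ) , 0<* 0<ρ (0<inv (positive⁻¹ (2ℚ * 4ℚ))) , 0 , λ i _ → *-monoˡ (<⇒≤ 0<ρ)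
        (inv-antimono (0<2π̃ i) (*-monoˡ (<⇒≤ (positive⁻¹ 2ℚ)) (π̃≤4 i)))

    -- The imaginary part ρ / 2π makes 2πiz equal to -ρ at every index of the approximation.
    zᶜ : ∃ λ z → InUpperHalfPlane z × (∀ i → approx (re z) i ≡ 0ℚ) × (∀ i → approx (im z) i ≡ height i)
    zᶜ = fromℚʳ 0ℚ +i mkℝ height height-cauchy , z-upper , (λ _ → refl) , (λ _ → refl)

    exponent-real : ∀ p z → IsReal p π̃ → (∀ i → approx (re z) i ≡ 0ℚ) → (∀ i → approx (im z) i ≡ height i) →
      IsReal (fromℕ 2 *ᶜ p *ᶜ 𝕚 *ᶜ z) (λ _ → - ρ)
    exponent-real p z (isReal p-re p-im) z-re z-im = isReal
      (λ i → trans (cong₄ (λ a b x y → ((2ℚ * a - 0ℚ * b) * 0ℚ - (2ℚ * b + 0ℚ * a) * 1ℚ) * x -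
          ((2ℚ * a - 0ℚ * b) * 1ℚ + (2ℚ * b + 0ℚ * a) * 0ℚ) * y) (p-re i) (p-im i) (z-re i) (z-im i))
          (re-eq simplified i))
      (λ i → trans (cong₄ (λ a b x y → ((2ℚ * a - 0ℚ * b) * 0ℚ - (2ℚ * b + 0ℚ * a) * 1ℚ) * y +
          ((2ℚ * a - 0ℚ * b) * 1ℚ + (2ℚ * b + 0ℚ * a) * 0ℚ) * x) (p-re i) (p-im i) (z-re i) (z-im i))
          (im-eq simplified i))
      where
      cong₄ : ∀ (f : ℚ → ℚ → ℚ → ℚ → ℚ) {a a′ b b′ x x′ y y′} → a ≡ a′ → b ≡ b′ → x ≡ x′ → y ≡ y′ →
          f a b x y ≡ f a′ b′ x′ y′
      cong₄ f refl refl refl refl = refl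
      simplified : RealSequence _ _ (λ _ → - ρ)
      simplified = isReal
        (λ i → trans (solve 2 (λ p y →
            ((con 2ℚ :* p :- con 0ℚ :* con 0ℚ) :* con 0ℚ :- (con 2ℚ :* con 0ℚ :+ con 0ℚ :* p) :* con 1ℚ) :* con
            0ℚ
            :- ((con 2ℚ :* p :- con 0ℚ :* con 0ℚ) :* con 1ℚ :+ (con 2ℚ :* con 0ℚ :+ con 0ℚ :* p) :* con 0ℚ) :* y
                := :- (con 2ℚ :* p :* y)) refl (π̃ i) (height i))
          (cong -_ (trans (solve 3 (λ p ρ v → p :* (ρ :* v) := ρ :* (p :* v)) refl (2ℚ * π̃ i) ρ (v i))
              (trans (cong (ρ *_) (inverseʳ (<⇒≢0 (0<2π̃ i)))) (*-identityʳ ρ)))))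
        (λ i → solve 2 (λ p y → ((con 2ℚ :* p :- con 0ℚ :* con 0ℚ) :* con 0ℚ :-
            (con 2ℚ :* con 0ℚ :+ con 0ℚ :* p) :* con 1ℚ) :* y
            :+ ((con 2ℚ :* p :- con 0ℚ :* con 0ℚ) :* con 1ℚ :+ (con 2ℚ :* con 0ℚ :+ con 0ℚ :* p) :* con 0ℚ) :*
                con 0ℚ := con 0ℚ) refl (π̃ i) (height i))

    exp-term : ∀ n → (ℤ.+ 1 / (n !)) {{ℕ._!≢0 n}} * (- ρ) ^ n ≡ E (- ρ) ! n
    exp-term n = trans (cong₂ _*_ (1/ι (n !) {{ℕ._!≢0 n}}) (sym (E-! (- ρ) n)))
        (trans (solve 3 (λ f e g → f :* (e :* g) := e :* (g :* f)) refl (inv (ι (n !))) (E (- ρ) ! n) (ι (n !)))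
      (trans (cong (E (- ρ) ! n *_) (inverseʳ (ι!≢0 n))) (*-identityʳ (E (- ρ) ! n))))

    -- All approximations of the exponent are -ρ, so the partial sums of exp have constant
    -- approximations, which `exp-converges` compares with the reciprocals `q`.
    qᶜ : ∀ x → IsReal x (λ _ → - ρ) → ∃ λ y → IsExp x y × IsReal y q
    qᶜ x x-real = L.limit , L.limit-sum , L.limit-real
      where
      module L = Limit (λ n → fromℚ ((ℤ.+ 1 / (n !)) {{ℕ._!≢0 n}}) *ᶜ power ℂ-rawSemiring x n)
          (λ n _ → E (- ρ) ! n)
        (λ n → real-cong (fromℚ ((ℤ.+ 1 / (n !)) {{ℕ._!≢0 n}}) *ᶜ power ℂ-rawSemiring x n) (λ _ → exp-term n)
            (real-* (fromℚ ((ℤ.+ 1 / (n !)) {{ℕ._!≢0 n}})) (power ℂ-rawSemiring x n) (real-ℚ _)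
            (real-^ x n x-real))) q
        (2ℚ * (expBound * expBound) + 2ℚ * expBound)
            (+-mono-≤-< (0≤* (<⇒≤ (positive⁻¹ 2ℚ)) (0≤* 0≤expBound 0≤expBound)) 0<2expBound)
        (λ n i n<i → exp-converges n i (ℕ.<⇒≤ n<i))

    Sᶜ : ∀ k → suc k ℕ.≤ K → ∀ x → IsReal x q → ∃ λ s → HasSum
        (λ n → fromℕ (σ k (suc n)) *ᶜ power ℂ-rawSemiring x (suc n)) s × IsReal s (S k)
    Sᶜ k k<K x x-real = L.limit , L.limit-sum , L.limit-real
      where
      module L = Limit (λ n → fromℕ (σ k (suc n)) *ᶜ power ℂ-rawSemiring x (suc n))
          (λ n i → ι (σ k (suc n)) * q i ^ suc n)
        (λ n → real-* (fromℕ (σ k (suc n))) (power ℂ-rawSemiring x (suc n))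
            (real-cong (fromℕ (σ k (suc n))) (λ _ → sym (ι-def (σ k (suc n)))) (real-ℚ _))
            (real-^ x (suc n) x-real)) (S k) (2ℚ * 1ℚ) (positive⁻¹ (2ℚ * 1ℚ))
        (λ n i n<i → ≤-trans (geometric-difference {a = λ j → ι (σ k (suc j)) * q i ^ suc j} (<⇒≤ 0<1)
            (S-geometric k i k<K) n<i)
          (*-monoˡ (<⇒≤ (positive⁻¹ (2ℚ * 1ℚ)))
              (≤-trans (*-monoʳ (0≤¼^ n) (toWitness {a? = ½ * ½ ≤? 1ℚ} _))
              (≤-trans (≤-reflexive (*-identityˡ _)) (¼^≤ n)))))

    -- The equations on the weights keep Agda from comparing IsG 4 with IsG (dbl 2) by unfolding both.
    point : ∃ λ z → InUpperHalfPlane z × ∀ k n m → k ≡ dbl n → n ≡ suc m → dbl (suc m) ℕ.≤ K → ∃ λ v →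
        IsG k z v × IsReal v (G̃ n)
    point =
      let p , isPi , p-real = πᶜ
          z , z-upper , z-re , z-im = zᶜ
          x , isExp , x-real = qᶜ (fromℕ 2 *ᶜ p *ᶜ 𝕚 *ᶜ z) (exponent-real p z p-real z-re z-im)
      in z , z-upper , λ { k n m refl refl le →
        let t , isZeta , t-real = ζᶜ m
            s , sum , s-real = Sᶜ (dbl (suc m) ℕ.∸ 1) le x x-real
        in eisenstein (dbl (suc m)) z p x s t isPi isExp isZeta sum t-real s-real }

    compare : ∀ {X : Set} (xs : List X) (w : X → ℚ) (e f : X → ℕ) g₄ g₆ gₖ {a b c} → IsReal g₄ a → IsReal g₆ b →
        IsReal gₖ c →
        gₖ ≈ ∑ xs (λ x → fromℚ (w x) *ᶜ (power ℂ-rawSemiring g₄ (e x) *ᶜ power ℂ-rawSemiring g₆ (f x))) → c ~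
            (λ i → ΣL xs (λ x → w x * (a i ^ e x * b i ^ f x)))
    compare xs w e f g₄ g₆ gₖ real₄ real₆ realₖ = ≈-~ gₖ
        (∑ xs (λ x → fromℚ (w x) *ᶜ (power ℂ-rawSemiring g₄ (e x) *ᶜ power ℂ-rawSemiring g₆ (f x)))) realₖ
        (real-∑ xs (λ x → fromℚ (w x) *ᶜ (power ℂ-rawSemiring g₄ (e x) *ᶜ power ℂ-rawSemiring g₆ (f x)))
            (λ x → real-* (fromℚ (w x)) (power ℂ-rawSemiring g₄ (e x) *ᶜ power ℂ-rawSemiring g₆ (f x))
            (real-ℚ (w x)) (real-* (power ℂ-rawSemiring g₄ (e x)) (power ℂ-rawSemiring g₆ (f x))
            (real-^ g₄ (e x) real₄) (real-^ g₆ (f x) real₆))))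

    module _ (m : ℕ) (w : ℕ → ℚ) (le : dbl (suc m) ℕ.≤ K) (expansion : IsExpansion (dbl (suc m)) w) where

      Value : ℕ → ℕ → ℂ → Set
      Value k n z = ∃ λ v → IsG k z v × IsReal v (G̃ n)

      compare-at : ∀ z → InUpperHalfPlane z → Value 4 2 z → Value 6 3 z → Value (dbl (suc m)) (suc m) z →
        G̃ (suc m) ~ (λ i → ΣL (exponents (dbl (suc m))) (λ (a , b) → w a * (G̃ 2 i ^ a * G̃ 3 i ^ b)))
      compare-at z z-upper (g₄ , isG₄ , real₄) (g₆ , isG₆ , real₆) (gₖ , isGₖ , realₖ) =
        compare (exponents (dbl (suc m))) (λ x → w (proj₁ x)) proj₁ proj₂ g₄ g₆ gₖ real₄ real₆ realₖ
            (expansion z g₄ g₆ gₖ z-upper isG₄ isG₆ isGₖ)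

      expansion-~ : G̃ (suc m) ~
          (λ i → ΣL (exponents (dbl (suc m))) (λ (a , b) → w a * (G̃ 2 i ^ a * G̃ 3 i ^ b)))
      expansion-~ = at point
        where
        at : (∃ λ z → InUpperHalfPlane z × ∀ k n m → k ≡ dbl n → n ≡ suc m → dbl (suc m) ℕ.≤ K → ∃ λ v →
            IsG k z v × IsReal v (G̃ n)) → _
        at (z , z-upper , value) = compare-at z z-upper (value 4 2 1 refl refl (ℕ.≤-trans (ℕ.m≤m+n 4 2) 6≤K))
            (value 6 3 2 refl refl 6≤K) (value (dbl (suc m)) (suc m) m refl refl le)

-- From 2-integrality to the 2-adic valuation.

module Valuation where

  open import Data.Integer.Base using (+_)
  open import Data.Nat.Coprimality as Coprime using (Coprime)
  open import Data.Nat.Divisibility using (_∣_; divides; _∣?_; ∣m+n∣m⇒∣n; ∣-trans; m∣m*n; ∣m⇒∣m*n)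
  open import Data.Nat.Primality using (euclidsLemma; prime[2])
  open import Data.Rational.Base hiding (truncate)
  open import Data.Rational.Properties
  open import Data.Rational.Solver using (module +-*-Solver)
  open import Data.Rational.Unnormalised.Base as ℚᵘ using (mkℚᵘ; *≡*)
  import Data.Rational.Unnormalised.Properties as ℚᵘ
  open import Relation.Binary.Construct.Add.Supremum.NonStrict ℤ._≤_ using (_≤⊤⁺) renaming ([_] to [_]≤⁺)
  open import Defs using (maxExponent; νℕ; ν; _≤⁺_; [_]; IsExpansion; exponents)
  open RationalArithmetic
  open PowerSeries using (dbl)
  open IntegralWeierstrass using (dbl-+; 2-Integral; integral)
  open Monomials using (ΣL; xᵉ)
  open ZetaRecurrence using (ι-injective; _~_)
  open RationalCoefficients using (module Solve; module Eisenstein)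
  open EisensteinPoint
  open +-*-Solver using (solve; _:+_; _:*_; _:-_; :-_; _:=_; con)

  2∤odd : ∀ d → ¬ 2 ∣ suc (dbl d)
  2∤odd zero (divides (suc q) ())
  2∤odd (suc d) (divides (suc q) eq) = 2∤odd d (divides q (ℕ.suc-injective (ℕ.suc-injective eq)))

  *-denominator : ∀ x → x * ι (↧ₙ x) ≡ ↥ x / 1
  *-denominator x@(mkℚ n d _) = toℚᵘ-injective
      (ℚᵘ.≃-trans (toℚᵘ-homo-* x (ι (suc d))) (ℚᵘ.≃-trans (ℚᵘ.*-congˡ {mkℚᵘ n d} (ι⇒ℚᵘ (suc d)))
    (ℚᵘ.≃-trans (*≡* (trans (ℤ.*-assoc n (+ suc d) (+ 1)) (cong (n ℤ.*_) (sym (ℤ.pos-* (suc d) 1)))))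
        (ℚᵘ.≃-sym (toℚᵘ-fromℚᵘ (mkℚᵘ n 0))))))

  -- As e is even, the product of the odd number with t is even; Euclid's lemma passes to t.
  even-numerator : ∀ d e s t u → 2 ∣ e → e ℕ.* s ≡ suc (dbl d) ℕ.* t ℕ.+ e ℕ.* u → 2 ∣ t
  even-numerator d e s t u 2∣e eq with euclidsLemma (suc (dbl d)) t prime[2]
    (∣m+n∣m⇒∣n (subst (2 ∣_) (trans eq (ℕ.+-comm (suc (dbl d) ℕ.* t) (e ℕ.* u))) (∣m⇒∣m*n s 2∣e))
        (∣m⇒∣m*n u 2∣e))
  ... | inj₁ 2∣odd = ⊥-elim (2∤odd d 2∣odd)
  ... | inj₂ 2∣t = 2∣t

  -- Clearing denominators gives odd · numerator = e m - e n with e the denominator. The subtraction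
  -- is moved to the other side to stay in ℕ, in two ways according to the sign of the numerator.
  2-integral-numerator : ∀ x → 2-Integral x → 2 ∣ ↧ₙ x → 2 ∣ ℤ.∣ ↥ x ∣
  2-integral-numerator x (integral d m n eq) 2∣e = by-sign (↥ x) (*-denominator x)
    where
    o e : ℕ
    o = suc (dbl d)
    e = ↧ₙ x
    cleared : ∀ {y} → x * ι e ≡ y → ι o * y ≡ ι e * ι m - ι e * ι n
    cleared {y} eq′ = trans (cong (ι o *_) (sym eq′))
        (trans (solve 3 (λ o x e → o :* (x :* e) := e :* (x :* o)) refl (ι o) x (ι e))
      (trans (cong (ι e *_) eq) (solve 3 (λ e m n → e :* (m :- n) := e :* m :- e :* n) refl (ι e) (ι m) (ι n))))
    ι-*+* : ∀ a b c d → ι (a ℕ.* b ℕ.+ c ℕ.* d) ≡ ι a * ι b + ι c * ι d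
    ι-*+* a b c d = trans (ι-+ (a ℕ.* b) (c ℕ.* d)) (cong₂ _+_ (ι-* a b) (ι-* c d))
    by-sign : ∀ p → x * ι e ≡ p / 1 → 2 ∣ ℤ.∣ p ∣
    by-sign (+ p) eq′ = even-numerator d e m p n 2∣e (ι-injective (trans (ι-* e m) (sym (trans (ι-*+* o p e n)
      (trans (cong (_+ ι e * ι n) (cleared (trans eq′ (sym (ι-def p)))))
          (solve 2 (λ a b → a :- b :+ b := a) refl (ι e * ι m) (ι e * ι n)))))))
    by-sign (ℤ.-[1+ p ]) eq′ = even-numerator d e n (suc p) m 2∣e
        (ι-injective (trans (ι-* e n) (sym (trans (ι-*+* o (suc p) e m)
      (trans (cong (_+ ι e * ι m) (trans (solve 2 (λ a b → a :* b := :- (a :* (:- b))) refl (ι o) (ι (suc p)))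
        (cong -_ (cleared (trans eq′ (cong -_ (sym (ι-def (suc p)))))))))
        (solve 2 (λ a b → :- (a :- b) :+ a := b) refl (ι e * ι m) (ι e * ι n)))))))

  -- Otherwise 2 divides both the denominator and the numerator, which are coprime.
  2-integral⇒odd-denominator : ∀ {x} → 2-Integral x → ¬ 2 ∣ ↧ₙ x
  2-integral⇒odd-denominator {x@(mkℚ n d c)} x-int 2∣e with Coprime.recompute c
      (2-integral-numerator x x-int 2∣e , 2∣e)
  ... | ()

  maxExponent-∤ : ∀ p n b → ¬ p ∣ n → maxExponent p n b ≡ 0
  maxExponent-∤ p n zero _ = refl
  maxExponent-∤ p n (suc e) p∤n with p ℕ.^ suc e ∣? n
  ... | yes pᵉ∣n = ⊥-elim (p∤n (∣-trans (m∣m*n (p ℕ.^ e)) pᵉ∣n))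
  ... | no _ = maxExponent-∤ p n e p∤n

  -- The denominator is odd, so its exponent of 2 is 0 and only the numerator counts.
  2-integral⇒0≤ν : ∀ {x} → 2-Integral x → [ + 0 ] ≤⁺ ν 2 x
  2-integral⇒0≤ν {x} x-int with x ≟ 0ℚ
  ... | yes _ = [ + 0 ] ≤⊤⁺
  ... | no _ = [ subst (λ e → + 0 ℤ.≤ + νℕ 2 ℤ.∣ ↥ x ∣ ℤ.- + e)
      (sym (maxExponent-∤ 2 (↧ₙ x) (↧ₙ x) (2-integral⇒odd-denominator x-int)))
    (ℤ.≤-trans (ℤ.+≤+ ℕ.z≤n) (ℤ.≤-reflexive (sym (ℤ.+-identityʳ (+ νℕ 2 ℤ.∣ ↥ x ∣))))) ]≤⁺

  expansion-null : ∀ K 6≤K R n m w → n ≡ suc m → dbl n ℕ.≤ K → IsExpansion (dbl n) w → let open Eisenstein K 6≤K R in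
    G̃ n ~ (λ i → ΣL (exponents (dbl n)) (λ (a , b) → w a * (G̃ 2 i ^ a * G̃ 3 i ^ b)))
  expansion-null K 6≤K R .(suc m) m w refl le expansion = Point.expansion-~ K 6≤K R m w le expansion

  half-weight : ∀ a b → 4 ℕ.* a ℕ.+ 6 ℕ.* b ≡ dbl (2 ℕ.* a ℕ.+ 3 ℕ.* b)
  half-weight a b = trans (ℕS.solve 2 (λ a b → ℕS.con 4 ℕS.:* a ℕS.:+ ℕS.con 6 ℕS.:* b ℕS.:=
    (ℕS.con 2 ℕS.:* a ℕS.:+ ℕS.con 3 ℕS.:* b) ℕS.:+ (ℕS.con 2 ℕS.:* a ℕS.:+ ℕS.con 3 ℕS.:* b)) refl a b)
        (sym (dbl-+ (2 ℕ.* a ℕ.+ 3 ℕ.* b)))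

  coefficients-2-integral : ∀ r s J w → 4 ℕ.≤ dbl (Solve.n r s J) → IsExpansion (dbl (Solve.n r s J)) w → ∀ q →
      q ℕ.≤ J → 2-Integral (w (xᵉ r s q))
  coefficients-2-integral r s J w 4≤k expansion = by-size (Solve.n r s J) refl
    where
    by-size : ∀ n → Solve.n r s J ≡ n → ∀ q → q ℕ.≤ J → 2-Integral (w (xᵉ r s q))
    by-size zero n≡ = contradiction (subst (4 ℕ.≤_) (cong dbl n≡) 4≤k) λ ()
    by-size (suc zero) n≡ = contradiction (subst (4 ℕ.≤_) (cong dbl n≡) 4≤k) λ { (ℕ.s≤s (ℕ.s≤s ())) }
    by-size (suc (suc N)) n≡ = Solve.integral-solution r s J N n≡ w
      (λ R → expansion-null (Solve.K r s J N n≡ w) (Solve.6≤K r s J N n≡ w) R (Solve.n r s J) (suc N) w n≡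
          (ℕ.m≤m+n (dbl (Solve.n r s J)) 6) expansion)

  coefficient-2-integral : ∀ k r s J w q → k ≡ dbl (Solve.n r s J) → q ℕ.≤ J → 4 ℕ.≤ k → IsExpansion k w →
      2-Integral (w (xᵉ r s q))
  coefficient-2-integral .(dbl (Solve.n r s J)) r s J w q refl q≤J 4≤k expansion = coefficients-2-integral r s J
      w 4≤k expansion q q≤J

open import Data.Integer.Base using (+_)
open import Data.Nat.Base using (ℕ; _+_; _*_; _≤_)
open import Data.Nat.Divisibility using (_∣_)
open import Data.Rational.Base using (ℚ)
open import Relation.Binary.PropositionalEquality using (_≡_)
open import Defs

theorem4p1 : (k : ℕ) → 4 ≤ k → 2 ∣ k → (w : ℕ → ℚ) → IsExpansion k w →
    ∀ a b → 4 * a + 6 * b ≡ k → [ + 0 ] ≤⁺ ν 2 (w a)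
theorem4p1 k 4≤k _ w expansion a b eq =
  -- With a = r + 3q and b = s + 2p the weight is 2(2r + 3s + 6(q + p)), so J is q + p.
  let r , s , q , p , a≡ , b≡ = Monomials.decompose a b
  in subst (λ a → [ + 0 ] ≤⁺ ν 2 (w a)) (sym a≡) (Valuation.2-integral⇒0≤ν
    (Valuation.coefficient-2-integral k r s (q + p) w q
      (trans (sym eq) (trans (cong₂ (λ a b → 4 * a + 6 * b) a≡ b≡)
        (trans (Valuation.half-weight (Monomials.xᵉ r s q) (Monomials.yᵉ r s p))
          (cong PowerSeries.dbl (Monomials.weight-split r s q p)))))
      (ℕ.m≤m+n q p) 4≤k expansion))
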